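{- Let $\mathcal{P}$ be $W(5,q)$ or $Q(6,q)$ and let $\mathcal{L}$ be a degree one Cameron-Liebler set of generators of $\mathcal{P}$ with parameter $x$, where $2\le x\le\sqrt[3]{2q^2}-\frac{\sqrt[3]{4q}}{3}+\frac16$. Then there is an integer $\alpha$ such that $\mathcal{L}$ is the union of the plane sets of $\alpha$ embedded hyperbolic quadrics $Q^+(5,q)$ (pairwise having no plane in common) and of $x-2\alpha$ point-pencils which are pairwise disjoint (i.e. whose vertices are pairwise non-collinear) and whose vertices are not contained in the $\alpha$ hyperbolic quadrics. For $\mathcal{P}=Q(6,q)$, or $\mathcal{P}=W(5,q)$ with $q$ even, $\alpha\in\{0,\dots,\lfloor x/2\rfloor\}$; for $\mathcal{P}=W(5,q)$ with $q$ odd, $\alpha=0$.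
   Context: $W(5,q)$ is the symplectic polar space and $Q(6,q)$ the parabolic quadric; both have rank $3$ and parameter $e=1$, and their generators are planes. With $A$ the real point-plane incidence matrix of $\mathcal{P}$, a set $\mathcal{L}$ of planes with characteristic vector $\chi$ is a degree one Cameron-Liebler set if $\chi\in\mathrm{im}(A^T)$; its parameter is $x=|\mathcal{L}|/((q+1)(q^2+1))$. A point-pencil with vertex $P$ is the set of all planes of $\mathcal{P}$ through the point $P$. An embedded hyperbolic quadric $Q^+(5,q)$ is a hyperbolic quadric of rank $3$ contained in $\mathcal{P}$ all of whose planes are planes of $\mathcal{P}$ (for $W(5,q)$ such quadrics exist only for $q$ even). -}

module Defs where

open import Level using (0ℓ)
open import Data.Nat as ℕ using (ℕ; zero; suc)
open import Data.Fin using (Fin; zero; suc)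
open import Data.Bool using (Bool; true; false; if_then_else_; _∧_; not)
open import Data.List using (List; []; _∷_; length; lookup)
open import Data.List.Membership.Propositional using (_∈_)
open import Data.List.Relation.Unary.Unique.Propositional using (Unique)
open import Data.Product using (Σ; ∃; _×_; _,_)
open import Data.Sum using (_⊎_)
open import Data.Integer using (+_)
open import Data.Rational as ℚ using (ℚ; _<_; _≤_)
open import Relation.Nullary using (¬_; Dec; does)
open import Relation.Binary.PropositionalEquality using (_≡_; _≢_)
open import Algebra.Structures using (IsCommutativeRing)

record FiniteField : Set₁ where
  infixl 6 _+_
  infixl 7 _*_
  field
    Carrier : Set
    _+_ _*_ : Carrier → Carrier → Carrier
    -_      : Carrier → Carrier
    0# 1#   : Carrier
    isCommutativeRing : IsCommutativeRing _≡_ _+_ _*_ -_ 0# 1#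
    0≢1     : 0# ≢ 1#
    _⁻¹     : Carrier → Carrier
    inverse : ∀ x → x ≢ 0# → x * (x ⁻¹) ≡ 1#
    _≟_     : (x y : Carrier) → Dec (x ≡ y)
    elems   : List Carrier
    elems-complete : ∀ x → x ∈ elems
    elems-unique   : Unique elems

  order : ℕ
  order = length elems

  -- q even  ⇔  characteristic 2
  Char2 : Set
  Char2 = 1# + 1# ≡ 0#

module Geometry (F : FiniteField) where
  open FiniteField F public

  q : ℕ
  q = order

  Vect : ℕ → Set
  Vect n = Fin n → Carrier

  ΣF : ∀ {m} → (Fin m → Carrier) → Carrier
  ΣF {zero}  f = 0#
  ΣF {suc m} f = f zero + ΣF (λ i → f (suc i))

  zeroV : ∀ {n} → Vect n
  zeroV _ = 0#

  _≐_ : ∀ {n} → Vect n → Vect n → Set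
  u ≐ v = ∀ i → u i ≡ v i

  _·_ : ∀ {n} → Carrier → Vect n → Vect n
  (a · u) i = a * u i

  lin : ∀ {m n} → (Fin m → Carrier) → (Fin m → Vect n) → Vect n
  lin c u i = ΣF (λ j → c j * u j i)

  LinIndep : ∀ {m n} → (Fin m → Vect n) → Set
  LinIndep u = ∀ c → lin c u ≐ zeroV → ∀ j → c j ≡ 0#

  -- a plane (projective) is given by a spanning triple of vectors
  Triple : ℕ → Set
  Triple n = Fin 3 → Vect n

  _∈span_ : ∀ {n} → Vect n → Triple n → Set
  v ∈span π = ∃ λ (c : Fin 3 → Carrier) → v ≐ lin c π

  SameSpan : ∀ {n} → Triple n → Triple n → Set
  SameSpan π ρ = (∀ i → π i ∈span ρ) × (∀ i → ρ i ∈span π)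

  NonZero : ∀ {n} → Vect n → Set
  NonZero u = ¬ (u ≐ zeroV)

  -- The two polar spaces, in standard coordinates.
  --  W(5,q): all points of PG(5,q), symplectic form
  --     B(u,v) = u0v1 - u1v0 + u2v3 - u3v2 + u4v5 - u5v4
  --  Q(6,q): quadric in PG(6,q) of  Qp(u) = u0u1 + u2u3 + u4u5 + u6²
  --     with polar form fp(u,v) = Qp(u+v) - Qp(u) - Qp(v).

  data Space : Set where
    W Q : Space

  dim : Space → ℕ
  dim W = 6
  dim Q = 7

  _-F_ : Carrier → Carrier → Carrier
  a -F b = a + (- b)

  Bsymp : Vect 6 → Vect 6 → Carrier
  Bsymp u v =
    ((u (# 0) * v (# 1)) -F (u (# 1) * v (# 0))) +
    ((u (# 2) * v (# 3)) -F (u (# 3) * v (# 2))) +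
    ((u (# 4) * v (# 5)) -F (u (# 5) * v (# 4)))
    where open import Data.Fin using (#_)

  Qpar : Vect 7 → Carrier
  Qpar u = (u (# 0) * u (# 1)) + (u (# 2) * u (# 3)) + (u (# 4) * u (# 5))
           + (u (# 6) * u (# 6))
    where open import Data.Fin using (#_)

  _+V_ : ∀ {n} → Vect n → Vect n → Vect n
  (u +V v) i = u i + v i

  fpar : Vect 7 → Vect 7 → Carrier
  fpar u v = (Qpar (u +V v) -F Qpar u) -F Qpar v

  Singular : (S : Space) → Vect (dim S) → Set
  Singular W u = NonZero u
  Singular Q u = NonZero u × Qpar u ≡ 0#

  Perp : (S : Space) → Vect (dim S) → Vect (dim S) → Set
  Perp W u v = Bsymp u v ≡ 0#
  Perp Q u v = fpar u v ≡ 0#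

  IsPlane : (S : Space) → Triple (dim S) → Set
  IsPlane S π = LinIndep π × (∀ i → Singular S (π i)) × (∀ i j → Perp S (π i) (π j))

  PointIn : ∀ {n} → Vect n → Triple n → Set
  PointIn v π = v ∈span π

  PlaneSet : Space → Set
  PlaneSet S = Triple (dim S) → Bool

  WellDefined : (S : Space) → PlaneSet S → Set
  WellDefined S L = ∀ π ρ → IsPlane S π → IsPlane S ρ → SameSpan π ρ → L π ≡ L ρ

  HasSize : (S : Space) → PlaneSet S → ℕ → Set
  HasSize S L N = Σ (List (Triple (dim S))) λ ps →
      (length ps ≡ N)
    × (∀ π → π ∈ ps → IsPlane S π × L π ≡ true)
    × (∀ i j → i ≢ j → ¬ SameSpan (lookup ps i) (lookup ps j))
    × (∀ π → IsPlane S π → L π ≡ true → ∃ λ ρ → ρ ∈ ps × SameSpan π ρ)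

  ΣQ : (Carrier → ℚ) → ℚ
  ΣQ f = go elems
    where
    go : List Carrier → ℚ
    go []       = ℚ.0ℚ
    go (a ∷ as) = f a ℚ.+ go as

  isZero : Carrier → Bool
  isZero a = does (a ≟ 0#)

  ℕtoℚ : ℕ → ℚ
  ℕtoℚ n = (+ n) ℚ./ 1

  ΣPlane : ∀ {n} → (Vect n → ℚ) → Triple n → ℚ
  ΣPlane v π = ΣQ λ a → ΣQ λ b → ΣQ λ c →
    if isZero a ∧ isZero b ∧ isZero c then ℚ.0ℚ
    else v (lin (coeffs a b c) π)
    where
    coeffs : Carrier → Carrier → Carrier → Fin 3 → Carrier
    coeffs a b c zero = a
    coeffs a b c (suc zero) = b
    coeffs a b c (suc (suc zero)) = c

  χ : ∀ {S : Space} → PlaneSet S → Triple (dim S) → ℚ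
  χ L π = if L π then ℚ.1ℚ else ℚ.0ℚ

  -- Degree one Cameron–Liebler set: χ ∈ im(Aᵀ), A the point-plane
  -- incidence matrix.  A function on points is a function v on vectors
  -- constant on projective points; then (Aᵀ v)(π) = Σ_{P ∈ π} v(P)
  -- = (1/(q-1)) Σ_{0 ≠ u ∈ π} v(u).
  DegreeOneCL : (S : Space) → PlaneSet S → Set
  DegreeOneCL S L = Σ (Vect (dim S) → ℚ) λ v →
      (∀ u w → u ≐ w → v u ≡ v w)
    × (∀ (λ' : Carrier) u → λ' ≢ 0# → v (λ' · u) ≡ v u)
    × (∀ π → IsPlane S π →
          χ L π ℚ.* ℕtoℚ (q ℕ.∸ 1) ≡ ΣPlane v π)

  HasParameter : (S : Space) → PlaneSet S → ℚ → Set
  HasParameter S L x = ∃ λ N → HasSize S L N ×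
    (x ℚ.* ℕtoℚ ((q ℕ.+ 1) ℕ.* (q ℕ.* q ℕ.+ 1)) ≡ ℕtoℚ N)

  -- 2 ≤ x ≤ ∛(2q²) − ∛(4q)/3 + 1/6.  The upper bound compares the
  -- rational x with a real number; it is stated as the Dedekind-cut
  -- unfolding: for all rationals r, s ≥ 0 with r³ > 2q² (so r > ∛(2q²))
  -- and s³ < 4q (so s < ∛(4q)), x < r − s/3 + 1/6,
  -- i.e. 6x < 6r − 2s + 1.
  InRange : ℚ → Set
  InRange x = (ℕtoℚ 2 ℚ.≤ x) ×
    (∀ r s → ℚ.0ℚ ℚ.≤ r → ℚ.0ℚ ℚ.≤ s →
       ℕtoℚ (2 ℕ.* q ℕ.* q) ℚ.< r ℚ.* r ℚ.* r →
       s ℚ.* s ℚ.* s ℚ.< ℕtoℚ (4 ℕ.* q) →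
       ℕtoℚ 6 ℚ.* x ℚ.< (ℕtoℚ 6 ℚ.* r ℚ.- ℕtoℚ 2 ℚ.* s) ℚ.+ ℚ.1ℚ)

  Qhyp : Vect 6 → Carrier
  Qhyp y = (y (# 0) * y (# 1)) + (y (# 2) * y (# 3)) + (y (# 4) * y (# 5))
    where open import Data.Fin using (#_)

  fhyp : Vect 6 → Vect 6 → Carrier
  fhyp u v = (Qhyp (u +V v) -F Qhyp u) -F Qhyp v

  IsHypGen : Triple 6 → Set
  IsHypGen g = LinIndep g × (∀ i → NonZero (g i) × Qhyp (g i) ≡ 0#)
             × (∀ i j → fhyp (g i) (g j) ≡ 0#)

  -- A Q⁺(5,q) in PG(V) is the image of the standard one under an
  -- injective linear map φ : F⁶ → V, given by 6 independent columns.
  Embedding : Space → Set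
  Embedding S = Fin 6 → Vect (dim S)

  apply : ∀ {S} → Embedding S → Vect 6 → Vect (dim S)
  apply φ y = lin y φ

  applyT : ∀ {S} → Embedding S → Triple 6 → Triple (dim S)
  applyT φ g i = apply φ (g i)

  PlaneOfQuadric : ∀ {S} → Embedding S → Triple (dim S) → Set
  PlaneOfQuadric φ π = ∃ λ g → IsHypGen g × SameSpan π (applyT φ g)

  PointOfQuadric : ∀ {S} → Embedding S → Vect (dim S) → Set
  PointOfQuadric φ v = ∃ λ y → NonZero y × Qhyp y ≡ 0# × v ≐ apply φ y

  EmbeddedHyperbolic : (S : Space) → Embedding S → Set
  EmbeddedHyperbolic S φ = LinIndep φ
    × (∀ y → NonZero y → Qhyp y ≡ 0# → Singular S (apply φ y))
    × (∀ g → IsHypGen g → IsPlane S (applyT φ g))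

-- Represent the set by a weight v on the points of the polar space whose sum over a
-- plane is 0 or 1.  The sum X of v is the parameter x, and the numbers N of planes of
-- the set through a line and (q + 1) T through a point are weighted sums of v as well,
-- related by pointwise identities between indicator functions.  The bound on x gives X < q.
-- A plane outside the set has T ≤ X on its points, so if T P > X then the pencil of P
-- lies in the set; remove it, and X drops by 1.  If T ≤ X everywhere, then every plane of
-- the set contains two points with T = 2, on all of whose lines N = 2.  They span a grid:
-- of the planes adjacent to a given plane of a hyperbolic quadric, more than 2q are in
-- the set, and therefore v has sum greater than q on this quadric.  If one of its planes
-- were outside the set, this sum would be at most X; so the quadric lies in the set, and
-- removing it lowers X by 2.  In W(5,q) with q odd, a third plane on a line of the grid
-- contradicts N = 2.

module Submission where

-- The constants in `N`, `T` and `X` come from incidence counts. A point orthogonal to a line but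
-- off it lies on exactly one plane through the line, a point of the line on all q + 1 of them; so
-- these planes have total weight v(line⊥) + q v(line). In the same way the planes on a point P have
-- total weight (q + 1)(v(P⊥) + q² v(P)), and all planes together (q + 1)(q² + 1) times the sum of
-- v. The weight is any field-valued function and may be negative, so nonnegativity and integrality
-- must come from plane sums. Integrality enters through `N`, a sum of q + 1 values 0 or 1. During
-- the induction neither T nor X is known to be an integer; therefore points with T < 3 are sought,
-- and equality N = 2 on their lines is deduced. All identities are linear in v. They hold for every
-- weight, and applied to the constant weight they count the points of the space and of a hyperbolic
-- quadric. The plane condition and X < q survive every removal, which is why the range of x is used
-- only to obtain X < q. The symmetric cases share one treatment of frames and quadrics; for W(5,q)
-- with q odd no quadric is ever formed.

open import Algebra.Bundles using (CommutativeRing)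
import Algebra.Properties.Ring
import Algebra.Solver.Ring
open import Algebra.Solver.Ring.AlmostCommutativeRing
  using (AlmostCommutativeRing; _-Raw-AlmostCommutative⟶_; fromCommutativeRing)
open import Algebra.Structures using (IsCommutativeRing)
open import Data.Bool using (_∧_; false; if_then_else_; true)
open import Data.Empty using (⊥; ⊥-elim)
open import Data.Fin as Fin using (Fin)
import Data.Fin.Properties as Finₚ
open import Data.Integer as ℤ using (ℤ)
import Data.Integer.Properties as ℤₚ
open import Data.List using (List; []; _++_; _∷_; cartesianProductWith; length; map)
import Data.List as List
open import Data.List.Membership.Propositional using (_∈_)
open import Data.List.Membership.Propositional.Properties using (∈-cartesianProductWith⁺; ∈-map⁻)
import Data.List.Properties as Listₚ
open import Data.List.Relation.Unary.All using (All; []; _∷_)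
import Data.List.Relation.Unary.All as All
open import Data.List.Relation.Unary.AllPairs using ([]; _∷_)
open import Data.List.Relation.Unary.Any using (any?; here; there)
open import Data.List.Relation.Unary.Unique.Propositional using (Unique)
import Data.List.Relation.Unary.Unique.Propositional.Properties as Uniqueₚ
open import Data.Maybe using (Maybe; just; nothing)
open import Data.Nat as ℕ using (suc; zero; ℕ)
import Data.Nat.Properties as ℕₚ
open import Data.Product using (_,_; _×_; proj₁; proj₂; Σ; ∃; ∃₂)
open import Data.Rational as ℚ using (ℚ)
import Data.Rational.Properties as ℚₚ
import Data.Rational.Unnormalised as ℚᵘ
import Data.Rational.Unnormalised.Properties as ℚᵘₚ
open import Data.Sum as Sum using (_⊎_; inj₁; inj₂)
open import Data.Unit using (tt; ⊤)
open import Data.Vec as Vec using (Vec; []; _∷_; lookup; replicate; tabulate; zipWith)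
import Data.Vec.Properties as Vecₚ
open import Defs using (FiniteField; module Geometry)
open import Function using (_∘_; id)
open import Function.Bundles using (_⇔_; mk⇔)
open import Relation.Binary.PropositionalEquality
  using (_≡_; _≢_; cong; cong₂; module ≡-Reasoning; refl; subst; sym; trans)
open import Relation.Nullary using (Dec; does; no; yes; ¬_)
open import Relation.Nullary.Decidable using (from-no; from-yes; ¬?)
open ≡-Reasoning

-- The stdlib ring solver instantiated with integer coefficients, so that
-- cancellation is decided on coefficients although the ring is abstract.
module IntegerCoefficients
  {A : Set} {add mul : A → A → A} {neg : A → A} {zer one : A}
  (isCR : IsCommutativeRing _≡_ add mul neg zer one) where

  private
    cr : CommutativeRing _ _
    cr = record { isCommutativeRing = isCR }
    module C = CommutativeRing cr
    open C using (_+_; _*_; -_; 0#; 1#)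
    open Algebra.Properties.Ring C.ring
      using (-‿distribˡ-*; -‿distribʳ-*; -‿+-comm; -0#≈0#; -‿involutive)

  -- The separate clause for 1 lets `nat 1` reduce to the unit itself, so that `1-homo` is `refl`
  -- and the constant `# 1` of a solver goal is literally the unit of the ring.
  nat : ℕ → A
  nat 0 = 0#
  nat 1 = 1#
  nat (suc (suc n)) = 1# + nat (suc n)

  nat-suc : ∀ n → nat (suc n) ≡ 1# + nat n
  nat-suc zero = sym (C.+-identityʳ 1#)
  nat-suc (suc n) = refl

  nat-+ : ∀ m n → nat (m ℕ.+ n) ≡ nat m + nat n
  nat-+ zero n = sym (C.+-identityˡ _)
  nat-+ (suc m) n = begin
    nat (suc (m ℕ.+ n))      ≡⟨ nat-suc (m ℕ.+ n) ⟩
    1# + nat (m ℕ.+ n)       ≡⟨ cong (1# +_) (nat-+ m n) ⟩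
    1# + (nat m + nat n)     ≡⟨ C.+-assoc _ _ _ ⟨
    (1# + nat m) + nat n     ≡⟨ cong (_+ nat n) (nat-suc m) ⟨
    nat (suc m) + nat n      ∎

  nat-* : ∀ m n → nat (m ℕ.* n) ≡ nat m * nat n
  nat-* zero n = sym (C.zeroˡ _)
  nat-* (suc m) n = begin
    nat (n ℕ.+ m ℕ.* n)          ≡⟨ nat-+ n (m ℕ.* n) ⟩
    nat n + nat (m ℕ.* n)        ≡⟨ cong₂ _+_ (sym (C.*-identityˡ _)) (nat-* m n) ⟩
    1# * nat n + nat m * nat n   ≡⟨ C.distribʳ _ _ _ ⟨
    (1# + nat m) * nat n         ≡⟨ cong (_* nat n) (nat-suc m) ⟨
    nat (suc m) * nat n          ∎

  private
    int : ℤ → A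
    int (ℤ.+ n) = nat n
    int ℤ.-[1+ n ] = - nat (suc n)

    int-neg : ∀ i → int (ℤ.- i) ≡ - int i
    int-neg (ℤ.+ zero) = sym -0#≈0#
    int-neg (ℤ.+ suc n) = refl
    int-neg ℤ.-[1+ n ] = sym (-‿involutive _)

    cancel : ∀ a b → (1# + a) + (- (1# + b)) ≡ a + (- b)
    cancel a b = begin
      (1# + a) + (- (1# + b))      ≡⟨ cong₂ _+_ (C.+-comm 1# a) (sym (-‿+-comm 1# b)) ⟩
      (a + 1#) + ((- 1#) + (- b))  ≡⟨ C.+-assoc a 1# _ ⟩
      a + (1# + ((- 1#) + (- b)))  ≡⟨ cong (a +_) (C.+-assoc 1# (- 1#) (- b)) ⟨
      a + ((1# + (- 1#)) + (- b))  ≡⟨ cong (λ z → a + (z + (- b))) (C.-‿inverseʳ 1#) ⟩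
      a + (0# + (- b))             ≡⟨ cong (a +_) (C.+-identityˡ _) ⟩
      a + (- b)                    ∎

    int-⊖ : ∀ m n → int (m ℤ.⊖ n) ≡ nat m + (- nat n)
    int-⊖ m zero = sym (trans (cong (nat m +_) -0#≈0#) (C.+-identityʳ _))
    int-⊖ zero (suc n) = sym (C.+-identityˡ _)
    int-⊖ (suc m) (suc n) = begin
      int (suc m ℤ.⊖ suc n)           ≡⟨ cong int (ℤₚ.[1+m]⊖[1+n]≡m⊖n m n) ⟩
      int (m ℤ.⊖ n)                   ≡⟨ int-⊖ m n ⟩
      nat m + (- nat n)               ≡⟨ cancel _ _ ⟨
      (1# + nat m) + (- (1# + nat n)) ≡⟨ cong₂ (λ x y → x + (- y)) (nat-suc m) (nat-suc n) ⟨
      nat (suc m) + (- nat (suc n))   ∎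

    int-+ : ∀ i j → int (i ℤ.+ j) ≡ int i + int j
    int-+ (ℤ.+ m) (ℤ.+ n) = nat-+ m n
    int-+ (ℤ.+ m) ℤ.-[1+ n ] = int-⊖ m (suc n)
    int-+ ℤ.-[1+ m ] (ℤ.+ n) = trans (int-⊖ n (suc m)) (C.+-comm _ _)
    int-+ ℤ.-[1+ m ] ℤ.-[1+ n ] = begin
      - nat (suc (suc (m ℕ.+ n)))        ≡⟨ cong (λ k → - nat (suc k)) (ℕₚ.+-suc m n) ⟨
      - nat (suc m ℕ.+ suc n)            ≡⟨ cong -_ (nat-+ (suc m) (suc n)) ⟩
      - (nat (suc m) + nat (suc n))      ≡⟨ -‿+-comm _ _ ⟨
      (- nat (suc m)) + (- nat (suc n))  ∎

    int-*ⁿ : ∀ m j → int (ℤ.+ m ℤ.* j) ≡ nat m * int j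
    int-*ⁿ m (ℤ.+ n) = trans (cong int (sym (ℤₚ.pos-* m n))) (nat-* m n)
    int-*ⁿ m ℤ.-[1+ n ] = begin
      int (ℤ.+ m ℤ.* ℤ.-[1+ n ])          ≡⟨ cong int (ℤₚ.neg-distribʳ-* (ℤ.+ m) (ℤ.+ suc n)) ⟨
      int (ℤ.- (ℤ.+ m ℤ.* ℤ.+ suc n))     ≡⟨ int-neg (ℤ.+ m ℤ.* ℤ.+ suc n) ⟩
      - int (ℤ.+ m ℤ.* ℤ.+ suc n)         ≡⟨ cong (λ z → - int z) (ℤₚ.pos-* m (suc n)) ⟨
      - nat (m ℕ.* suc n)             ≡⟨ cong -_ (nat-* m (suc n)) ⟩
      - (nat m * nat (suc n))         ≡⟨ -‿distribʳ-* _ _ ⟩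
      nat m * (- nat (suc n))         ∎

    int-* : ∀ i j → int (i ℤ.* j) ≡ int i * int j
    int-* (ℤ.+ m) j = int-*ⁿ m j
    int-* ℤ.-[1+ m ] j = begin
      int (ℤ.-[1+ m ] ℤ.* j)          ≡⟨ cong int (ℤₚ.neg-distribˡ-* (ℤ.+ suc m) j) ⟨
      int (ℤ.- (ℤ.+ suc m ℤ.* j))     ≡⟨ int-neg (ℤ.+ suc m ℤ.* j) ⟩
      - int (ℤ.+ suc m ℤ.* j)         ≡⟨ cong -_ (int-*ⁿ (suc m) j) ⟩
      - (nat (suc m) * int j)       ≡⟨ -‿distribˡ-* _ _ ⟩
      (- nat (suc m)) * int j       ∎

    acr : AlmostCommutativeRing _ _
    acr = fromCommutativeRing cr

    morphism : ℤ.+-*-rawRing -Raw-AlmostCommutative⟶ acr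
    morphism = record
      { ⟦_⟧ = int ; +-homo = int-+ ; *-homo = int-* ; -‿homo = int-neg
      ; 0-homo = refl ; 1-homo = refl }

    dec : ∀ i j → Maybe (int i ≡ int j)
    dec i j with i ℤ.≟ j
    ... | yes p = just (cong int p)
    ... | no _ = nothing

  open Algebra.Solver.Ring ℤ.+-*-rawRing acr morphism dec public
    using (solve; _:=_; _:+_; _:*_; _:-_; :-_; con; Polynomial)

  # : ∀ {n} → ℕ → Polynomial n
  # k = con (ℤ.+ k)

-- Ordered fields and finite sums

record OrderedField : Set₁ where
  infixl 6 _+_
  infixl 7 _*_
  infix 8 -_
  infix 4 _≤_
  field
    Carrier : Set
    _+_ _*_ : Carrier → Carrier → Carrier
    -_      : Carrier → Carrier
    0# 1#   : Carrier
    isCommutativeRing : IsCommutativeRing _≡_ _+_ _*_ -_ 0# 1#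
    0≢1     : 0# ≢ 1#
    inverse : ∀ x → x ≢ 0# → ∃ λ y → y * x ≡ 1#
    _≤_     : Carrier → Carrier → Set
    _≤?_    : ∀ x y → Dec (x ≤ y)
    ≤-trans   : ∀ {x y z} → x ≤ y → y ≤ z → x ≤ z
    ≤-antisym : ∀ {x y} → x ≤ y → y ≤ x → x ≡ y
    ≤-total   : ∀ x y → x ≤ y ⊎ y ≤ x
    +-mono    : ∀ {x y z w} → x ≤ y → z ≤ w → x + z ≤ y + w
    *-nonneg  : ∀ {x y} → 0# ≤ x → 0# ≤ y → 0# ≤ x * y
    0≤1       : 0# ≤ 1#

module FiniteSums (R : OrderedField) where
  open OrderedField R public
  module RS = IntegerCoefficients isCommutativeRing
  open RS using (nat; nat-suc)

  infixl 6 _-_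
  _-_ : Carrier → Carrier → Carrier
  x - y = x + - y

  ≤-refl : ∀ {x} → x ≤ x
  ≤-refl {x} with ≤-total x x
  ... | inj₁ p = p
  ... | inj₂ p = p

  ≤-reflexive : ∀ {x y} → x ≡ y → x ≤ y
  ≤-reflexive refl = ≤-refl

  ≰⇒≥ : ∀ {x y} → ¬ x ≤ y → y ≤ x
  ≰⇒≥ {x} {y} n with ≤-total x y
  ... | inj₁ p = ⊥-elim (n p)
  ... | inj₂ p = p

  ≤-diff : ∀ {x y} d → 0# ≤ d → y ≡ x + d → x ≤ y
  ≤-diff {x} d p refl = ≤-trans (≤-reflexive (let open RS in solve 1 (λ x → x := x :+ (# 0)) refl x)) (+-mono ≤-refl p)

  diff-≤ : ∀ {x y} → x ≤ y → 0# ≤ y - x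
  diff-≤ {x} {y} p = ≤-trans (≤-reflexive (let open RS in solve 1 (λ x → (# 0) := x :- x) refl x)) (+-mono p ≤-refl)

  *-monoˡ : ∀ {x y c} → 0# ≤ c → x ≤ y → c * x ≤ c * y
  *-monoˡ {x} {y} {c} p l = ≤-diff (c * (y - x)) (*-nonneg p (diff-≤ l)) (let open RS in solve 3 (λ x y c → c :* y := c :* x :+ c :* (y :- x)) refl x y c)

  +-cancel : ∀ {x y} z → x + z ≤ y + z → x ≤ y
  +-cancel {x} {y} z p = ≤-diff _ (diff-≤ p) (let open RS in solve 3 (λ x y z → y := x :+ (y :+ z :- (x :+ z))) refl x y z)

  ≢⇒cancel : ∀ {c x y} → c ≢ 0# → c * x ≡ c * y → x ≡ y
  ≢⇒cancel {c} {x} {y} n e with inverse c n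
  ... | d , p = begin
    x            ≡⟨ lem x ⟩
    d * (c * x)  ≡⟨ cong (d *_) e ⟩
    d * (c * y)  ≡⟨ lem y ⟨
    y            ∎
    where
    lem : ∀ z → z ≡ d * (c * z)
    lem z = trans (let open RS in solve 1 (λ z → z := (# 1) :* z) refl z) (trans (cong (_* z) (sym p)) (let open RS in solve 3 (λ d c z → d :* c :* z := d :* (c :* z)) refl d c z))

  1≰0 : ¬ 1# ≤ 0#
  1≰0 p = 0≢1 (≤-antisym 0≤1 p)

  -- x < y is expressed as ¬ y ≤ x
  <-≤-trans : ∀ {x y z} → ¬ y ≤ x → y ≤ z → ¬ z ≤ x
  <-≤-trans n p q = n (≤-trans p q)

  cancel-≤ : ∀ {c x y} → ¬ c ≤ 0# → c * x ≤ c * y → x ≤ y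
  cancel-≤ {c} {x} {y} n p with ≤-total x y
  ... | inj₁ q = q
  ... | inj₂ q = ≤-reflexive (sym (≢⇒cancel (λ e → n (≤-reflexive e)) (≤-antisym (*-monoˡ (≰⇒≥ n) q) p)))

  nat≥0 : ∀ n → 0# ≤ nat n
  nat≥0 zero = ≤-refl
  nat≥0 (suc n) = ≤-trans (≤-trans 0≤1 (≤-diff _ (nat≥0 n) refl)) (≤-reflexive (sym (nat-suc n)))

  sum : {A : Set} → List A → (A → Carrier) → Carrier
  sum [] g = 0#
  sum (a ∷ as) g = g a + sum as g

  module _ {A : Set} where

    sum-cong : ∀ (as : List A) {g h} → (∀ a → g a ≡ h a) → sum as g ≡ sum as h
    sum-cong [] e = refl
    sum-cong (a ∷ as) e = cong₂ _+_ (e a) (sum-cong as e)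

    sum-cong∈ : ∀ (as : List A) {g h} → (∀ a → a ∈ as → g a ≡ h a) → sum as g ≡ sum as h
    sum-cong∈ [] e = refl
    sum-cong∈ (a ∷ as) e = cong₂ _+_ (e a (here refl)) (sum-cong∈ as (λ b m → e b (there m)))

    sum-0 : ∀ (as : List A) → sum as (λ _ → 0#) ≡ 0#
    sum-0 [] = refl
    sum-0 (a ∷ as) = trans (cong (0# +_) (sum-0 as)) (let open RS in solve 0 ((# 0) :+ (# 0) := (# 0)) refl)

    sum-+ : ∀ (as : List A) g h → sum as (λ a → g a + h a) ≡ sum as g + sum as h
    sum-+ [] g h = (let open RS in solve 0 ((# 0) := (# 0) :+ (# 0)) refl)
    sum-+ (a ∷ as) g h = trans (cong ((g a + h a) +_) (sum-+ as g h))
      (let open RS in solve 4 (λ x y s t → x :+ y :+ (s :+ t) := x :+ s :+ (y :+ t)) refl (g a) (h a) (sum as g) (sum as h))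

    sum-* : ∀ (as : List A) c g → sum as (λ a → c * g a) ≡ c * sum as g
    sum-* [] c g = (let open RS in solve 1 (λ c → (# 0) := c :* (# 0)) refl c)
    sum-* (a ∷ as) c g = trans (cong (c * g a +_) (sum-* as c g))
      (let open RS in solve 3 (λ c x s → c :* x :+ c :* s := c :* (x :+ s)) refl c (g a) (sum as g))

    sum-*ʳ : ∀ (as : List A) c g → sum as (λ a → g a * c) ≡ sum as g * c
    sum-*ʳ as c g = trans (sum-cong as (λ a → (let open RS in solve 2 (λ c x → x :* c := c :* x) refl c (g a))))
      (trans (sum-* as c g) (let open RS in solve 2 (λ c s → c :* s := s :* c) refl c (sum as g)))

    sum-const : ∀ (as : List A) c → sum as (λ _ → c) ≡ nat (length as) * c
    sum-const [] c = (let open RS in solve 1 (λ c → (# 0) := (# 0) :* c) refl c)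
    sum-const (a ∷ as) c = trans (cong (c +_) (sum-const as c))
      (trans (let open RS in solve 2 (λ c n → c :+ n :* c := ((# 1) :+ n) :* c) refl c (nat (length as))) (cong (_* c) (sym (nat-suc (length as)))))

    sum-≤ : ∀ (as : List A) {g h} → (∀ a → a ∈ as → g a ≤ h a) → sum as g ≤ sum as h
    sum-≤ [] e = ≤-refl
    sum-≤ (a ∷ as) e = +-mono (e a (here refl)) (sum-≤ as (λ b m → e b (there m)))

    sum≥0 : ∀ (as : List A) {g} → (∀ a → 0# ≤ g a) → 0# ≤ sum as g
    sum≥0 as e = ≤-trans (≤-reflexive (sym (sum-0 as))) (sum-≤ as (λ a _ → e a))

    term≤sum : ∀ (as : List A) {g} → (∀ a → 0# ≤ g a) → ∀ {a} → a ∈ as → g a ≤ sum as g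
    term≤sum (a ∷ as) {g} e (here refl) = ≤-diff _ (sum≥0 as e) refl
    term≤sum (b ∷ as) {g} e {a} (there m) = ≤-trans (term≤sum as e m)
      (≤-diff _ (e b) (let open RS in solve 2 (λ x s → x :+ s := s :+ x) refl (g b) (sum as g)))

    sum-++ : ∀ (as bs : List A) g → sum (as ++ bs) g ≡ sum as g + sum bs g
    sum-++ [] bs g = (let open RS in solve 1 (λ s → s := (# 0) :+ s) refl (sum bs g))
    sum-++ (a ∷ as) bs g = trans (cong (g a +_) (sum-++ as bs g))
      (let open RS in solve 3 (λ x s t → x :+ (s :+ t) := x :+ s :+ t) refl (g a) (sum as g) (sum bs g))

    pigeon : ∀ (as : List A) g c → ¬ nat (length as) * c ≤ sum as g → ∃ λ a → a ∈ as × ¬ c ≤ g a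
    pigeon as g c n with any? (λ a → Dec-¬ (c ≤? g a)) as
      where
      Dec-¬ : ∀ {P : Set} → Dec P → Dec (¬ P)
      Dec-¬ (yes p) = no (λ n → n p)
      Dec-¬ (no p) = yes p
    ... | yes p = let (a , m , l) = find p in a , m , l
      where open import Data.List.Membership.Propositional using (find)
    ... | no none = ⊥-elim (n (≤-trans (≤-reflexive (sym (sum-const as c))) (sum-≤ as (λ a m → small a m))))
      where
      open import Data.List.Membership.Propositional using (lose)
      small : ∀ a → a ∈ as → c ≤ g a
      small a m with c ≤? g a
      ... | yes p = p
      ... | no p = ⊥-elim (none (lose m p))

  sum-swap : ∀ {A B : Set} (as : List A) (bs : List B) (g : A → B → Carrier) →
    sum as (λ a → sum bs (g a)) ≡ sum bs (λ b → sum as (λ a → g a b))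
  sum-swap [] bs g = sym (sum-0 bs)
  sum-swap (a ∷ as) bs g = trans (cong (sum bs (g a) +_) (sum-swap as bs g))
    (sym (sum-+ bs (g a) (λ b → sum as (λ a → g a b))))

  sum-map : ∀ {A B : Set} (φ : A → B) (as : List A) g → sum (map φ as) g ≡ sum as (λ a → g (φ a))
  sum-map φ [] g = refl
  sum-map φ (a ∷ as) g = cong (g (φ a) +_) (sum-map φ as g)

  sum-cart : ∀ {A B C : Set} (φ : A → B → C) as bs g →
    sum (cartesianProductWith φ as bs) g ≡ sum as (λ a → sum bs (λ b → g (φ a b)))
  sum-cart φ [] bs g = refl
  sum-cart φ (a ∷ as) bs g = trans (sum-++ (map (φ a) bs) _ g)
    (cong₂ _+_ (sum-map (φ a) bs g) (sum-cart φ as bs g))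

  𝟙 : ∀ {P : Set} → Dec P → Carrier
  𝟙 (yes _) = 1#
  𝟙 (no _) = 0#

  𝟙-yes : ∀ {P : Set} (d : Dec P) → P → 𝟙 d ≡ 1#
  𝟙-yes (yes _) p = refl
  𝟙-yes (no n) p = ⊥-elim (n p)

  𝟙-no : ∀ {P : Set} (d : Dec P) → ¬ P → 𝟙 d ≡ 0#
  𝟙-no (yes p) n = ⊥-elim (n p)
  𝟙-no (no _) n = refl

  𝟙-cong : ∀ {P Q : Set} (d : Dec P) (e : Dec Q) → (P → Q) → (Q → P) → 𝟙 d ≡ 𝟙 e
  𝟙-cong (yes p) e f g = sym (𝟙-yes e (f p))
  𝟙-cong (no n) e f g = sym (𝟙-no e (n ∘ g))

  sum-single : ∀ {A : Set} (as : List A) g b → Unique as → b ∈ as →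
    (∀ a → a ≢ b → g a ≡ 0#) → sum as g ≡ g b
  sum-single (a ∷ as) g b (ap ∷ u) (here refl) z =
    trans (cong (g a +_) (trans (sum-cong∈ as (λ c m → z c (λ e → All.lookup ap m (sym e)))) (sum-0 as)))
      (let open RS in solve 1 (λ x → x :+ (# 0) := x) refl (g a))
  sum-single (a ∷ as) g b (ap ∷ u) (there m) z =
    trans (cong₂ _+_ (z a (All.lookup ap m)) (sum-single as g b u m z)) (let open RS in solve 1 (λ x → (# 0) :+ x := x) refl (g b))

  sum-δ : ∀ {A : Set} (_≟_ : ∀ (x y : A) → Dec (x ≡ y)) (as : List A) b → Unique as → b ∈ as →
    ∀ (g : A → Carrier) → sum as (λ a → 𝟙 (a ≟ b) * g a) ≡ g b
  sum-δ _≟_ as b u m g = trans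
    (sum-single as _ b u m (λ a n → trans (cong (_* g a) (𝟙-no (a ≟ b) n)) (let open RS in solve 1 (λ x → (# 0) :* x := (# 0)) refl (g a))))
    (trans (cong (_* g b) (𝟙-yes (b ≟ b) refl)) (let open RS in solve 1 (λ x → (# 1) :* x := x) refl (g b)))

  two : ∀ {A : Set} (as : List A) g → (∀ a → 0# ≤ g a) → Unique as → ∀ {a b} → a ∈ as → b ∈ as → a ≢ b →
    g a + g b ≤ sum as g
  two (c ∷ as) g e (ap ∷ u) (here refl) (here refl) n = ⊥-elim (n refl)
  two (c ∷ as) g e (ap ∷ u) (here refl) (there m) n = +-mono ≤-refl (term≤sum as e m)
  two (c ∷ as) g e (ap ∷ u) {a} {b} (there m) (here refl) n =
    ≤-trans (≤-reflexive (let open RS in solve 2 (λ x y → x :+ y := y :+ x) refl (g a) (g b))) (+-mono ≤-refl (term≤sum as e m))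
  two (c ∷ as) g e (ap ∷ u) {a} {b} (there m) (there m') n =
    ≤-trans (≤-reflexive (let open RS in solve 2 (λ x y → x :+ y := (# 0) :+ (x :+ y)) refl (g a) (g b))) (+-mono (e c) (two as g e u m m' n))

  -- The source of integrality: it makes `N` a natural number, which allows N < 3 to be sharpened to
  -- N ≤ 2.
  count : ∀ {A : Set} (as : List A) g → (∀ a → g a ≡ 0# ⊎ g a ≡ 1#) → ∃ λ n → sum as g ≡ nat n
  count [] g e = 0 , refl
  count (a ∷ as) g e with count as g e | e a
  ... | n , p | inj₁ z = n , trans (cong₂ _+_ z p) (let open RS in solve 1 (λ x → (# 0) :+ x := x) refl (nat n))
  ... | n , p | inj₂ z = suc n , trans (cong₂ _+_ z p) (sym (nat-suc n))

-- Vectors over a finite field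

module Vectors (R : OrderedField) (F : FiniteField) where
  open FiniteSums R public
  open RS using (nat)
  open FiniteField F public
    using (order; elems; elems-complete; elems-unique)
    renaming (Carrier to K; _+_ to infixl 6 _+ᶠ_; _*_ to infixl 7 _*ᶠ_; -_ to infix 8 -ᶠ_; 0# to 0ᶠ; 1# to 1ᶠ;
              0≢1 to 0≢1ᶠ; _⁻¹ to _⁻¹ᶠ; inverse to inverseᶠ; _≟_ to infix 4 _≟ᶠ_)
  module FS = IntegerCoefficients (FiniteField.isCommutativeRing F)

  cancelᶠ : ∀ {x y} → x ≢ 0ᶠ → x *ᶠ y ≡ 0ᶠ → y ≡ 0ᶠ
  cancelᶠ {x} {y} n e = begin
    y                       ≡⟨ (let open FS in solve 1 (λ y → y := (# 1) :* y) refl y) ⟩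
    1ᶠ *ᶠ y                 ≡⟨ cong (_*ᶠ y) (inverseᶠ x n) ⟨
    x *ᶠ x ⁻¹ᶠ *ᶠ y         ≡⟨ (let open FS in solve 3 (λ x y i → x :* i :* y := i :* (x :* y)) refl x y (x ⁻¹ᶠ)) ⟩
    x ⁻¹ᶠ *ᶠ (x *ᶠ y)       ≡⟨ cong (x ⁻¹ᶠ *ᶠ_) e ⟩
    x ⁻¹ᶠ *ᶠ 0ᶠ             ≡⟨ (let open FS in solve 1 (λ i → i :* (# 0) := (# 0)) refl (x ⁻¹ᶠ)) ⟩
    0ᶠ                      ∎

  diff0 : ∀ {x y} → x +ᶠ -ᶠ y ≡ 0ᶠ → x ≡ y
  diff0 {x} {y} e = trans (let open FS in solve 2 (λ x y → x := x :- y :+ y) refl x y) (trans (cong (_+ᶠ y) e) (let open FS in solve 1 (λ y → (# 0) :+ y := y) refl y))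

  ∑F : (K → Carrier) → Carrier
  ∑F = sum elems

  q : Carrier
  q = nat order

  ∑F-const : ∀ c → ∑F (λ _ → c) ≡ q * c
  ∑F-const = sum-const elems

  2≤q : 1# + 1# ≤ q
  2≤q = ≤-trans (two elems (λ _ → 1#) (λ _ → 0≤1) elems-unique (elems-complete 0ᶠ) (elems-complete 1ᶠ) 0≢1ᶠ)
    (≤-reflexive (trans (∑F-const 1#) (let open RS in solve 1 (λ q → q :* (# 1) := q) refl q)))

  ∑F-δ : ∀ b (g : K → Carrier) → ∑F (λ a → 𝟙 (a ≟ᶠ b) * g a) ≡ g b
  ∑F-δ b = sum-δ _≟ᶠ_ elems b elems-unique (elems-complete b)

  δ : K → Carrier
  δ x = 𝟙 (x ≟ᶠ 0ᶠ)

  δ-1 : ∀ {x} → x ≡ 0ᶠ → δ x ≡ 1#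
  δ-1 = 𝟙-yes (_ ≟ᶠ 0ᶠ)

  δ-0 : ∀ {x} → x ≢ 0ᶠ → δ x ≡ 0#
  δ-0 = 𝟙-no (_ ≟ᶠ 0ᶠ)

  δ-cong : ∀ {x y} → (x ≡ 0ᶠ → y ≡ 0ᶠ) → (y ≡ 0ᶠ → x ≡ 0ᶠ) → δ x ≡ δ y
  δ-cong = 𝟙-cong (_ ≟ᶠ 0ᶠ) (_ ≟ᶠ 0ᶠ)

  δ-neg : ∀ x → δ (-ᶠ x) ≡ δ x
  δ-neg x = δ-cong (λ e → trans (let open FS in solve 1 (λ x → x := :- :- x) refl x) (trans (cong -ᶠ_ e) (let open FS in solve 0 (:- (# 0) := (# 0)) refl))) (λ e → trans (cong -ᶠ_ e) (let open FS in solve 0 (:- (# 0) := (# 0)) refl))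

  ∑F-δ- : ∀ b (g : K → Carrier) → ∑F (λ a → δ (a +ᶠ -ᶠ b) * g a) ≡ g b
  ∑F-δ- b g = trans (sum-cong elems (λ a → cong (_* g a)
    (𝟙-cong (_ ≟ᶠ 0ᶠ) (a ≟ᶠ b) diff0 (λ e → trans (cong (_+ᶠ -ᶠ b) e) (let open FS in solve 1 (λ b → b :- b := (# 0)) refl b))))) (∑F-δ b g)

  -- the number of roots of a polynomial of degree at most one
  ∑F-affine : ∀ x y → ∑F (λ s → δ (y +ᶠ s *ᶠ x)) ≡ 1# - δ x + q * (δ x * δ y)
  ∑F-affine x y with x ≟ᶠ 0ᶠ
  ... | yes e = trans (sum-cong elems (λ s → cong δ (trans (cong (λ z → y +ᶠ s *ᶠ z) e) (let open FS in solve 2 (λ y s → y :+ s :* (# 0) := y) refl y s))))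
                  (trans (∑F-const (δ y)) (let open RS in solve 2 (λ q d → q :* d := (# 1) :- (# 1) :+ q :* ((# 1) :* d)) refl q (δ y)))
  ... | no n = trans (sum-single elems _ s₀ elems-unique (elems-complete s₀) (λ s d → δ-0 (λ e → d (uniq s e))))
                 (trans (δ-1 root) (let open RS in solve 2 (λ q d → (# 1) := (# 1) :- (# 0) :+ q :* ((# 0) :* d)) refl q (δ y)))
    where
    s₀ = -ᶠ (y *ᶠ x ⁻¹ᶠ)
    root : y +ᶠ s₀ *ᶠ x ≡ 0ᶠ
    root = trans (let open FS in solve 3 (λ x y i → y :+ ( :- (y :* i)) :* x := y :* ((# 1) :- x :* i)) refl x y (x ⁻¹ᶠ))
      (trans (cong (λ z → y *ᶠ (1ᶠ +ᶠ -ᶠ z)) (inverseᶠ x n)) (let open FS in solve 1 (λ y → y :* ((# 1) :- (# 1)) := (# 0)) refl y))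
    uniq : ∀ s → y +ᶠ s *ᶠ x ≡ 0ᶠ → s ≡ s₀
    uniq s e = diff0 (cancelᶠ n (trans (let open FS in solve 4 (λ x y s t → x :* (s :- t) := y :+ s :* x :- (y :+ t :* x)) refl x y s s₀)
      (trans (cong₂ (λ a b → a +ᶠ -ᶠ b) e root) (let open FS in solve 0 ((# 0) :- (# 0) := (# 0)) refl))))

  ∑F-affine⁻ : ∀ x y → ∑F (λ s → δ (y +ᶠ -ᶠ (s *ᶠ x))) ≡ 1# - δ x + q * (δ x * δ y)
  ∑F-affine⁻ x y = trans (sum-cong elems (λ s → cong δ (let open FS in solve 3 (λ x y s → y :- s :* x := y :+ s :* ( :- x)) refl x y s)))
    (trans (∑F-affine (-ᶠ x) y) (cong (λ d → 1# - d + q * (d * δ y)) (δ-neg x)))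

  V : ℕ → Set
  V = Vec K

  vecs : ∀ n → List (V n)
  vecs zero = [] ∷ []
  vecs (suc n) = cartesianProductWith _∷_ elems (vecs n)

  vecs-complete : ∀ {n} (w : V n) → w ∈ vecs n
  vecs-complete [] = here refl
  vecs-complete (a ∷ w) = ∈-cartesianProductWith⁺ _∷_ (elems-complete a) (vecs-complete w)

  vecs-unique : ∀ n → Unique (vecs n)
  vecs-unique zero = All.[] ∷ []
    where open import Data.List.Relation.Unary.AllPairs using ([]; _∷_)
  vecs-unique (suc n) = Uniqueₚ.cartesianProductWith⁺ _∷_ Vecₚ.∷-injective elems-unique (vecs-unique n)

  infix 4 _≟ⱽ_
  _≟ⱽ_ : ∀ {n} (u w : V n) → Dec (u ≡ w)
  _≟ⱽ_ = Vecₚ.≡-dec _≟ᶠ_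

  ∑V : ∀ {n} → (V n → Carrier) → Carrier
  ∑V = sum (vecs _)

  ∑V-δ : ∀ {n} (u : V n) (g : V n → Carrier) → ∑V (λ w → 𝟙 (w ≟ⱽ u) * g w) ≡ g u
  ∑V-δ u = sum-δ _≟ⱽ_ (vecs _) u (vecs-unique _) (vecs-complete u)

  abstract
    search : ∀ {n} {P : V n → Set} → (∀ w → Dec (P w)) → ∃ P ⊎ (∀ w → ¬ P w)
    search P? with any? P? (vecs _)
    ... | yes a = let (w , _ , p) = find a in inj₁ (w , p)
      where open import Data.List.Membership.Propositional using (find)
    ... | no n = inj₂ (λ w p → n (lose (vecs-complete w) p))
      where open import Data.List.Membership.Propositional using (lose)

    searchF : ∀ {P : K → Set} → (∀ w → Dec (P w)) → ∃ P ⊎ (∀ w → ¬ P w)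
    searchF P? with any? P? elems
    ... | yes a = let (w , _ , p) = find a in inj₁ (w , p)
      where open import Data.List.Membership.Propositional using (find)
    ... | no n = inj₂ (λ w p → n (lose (elems-complete w) p))
      where open import Data.List.Membership.Propositional using (lose)

  -- Fibres of ψ have at most one element, so P q ≤ P for the positive number P of vectors of length
  -- n, against q ≥ 2. This pigeonhole argument takes the place of dimension theory throughout.
  no-injection : ∀ n (ψ : V (suc n) → V n) → (∀ a b → ψ a ≡ ψ b → a ≡ b) → ⊥
  no-injection n ψ inj = 1≰0 (+-cancel 1# (≤-trans 2≤q (≤-trans (cancel-≤ P>0 P-bound) (≤-reflexive (let open RS in solve 0 ((# 1) := (# 0) :+ (# 1)) refl)))))
    where
    P = ∑V {n} (λ _ → 1#)
    P>0 : ¬ P ≤ 0#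
    P>0 p = 1≰0 (≤-trans (term≤sum (vecs n) {λ _ → 1#} (λ _ → 0≤1) (vecs-complete (replicate n 0ᶠ))) p)
    fibre≤1 : ∀ b → ∑V (λ a → 𝟙 (b ≟ⱽ ψ a)) ≤ 1#
    fibre≤1 b with search (λ a → b ≟ⱽ ψ a)
    ... | inj₁ (a , e) = ≤-reflexive (trans (sum-single (vecs _) _ a (vecs-unique _) (vecs-complete a)
            (λ c d → 𝟙-no (b ≟ⱽ ψ c) (λ e' → d (inj c a (trans (sym e') e))))) (𝟙-yes (b ≟ⱽ ψ a) e))
    ... | inj₂ none = ≤-trans (≤-reflexive (trans (sum-cong (vecs (suc n)) (λ a → 𝟙-no (b ≟ⱽ ψ a) (none a))) (sum-0 (vecs (suc n))))) 0≤1
    size : ∑V {suc n} (λ _ → 1#) ≡ P * q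
    size = trans (sum-cart _∷_ elems (vecs n) _) (trans (∑F-const P) (let open RS in solve 2 (λ q P → q :* P := P :* q) refl q P))
    P-bound : P * q ≤ P * 1#
    P-bound = ≤-trans (≤-reflexive (begin
      P * q                                            ≡⟨ size ⟨
      ∑V {suc n} (λ _ → 1#)                            ≡⟨ sum-cong (vecs _) (λ a → ∑V-δ (ψ a) (λ _ → 1#)) ⟨
      ∑V (λ a → ∑V (λ b → 𝟙 (b ≟ⱽ ψ a) * 1#))          ≡⟨ sum-swap (vecs (suc n)) (vecs n) _ ⟩
      ∑V (λ b → ∑V (λ a → 𝟙 (b ≟ⱽ ψ a) * 1#))          ≡⟨ sum-cong (vecs _) (λ b → sum-cong (vecs (suc n)) (λ a → (let open RS in solve 1 (λ x → x :* (# 1) := x) refl (𝟙 (b ≟ⱽ ψ a))))) ⟩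
      ∑V (λ b → ∑V (λ a → 𝟙 (b ≟ⱽ ψ a)))               ∎))
      (≤-trans (sum-≤ (vecs n) (λ b _ → fibre≤1 b)) (≤-reflexive (let open RS in solve 1 (λ P → P := P :* (# 1)) refl P)))

  infixl 6 _⊕_∙_
  abstract
    _⊕_∙_ : ∀ {n} → V n → K → V n → V n
    u ⊕ s ∙ w = zipWith (λ x y → x +ᶠ s *ᶠ y) u w

    0ⱽ : ∀ {n} → V n
    0ⱽ = replicate _ 0ᶠ

    lookup-⊕ : ∀ {n} (u w : V n) s i → lookup (u ⊕ s ∙ w) i ≡ lookup u i +ᶠ s *ᶠ lookup w i
    lookup-⊕ u w s i = Vecₚ.lookup-zipWith _ i u w

    lookup-0 : ∀ {n} (i : Fin n) → lookup 0ⱽ i ≡ 0ᶠ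
    lookup-0 i = Vecₚ.lookup-replicate i 0ᶠ

  infixl 6 _⊞_⊠_
  -- Syntax of linear combinations. As the vector operations are abstract, `vsolve` checks a vector
  -- identity by evaluating both sides at one coordinate, where it becomes a goal for the ring
  -- solver.
  data Lin (k : ℕ) : Set where
    𝟘 : Lin k
    var : Fin k → Lin k
    _⊞_⊠_ : Lin k → K → Lin k → Lin k

  v# : ∀ {k} m {m<k : _} → Lin k
  v# m {m<k} = var (Fin.#_ m {m<n = m<k})

  evalV : ∀ {k n} → Lin k → Vec (V n) k → V n
  evalV 𝟘 us = 0ⱽ
  evalV (var i) us = lookup us i
  evalV (l ⊞ s ⊠ m) us = evalV l us ⊕ s ∙ evalV m us

  evalF : ∀ {k} → Lin k → Vec K k → K
  evalF 𝟘 xs = 0ᶠ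
  evalF (var i) xs = lookup xs i
  evalF (l ⊞ s ⊠ m) xs = evalF l xs +ᶠ s *ᶠ evalF m xs

  lookup-evalV : ∀ {k n} (l : Lin k) (us : Vec (V n) k) i →
    lookup (evalV l us) i ≡ evalF l (Vec.map (λ u → lookup u i) us)
  lookup-evalV 𝟘 us i = lookup-0 i
  lookup-evalV (var j) us i = sym (Vecₚ.lookup-map j (λ u → lookup u i) us)
  lookup-evalV (l ⊞ s ⊠ m) us i = trans (lookup-⊕ (evalV l us) (evalV m us) s i)
    (cong₂ (λ a b → a +ᶠ s *ᶠ b) (lookup-evalV l us i) (lookup-evalV m us i))

  ext : ∀ {n} {u w : V n} → (∀ i → lookup u i ≡ lookup w i) → u ≡ w
  ext {u = u} {w} e = trans (sym (Vecₚ.tabulate∘lookup u)) (trans (Vecₚ.tabulate-cong e) (Vecₚ.tabulate∘lookup w))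

  vsolve : ∀ {k n} (l r : Lin k) (us : Vec (V n) k) → (∀ xs → evalF l xs ≡ evalF r xs) → evalV l us ≡ evalV r us
  vsolve l r us e = ext (λ i → trans (lookup-evalV l us i) (trans (e _) (sym (lookup-evalV r us i))))

  lc₃ : ∀ {n} → K → K → K → V n → V n → V n → V n
  lc₃ a b c e₁ e₂ e₃ = 0ⱽ ⊕ a ∙ e₁ ⊕ b ∙ e₂ ⊕ c ∙ e₃

module Over (R : OrderedField) (F : FiniteField) where
  open Vectors R F public
  open RS using (nat)

  -- Indicator sums over the field

  module WeightIdentities where
    open RS using (nat)

    δ² : ∀ x → δ x * δ x ≡ δ x
    δ² x with x ≟ᶠ 0ᶠ
    ... | yes _ = (let open RS in solve 0 ((# 1) :* (# 1) := (# 1)) refl)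
    ... | no _ = (let open RS in solve 0 ((# 0) :* (# 0) := (# 0)) refl)

    ∑F-single : ∀ b (g : K → Carrier) → (∀ a → a ≢ b → g a ≡ 0#) → ∑F g ≡ g b
    ∑F-single b g = sum-single elems g b elems-unique (elems-complete b)

    ∑F-0 : ∀ (g : K → Carrier) → (∀ a → g a ≡ 0#) → ∑F g ≡ 0#
    ∑F-0 g z = trans (sum-cong elems z) (sum-0 elems)

    ∑F-lin₂ : ∀ a b c (g h : K → Carrier) → ∑F (λ s → a * g s + b * (c * h s)) ≡ a * ∑F g + b * (c * ∑F h)
    ∑F-lin₂ a b c g h = trans (sum-+ elems _ _) (cong₂ _+_ (sum-* elems a g)
      (trans (sum-* elems b _) (cong (b *_) (sum-* elems c h))))

    zeroˡ : ∀ {x y} → x ≡ 0# → x * y ≡ 0#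
    zeroˡ {y = y} refl = (let open RS in solve 1 (λ y → (# 0) :* y := (# 0)) refl y)

    zeroʳ : ∀ {x y} → y ≡ 0# → x * y ≡ 0#
    zeroʳ {x = x} refl = (let open RS in solve 1 (λ x → x :* (# 0) := (# 0)) refl x)

    2# 3# : Carrier
    2# = 1# + 1#
    3# = 1# + 1# + 1#

    q≰0 : ¬ q ≤ 0#
    q≰0 p = 1≰0 (≤-trans (≤-diff 1# 0≤1 refl) (≤-trans 2≤q p))

    0≤q : 0# ≤ q
    0≤q = ≰⇒≥ q≰0

    nat<3 : ∀ m → ¬ 3# ≤ nat m → nat m ≤ 2#
    nat<3 0 _ = +-mono-0 0≤1 0≤1
      where
      +-mono-0 : ∀ {x y} → 0# ≤ x → 0# ≤ y → 0# ≤ x + y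
      +-mono-0 p r = ≤-trans (≤-reflexive (let open RS in solve 0 ((# 0) := (# 0) :+ (# 0)) refl)) (+-mono p r)
    nat<3 1 _ = ≤-diff 1# 0≤1 refl
    nat<3 2 _ = ≤-refl
    nat<3 (suc (suc (suc m))) l = ⊥-elim (l (≤-diff (nat m) (nat≥0 m)
      (trans (cong (λ z → 1# + (1# + z)) (RS.nat-suc m)) (let open RS in solve 1 (λ x → (# 1) :+ ((# 1) :+ ((# 1) :+ x)) := (# 1) :+ (# 1) :+ (# 1) :+ x) refl (nat m)))))

    -- With (x, y) the coordinates of w in a hyperbolic frame, this counts the
    -- planes of the hyperbolic quadric through w adjacent to a given plane.
    quadric-count : ∀ x₁ x₂ x₃ y₁ y₂ y₃ →
      δ x₁ * (δ x₃ * δ y₂) + ∑F (λ s → δ x₁ * (δ (x₂ +ᶠ s *ᶠ x₃) * δ (y₃ +ᶠ -ᶠ (s *ᶠ y₂))))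
        + ∑F (λ s → ∑F (λ r → δ (x₂ +ᶠ s *ᶠ x₁) * (δ (x₃ +ᶠ r *ᶠ x₁) * δ (y₁ +ᶠ -ᶠ (s *ᶠ y₂) +ᶠ -ᶠ (r *ᶠ y₃)))))
      ≡ δ (x₁ *ᶠ y₁ +ᶠ x₂ *ᶠ y₂ +ᶠ x₃ *ᶠ y₃) + q * (δ x₁ * (δ x₂ * δ x₃))
        + q * q * (δ x₁ * (δ x₂ * δ x₃) * (δ y₁ * (δ y₂ * δ y₃)))
    quadric-count x₁ x₂ x₃ y₁ y₂ y₃ with x₁ ≟ᶠ 0ᶠ
    -- With xᵢ = B eᵢ w, the vectors of the base plane orthogonal to w form a line unless all xᵢ
    -- vanish, and the three sums are charts for the lines of that plane. Here x₁ ≠ 0: the line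
    -- avoids e₁ and only the double sum sees it, at `s₀` and `r₀`. Multiplied by x₁, the remaining
    -- condition becomes the quadratic form.
    ... | no n₁ = begin
        0# * (δ x₃ * δ y₂) + ∑F (λ s → 0# * _) + ∑F (λ s → ∑F (g s))
          ≡⟨ cong₂ (λ a b → 0# * (δ x₃ * δ y₂) + a + b) (∑F-0 _ (λ s → zeroˡ refl)) sg ⟩
        0# * (δ x₃ * δ y₂) + 0# + δ (x₁ *ᶠ y₁ +ᶠ x₂ *ᶠ y₂ +ᶠ x₃ *ᶠ y₃)
          ≡⟨ (let open RS in solve 5 (λ q a b c d → (# 0) :* a :+ (# 0) :+ d := d :+ q :* ((# 0) :* b) :+ q :* q :* ((# 0) :* b :* c)) refl q (δ x₃ * δ y₂) (δ x₂ * δ x₃) (δ y₁ * (δ y₂ * δ y₃)) (δ (x₁ *ᶠ y₁ +ᶠ x₂ *ᶠ y₂ +ᶠ x₃ *ᶠ y₃))) ⟩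
        _ ∎
      where
      i = x₁ ⁻¹ᶠ
      s₀ = -ᶠ (x₂ *ᶠ i)
      r₀ = -ᶠ (x₃ *ᶠ i)
      g : K → K → Carrier
      g s r = δ (x₂ +ᶠ s *ᶠ x₁) * (δ (x₃ +ᶠ r *ᶠ x₁) * δ (y₁ +ᶠ -ᶠ (s *ᶠ y₂) +ᶠ -ᶠ (r *ᶠ y₃)))
      root : ∀ x → x +ᶠ -ᶠ (x *ᶠ i) *ᶠ x₁ ≡ 0ᶠ
      root x = trans (let open FS in solve 3 (λ x x₁ i → x :+ ( :- (x :* i)) :* x₁ := x :* ((# 1) :- x₁ :* i)) refl x x₁ i)
        (trans (cong (λ z → x *ᶠ (1ᶠ +ᶠ -ᶠ z)) (inverseᶠ x₁ n₁)) (let open FS in solve 1 (λ x → x :* ((# 1) :- (# 1)) := (# 0)) refl x))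
      uniq : ∀ x s → x +ᶠ s *ᶠ x₁ ≡ 0ᶠ → s ≡ -ᶠ (x *ᶠ i)
      uniq x s e = diff0 (cancelᶠ n₁ (trans (let open FS in solve 4 (λ x x₁ s t → x₁ :* (s :- t) := x :+ s :* x₁ :- (x :+ t :* x₁)) refl x x₁ s (-ᶠ (x *ᶠ i)))
        (trans (cong₂ (λ a b → a +ᶠ -ᶠ b) e (root x)) (let open FS in solve 0 ((# 0) :- (# 0) := (# 0)) refl))))
      h-eq : x₁ *ᶠ (y₁ +ᶠ -ᶠ (s₀ *ᶠ y₂) +ᶠ -ᶠ (r₀ *ᶠ y₃)) ≡ x₁ *ᶠ y₁ +ᶠ x₂ *ᶠ y₂ +ᶠ x₃ *ᶠ y₃
      h-eq = begin
        x₁ *ᶠ (y₁ +ᶠ -ᶠ (s₀ *ᶠ y₂) +ᶠ -ᶠ (r₀ *ᶠ y₃))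
          ≡⟨ (let open FS in solve 7 (λ x₁ x₂ x₃ y₁ y₂ y₃ i → x₁ :* (y₁ :- ( :- (x₂ :* i)) :* y₂ :- ( :- (x₃ :* i)) :* y₃) := x₁ :* y₁ :+ (x₁ :* i) :* (x₂ :* y₂) :+ (x₁ :* i) :* (x₃ :* y₃)) refl x₁ x₂ x₃ y₁ y₂ y₃ i) ⟩
        x₁ *ᶠ y₁ +ᶠ (x₁ *ᶠ i) *ᶠ (x₂ *ᶠ y₂) +ᶠ (x₁ *ᶠ i) *ᶠ (x₃ *ᶠ y₃)
          ≡⟨ cong (λ z → x₁ *ᶠ y₁ +ᶠ z *ᶠ (x₂ *ᶠ y₂) +ᶠ z *ᶠ (x₃ *ᶠ y₃)) (inverseᶠ x₁ n₁) ⟩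
        x₁ *ᶠ y₁ +ᶠ 1ᶠ *ᶠ (x₂ *ᶠ y₂) +ᶠ 1ᶠ *ᶠ (x₃ *ᶠ y₃)
          ≡⟨ (let open FS in solve 3 (λ a b c → a :+ (# 1) :* b :+ (# 1) :* c := a :+ b :+ c) refl (x₁ *ᶠ y₁) (x₂ *ᶠ y₂) (x₃ *ᶠ y₃)) ⟩
        x₁ *ᶠ y₁ +ᶠ x₂ *ᶠ y₂ +ᶠ x₃ *ᶠ y₃ ∎
      sg : ∑F (λ s → ∑F (g s)) ≡ δ (x₁ *ᶠ y₁ +ᶠ x₂ *ᶠ y₂ +ᶠ x₃ *ᶠ y₃)
      sg = begin
        ∑F (λ s → ∑F (g s))  ≡⟨ ∑F-single s₀ _ (λ s d → ∑F-0 (g s) (λ r → zeroˡ (δ-0 (λ e → d (uniq x₂ s e))))) ⟩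
        ∑F (g s₀)            ≡⟨ ∑F-single r₀ _ (λ r d → zeroʳ (zeroˡ (δ-0 (λ e → d (uniq x₃ r e))))) ⟩
        g s₀ r₀              ≡⟨ cong₂ (λ a b → a * (b * δ (y₁ +ᶠ -ᶠ (s₀ *ᶠ y₂) +ᶠ -ᶠ (r₀ *ᶠ y₃)))) (δ-1 (root x₂)) (δ-1 (root x₃)) ⟩
        1# * (1# * δ (y₁ +ᶠ -ᶠ (s₀ *ᶠ y₂) +ᶠ -ᶠ (r₀ *ᶠ y₃))) ≡⟨ (let open RS in solve 1 (λ d → (# 1) :* ((# 1) :* d) := d) refl (δ (y₁ +ᶠ -ᶠ (s₀ *ᶠ y₂) +ᶠ -ᶠ (r₀ *ᶠ y₃)))) ⟩
        δ (y₁ +ᶠ -ᶠ (s₀ *ᶠ y₂) +ᶠ -ᶠ (r₀ *ᶠ y₃))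
          ≡⟨ δ-cong (λ e → trans (sym h-eq) (trans (cong (x₁ *ᶠ_) e) (let open FS in solve 1 (λ x₁ → x₁ :* (# 0) := (# 0)) refl x₁))) (λ e → cancelᶠ n₁ (trans h-eq e)) ⟩
        δ (x₁ *ᶠ y₁ +ᶠ x₂ *ᶠ y₂ +ᶠ x₃ *ᶠ y₃) ∎
    ... | yes refl with x₃ ≟ᶠ 0ᶠ
    -- Now the line passes through e₁ and differs from ⟨e₁, e₃⟩, so the middle sum sees it, for the
    -- single value `s₀`.
    ... | no n₃ = begin
        1# * (0# * δ y₂) + ∑F (λ s → 1# * (δ (x₂ +ᶠ s *ᶠ x₃) * δ (y₃ +ᶠ -ᶠ (s *ᶠ y₂)))) + ∑F (λ s → ∑F (λ r → δ (x₂ +ᶠ s *ᶠ 0ᶠ) * (δ (x₃ +ᶠ r *ᶠ 0ᶠ) * _)))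
          ≡⟨ cong₂ (λ a b → 1# * (0# * δ y₂) + a + b) sg (∑F-0 _ (λ s → ∑F-0 _ (λ r → zeroʳ (zeroˡ (δ-0 (λ e → n₃ (trans (let open FS in solve 2 (λ x₃ r → x₃ := x₃ :+ r :* (# 0)) refl x₃ r) e))))))) ⟩
        1# * (0# * δ y₂) + δ (0ᶠ *ᶠ y₁ +ᶠ x₂ *ᶠ y₂ +ᶠ x₃ *ᶠ y₃) + 0#
          ≡⟨ (let open RS in solve 5 (λ q a b c d → (# 1) :* ((# 0) :* a) :+ d :+ (# 0) := d :+ q :* ((# 1) :* (b :* (# 0))) :+ q :* q :* ((# 1) :* (b :* (# 0)) :* c)) refl q (δ y₂) (δ x₂) (δ y₁ * (δ y₂ * δ y₃)) (δ (0ᶠ *ᶠ y₁ +ᶠ x₂ *ᶠ y₂ +ᶠ x₃ *ᶠ y₃))) ⟩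
        _ ∎
      where
      i = x₃ ⁻¹ᶠ
      s₀ = -ᶠ (x₂ *ᶠ i)
      root : x₂ +ᶠ s₀ *ᶠ x₃ ≡ 0ᶠ
      root = trans (let open FS in solve 3 (λ x₂ x₃ i → x₂ :+ ( :- (x₂ :* i)) :* x₃ := x₂ :* ((# 1) :- x₃ :* i)) refl x₂ x₃ i)
        (trans (cong (λ z → x₂ *ᶠ (1ᶠ +ᶠ -ᶠ z)) (inverseᶠ x₃ n₃)) (let open FS in solve 1 (λ x₂ → x₂ :* ((# 1) :- (# 1)) := (# 0)) refl x₂))
      uniq : ∀ s → x₂ +ᶠ s *ᶠ x₃ ≡ 0ᶠ → s ≡ s₀
      uniq s e = diff0 (cancelᶠ n₃ (trans (let open FS in solve 4 (λ x₂ x₃ s t → x₃ :* (s :- t) := x₂ :+ s :* x₃ :- (x₂ :+ t :* x₃)) refl x₂ x₃ s s₀)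
        (trans (cong₂ (λ a b → a +ᶠ -ᶠ b) e root) (let open FS in solve 0 ((# 0) :- (# 0) := (# 0)) refl))))
      h-eq : x₃ *ᶠ (y₃ +ᶠ -ᶠ (s₀ *ᶠ y₂)) ≡ 0ᶠ *ᶠ y₁ +ᶠ x₂ *ᶠ y₂ +ᶠ x₃ *ᶠ y₃
      h-eq = trans (let open FS in solve 5 (λ x₂ x₃ y₂ y₃ i → x₃ :* (y₃ :- ( :- (x₂ :* i)) :* y₂) := (x₃ :* i) :* (x₂ :* y₂) :+ x₃ :* y₃) refl x₂ x₃ y₂ y₃ i)
        (trans (cong (λ z → z *ᶠ (x₂ *ᶠ y₂) +ᶠ x₃ *ᶠ y₃) (inverseᶠ x₃ n₃))
          (let open FS in solve 3 (λ y₁ b c → (# 1) :* b :+ c := (# 0) :* y₁ :+ b :+ c) refl y₁ (x₂ *ᶠ y₂) (x₃ *ᶠ y₃)))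
      sg : ∑F (λ s → 1# * (δ (x₂ +ᶠ s *ᶠ x₃) * δ (y₃ +ᶠ -ᶠ (s *ᶠ y₂)))) ≡ δ (0ᶠ *ᶠ y₁ +ᶠ x₂ *ᶠ y₂ +ᶠ x₃ *ᶠ y₃)
      sg = begin
        ∑F (λ s → 1# * (δ (x₂ +ᶠ s *ᶠ x₃) * δ (y₃ +ᶠ -ᶠ (s *ᶠ y₂))))
          ≡⟨ ∑F-single s₀ _ (λ s d → zeroʳ (zeroˡ (δ-0 (λ e → d (uniq s e))))) ⟩
        1# * (δ (x₂ +ᶠ s₀ *ᶠ x₃) * δ (y₃ +ᶠ -ᶠ (s₀ *ᶠ y₂)))
          ≡⟨ cong (λ a → 1# * (a * δ (y₃ +ᶠ -ᶠ (s₀ *ᶠ y₂)))) (δ-1 root) ⟩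
        1# * (1# * δ (y₃ +ᶠ -ᶠ (s₀ *ᶠ y₂))) ≡⟨ (let open RS in solve 1 (λ d → (# 1) :* ((# 1) :* d) := d) refl (δ (y₃ +ᶠ -ᶠ (s₀ *ᶠ y₂)))) ⟩
        δ (y₃ +ᶠ -ᶠ (s₀ *ᶠ y₂))
          ≡⟨ δ-cong (λ e → trans (sym h-eq) (trans (cong (x₃ *ᶠ_) e) (let open FS in solve 1 (λ x₃ → x₃ :* (# 0) := (# 0)) refl x₃))) (λ e → cancelᶠ n₃ (trans h-eq e)) ⟩
        δ (0ᶠ *ᶠ y₁ +ᶠ x₂ *ᶠ y₂ +ᶠ x₃ *ᶠ y₃) ∎
    ... | yes refl with x₂ ≟ᶠ 0ᶠ
    ... | no n₂ = begin
        1# * (1# * δ y₂) + ∑F (λ s → 1# * (δ (x₂ +ᶠ s *ᶠ 0ᶠ) * δ (y₃ +ᶠ -ᶠ (s *ᶠ y₂)))) + ∑F (λ s → ∑F (λ r → δ (x₂ +ᶠ s *ᶠ 0ᶠ) * _))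
          ≡⟨ cong₂ (λ a b → 1# * (1# * δ y₂) + a + b)
               (∑F-0 _ (λ s → zeroʳ (zeroˡ (δ-0 (λ e → n₂ (trans (let open FS in solve 2 (λ x₂ s → x₂ := x₂ :+ s :* (# 0)) refl x₂ s) e))))))
               (∑F-0 _ (λ s → ∑F-0 _ (λ r → zeroˡ (δ-0 (λ e → n₂ (trans (let open FS in solve 2 (λ x₂ s → x₂ := x₂ :+ s :* (# 0)) refl x₂ s) e)))))) ⟩
        1# * (1# * δ y₂) + 0# + 0#
          ≡⟨ (let open RS in solve 3 (λ q a c → (# 1) :* ((# 1) :* a) :+ (# 0) :+ (# 0) := a :+ q :* ((# 1) :* ((# 0) :* (# 1))) :+ q :* q :* ((# 1) :* ((# 0) :* (# 1)) :* c)) refl q (δ y₂) (δ y₁ * (δ y₂ * δ y₃))) ⟩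
        δ y₂ + q * (1# * (0# * 1#)) + q * q * (1# * (0# * 1#) * (δ y₁ * (δ y₂ * δ y₃)))
          ≡⟨ cong (λ d → d + q * (1# * (0# * 1#)) + q * q * (1# * (0# * 1#) * (δ y₁ * (δ y₂ * δ y₃))))
               (δ-cong (λ e → cancelᶠ n₂ (trans (let open FS in solve 4 (λ x₂ y₁ y₂ y₃ → x₂ :* y₂ := (# 0) :* y₁ :+ x₂ :* y₂ :+ (# 0) :* y₃) refl x₂ y₁ y₂ y₃) e))
                       (λ e → trans (let open FS in solve 4 (λ x₂ y₁ y₂ y₃ → (# 0) :* y₁ :+ x₂ :* y₂ :+ (# 0) :* y₃ := x₂ :* y₂) refl x₂ y₁ y₂ y₃) (trans (cong (x₂ *ᶠ_) e) (let open FS in solve 1 (λ x₂ → x₂ :* (# 0) := (# 0)) refl x₂)))) ⟨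
        _ ∎
    -- Now w is orthogonal to the base plane. A line of that plane is counted when it contains w: q
    -- + 1 lines, or all q² + q + 1 of them if the yᵢ vanish as well.
    ... | yes refl = begin
        1# * (1# * δ y₂) + ∑F (λ s → 1# * (δ (0ᶠ +ᶠ s *ᶠ 0ᶠ) * δ (y₃ +ᶠ -ᶠ (s *ᶠ y₂))))
          + ∑F (λ s → ∑F (λ r → δ (0ᶠ +ᶠ s *ᶠ 0ᶠ) * (δ (0ᶠ +ᶠ r *ᶠ 0ᶠ) * δ (y₁ +ᶠ -ᶠ (s *ᶠ y₂) +ᶠ -ᶠ (r *ᶠ y₃)))))
          ≡⟨ cong₂ (λ a b → 1# * (1# * δ y₂) + a + b)
               (sum-cong elems (λ s → trans (cong (λ d → 1# * (d * δ (y₃ +ᶠ -ᶠ (s *ᶠ y₂)))) (z s)) (let open RS in solve 1 (λ d → (# 1) :* ((# 1) :* d) := d) refl (δ (y₃ +ᶠ -ᶠ (s *ᶠ y₂))))))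
               (sum-cong elems (λ s → sum-cong elems (λ r →
                 trans (cong₂ (λ a b → a * (b * δ (y₁ +ᶠ -ᶠ (s *ᶠ y₂) +ᶠ -ᶠ (r *ᶠ y₃)))) (z s) (z r))
                 (trans (let open RS in solve 1 (λ d → (# 1) :* ((# 1) :* d) := d) refl (δ (y₁ +ᶠ -ᶠ (s *ᶠ y₂) +ᶠ -ᶠ (r *ᶠ y₃)))) (cong δ (let open FS in solve 3 (λ y₁ a b → y₁ :- a :- b := y₁ :- b :- a) refl y₁ (s *ᶠ y₂) (r *ᶠ y₃))))))) ⟩
        1# * (1# * δ y₂) + ∑F (λ s → δ (y₃ +ᶠ -ᶠ (s *ᶠ y₂)))
          + ∑F (λ s → ∑F (λ r → δ (y₁ +ᶠ -ᶠ (r *ᶠ y₃) +ᶠ -ᶠ (s *ᶠ y₂))))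
          ≡⟨ cong₂ (λ a b → 1# * (1# * δ y₂) + a + b) (∑F-affine⁻ y₂ y₃) double ⟩
        1# * (1# * δ y₂) + (1# - δ y₂ + q * (δ y₂ * δ y₃)) + (q * (1# - δ y₂) + q * δ y₂ * (1# - δ y₃ + q * (δ y₃ * δ y₁)))
          ≡⟨ (let open RS in solve 4 (λ q a b c → (# 1) :* ((# 1) :* b) :+ ((# 1) :- b :+ q :* (b :* c)) :+ (q :* ((# 1) :- b) :+ q :* b :* ((# 1) :- c :+ q :* (c :* a))) := (# 1) :+ q :* ((# 1) :* ((# 1) :* (# 1))) :+ q :* q :* ((# 1) :* ((# 1) :* (# 1)) :* (a :* (b :* c)))) refl q (δ y₁) (δ y₂) (δ y₃)) ⟩
        1# + q * (1# * (1# * 1#)) + q * q * (1# * (1# * 1#) * (δ y₁ * (δ y₂ * δ y₃)))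
          ≡⟨ cong (λ d → d + q * (1# * (1# * 1#)) + q * q * (1# * (1# * 1#) * (δ y₁ * (δ y₂ * δ y₃))))
               (δ-1 (let open FS in solve 3 (λ y₁ y₂ y₃ → (# 0) :* y₁ :+ (# 0) :* y₂ :+ (# 0) :* y₃ := (# 0)) refl y₁ y₂ y₃)) ⟨
        _ ∎
      where
      z : ∀ s → δ (0ᶠ +ᶠ s *ᶠ 0ᶠ) ≡ 1#
      z s = δ-1 (let open FS in solve 1 (λ s → (# 0) :+ s :* (# 0) := (# 0)) refl s)
      double : ∑F (λ s → ∑F (λ r → δ (y₁ +ᶠ -ᶠ (r *ᶠ y₃) +ᶠ -ᶠ (s *ᶠ y₂))))
               ≡ q * (1# - δ y₂) + q * δ y₂ * (1# - δ y₃ + q * (δ y₃ * δ y₁))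
      double = begin
        ∑F (λ s → ∑F (λ r → δ (y₁ +ᶠ -ᶠ (r *ᶠ y₃) +ᶠ -ᶠ (s *ᶠ y₂)))) ≡⟨ sum-swap elems elems _ ⟩
        ∑F (λ r → ∑F (λ s → δ (y₁ +ᶠ -ᶠ (r *ᶠ y₃) +ᶠ -ᶠ (s *ᶠ y₂)))) ≡⟨ sum-cong elems (λ r → ∑F-affine⁻ y₂ (y₁ +ᶠ -ᶠ (r *ᶠ y₃))) ⟩
        ∑F (λ r → 1# - δ y₂ + q * (δ y₂ * δ (y₁ +ᶠ -ᶠ (r *ᶠ y₃)))) ≡⟨ sum-cong elems (λ r → (let open RS in solve 3 (λ q b d → (# 1) :- b :+ q :* (b :* d) := ((# 1) :- b) :* (# 1) :+ q :* (b :* d)) refl q (δ y₂) (δ (y₁ +ᶠ -ᶠ (r *ᶠ y₃))))) ⟩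
        ∑F (λ r → (1# - δ y₂) * 1# + q * (δ y₂ * δ (y₁ +ᶠ -ᶠ (r *ᶠ y₃)))) ≡⟨ ∑F-lin₂ _ _ _ (λ _ → 1#) _ ⟩
        (1# - δ y₂) * ∑F (λ _ → 1#) + q * (δ y₂ * ∑F (λ r → δ (y₁ +ᶠ -ᶠ (r *ᶠ y₃))))
          ≡⟨ cong₂ (λ a b → (1# - δ y₂) * a + q * (δ y₂ * b)) (∑F-const 1#) (∑F-affine⁻ y₃ y₁) ⟩
        (1# - δ y₂) * (q * 1#) + q * (δ y₂ * (1# - δ y₃ + q * (δ y₃ * δ y₁)))
          ≡⟨ (let open RS in solve 3 (λ q b d → ((# 1) :- b) :* (q :* (# 1)) :+ q :* (b :* d) := q :* ((# 1) :- b) :+ q :* b :* d) refl q (δ y₂) (1# - δ y₃ + q * (δ y₃ * δ y₁))) ⟩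
        _ ∎

  -- Axioms for polar spaces of rank three

  module PolarSpaces where

    -- The common axioms of W(5,q), Q(6,q) and Q⁺(5,q).  Sing also holds for
    -- the zero vector; ε is the sign of the form.
    record Polar (n : ℕ) : Set₁ where
      field
        B      : V n → V n → K
        ε      : K
        ε²     : ε *ᶠ ε ≡ 1ᶠ
        B-sym  : ∀ u w → B w u ≡ ε *ᶠ B u w
        B-lin  : ∀ u s w z → B (u ⊕ s ∙ w) z ≡ B u z +ᶠ s *ᶠ B w z
        Sing   : V n → Set
        Sing?  : ∀ u → Dec (Sing u)
        Sing-0 : Sing 0ⱽ
        Sing-⊕ : ∀ {u s w} → Sing u → Sing w → B u w ≡ 0ᶠ → Sing (u ⊕ s ∙ w)
        B-self : ∀ {u} → Sing u → B u u ≡ 0ᶠ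
        -- Every hyperbolic line has a second singular point; `full-frame` uses this to choose dual
        -- vectors inside the polar space.
        fix    : ∀ {e f} → Sing e → B e f ≡ 1ᶠ → ∃ λ c → Sing (f ⊕ c ∙ e)
        nondeg : ∀ {u} → Sing u → u ≢ 0ⱽ → ∃ λ w → B u w ≡ 1ᶠ
        -- Bounds the dimension by 7. Together with `no-injection` this is what limits the rank to
        -- 3, in `no-solid`.
        embed  : V n → V 7
        embed-injective : ∀ u w → embed u ≡ embed w → u ≡ w

  -- The forms of W(5,q), Q(6,q) and the hyperbolic quadric

  module Spaces where
    open PolarSpaces

    pattern 0F = Fin.zero
    pattern 1F = Fin.suc Fin.zero
    pattern 2F = Fin.suc (Fin.suc Fin.zero)
    pattern 3F = Fin.suc (Fin.suc (Fin.suc Fin.zero))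
    pattern 4F = Fin.suc (Fin.suc (Fin.suc (Fin.suc Fin.zero)))
    pattern 5F = Fin.suc (Fin.suc (Fin.suc (Fin.suc (Fin.suc Fin.zero))))
    pattern 6F = Fin.suc (Fin.suc (Fin.suc (Fin.suc (Fin.suc (Fin.suc Fin.zero)))))

    infix 25 _!_
    _!_ : ∀ {n} → V n → Fin n → K
    _!_ = lookup

    unit : Fin 6 → K → V 6
    unit 0F c = c ∷ 0ᶠ ∷ 0ᶠ ∷ 0ᶠ ∷ 0ᶠ ∷ 0ᶠ ∷ []
    unit 1F c = 0ᶠ ∷ c ∷ 0ᶠ ∷ 0ᶠ ∷ 0ᶠ ∷ 0ᶠ ∷ []
    unit 2F c = 0ᶠ ∷ 0ᶠ ∷ c ∷ 0ᶠ ∷ 0ᶠ ∷ 0ᶠ ∷ []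
    unit 3F c = 0ᶠ ∷ 0ᶠ ∷ 0ᶠ ∷ c ∷ 0ᶠ ∷ 0ᶠ ∷ []
    unit 4F c = 0ᶠ ∷ 0ᶠ ∷ 0ᶠ ∷ 0ᶠ ∷ c ∷ 0ᶠ ∷ []
    unit 5F c = 0ᶠ ∷ 0ᶠ ∷ 0ᶠ ∷ 0ᶠ ∷ 0ᶠ ∷ c ∷ []

    nonzero-coordinate : ∀ {n} (u : V n) → u ≢ 0ⱽ → ∃ λ i → u ! i ≢ 0ᶠ
    nonzero-coordinate u nz with Finₚ.any? (λ i → ¬? (u ! i ≟ᶠ 0ᶠ))
    ... | yes r = r
    ... | no none = ⊥-elim (nz (ext (λ i → trans (zero' i) (sym (lookup-0 i)))))
      where
      zero' : ∀ i → u ! i ≡ 0ᶠ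
      zero' i with u ! i ≟ᶠ 0ᶠ
      ... | yes e = e
      ... | no ne = ⊥-elim (none (i , ne))

    -- σ = 1 gives the polar form of Q⁺(5,q), σ = −1 the form of W(5,q)
    module Form (σ : K) (σ² : σ *ᶠ σ ≡ 1ᶠ) where

      block : K → K → K → K → K
      block a b c d = a *ᶠ d +ᶠ σ *ᶠ (b *ᶠ c)

      block-sym : ∀ a b c d → block c d a b ≡ σ *ᶠ block a b c d
      block-sym a b c d = trans (let open FS in solve 5 (λ a b c d s → c :* b :+ s :* (d :* a) := s :* (a :* d) :+ (# 1) :* (b :* c)) refl a b c d σ)
        (trans (cong (λ z → σ *ᶠ (a *ᶠ d) +ᶠ z *ᶠ (b *ᶠ c)) (sym σ²)) (let open FS in solve 5 (λ a b c d s → s :* (a :* d) :+ (s :* s) :* (b :* c) := s :* (a :* d :+ s :* (b :* c))) refl a b c d σ))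

      block-lin : ∀ a b s a' b' c d → block (a +ᶠ s *ᶠ a') (b +ᶠ s *ᶠ b') c d ≡ block a b c d +ᶠ s *ᶠ block a' b' c d
      block-lin a b s a' b' c d = (let open FS in solve 8 (λ σ a b s a' b' c d → (a :+ s :* a') :* d :+ σ :* ((b :+ s :* b') :* c) := a :* d :+ σ :* (b :* c) :+ s :* (a' :* d :+ σ :* (b' :* c))) refl σ a b s a' b' c d)

      dual : Fin 6 → Fin 6
      dual 0F = 1F
      dual 1F = 0F
      dual 2F = 3F
      dual 3F = 2F
      dual 4F = 5F
      dual 5F = 4F

      sign : Fin 6 → K
      sign 0F = σ
      sign 1F = 1ᶠ
      sign 2F = σ
      sign 3F = 1ᶠ
      sign 4F = σ
      sign 5F = 1ᶠ

      abstract
        form : V 6 → V 6 → K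
        form u w = block (u ! 0F) (u ! 1F) (w ! 0F) (w ! 1F) +ᶠ block (u ! 2F) (u ! 3F) (w ! 2F) (w ! 3F) +ᶠ block (u ! 4F) (u ! 5F) (w ! 4F) (w ! 5F)

        form-def : ∀ u w → form u w ≡ block (u ! 0F) (u ! 1F) (w ! 0F) (w ! 1F) +ᶠ block (u ! 2F) (u ! 3F) (w ! 2F) (w ! 3F) +ᶠ block (u ! 4F) (u ! 5F) (w ! 4F) (w ! 5F)
        form-def u w = refl

        form-sym : ∀ u w → form w u ≡ σ *ᶠ form u w
        form-sym u w = trans (cong₂ _+ᶠ_ (cong₂ _+ᶠ_ (block-sym _ _ _ _) (block-sym _ _ _ _)) (block-sym _ _ _ _))
          (let open FS in solve 4 (λ s a b c → s :* a :+ s :* b :+ s :* c := s :* (a :+ b :+ c)) refl σ (block (u ! 0F) (u ! 1F) (w ! 0F) (w ! 1F)) (block (u ! 2F) (u ! 3F) (w ! 2F) (w ! 3F)) (block (u ! 4F) (u ! 5F) (w ! 4F) (w ! 5F)))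

        form-lin : ∀ u s w z → form (u ⊕ s ∙ w) z ≡ form u z +ᶠ s *ᶠ form w z
        form-lin u s w z = trans (cong₂ _+ᶠ_ (cong₂ _+ᶠ_ (b 0F 1F) (b 2F 3F)) (b 4F 5F))
          (let open FS in solve 7 (λ s a b c a' b' c' → a :+ s :* a' :+ (b :+ s :* b') :+ (c :+ s :* c') := a :+ b :+ c :+ s :* (a' :+ b' :+ c')) refl s (β u 0F 1F) (β u 2F 3F) (β u 4F 5F) (β w 0F 1F) (β w 2F 3F) (β w 4F 5F))
          where
          β : V 6 → Fin 6 → Fin 6 → K
          β u i j = block (u ! i) (u ! j) (z ! i) (z ! j)
          b : ∀ i j → β (u ⊕ s ∙ w) i j ≡ β u i j +ᶠ s *ᶠ β w i j
          b i j = trans (cong₂ (λ x y → block x y (z ! i) (z ! j)) (lookup-⊕ u w s i) (lookup-⊕ u w s j)) (block-lin _ _ _ _ _ _ _)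

        form-unit : ∀ u j c → form u (unit j c) ≡ sign j *ᶠ (u ! dual j *ᶠ c)
        form-unit u 0F k = (let open FS in solve 8 (λ σ k a b c d e f → a :* (# 0) :+ σ :* (b :* k) :+ (c :* (# 0) :+ σ :* (d :* (# 0))) :+ (e :* (# 0) :+ σ :* (f :* (# 0))) := σ :* (b :* k)) refl σ k (u ! 0F) (u ! 1F) (u ! 2F) (u ! 3F) (u ! 4F) (u ! 5F))
        form-unit u 1F k = (let open FS in solve 8 (λ σ k a b c d e f → a :* k :+ σ :* (b :* (# 0)) :+ (c :* (# 0) :+ σ :* (d :* (# 0))) :+ (e :* (# 0) :+ σ :* (f :* (# 0))) := (# 1) :* (a :* k)) refl σ k (u ! 0F) (u ! 1F) (u ! 2F) (u ! 3F) (u ! 4F) (u ! 5F))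
        form-unit u 2F k = (let open FS in solve 8 (λ σ k a b c d e f → a :* (# 0) :+ σ :* (b :* (# 0)) :+ (c :* (# 0) :+ σ :* (d :* k)) :+ (e :* (# 0) :+ σ :* (f :* (# 0))) := σ :* (d :* k)) refl σ k (u ! 0F) (u ! 1F) (u ! 2F) (u ! 3F) (u ! 4F) (u ! 5F))
        form-unit u 3F k = (let open FS in solve 8 (λ σ k a b c d e f → a :* (# 0) :+ σ :* (b :* (# 0)) :+ (c :* k :+ σ :* (d :* (# 0))) :+ (e :* (# 0) :+ σ :* (f :* (# 0))) := (# 1) :* (c :* k)) refl σ k (u ! 0F) (u ! 1F) (u ! 2F) (u ! 3F) (u ! 4F) (u ! 5F))
        form-unit u 4F k = (let open FS in solve 8 (λ σ k a b c d e f → a :* (# 0) :+ σ :* (b :* (# 0)) :+ (c :* (# 0) :+ σ :* (d :* (# 0))) :+ (e :* (# 0) :+ σ :* (f :* k)) := σ :* (f :* k)) refl σ k (u ! 0F) (u ! 1F) (u ! 2F) (u ! 3F) (u ! 4F) (u ! 5F))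
        form-unit u 5F k = (let open FS in solve 8 (λ σ k a b c d e f → a :* (# 0) :+ σ :* (b :* (# 0)) :+ (c :* (# 0) :+ σ :* (d :* (# 0))) :+ (e :* k :+ σ :* (f :* (# 0))) := (# 1) :* (e :* k)) refl σ k (u ! 0F) (u ! 1F) (u ! 2F) (u ! 3F) (u ! 4F) (u ! 5F))

      sign² : ∀ j → sign j *ᶠ sign j ≡ 1ᶠ
      sign² 0F = σ²
      sign² 1F = (let open FS in solve 0 ((# 1) :* (# 1) := (# 1)) refl)
      sign² 2F = σ²
      sign² 3F = (let open FS in solve 0 ((# 1) :* (# 1) := (# 1)) refl)
      sign² 4F = σ²
      sign² 5F = (let open FS in solve 0 ((# 1) :* (# 1) := (# 1)) refl)

      dual-dual : ∀ j → dual (dual j) ≡ j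
      dual-dual 0F = refl
      dual-dual 1F = refl
      dual-dual 2F = refl
      dual-dual 3F = refl
      dual-dual 4F = refl
      dual-dual 5F = refl

      form-nondeg : ∀ u i → u ! i ≢ 0ᶠ → ∃ λ w → form u w ≡ 1ᶠ
      form-nondeg u i nz = unit (dual i) (sign (dual i) *ᶠ (u ! i) ⁻¹ᶠ) , (begin
        form u (unit (dual i) (s *ᶠ x ⁻¹ᶠ))     ≡⟨ form-unit u (dual i) _ ⟩
        s *ᶠ (u ! dual (dual i) *ᶠ (s *ᶠ x ⁻¹ᶠ)) ≡⟨ cong (λ j → s *ᶠ (u ! j *ᶠ (s *ᶠ x ⁻¹ᶠ))) (dual-dual i) ⟩
        s *ᶠ (x *ᶠ (s *ᶠ x ⁻¹ᶠ))                ≡⟨ (let open FS in solve 3 (λ s x i → s :* (x :* (s :* i)) := (s :* s) :* (x :* i)) refl s x (x ⁻¹ᶠ)) ⟩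
        s *ᶠ s *ᶠ (x *ᶠ x ⁻¹ᶠ)                  ≡⟨ cong₂ _*ᶠ_ (sign² (dual i)) (inverseᶠ x nz) ⟩
        1ᶠ *ᶠ 1ᶠ                                ≡⟨ (let open FS in solve 0 ((# 1) :* (# 1) := (# 1)) refl) ⟩
        1ᶠ ∎)
        where
        x = u ! i
        s = sign (dual i)

    1²≡1 : 1ᶠ *ᶠ 1ᶠ ≡ 1ᶠ
    1²≡1 = (let open FS in solve 0 ((# 1) :* (# 1) := (# 1)) refl)

    -1²≡1 : -ᶠ 1ᶠ *ᶠ -ᶠ 1ᶠ ≡ 1ᶠ
    -1²≡1 = (let open FS in solve 0 (( :- (# 1)) :* ( :- (# 1)) := (# 1)) refl)

    -- In characteristic 2 the bilinear form does not determine the quadratic form, so both are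
    -- kept, tied together by `Q-⊕` and `B-diag`. This covers all characteristics at once.
    record Quadratic (n : ℕ) : Set₁ where
      field
        Q : V n → K
        B : V n → V n → K
        B-sym  : ∀ u w → B w u ≡ B u w
        B-lin  : ∀ u s w z → B (u ⊕ s ∙ w) z ≡ B u z +ᶠ s *ᶠ B w z
        B-diag : ∀ u → B u u ≡ Q u +ᶠ Q u
        Q-0    : Q 0ⱽ ≡ 0ᶠ
        Q-⊕    : ∀ u s w → Q (u ⊕ s ∙ w) ≡ Q u +ᶠ s *ᶠ B u w +ᶠ s *ᶠ s *ᶠ Q w
        nondeg : ∀ {u} → Q u ≡ 0ᶠ → u ≢ 0ⱽ → ∃ λ w → B u w ≡ 1ᶠ
        embed  : V n → V 7
        embed-injective : ∀ u w → embed u ≡ embed w → u ≡ w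

      polar : Polar n
      polar = record
        { B = B ; ε = 1ᶠ ; ε² = 1²≡1
        ; B-sym = λ u w → trans (B-sym u w) (let open FS in solve 1 (λ b → b := (# 1) :* b) refl (B u w))
        ; B-lin = B-lin
        ; Sing = λ u → Q u ≡ 0ᶠ ; Sing? = λ u → Q u ≟ᶠ 0ᶠ ; Sing-0 = Q-0
        ; Sing-⊕ = λ {u} {s} {w} a b c → trans (Q-⊕ u s w) (trans (cong₂ (λ x y → x +ᶠ s *ᶠ B u w +ᶠ s *ᶠ s *ᶠ y) a b)
            (trans (cong (λ x → 0ᶠ +ᶠ s *ᶠ x +ᶠ s *ᶠ s *ᶠ 0ᶠ) c) (let open FS in solve 1 (λ s → (# 0) :+ s :* (# 0) :+ s :* s :* (# 0) := (# 0)) refl s)))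
        ; B-self = λ {u} a → trans (B-diag u) (trans (cong (λ x → x +ᶠ x) a) (let open FS in solve 0 ((# 0) :+ (# 0) := (# 0)) refl))
        ; fix = λ {e} {f} s b → -ᶠ Q f , trans (Q-⊕ f (-ᶠ Q f) e) (trans (cong₂ (λ x y → Q f +ᶠ -ᶠ Q f *ᶠ x +ᶠ -ᶠ Q f *ᶠ -ᶠ Q f *ᶠ y) (trans (B-sym e f) b) s)
            (let open FS in solve 1 (λ x → x :+ ( :- x) :* (# 1) :+ ( :- x) :* ( :- x) :* (# 0) := (# 0)) refl (Q f)))
        ; nondeg = nondeg ; embed = embed ; embed-injective = embed-injective }

    pad : V 6 → V 7
    pad u = 0ᶠ ∷ u

    pad-injective : ∀ u w → pad u ≡ pad w → u ≡ w
    pad-injective u w e = Vecₚ.∷-injectiveʳ e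

    module Form⁺ = Form 1ᶠ 1²≡1
    module Form⁻ = Form (-ᶠ 1ᶠ) -1²≡1
    open Form⁺ public using (block) renaming (form to B₆)

    abstract
      Q₆ : V 6 → K
      Q₆ u = u ! 0F *ᶠ u ! 1F +ᶠ u ! 2F *ᶠ u ! 3F +ᶠ u ! 4F *ᶠ u ! 5F

      Q₆-def : ∀ u → Q₆ u ≡ u ! 0F *ᶠ u ! 1F +ᶠ u ! 2F *ᶠ u ! 3F +ᶠ u ! 4F *ᶠ u ! 5F
      Q₆-def u = refl

      Q₆-⊕ : ∀ u s w → Q₆ (u ⊕ s ∙ w) ≡ Q₆ u +ᶠ s *ᶠ B₆ u w +ᶠ s *ᶠ s *ᶠ Q₆ w
      Q₆-⊕ u s w = trans (cong₂ _+ᶠ_ (cong₂ _+ᶠ_ (b 0F 1F) (b 2F 3F)) (b 4F 5F))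
          (trans (let open FS in solve 10 (λ s a b c a' b' c' a'' b'' c'' → a :+ s :* a' :+ s :* s :* a'' :+ (b :+ s :* b' :+ s :* s :* b'') :+ (c :+ s :* c' :+ s :* s :* c'') := a :+ b :+ c :+ s :* (a' :+ b' :+ c') :+ s :* s :* (a'' :+ b'' :+ c'')) refl s (x u 0F 1F) (x u 2F 3F) (x u 4F 5F) (β 0F 1F) (β 2F 3F) (β 4F 5F) (x w 0F 1F) (x w 2F 3F) (x w 4F 5F))
            (cong (λ z → Q₆ u +ᶠ s *ᶠ z +ᶠ s *ᶠ s *ᶠ Q₆ w) (sym (Form⁺.form-def u w))))
        where
        x : V 6 → Fin 6 → Fin 6 → K
        x u i j = u ! i *ᶠ u ! j
        β : Fin 6 → Fin 6 → K
        β i j = block (u ! i) (u ! j) (w ! i) (w ! j)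
        b : ∀ i j → x (u ⊕ s ∙ w) i j ≡ x u i j +ᶠ s *ᶠ β i j +ᶠ s *ᶠ s *ᶠ x w i j
        b i j = trans (cong₂ _*ᶠ_ (lookup-⊕ u w s i) (lookup-⊕ u w s j))
          (let open FS in solve 5 (λ s a b c d → (a :+ s :* c) :* (b :+ s :* d) := a :* b :+ s :* (a :* d :+ (# 1) :* (b :* c)) :+ s :* s :* (c :* d)) refl s (u ! i) (u ! j) (w ! i) (w ! j))

      Q₆-diag : ∀ u → B₆ u u ≡ Q₆ u +ᶠ Q₆ u
      Q₆-diag u = trans (Form⁺.form-def u u) (let open FS in solve 6 (λ a b c d e f → (a :* b :+ (# 1) :* (b :* a)) :+ (c :* d :+ (# 1) :* (d :* c)) :+ (e :* f :+ (# 1) :* (f :* e)) := (a :* b :+ c :* d :+ e :* f) :+ (a :* b :+ c :* d :+ e :* f)) refl (u ! 0F) (u ! 1F) (u ! 2F) (u ! 3F) (u ! 4F) (u ! 5F))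

      Q₆-0 : Q₆ 0ⱽ ≡ 0ᶠ
      Q₆-0 = trans (cong₂ _+ᶠ_ (cong₂ _+ᶠ_ (cong₂ _*ᶠ_ (lookup-0 0F) (lookup-0 1F)) (cong₂ _*ᶠ_ (lookup-0 2F) (lookup-0 3F))) (cong₂ _*ᶠ_ (lookup-0 4F) (lookup-0 5F)))
            (let open FS in solve 0 ((# 0) :* (# 0) :+ (# 0) :* (# 0) :+ (# 0) :* (# 0) := (# 0)) refl)

      Q₆-unit : ∀ j → Q₆ (unit j 1ᶠ) ≡ 0ᶠ
      Q₆-unit 0F = (let open FS in solve 0 ((# 1) :* (# 0) :+ (# 0) :* (# 0) :+ (# 0) :* (# 0) := (# 0)) refl)
      Q₆-unit 1F = (let open FS in solve 0 ((# 0) :* (# 1) :+ (# 0) :* (# 0) :+ (# 0) :* (# 0) := (# 0)) refl)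
      Q₆-unit 2F = (let open FS in solve 0 ((# 0) :* (# 0) :+ (# 1) :* (# 0) :+ (# 0) :* (# 0) := (# 0)) refl)
      Q₆-unit 3F = (let open FS in solve 0 ((# 0) :* (# 0) :+ (# 0) :* (# 1) :+ (# 0) :* (# 0) := (# 0)) refl)
      Q₆-unit 4F = (let open FS in solve 0 ((# 0) :* (# 0) :+ (# 0) :* (# 0) :+ (# 1) :* (# 0) := (# 0)) refl)
      Q₆-unit 5F = (let open FS in solve 0 ((# 0) :* (# 0) :+ (# 0) :* (# 0) :+ (# 0) :* (# 1) := (# 0)) refl)

    hyperbolic : Quadratic 6
    hyperbolic = record
      { Q = Q₆ ; B = B₆ ; B-sym = λ u w → trans (Form⁺.form-sym u w) (let open FS in solve 1 (λ b → (# 1) :* b := b) refl (B₆ u w)) ; B-lin = Form⁺.form-lin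
      ; B-diag = Q₆-diag ; Q-0 = Q₆-0
      ; Q-⊕ = Q₆-⊕
      ; nondeg = λ {u} _ nz → let (i , ne) = nonzero-coordinate u nz in Form⁺.form-nondeg u i ne
      ; embed = pad ; embed-injective = pad-injective }

    symplectic : Polar 6
    symplectic = record
      { B = Form⁻.form ; ε = -ᶠ 1ᶠ ; ε² = -1²≡1 ; B-sym = Form⁻.form-sym ; B-lin = Form⁻.form-lin
      ; Sing = λ _ → ⊤ ; Sing? = λ _ → yes tt ; Sing-0 = tt ; Sing-⊕ = λ _ _ _ → tt
      ; B-self = λ {u} _ → trans (Form⁻.form-def u u) (let open FS in solve 6 (λ a b c d e f → (a :* b :+ ( :- (# 1)) :* (b :* a)) :+ (c :* d :+ ( :- (# 1)) :* (d :* c)) :+ (e :* f :+ ( :- (# 1)) :* (f :* e)) := (# 0)) refl (u ! 0F) (u ! 1F) (u ! 2F) (u ! 3F) (u ! 4F) (u ! 5F))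
      ; fix = λ _ _ → 0ᶠ , tt
      ; nondeg = λ {u} _ nz → let (i , ne) = nonzero-coordinate u nz in Form⁻.form-nondeg u i ne
      ; embed = pad ; embed-injective = pad-injective }

    abstract
      first : V 7 → V 6
      first u = u ! 0F ∷ u ! 1F ∷ u ! 2F ∷ u ! 3F ∷ u ! 4F ∷ u ! 5F ∷ []

      first-⊕ : ∀ u s w → first (u ⊕ s ∙ w) ≡ first u ⊕ s ∙ first w
      first-⊕ u s w = ext λ { 0F → l 0F 0F refl refl ; 1F → l 1F 1F refl refl ; 2F → l 2F 2F refl refl ; 3F → l 3F 3F refl refl ; 4F → l 4F 4F refl refl ; 5F → l 5F 5F refl refl }
        where
        l : ∀ (j : Fin 6) (i : Fin 7) → first u ! j ≡ u ! i → first w ! j ≡ w ! i → (u ⊕ s ∙ w) ! i ≡ (first u ⊕ s ∙ first w) ! j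
        l j i e e' = trans (lookup-⊕ u w s i) (sym (trans (lookup-⊕ (first u) (first w) s j) (cong₂ (λ x y → x +ᶠ s *ᶠ y) e e')))

      first-0 : first 0ⱽ ≡ 0ⱽ
      first-0 = ext λ { 0F → l 0F 0F ; 1F → l 1F 1F ; 2F → l 2F 2F ; 3F → l 3F 3F ; 4F → l 4F 4F ; 5F → l 5F 5F }
        where
        l : ∀ (i : Fin 7) (j : Fin 6) → 0ⱽ ! i ≡ 0ⱽ ! j
        l i j = trans (lookup-0 i) (sym (lookup-0 j))

      first-injective : ∀ u → first u ≡ 0ⱽ → u ! 6F ≡ 0ᶠ → u ≡ 0ⱽ
      first-injective u e u₆ = ext λ { 0F → l 0F 0F refl ; 1F → l 1F 1F refl ; 2F → l 2F 2F refl ; 3F → l 3F 3F refl ; 4F → l 4F 4F refl ; 5F → l 5F 5F refl ; 6F → trans u₆ (sym (lookup-0 6F)) }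
        where
        l : ∀ (j : Fin 6) (i : Fin 7) → first u ! j ≡ u ! i → u ! i ≡ 0ⱽ ! i
        l j i r = trans (sym r) (trans (cong (_! j) e) (trans (lookup-0 j) (sym (lookup-0 i))))

      first-def : ∀ u → first u ≡ u ! 0F ∷ u ! 1F ∷ u ! 2F ∷ u ! 3F ∷ u ! 4F ∷ u ! 5F ∷ []
      first-def u = refl

      Q₇ : V 7 → K
      Q₇ u = Q₆ (first u) +ᶠ u ! 6F *ᶠ u ! 6F

      Q₇-def : ∀ u → Q₇ u ≡ Q₆ (first u) +ᶠ u ! 6F *ᶠ u ! 6F
      Q₇-def u = refl

      B₇ : V 7 → V 7 → K
      B₇ u w = B₆ (first u) (first w) +ᶠ (u ! 6F *ᶠ w ! 6F +ᶠ u ! 6F *ᶠ w ! 6F)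

      B₇-sym : ∀ u w → B₇ w u ≡ B₇ u w
      B₇-sym u w = cong₂ _+ᶠ_ (Quadratic.B-sym hyperbolic (first u) (first w)) (let open FS in solve 2 (λ a b → b :* a :+ b :* a := a :* b :+ a :* b) refl (u ! 6F) (w ! 6F))

      B₇-lin : ∀ u s w z → B₇ (u ⊕ s ∙ w) z ≡ B₇ u z +ᶠ s *ᶠ B₇ w z
      B₇-lin u s w z = trans (cong₂ _+ᶠ_ (trans (cong (λ x → B₆ x (first z)) (first-⊕ u s w)) (Form⁺.form-lin (first u) s (first w) (first z)))
          (cong (λ x → x *ᶠ z ! 6F +ᶠ x *ᶠ z ! 6F) (lookup-⊕ u w s 6F)))
          (let open FS in solve 6 (λ s b c x y z → b :+ s :* c :+ ((x :+ s :* y) :* z :+ (x :+ s :* y) :* z) := b :+ (x :* z :+ x :* z) :+ s :* (c :+ (y :* z :+ y :* z))) refl s (B₆ (first u) (first z)) (B₆ (first w) (first z)) (u ! 6F) (w ! 6F) (z ! 6F))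

      Q₇-diag : ∀ u → B₇ u u ≡ Q₇ u +ᶠ Q₇ u
      Q₇-diag u = trans (cong (_+ᶠ (u ! 6F *ᶠ u ! 6F +ᶠ u ! 6F *ᶠ u ! 6F)) (Q₆-diag (first u)))
          (let open FS in solve 2 (λ a x → a :+ a :+ (x :* x :+ x :* x) := a :+ x :* x :+ (a :+ x :* x)) refl (Q₆ (first u)) (u ! 6F))

      Q₇-0 : Q₇ 0ⱽ ≡ 0ᶠ
      Q₇-0 = trans (cong₂ _+ᶠ_ (trans (cong Q₆ first-0) Q₆-0) (cong₂ _*ᶠ_ (lookup-0 6F) (lookup-0 6F))) (let open FS in solve 0 ((# 0) :+ (# 0) :* (# 0) := (# 0)) refl)

      Q₇-⊕ : ∀ u s w → Q₇ (u ⊕ s ∙ w) ≡ Q₇ u +ᶠ s *ᶠ B₇ u w +ᶠ s *ᶠ s *ᶠ Q₇ w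
      Q₇-⊕ u s w = trans (cong₂ _+ᶠ_ (trans (cong Q₆ (first-⊕ u s w)) (Q₆-⊕ (first u) s (first w))) (cong (λ x → x *ᶠ x) (lookup-⊕ u w s 6F)))
          (let open FS in solve 6 (λ s a b c x y → a :+ s :* b :+ s :* s :* c :+ (x :+ s :* y) :* (x :+ s :* y) := a :+ x :* x :+ s :* (b :+ (x :* y :+ x :* y)) :+ s :* s :* (c :+ y :* y)) refl s (Q₆ (first u)) (B₆ (first u) (first w)) (Q₆ (first w)) (u ! 6F) (w ! 6F))

      lift : K → V 6 → V 7
      lift c w = w ! 0F ∷ w ! 1F ∷ w ! 2F ∷ w ! 3F ∷ w ! 4F ∷ w ! 5F ∷ c ∷ []

      first-lift : ∀ c w → first (lift c w) ≡ w
      first-lift c w = ext λ { 0F → refl ; 1F → refl ; 2F → refl ; 3F → refl ; 4F → refl ; 5F → refl }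

      B₇-lift : ∀ u w → B₇ u (lift 0ᶠ w) ≡ B₆ (first u) w
      B₇-lift u w = trans (cong (λ z → B₆ (first u) z +ᶠ (u ! 6F *ᶠ 0ᶠ +ᶠ u ! 6F *ᶠ 0ᶠ)) (first-lift 0ᶠ w)) (let open FS in solve 2 (λ b x → b :+ (x :* (# 0) :+ x :* (# 0)) := b) refl (B₆ (first u) w) (u ! 6F))

      Q₇-lift : ∀ w → Q₇ (lift 0ᶠ w) ≡ Q₆ w
      Q₇-lift w = trans (cong (λ z → Q₆ z +ᶠ 0ᶠ *ᶠ 0ᶠ) (first-lift 0ᶠ w)) (let open FS in solve 1 (λ b → b :+ (# 0) :* (# 0) := b) refl (Q₆ w))

      -- In characteristic 2 the last basis vector is in the radical of `B₇`, but it is not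
      -- singular: if the first six coordinates of u vanish, then `Q₇` u is the square of the last
      -- one, and u = 0. This is why nondegeneracy is demanded of singular vectors.
      Q₇-nondeg : ∀ {u} → Q₇ u ≡ 0ᶠ → u ≢ 0ⱽ → ∃ λ w → B₇ u w ≡ 1ᶠ
      Q₇-nondeg {u} z nz with first u ≟ⱽ 0ⱽ
      ... | no ne = let (i , n) = nonzero-coordinate (first u) ne
                        (w , e) = Form⁺.form-nondeg (first u) i n in lift 0ᶠ w , trans (B₇-lift u w) e
      ... | yes e = ⊥-elim (nz (first-injective u e u₆))
        where
        u₆ : u ! 6F ≡ 0ᶠ
        u₆ with u ! 6F ≟ᶠ 0ᶠ
        ... | yes z₆ = z₆
        ... | no n₆ = cancelᶠ n₆ (trans (let open FS in solve 1 (λ x → x :* x := (# 0) :+ x :* x) refl (u ! 6F)) (trans (cong (_+ᶠ u ! 6F *ᶠ u ! 6F) (sym (trans (cong Q₆ e) Q₆-0))) z))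

    parabolic : Quadratic 7
    parabolic = record
      { Q = Q₇ ; B = B₇ ; B-sym = B₇-sym ; B-lin = B₇-lin ; B-diag = Q₇-diag ; Q-0 = Q₇-0 ; Q-⊕ = Q₇-⊕ ; nondeg = Q₇-nondeg
      ; embed = id ; embed-injective = λ _ _ e → e }

  -- Planes, dual systems and hyperbolic frames

  module PolarTheory {n : ℕ} (P : PolarSpaces.Polar n) where
    open PolarSpaces.Polar P public
    open Spaces

    0-sym : ∀ {u w} → B u w ≡ 0ᶠ → B w u ≡ 0ᶠ
    0-sym e = trans (B-sym _ _) (trans (cong (ε *ᶠ_) e) (let open FS in solve 1 (λ e → e :* (# 0) := (# 0)) refl ε))

    B-linʳ : ∀ u s w z → B z (u ⊕ s ∙ w) ≡ B z u +ᶠ s *ᶠ B z w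
    B-linʳ u s w z = begin
      B z (u ⊕ s ∙ w)                    ≡⟨ B-sym _ _ ⟩
      ε *ᶠ B (u ⊕ s ∙ w) z               ≡⟨ cong (ε *ᶠ_) (B-lin u s w z) ⟩
      ε *ᶠ (B u z +ᶠ s *ᶠ B w z)         ≡⟨ (let open FS in solve 4 (λ e x y s → e :* (x :+ s :* y) := e :* x :+ s :* (e :* y)) refl ε (B u z) (B w z) s) ⟩
      ε *ᶠ B u z +ᶠ s *ᶠ (ε *ᶠ B w z)    ≡⟨ cong₂ (λ a b → a +ᶠ s *ᶠ b) (B-sym u z) (B-sym w z) ⟨
      B z u +ᶠ s *ᶠ B z w                ∎

    B-0 : ∀ z → B 0ⱽ z ≡ 0ᶠ
    B-0 z = begin
      B 0ⱽ z                           ≡⟨ cong (λ u → B u z) (vsolve {0} {n} 𝟘 (𝟘 ⊞ -ᶠ 1ᶠ ⊠ 𝟘) [] (λ _ → (let open FS in solve 0 ((# 0) := (# 0) :+ ( :- (# 1)) :* (# 0)) refl))) ⟩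
      B (0ⱽ ⊕ -ᶠ 1ᶠ ∙ 0ⱽ) z            ≡⟨ B-lin _ _ _ _ ⟩
      B 0ⱽ z +ᶠ (-ᶠ 1ᶠ) *ᶠ B 0ⱽ z      ≡⟨ (let open FS in solve 1 (λ b → b :+ ( :- (# 1)) :* b := (# 0)) refl (B 0ⱽ z)) ⟩
      0ᶠ                               ∎

    B-0ʳ : ∀ z → B z 0ⱽ ≡ 0ᶠ
    B-0ʳ z = 0-sym (B-0 z)

    B-eval : ∀ {k} (l : Lin k) us z → B (evalV l us) z ≡ evalF l (Vec.map (λ u → B u z) us)
    B-eval 𝟘 us z = B-0 z
    B-eval (var j) us z = sym (Vecₚ.lookup-map j (λ u → B u z) us)
    B-eval (l ⊞ s ⊠ m) us z = trans (B-lin _ s _ z) (cong₂ (λ a b → a +ᶠ s *ᶠ b) (B-eval l us z) (B-eval m us z))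

    B-evalʳ : ∀ {k} (l : Lin k) us z → B z (evalV l us) ≡ evalF l (Vec.map (B z) us)
    B-evalʳ 𝟘 us z = B-0ʳ z
    B-evalʳ (var j) us z = sym (Vecₚ.lookup-map j (B z) us)
    B-evalʳ (l ⊞ s ⊠ m) us z = trans (B-linʳ _ s _ z) (cong₂ (λ a b → a +ᶠ s *ᶠ b) (B-evalʳ l us z) (B-evalʳ m us z))

    linˡ : ∀ {u s w z a b c} → B u z ≡ a → B w z ≡ b → a +ᶠ s *ᶠ b ≡ c → B (u ⊕ s ∙ w) z ≡ c
    linˡ p q r = trans (B-lin _ _ _ _) (trans (cong₂ (λ a b → a +ᶠ _ *ᶠ b) p q) r)

    linʳ : ∀ {u s w z a b c} → B z u ≡ a → B z w ≡ b → a +ᶠ s *ᶠ b ≡ c → B z (u ⊕ s ∙ w) ≡ c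
    linʳ p q r = trans (B-linʳ _ _ _ _) (trans (cong₂ (λ a b → a +ᶠ _ *ᶠ b) p q) r)

    linˡ-keep : ∀ {u s w z c} → B u z ≡ c → B w z ≡ 0ᶠ → B (u ⊕ s ∙ w) z ≡ c
    linˡ-keep {s = s} {c = c} p q = linˡ p q (let open FS in solve 2 (λ s c → c :+ s :* (# 0) := c) refl s c)

    linʳ-keep : ∀ {u s w z c} → B z u ≡ c → B z w ≡ 0ᶠ → B z (u ⊕ s ∙ w) ≡ c
    linʳ-keep {s = s} {c = c} p q = linʳ p q (let open FS in solve 2 (λ s c → c :+ s :* (# 0) := c) refl s c)

    -- Independence is witnessed by a dual system f₁, f₂, f₃. It makes the coefficients of a vector
    -- w of the plane available as B w fᵢ; the fᵢ may be neither singular nor mutually orthogonal.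
    record Plane (e₁ e₂ e₃ : V n) : Set where
      field
        s₁ : Sing e₁
        s₂ : Sing e₂
        s₃ : Sing e₃
        p₁₂ : B e₁ e₂ ≡ 0ᶠ
        p₁₃ : B e₁ e₃ ≡ 0ᶠ
        p₂₃ : B e₂ e₃ ≡ 0ᶠ
        f₁ f₂ f₃ : V n
        d₁₁ : B e₁ f₁ ≡ 1ᶠ
        d₁₂ : B e₁ f₂ ≡ 0ᶠ
        d₁₃ : B e₁ f₃ ≡ 0ᶠ
        d₂₁ : B e₂ f₁ ≡ 0ᶠ
        d₂₂ : B e₂ f₂ ≡ 1ᶠ
        d₂₃ : B e₂ f₃ ≡ 0ᶠ
        d₃₁ : B e₃ f₁ ≡ 0ᶠ
        d₃₂ : B e₃ f₂ ≡ 0ᶠ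
        d₃₃ : B e₃ f₃ ≡ 1ᶠ

    swap₁₂ : ∀ {a b c} → Plane a b c → Plane b a c
    swap₁₂ p = record
      { s₁ = s₂ ; s₂ = s₁ ; s₃ = s₃ ; p₁₂ = 0-sym p₁₂ ; p₁₃ = p₂₃ ; p₂₃ = p₁₃
      ; f₁ = f₂ ; f₂ = f₁ ; f₃ = f₃ ; d₁₁ = d₂₂ ; d₁₂ = d₂₁ ; d₁₃ = d₂₃ ; d₂₁ = d₁₂ ; d₂₂ = d₁₁ ; d₂₃ = d₁₃
      ; d₃₁ = d₃₂ ; d₃₂ = d₃₁ ; d₃₃ = d₃₃ }
      where open Plane p

    swap₂₃ : ∀ {a b c} → Plane a b c → Plane a c b
    swap₂₃ p = record
      { s₁ = s₁ ; s₂ = s₃ ; s₃ = s₂ ; p₁₂ = p₁₃ ; p₁₃ = p₁₂ ; p₂₃ = 0-sym p₂₃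
      ; f₁ = f₁ ; f₂ = f₃ ; f₃ = f₂ ; d₁₁ = d₁₁ ; d₁₂ = d₁₃ ; d₁₃ = d₁₂ ; d₂₁ = d₃₁ ; d₂₂ = d₃₃ ; d₂₃ = d₃₂
      ; d₃₁ = d₂₁ ; d₃₂ = d₂₃ ; d₃₃ = d₂₂ }
      where open Plane p

    swap₁₃ : ∀ {a b c} → Plane a b c → Plane c b a
    swap₁₃ = swap₁₂ ∘ swap₂₃ ∘ swap₁₂

    rot : ∀ {a b c} → Plane a b c → Plane b c a
    rot = swap₂₃ ∘ swap₁₂

    add₃₁ : ∀ {a b c} s → Plane a b c → Plane a b (c ⊕ s ∙ a)
    add₃₁ s p = record
      { s₁ = s₁ ; s₂ = s₂ ; s₃ = Sing-⊕ s₃ s₁ (0-sym p₁₃) ; p₁₂ = p₁₂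
      ; p₁₃ = linʳ-keep p₁₃ (B-self s₁) ; p₂₃ = linʳ-keep p₂₃ (0-sym p₁₂)
      ; f₁ = f₁ ⊕ -ᶠ s ∙ f₃ ; f₂ = f₂ ; f₃ = f₃
      ; d₁₁ = linʳ-keep d₁₁ d₁₃ ; d₁₂ = d₁₂ ; d₁₃ = d₁₃ ; d₂₁ = linʳ-keep d₂₁ d₂₃ ; d₂₂ = d₂₂ ; d₂₃ = d₂₃
      ; d₃₁ = linʳ (linˡ d₃₁ d₁₁ refl) (linˡ d₃₃ d₁₃ refl) (let open FS in solve 1 (λ s → (# 0) :+ s :* (# 1) :+ ( :- s) :* ((# 1) :+ s :* (# 0)) := (# 0)) refl s)
      ; d₃₂ = linˡ-keep d₃₂ d₁₂ ; d₃₃ = linˡ-keep d₃₃ d₁₃ }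
      where open Plane p

    add₃₂ : ∀ {a b c} s → Plane a b c → Plane a b (c ⊕ s ∙ b)
    add₃₂ s = swap₁₂ ∘ add₃₁ s ∘ swap₁₂

    -- The old vector c, rescaled, is dual to the new vector u, and it is already orthogonal to a
    -- and b. The other two dual vectors only have to be made orthogonal to u.
    replace : ∀ {a b c u} → Plane a b c → Sing u → B a u ≡ 0ᶠ → B b u ≡ 0ᶠ → B c u ≢ 0ᶠ → Plane a b u
    replace {a} {b} {c} {u} p su pa pb pc = record
      { s₁ = s₁ ; s₂ = s₂ ; s₃ = su ; p₁₂ = p₁₂ ; p₁₃ = pa ; p₂₃ = pb
      ; f₁ = f₁ ⊕ -ᶠ B u f₁ ∙ g ; f₂ = f₂ ⊕ -ᶠ B u f₂ ∙ g ; f₃ = g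
      ; d₁₁ = linʳ-keep d₁₁ ag ; d₁₂ = linʳ-keep d₁₂ ag ; d₁₃ = ag
      ; d₂₁ = linʳ-keep d₂₁ bg ; d₂₂ = linʳ-keep d₂₂ bg ; d₂₃ = bg
      ; d₃₁ = linʳ refl ug (let open FS in solve 1 (λ x → x :+ ( :- x) :* (# 1) := (# 0)) refl (B u f₁))
      ; d₃₂ = linʳ refl ug (let open FS in solve 1 (λ x → x :+ ( :- x) :* (# 1) := (# 0)) refl (B u f₂)) ; d₃₃ = ug }
      where
      open Plane p
      i = (B c u) ⁻¹ᶠ
      g = 0ⱽ ⊕ ε *ᶠ i ∙ c
      ag : B a g ≡ 0ᶠ
      ag = linʳ-keep (B-0ʳ a) p₁₃
      bg : B b g ≡ 0ᶠ
      bg = linʳ-keep (B-0ʳ b) p₂₃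
      ug : B u g ≡ 1ᶠ
      ug = linʳ (B-0ʳ u) (B-sym c u) (begin
        0ᶠ +ᶠ ε *ᶠ i *ᶠ (ε *ᶠ B c u)  ≡⟨ (let open FS in solve 3 (λ e i x → (# 0) :+ e :* i :* (e :* x) := (e :* e) :* (x :* i)) refl ε i (B c u)) ⟩
        ε *ᶠ ε *ᶠ (B c u *ᶠ i)        ≡⟨ cong₂ _*ᶠ_ ε² (inverseᶠ _ pc) ⟩
        1ᶠ *ᶠ 1ᶠ                      ≡⟨ (let open FS in solve 0 ((# 1) :* (# 1) := (# 1)) refl) ⟩
        1ᶠ                            ∎)

    -- Steinitz exchange: for u in the plane, B u f₃ is its coefficient at c. Here the rescaled f₃,
    -- instead of c, stays the third dual vector.
    exchange : ∀ {a b c u} (p : Plane a b c) → Sing u → B a u ≡ 0ᶠ → B b u ≡ 0ᶠ → B u (Plane.f₃ p) ≢ 0ᶠ → Plane a b u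
    exchange {a} {b} {c} {u} p su pa pb n = record
      { s₁ = s₁ ; s₂ = s₂ ; s₃ = su ; p₁₂ = p₁₂ ; p₁₃ = pa ; p₂₃ = pb
      ; f₁ = f₁ ⊕ -ᶠ B u f₁ ∙ g ; f₂ = f₂ ⊕ -ᶠ B u f₂ ∙ g ; f₃ = g
      ; d₁₁ = linʳ-keep d₁₁ ag ; d₁₂ = linʳ-keep d₁₂ ag ; d₁₃ = ag
      ; d₂₁ = linʳ-keep d₂₁ bg ; d₂₂ = linʳ-keep d₂₂ bg ; d₂₃ = bg
      ; d₃₁ = linʳ refl ug (let open FS in solve 1 (λ x → x :+ ( :- x) :* (# 1) := (# 0)) refl (B u f₁))
      ; d₃₂ = linʳ refl ug (let open FS in solve 1 (λ x → x :+ ( :- x) :* (# 1) := (# 0)) refl (B u f₂)) ; d₃₃ = ug }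
      where
      open Plane p
      i = (B u f₃) ⁻¹ᶠ
      g = 0ⱽ ⊕ i ∙ f₃
      ag : B a g ≡ 0ᶠ
      ag = linʳ-keep (B-0ʳ a) d₁₃
      bg : B b g ≡ 0ᶠ
      bg = linʳ-keep (B-0ʳ b) d₂₃
      ug : B u g ≡ 1ᶠ
      ug = linʳ (B-0ʳ u) refl (trans (let open FS in solve 2 (λ i x → (# 0) :+ i :* x := x :* i) refl i (B u f₃)) (inverseᶠ _ n))

    -- Formally orthogonality to the plane; for singular w this is membership, by `maximal`. Sums
    -- over a plane can thus be written with the indicators of three linear conditions.
    record InPlane (e₁ e₂ e₃ w : V n) : Set where
      constructor inPlane
      field
        i₁ : B e₁ w ≡ 0ᶠ
        i₂ : B e₂ w ≡ 0ᶠ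
        i₃ : B e₃ w ≡ 0ᶠ

    comb : ∀ {k} → (Fin k → K) → (Fin k → V n) → V n
    comb {zero} a u = 0ⱽ
    comb {suc k} a u = comb (a ∘ Fin.suc) (u ∘ Fin.suc) ⊕ a Fin.zero ∙ u Fin.zero

    comb-cong : ∀ {k} {a b : Fin k → K} (u : Fin k → V n) → (∀ i → a i ≡ b i) → comb a u ≡ comb b u
    comb-cong {zero} u e = refl
    comb-cong {suc k} u e = cong₂ (λ x y → x ⊕ y ∙ u Fin.zero) (comb-cong (u ∘ Fin.suc) (e ∘ Fin.suc)) (e Fin.zero)

    Bʳ-comb-0 : ∀ {k} z (a : Fin k → K) u → (∀ j → B z (u j) ≡ 0ᶠ) → B z (comb a u) ≡ 0ᶠ
    Bʳ-comb-0 {zero} z a u e = B-0ʳ z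
    Bʳ-comb-0 {suc k} z a u e = linʳ-keep (Bʳ-comb-0 z (a ∘ Fin.suc) (u ∘ Fin.suc) (e ∘ Fin.suc)) (e Fin.zero)

    Bʳ-comb : ∀ {k} z (a : Fin k → K) u i → B z (u i) ≡ 1ᶠ → (∀ j → j ≢ i → B z (u j) ≡ 0ᶠ) → B z (comb a u) ≡ a i
    Bʳ-comb {suc k} z a u Fin.zero e o = linʳ (Bʳ-comb-0 z (a ∘ Fin.suc) (u ∘ Fin.suc) (λ j → o (Fin.suc j) (λ ()))) e
      (let open FS in solve 1 (λ a → (# 0) :+ a :* (# 1) := a) refl (a Fin.zero))
    Bʳ-comb {suc k} z a u (Fin.suc i) e o = linʳ-keep
      (Bʳ-comb z (a ∘ Fin.suc) (u ∘ Fin.suc) i e (λ j d → o (Fin.suc j) (λ { refl → d refl }))) (o Fin.zero (λ ()))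

    B-comb : ∀ {k} z (a : Fin k → K) u i → B (u i) z ≡ 1ᶠ → (∀ j → j ≢ i → B (u j) z ≡ 0ᶠ) → B (comb a u) z ≡ a i
    B-comb {suc k} z a u Fin.zero e o = linˡ (0-sym (Bʳ-comb-0 z (a ∘ Fin.suc) (u ∘ Fin.suc) (λ j → 0-sym (o (Fin.suc j) (λ ()))))) e
      (let open FS in solve 1 (λ a → (# 0) :+ a :* (# 1) := a) refl (a Fin.zero))
    B-comb {suc k} z a u (Fin.suc i) e o = linˡ-keep
      (B-comb z (a ∘ Fin.suc) (u ∘ Fin.suc) i e (λ j d → o (Fin.suc j) (λ { refl → d refl }))) (o Fin.zero (λ ()))

    -- The combinations of the eight vectors are distinct: pairing with the e i recovers the
    -- coefficients of the f i, and then pairing with the f i recovers those of the e i, whatever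
    -- the products among the f i are. So eight coordinates would inject into seven.
    no-solid : (e f : Fin 4 → V n) → (∀ i j → B (e i) (e j) ≡ 0ᶠ) → (∀ i → B (e i) (f i) ≡ 1ᶠ) →
      (∀ i j → i ≢ j → B (e i) (f j) ≡ 0ᶠ) → ⊥
    no-solid e f ee ef ef0 = no-injection 7 (embed ∘ ψ) (λ a b p → injective a b (embed-injective _ _ p))
      where
      fst snd : V 8 → Fin 4 → K
      fst c = lookup (Vec.take 4 c)
      snd c = lookup (Vec.drop 4 c)
      ψ : V 8 → V n
      ψ c = comb (snd c) f ⊕ 1ᶠ ∙ comb (fst c) e
      eψ : ∀ c i → B (e i) (ψ c) ≡ snd c i
      eψ c i = linʳ-keep (Bʳ-comb (e i) (snd c) f i (ef i) (λ j d → ef0 i j (d ∘ sym))) (Bʳ-comb-0 (e i) (fst c) e (ee i))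
      ψf : ∀ c i → B (ψ c) (f i) ≡ B (comb (snd c) f) (f i) +ᶠ 1ᶠ *ᶠ fst c i
      ψf c i = linˡ refl (B-comb (f i) (fst c) e i (ef i) (λ j d → ef0 j i d)) refl
      snd≡ : ∀ a b → ψ a ≡ ψ b → ∀ i → snd a i ≡ snd b i
      snd≡ a b p i = trans (sym (eψ a i)) (trans (cong (B (e i)) p) (eψ b i))
      fst≡ : ∀ a b → ψ a ≡ ψ b → ∀ i → fst a i ≡ fst b i
      fst≡ a b p i = diff0 (trans (let open FS in solve 3 (λ x y c → x :- y := c :+ (# 1) :* x :- (c :+ (# 1) :* y)) refl (fst a i) (fst b i) (B (comb (snd a) f) (f i)))
        (trans (cong₂ (λ s t → s +ᶠ -ᶠ t) (trans (sym (ψf a i)) (trans (cong (λ z → B z (f i)) p) (ψf b i)))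
          (cong (λ z → B z (f i) +ᶠ 1ᶠ *ᶠ fst b i) (comb-cong f (snd≡ a b p)))) (let open FS in solve 1 (λ x → x :- x := (# 0)) refl (B (comb (snd b) f) (f i) +ᶠ 1ᶠ *ᶠ fst b i))))
      injective : ∀ a b → ψ a ≡ ψ b → a ≡ b
      injective a b p = trans (sym (Vecₚ.take++drop≡id 4 a)) (trans (cong₂ Vec._++_ (ext {u = Vec.take 4 a} {Vec.take 4 b} (fst≡ a b p)) (ext {u = Vec.drop 4 a} {Vec.drop 4 b} (snd≡ a b p))) (Vecₚ.take++drop≡id 4 b))

    maximal-0 : ∀ {e₁ e₂ e₃ w} (p : Plane e₁ e₂ e₃) → Sing w → InPlane e₁ e₂ e₃ w →
      B w (Plane.f₁ p) ≡ 0ᶠ → B w (Plane.f₂ p) ≡ 0ᶠ → B w (Plane.f₃ p) ≡ 0ᶠ → w ≡ 0ⱽ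
    maximal-0 {e₁} {e₂} {e₃} {w} p sw (inPlane i₁ i₂ i₃) wf₁ wf₂ wf₃ with w ≟ⱽ 0ⱽ
    ... | yes e = e
    ... | no nz = ⊥-elim (no-solid e f ee ef ef0)
      where
      open Plane p
      h = proj₁ (nondeg sw nz)
      wh = proj₂ (nondeg sw nz)
      -- The corrections make the dual vector of w orthogonal to the eᵢ; they leave its product with
      -- w at 1 because w is orthogonal to every fᵢ.
      f₄ = h ⊕ -ᶠ B e₁ h ∙ f₁ ⊕ -ᶠ B e₂ h ∙ f₂ ⊕ -ᶠ B e₃ h ∙ f₃
      e f : Fin 4 → V n
      e = lookup (e₁ ∷ e₂ ∷ e₃ ∷ w ∷ [])
      f = lookup (f₁ ∷ f₂ ∷ f₃ ∷ f₄ ∷ [])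
      pattern 0F = Fin.zero
      pattern 1F = Fin.suc Fin.zero
      pattern 2F = Fin.suc (Fin.suc Fin.zero)
      pattern 3F = Fin.suc (Fin.suc (Fin.suc Fin.zero))
      ee : ∀ i j → B (e i) (e j) ≡ 0ᶠ
      ee 0F 0F = B-self s₁
      ee 0F 1F = p₁₂
      ee 0F 2F = p₁₃
      ee 0F 3F = i₁
      ee 1F 0F = 0-sym p₁₂
      ee 1F 1F = B-self s₂
      ee 1F 2F = p₂₃
      ee 1F 3F = i₂
      ee 2F 0F = 0-sym p₁₃
      ee 2F 1F = 0-sym p₂₃
      ee 2F 2F = B-self s₃
      ee 2F 3F = i₃
      ee 3F 0F = 0-sym i₁
      ee 3F 1F = 0-sym i₂
      ee 3F 2F = 0-sym i₃
      ee 3F 3F = B-self sw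
      ef : ∀ i → B (e i) (f i) ≡ 1ᶠ
      ef 0F = d₁₁
      ef 1F = d₂₂
      ef 2F = d₃₃
      ef 3F = linʳ-keep (linʳ-keep (linʳ-keep wh wf₁) wf₂) wf₃
      ef0 : ∀ i j → i ≢ j → B (e i) (f j) ≡ 0ᶠ
      ef0 0F 0F d = ⊥-elim (d refl)
      ef0 0F 1F d = d₁₂
      ef0 0F 2F d = d₁₃
      ef0 0F 3F d = linʳ-keep (linʳ-keep (linʳ refl d₁₁ (let open FS in solve 1 (λ x → x :+ ( :- x) :* (# 1) := (# 0)) refl (B e₁ h))) d₁₂) d₁₃
      ef0 1F 0F d = d₂₁
      ef0 1F 1F d = ⊥-elim (d refl)
      ef0 1F 2F d = d₂₃
      ef0 1F 3F d = linʳ-keep (linʳ (linʳ-keep refl d₂₁) d₂₂ (let open FS in solve 1 (λ x → x :+ ( :- x) :* (# 1) := (# 0)) refl (B e₂ h))) d₂₃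
      ef0 2F 0F d = d₃₁
      ef0 2F 1F d = d₃₂
      ef0 2F 2F d = ⊥-elim (d refl)
      ef0 2F 3F d = linʳ (linʳ-keep (linʳ-keep refl d₃₁) d₃₂) d₃₃ (let open FS in solve 1 (λ x → x :+ ( :- x) :* (# 1) := (# 0)) refl (B e₃ h))
      ef0 3F 0F d = wf₁
      ef0 3F 1F d = wf₂
      ef0 3F 2F d = wf₃
      ef0 3F 3F d = ⊥-elim (d refl)

    -- Otherwise there are four independent pairwise orthogonal singular vectors,
    -- which together with a dual system are eight independent vectors.
    maximal : ∀ {e₁ e₂ e₃ w} (p : Plane e₁ e₂ e₃) → Sing w → InPlane e₁ e₂ e₃ w →
      w ≡ lc₃ (B w (Plane.f₁ p)) (B w (Plane.f₂ p)) (B w (Plane.f₃ p)) e₁ e₂ e₃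
    maximal {e₁} {e₂} {e₃} {w} p sw (inPlane i₁ i₂ i₃) = begin
      w                                   ≡⟨ (vsolve (v# 0) (((((((v# 0) ⊞ (-ᶠ (B w f₁)) ⊠ (v# 1)) ⊞ (-ᶠ (B w f₂)) ⊠ (v# 2)) ⊞ (-ᶠ (B w f₃)) ⊠ (v# 3)) ⊞ (B w f₁) ⊠ (v# 1)) ⊞ (B w f₂) ⊠ (v# 2)) ⊞ (B w f₃) ⊠ (v# 3)) (w ∷ e₁ ∷ e₂ ∷ e₃ ∷ []) (λ { (wᶜ ∷ e₁ᶜ ∷ e₂ᶜ ∷ e₃ᶜ ∷ []) → (let open FS in solve 7 (λ w e₁ e₂ e₃ a b c → w := (w :+ ( :- a) :* e₁ :+ ( :- b) :* e₂ :+ ( :- c) :* e₃) :+ a :* e₁ :+ b :* e₂ :+ c :* e₃) refl wᶜ e₁ᶜ e₂ᶜ e₃ᶜ (B w f₁) (B w f₂) (B w f₃)) })) ⟩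
      _ ⊕ B w f₁ ∙ e₁ ⊕ B w f₂ ∙ e₂ ⊕ B w f₃ ∙ e₃ ≡⟨ cong (λ z → z ⊕ B w f₁ ∙ e₁ ⊕ B w f₂ ∙ e₂ ⊕ B w f₃ ∙ e₃) rest ⟩
      lc₃ (B w f₁) (B w f₂) (B w f₃) e₁ e₂ e₃ ∎
      where
      open Plane p
      rest : w ⊕ -ᶠ B w f₁ ∙ e₁ ⊕ -ᶠ B w f₂ ∙ e₂ ⊕ -ᶠ B w f₃ ∙ e₃ ≡ 0ⱽ
      rest = maximal-0 p
        (Sing-⊕ (Sing-⊕ (Sing-⊕ sw s₁ (0-sym i₁)) s₂ (linˡ-keep (0-sym i₂) p₁₂)) s₃ (linˡ-keep (linˡ-keep (0-sym i₃) p₁₃) p₂₃))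
        (inPlane (linʳ-keep (linʳ-keep (linʳ-keep i₁ (B-self s₁)) p₁₂) p₁₃)
                 (linʳ-keep (linʳ-keep (linʳ-keep i₂ (0-sym p₁₂)) (B-self s₂)) p₂₃)
                 (linʳ-keep (linʳ-keep (linʳ-keep i₃ (0-sym p₁₃)) (0-sym p₂₃)) (B-self s₃)))
        (linˡ-keep (linˡ-keep (linˡ refl d₁₁ (let open FS in solve 1 (λ x → x :+ ( :- x) :* (# 1) := (# 0)) refl (B w f₁))) d₂₁) d₃₁)
        (linˡ-keep (linˡ (linˡ-keep refl d₁₂) d₂₂ (let open FS in solve 1 (λ x → x :+ ( :- x) :* (# 1) := (# 0)) refl (B w f₂))) d₃₂)
        (linˡ (linˡ-keep (linˡ-keep refl d₁₃) d₂₃) d₃₃ (let open FS in solve 1 (λ x → x :+ ( :- x) :* (# 1) := (# 0)) refl (B w f₃)))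

    -- If u is orthogonal to c, it lies in the plane by `maximal`, and its coefficient at c decides.
    -- Together with `extend₂` and `extend₁` this decides independence and delivers the dual system
    -- in the positive case.
    extend₃ : ∀ {a b c u} → Plane a b c → Sing u → B a u ≡ 0ᶠ → B b u ≡ 0ᶠ →
      Plane a b u ⊎ ∃₂ λ s t → u ≡ 0ⱽ ⊕ s ∙ a ⊕ t ∙ b
    extend₃ {a} {b} {c} {u} p su pa pb with B c u ≟ᶠ 0ᶠ
    ... | no n = inj₁ (replace p su pa pb n)
    ... | yes pc with B u (Plane.f₃ p) ≟ᶠ 0ᶠ
    ... | no n = inj₁ (exchange p su pa pb n)
    ... | yes y₃=0 = inj₂ (_ , _ , trans (maximal p su (inPlane pa pb pc))
            (trans (cong (λ z → lc₃ (B u f₁) (B u f₂) z a b c) y₃=0)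
              (vsolve (((𝟘 ⊞ (B u f₁) ⊠ (v# 0)) ⊞ (B u f₂) ⊠ (v# 1)) ⊞ 0ᶠ ⊠ (v# 2)) ((𝟘 ⊞ (B u f₁) ⊠ (v# 0)) ⊞ (B u f₂) ⊠ (v# 1)) (a ∷ b ∷ c ∷ []) (λ { (aᶜ ∷ bᶜ ∷ cᶜ ∷ []) → (let open FS in solve 5 (λ a b c s t → (# 0) :+ s :* a :+ t :* b :+ (# 0) :* c := (# 0) :+ s :* a :+ t :* b) refl aᶜ bᶜ cᶜ (B u f₁) (B u f₂)) }))))
      where open Plane p

    extend₂ : ∀ {a b c u} → Plane a b c → Sing u → B a u ≡ 0ᶠ →
      (∃ λ d → Plane a u d) ⊎ ∃ λ s → u ≡ 0ⱽ ⊕ s ∙ a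
    extend₂ {a} {b} {c} {u} p su pa with B b u ≟ᶠ 0ᶠ
    ... | no n = inj₁ (_ , swap₂₃ (replace (swap₂₃ (add₃₂ s p)) su pa (linˡ refl refl cu) n))
      where
      -- Chosen so that c + s b is orthogonal to u; then b is the vector traded for u.
      s = -ᶠ (B c u *ᶠ (B b u) ⁻¹ᶠ)
      cu : B c u +ᶠ s *ᶠ B b u ≡ 0ᶠ
      cu = trans (let open FS in solve 3 (λ x y i → x :+ ( :- (x :* i)) :* y := x :* ((# 1) :- y :* i)) refl (B c u) (B b u) ((B b u) ⁻¹ᶠ))
        (trans (cong (λ z → B c u *ᶠ (1ᶠ +ᶠ -ᶠ z)) (inverseᶠ _ n)) (let open FS in solve 1 (λ x → x :* ((# 1) :- (# 1)) := (# 0)) refl (B c u)))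
    ... | yes pb with extend₃ p su pa pb
    ... | inj₁ p' = inj₁ (_ , swap₂₃ p')
    ... | inj₂ (s , t , e) with t ≟ᶠ 0ᶠ
    ... | yes refl = inj₂ (s , trans e (vsolve ((𝟘 ⊞ s ⊠ (v# 0)) ⊞ 0ᶠ ⊠ (v# 1)) (𝟘 ⊞ s ⊠ (v# 0)) (a ∷ b ∷ []) (λ { (aᶜ ∷ bᶜ ∷ []) → (let open FS in solve 3 (λ a b s → (# 0) :+ s :* a :+ (# 0) :* b := (# 0) :+ s :* a) refl aᶜ bᶜ s) })))
    ... | no n = inj₁ (_ , swap₂₃ (exchange (swap₂₃ p) su pa cu (λ z → n (trans (sym uf) z))))
      where
      open Plane p
      uf : B u f₂ ≡ t
      uf = trans (cong (λ z → B z f₂) e) (linˡ (linˡ-keep (B-0 _) d₁₂) d₂₂ (let open FS in solve 1 (λ t → (# 0) :+ t :* (# 1) := t) refl t))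
      cu : B c u ≡ 0ᶠ
      cu = trans (cong (B c) e) (linʳ-keep (linʳ-keep (B-0ʳ _) (0-sym p₁₃)) (0-sym p₂₃))

    extend₁ : ∀ {a b c u} → Plane a b c → Sing u → u ≢ 0ⱽ → ∃₂ λ d e → Plane u d e
    extend₁ {a} {b} {c} {u} p su nz with B a u ≟ᶠ 0ᶠ
    ... | no n = _ , _ , rot (rot (replace (swap₂₃ (add₃₂ t (rot (rot (add₃₁ s p))))) su (linˡ refl refl (cu (B c u) n)) (linˡ refl refl (cu (B b u) n)) n))
      where
      s = -ᶠ (B c u *ᶠ (B a u) ⁻¹ᶠ)
      t = -ᶠ (B b u *ᶠ (B a u) ⁻¹ᶠ)
      cu : ∀ x {y} → y ≢ 0ᶠ → x +ᶠ -ᶠ (x *ᶠ y ⁻¹ᶠ) *ᶠ y ≡ 0ᶠ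
      cu x {y} n = trans (let open FS in solve 3 (λ x y i → x :+ ( :- (x :* i)) :* y := x :* ((# 1) :- y :* i)) refl x y (y ⁻¹ᶠ))
        (trans (cong (λ z → x *ᶠ (1ᶠ +ᶠ -ᶠ z)) (inverseᶠ _ n)) (let open FS in solve 1 (λ x → x :* ((# 1) :- (# 1)) := (# 0)) refl x))
    ... | yes pa with extend₂ p su pa
    ... | inj₁ (d , p') = _ , _ , swap₁₂ p'
    ... | inj₂ (s , e) = _ , _ , rot (rot (exchange (rot p) su bu cu (λ z → nz (trans e (trans (cong (λ s → 0ⱽ ⊕ s ∙ a) (trans (sym uf) z)) (vsolve (𝟘 ⊞ 0ᶠ ⊠ (v# 0)) 𝟘 (a ∷ []) (λ { (aᶜ ∷ []) → (let open FS in solve 1 (λ a → (# 0) :+ (# 0) :* a := (# 0)) refl aᶜ) })))))))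
      where
      open Plane p
      uf : B u f₁ ≡ s
      uf = trans (cong (λ z → B z f₁) e) (linˡ (B-0 _) d₁₁ (let open FS in solve 1 (λ s → (# 0) :+ s :* (# 1) := s) refl s))
      bu : B b u ≡ 0ᶠ
      bu = trans (cong (B b) e) (linʳ-keep (B-0ʳ _) (0-sym p₁₂))
      cu : B c u ≡ 0ᶠ
      cu = trans (cong (B c) e) (linʳ-keep (B-0ʳ _) (0-sym p₁₃))

    -- k enumerates the planes through ⟨e₁, e₂⟩ other than ⟨e₁, e₂, e₃⟩
    record Fan (e₁ e₂ e₃ : V n) (k : K → V n) : Set where
      field
        k-sing : ∀ c → Sing (k c)
        k₁ : ∀ c → B e₁ (k c) ≡ 0ᶠ
        k₂ : ∀ c → B e₂ (k c) ≡ 0ᶠ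
        k₃ : ∀ c → B e₃ (k c) ≢ 0ᶠ
        root : ∀ w → Sing w → B e₁ w ≡ 0ᶠ → B e₂ w ≡ 0ᶠ → B e₃ w ≢ 0ᶠ →
          ∃ λ c₀ → B (k c₀) w ≡ 0ᶠ × (∀ c → B (k c) w ≡ 0ᶠ → c ≡ c₀)

    -- The dual vectors span an opposite plane, so the six vectors form a hyperbolic basis of a
    -- 6-dimensional space.
    record Frame {e₁ e₂ e₃} (p : Plane e₁ e₂ e₃) : Set where
      open Plane p
      field
        t₁ : Sing f₁
        t₂ : Sing f₂
        t₃ : Sing f₃
        g₁₂ : B f₁ f₂ ≡ 0ᶠ
        g₁₃ : B f₁ f₃ ≡ 0ᶠ
        g₂₃ : B f₂ f₃ ≡ 0ᶠ

    rot-frame : ∀ {e₁ e₂ e₃} {p : Plane e₁ e₂ e₃} → Frame p → Frame (rot p)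
    rot-frame fr = record { t₁ = t₂ ; t₂ = t₃ ; t₃ = t₁ ; g₁₂ = g₂₃ ; g₁₃ = 0-sym g₁₂ ; g₂₃ = 0-sym g₁₃ }
      where open Frame fr

    -- A parametrisation of the q² + q + 1 lines of the plane: the first two vectors here span the
    -- q² lines missing e₁, those of `on-point` the lines on e₁ except ⟨e₁, e₃⟩.
    off-point : ∀ {e₁ e₂ e₃} s r → Plane e₁ e₂ e₃ → Plane (e₂ ⊕ s ∙ e₁) (e₃ ⊕ r ∙ e₁) e₁
    off-point s r p = swap₁₃ (add₃₁ s (swap₂₃ (add₃₁ r p)))

    on-point : ∀ {e₁ e₂ e₃} s → Plane e₁ e₂ e₃ → Plane e₁ (e₂ ⊕ s ∙ e₃) e₃
    on-point s p = swap₂₃ (add₃₂ s (swap₂₃ p))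

    1≢0ᶠ : ∀ {x} → x ≡ 1ᶠ → x ≢ 0ᶠ
    1≢0ᶠ refl e = 0≢1ᶠ (sym e)

    nonzero : ∀ {u z} → B u z ≡ 1ᶠ → u ≢ 0ⱽ
    nonzero e refl = 1≢0ᶠ e (B-0 _)

    -- A line of a plane of Q⁺(5,q) is on exactly one further plane of the quadric. `adjacent₁`,
    -- `adjacent₂` and `adjacent₃` give it for ⟨e₁, e₃⟩ and the two families of other lines; the
    -- third vector is the combination of the fᵢ that is orthogonal to the line.
    adjacent₁ : ∀ {e₁ e₂ e₃} (p : Plane e₁ e₂ e₃) → Frame p → Plane e₁ e₃ (Plane.f₂ p)
    adjacent₁ p fr = replace (swap₂₃ p) t₂ d₁₂ d₃₂ (1≢0ᶠ d₂₂)
      where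
      open Plane p
      open Frame fr

    adjacent₂ : ∀ {e₁ e₂ e₃} (p : Plane e₁ e₂ e₃) → Frame p → ∀ s → Plane e₁ (e₂ ⊕ s ∙ e₃) (Plane.f₃ p ⊕ -ᶠ s ∙ Plane.f₂ p)
    adjacent₂ p fr s = replace (on-point s p) (Sing-⊕ t₃ t₂ (0-sym g₂₃)) (linʳ-keep d₁₃ d₁₂)
      (linˡ (linʳ d₂₃ d₂₂ refl) (linʳ d₃₃ d₃₂ refl) (let open FS in solve 1 (λ s → (# 0) :+ ( :- s) :* (# 1) :+ s :* ((# 1) :+ ( :- s) :* (# 0)) := (# 0)) refl s)) (1≢0ᶠ (linʳ-keep d₃₃ d₃₂))
      where
      open Plane p
      open Frame fr

    adjacent₃ : ∀ {e₁ e₂ e₃} (p : Plane e₁ e₂ e₃) → Frame p → ∀ s r →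
      Plane (e₂ ⊕ s ∙ e₁) (e₃ ⊕ r ∙ e₁) (Plane.f₁ p ⊕ -ᶠ s ∙ Plane.f₂ p ⊕ -ᶠ r ∙ Plane.f₃ p)
    adjacent₃ p fr s r = replace (off-point s r p)
      (Sing-⊕ (Sing-⊕ t₁ t₂ g₁₂) t₃ (linˡ-keep g₁₃ g₂₃))
      (linˡ (linʳ-keep (linʳ d₂₁ d₂₂ refl) d₂₃) (linʳ-keep (linʳ-keep d₁₁ d₁₂) d₁₃) (let open FS in solve 1 (λ s → (# 0) :+ ( :- s) :* (# 1) :+ s :* (# 1) := (# 0)) refl s))
      (linˡ (linʳ (linʳ-keep d₃₁ d₃₂) d₃₃ refl) (linʳ-keep (linʳ-keep d₁₁ d₁₂) d₁₃) (let open FS in solve 1 (λ r → (# 0) :+ ( :- r) :* (# 1) :+ r :* (# 1) := (# 0)) refl r))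
      (1≢0ᶠ (linʳ-keep (linʳ-keep d₁₁ d₁₂) d₁₃))
      where
      open Plane p
      open Frame fr

    abstract
      -- Each dual vector is made singular by `fix` and then orthogonal to the preceding ones by
      -- adding multiples of e₁ and e₂. Adding vectors of the plane never disturbs duality, since
      -- the plane is totally isotropic.
      full-frame : ∀ {e₁ e₂ e₃} → Plane e₁ e₂ e₃ → Σ (Plane e₁ e₂ e₃) Frame
      full-frame {e₁} {e₂} {e₃} p = p' , record { t₁ = t₁ ; t₂ = t₂ ; t₃ = t₃
          ; g₁₂ = linʳ refl F₁e₁ (clear (B F₁ G₂))
          ; g₁₃ = linʳ-keep (linʳ refl F₁e₁ (clear (B F₁ G₃))) (0-sym e₂F₁)
          ; g₂₃ = linʳ (linʳ-keep refl (0-sym e₁F₂)) F₂e₂ (clear (B F₂ G₃)) }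
        where
        open Plane p
        F₁ G₂ F₂ G₃ F₃ : V n
        F₁ = f₁ ⊕ proj₁ (fix s₁ d₁₁) ∙ e₁
        G₂ = f₂ ⊕ proj₁ (fix s₂ d₂₂) ∙ e₂
        F₂ = G₂ ⊕ -ᶠ (ε *ᶠ B F₁ G₂) ∙ e₁
        G₃ = f₃ ⊕ proj₁ (fix s₃ d₃₃) ∙ e₃
        F₃ = G₃ ⊕ -ᶠ (ε *ᶠ B F₁ G₃) ∙ e₁ ⊕ -ᶠ (ε *ᶠ B F₂ G₃) ∙ e₂
        e₁F₁ : B e₁ F₁ ≡ 1ᶠ
        e₁F₁ = linʳ-keep d₁₁ (B-self s₁)
        e₂F₁ : B e₂ F₁ ≡ 0ᶠ
        e₂F₁ = linʳ-keep d₂₁ (0-sym p₁₂)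
        e₃F₁ : B e₃ F₁ ≡ 0ᶠ
        e₃F₁ = linʳ-keep d₃₁ (0-sym p₁₃)
        e₁G₂ : B e₁ G₂ ≡ 0ᶠ
        e₁G₂ = linʳ-keep d₁₂ p₁₂
        e₁F₂ : B e₁ F₂ ≡ 0ᶠ
        e₁F₂ = linʳ-keep e₁G₂ (B-self s₁)
        e₂F₂ : B e₂ F₂ ≡ 1ᶠ
        e₂F₂ = linʳ-keep (linʳ-keep d₂₂ (B-self s₂)) (0-sym p₁₂)
        e₃F₂ : B e₃ F₂ ≡ 0ᶠ
        e₃F₂ = linʳ-keep (linʳ-keep d₃₂ (0-sym p₂₃)) (0-sym p₁₃)
        e₁G₃ : B e₁ G₃ ≡ 0ᶠ
        e₁G₃ = linʳ-keep d₁₃ p₁₃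
        e₂G₃ : B e₂ G₃ ≡ 0ᶠ
        e₂G₃ = linʳ-keep d₂₃ p₂₃
        F₁e₁ : B F₁ e₁ ≡ ε
        F₁e₁ = trans (B-sym e₁ F₁) (trans (cong (ε *ᶠ_) e₁F₁) (let open FS in solve 1 (λ e → e :* (# 1) := e) refl ε))
        F₂e₂ : B F₂ e₂ ≡ ε
        F₂e₂ = trans (B-sym e₂ F₂) (trans (cong (ε *ᶠ_) e₂F₂) (let open FS in solve 1 (λ e → e :* (# 1) := e) refl ε))
        clear : ∀ b → b +ᶠ -ᶠ (ε *ᶠ b) *ᶠ ε ≡ 0ᶠ
        clear b = trans (let open FS in solve 2 (λ b e → b :+ ( :- (e :* b)) :* e := b :* ((# 1) :- e :* e)) refl b ε) (trans (cong (λ z → b *ᶠ (1ᶠ +ᶠ -ᶠ z)) ε²) (let open FS in solve 1 (λ b → b :* ((# 1) :- (# 1)) := (# 0)) refl b))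
        t₁ : Sing F₁
        t₁ = proj₂ (fix s₁ d₁₁)
        t₂ : Sing F₂
        t₂ = Sing-⊕ (proj₂ (fix s₂ d₂₂)) s₁ (0-sym e₁G₂)
        t₃ : Sing F₃
        t₃ = Sing-⊕ (Sing-⊕ (proj₂ (fix s₃ d₃₃)) s₁ (0-sym e₁G₃)) s₂ (linˡ-keep (0-sym e₂G₃) p₁₂)
        p' : Plane e₁ e₂ e₃
        p' = record
          { s₁ = s₁ ; s₂ = s₂ ; s₃ = s₃ ; p₁₂ = p₁₂ ; p₁₃ = p₁₃ ; p₂₃ = p₂₃
          ; f₁ = F₁ ; f₂ = F₂ ; f₃ = F₃
          ; d₁₁ = e₁F₁ ; d₁₂ = e₁F₂ ; d₁₃ = linʳ-keep (linʳ-keep e₁G₃ (B-self s₁)) p₁₂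
          ; d₂₁ = e₂F₁ ; d₂₂ = e₂F₂ ; d₂₃ = linʳ-keep (linʳ-keep e₂G₃ (0-sym p₁₂)) (B-self s₂)
          ; d₃₁ = e₃F₁ ; d₃₂ = e₃F₂ ; d₃₃ = linʳ-keep (linʳ-keep (linʳ-keep d₃₃ (B-self s₃)) (0-sym p₁₃)) (0-sym p₂₃) }

    -- the quadratic form of the hyperbolic quadric of a frame, extended by 0 to its radical
    hyp : ∀ {e₁ e₂ e₃} → Plane e₁ e₂ e₃ → V n → K
    hyp {e₁} {e₂} {e₃} p w = B e₁ w *ᶠ B w f₁ +ᶠ B e₂ w *ᶠ B w f₂ +ᶠ B e₃ w *ᶠ B w f₃
      where open Plane p

    -- For a symmetric form a frame carries `B₆` and `Q₆` over to the span of the frame. The order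
    -- e₁, f₁, e₂, f₂, e₃, f₃ of the basis matches the pairing of coordinates in `Q₆`.
    module Coordinates (ε≡1 : ε ≡ 1ᶠ) {e₁ e₂ e₃ : V n} (p : Plane e₁ e₂ e₃) (fr : Frame p) where
      open Plane p
      open Frame fr

      sym' : ∀ u w → B w u ≡ B u w
      sym' u w = trans (B-sym u w) (trans (cong (_*ᶠ B u w) ε≡1) (let open FS in solve 1 (λ b → (# 1) :* b := b) refl (B u w)))

      φ : V 6 → V n
      φ y = 0ⱽ ⊕ y ! 0F ∙ e₁ ⊕ y ! 1F ∙ f₁ ⊕ y ! 2F ∙ e₂ ⊕ y ! 3F ∙ f₂ ⊕ y ! 4F ∙ e₃ ⊕ y ! 5F ∙ f₃

      coords : V n → V 6
      coords w = B w f₁ ∷ B e₁ w ∷ B w f₂ ∷ B e₂ w ∷ B w f₃ ∷ B e₃ w ∷ []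

      coords-φ : ∀ y → coords (φ y) ≡ y
      coords-φ y = ext λ
        { 0F → linˡ-keep (linˡ-keep (linˡ-keep (linˡ-keep (linˡ-keep (linˡ (B-0 _) d₁₁ (l 0F)) (B-self t₁)) d₂₁) (0-sym g₁₂)) d₃₁) (0-sym g₁₃)
        ; 1F → linʳ-keep (linʳ-keep (linʳ-keep (linʳ-keep (linʳ (linʳ-keep (B-0ʳ _) (B-self s₁)) d₁₁ (l 1F)) p₁₂) d₁₂) p₁₃) d₁₃
        ; 2F → linˡ-keep (linˡ-keep (linˡ-keep (linˡ (linˡ-keep (linˡ-keep (B-0 _) d₁₂) g₁₂) d₂₂ (l 2F)) (B-self t₂)) d₃₂) (0-sym g₂₃)
        ; 3F → linʳ-keep (linʳ-keep (linʳ (linʳ-keep (linʳ-keep (linʳ-keep (B-0ʳ _) (0-sym p₁₂)) d₂₁) (B-self s₂)) d₂₂ (l 3F)) p₂₃) d₂₃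
        ; 4F → linˡ-keep (linˡ (linˡ-keep (linˡ-keep (linˡ-keep (linˡ-keep (B-0 _) d₁₃) g₁₃) d₂₃) g₂₃) d₃₃ (l 4F)) (B-self t₃)
        ; 5F → linʳ (linʳ-keep (linʳ-keep (linʳ-keep (linʳ-keep (linʳ-keep (B-0ʳ _) (0-sym p₁₃)) d₃₁) (0-sym p₂₃)) d₃₂) (B-self s₃)) d₃₃ (l 5F) }
        where
        l : ∀ i → 0ᶠ +ᶠ y ! i *ᶠ 1ᶠ ≡ y ! i
        l i = (let open FS in solve 1 (λ y → (# 0) :+ y :* (# 1) := y) refl (y ! i))

      coords-⊕ : ∀ u s w → coords (u ⊕ s ∙ w) ≡ coords u ⊕ s ∙ coords w
      coords-⊕ u s w = ext λ
        { 0F → l 0F (B-lin _ _ _ _) ; 1F → l 1F (B-linʳ _ _ _ _) ; 2F → l 2F (B-lin _ _ _ _)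
        ; 3F → l 3F (B-linʳ _ _ _ _) ; 4F → l 4F (B-lin _ _ _ _) ; 5F → l 5F (B-linʳ _ _ _ _) }
        where
        l : ∀ i → coords (u ⊕ s ∙ w) ! i ≡ coords u ! i +ᶠ s *ᶠ coords w ! i → coords (u ⊕ s ∙ w) ! i ≡ (coords u ⊕ s ∙ coords w) ! i
        l i e = trans e (sym (lookup-⊕ (coords u) (coords w) s i))

      φ-⊕ : ∀ y s z → φ (y ⊕ s ∙ z) ≡ φ y ⊕ s ∙ φ z
      φ-⊕ y s z = step 5F (step 4F (step 3F (step 2F (step 1F (step 0F (vsolve 𝟘 (𝟘 ⊞ s ⊠ 𝟘) ([]) (λ { ([]) → (let open FS in solve 1 (λ s → (# 0) := (# 0) :+ s :* (# 0)) refl s) })))))))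
        where
        step : ∀ i {X x x' e : V n} → X ≡ x ⊕ s ∙ x' → X ⊕ (y ⊕ s ∙ z) ! i ∙ e ≡ (x ⊕ y ! i ∙ e) ⊕ s ∙ (x' ⊕ z ! i ∙ e)
        step i {x = x} {x'} {e} refl = trans (cong (λ c → x ⊕ s ∙ x' ⊕ c ∙ e) (lookup-⊕ y z s i))
          (vsolve (((v# 0) ⊞ s ⊠ (v# 1)) ⊞ ((y ! i) +ᶠ (s *ᶠ (z ! i))) ⊠ (v# 2)) (((v# 0) ⊞ (y ! i) ⊠ (v# 2)) ⊞ s ⊠ ((v# 1) ⊞ (z ! i) ⊠ (v# 2))) (x ∷ x' ∷ e ∷ []) (λ { (xᶜ ∷ x'ᶜ ∷ eᶜ ∷ []) → (let open FS in solve 6 (λ x x' e s a b → x :+ s :* x' :+ (a :+ s :* b) :* e := x :+ a :* e :+ s :* (x' :+ b :* e)) refl xᶜ x'ᶜ eᶜ s (y ! i) (z ! i)) }))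

      B-φ : ∀ y w → B (φ y) w ≡ B₆ y (coords w)
      B-φ y w = trans (linˡ (linˡ (linˡ (linˡ (linˡ (linˡ (B-0 w) refl refl) (sym' w f₁) refl) refl refl) (sym' w f₂) refl) refl refl) (sym' w f₃) refl)
        (trans (regroup (y ! 0F) (y ! 1F) (y ! 2F) (y ! 3F) (y ! 4F) (y ! 5F) _ _ _ _ _ _) (sym (Form⁺.form-def y (coords w))))
        where
        regroup : ∀ a b c d e f u v w x y z → 0ᶠ +ᶠ a *ᶠ u +ᶠ b *ᶠ v +ᶠ c *ᶠ w +ᶠ d *ᶠ x +ᶠ e *ᶠ y +ᶠ f *ᶠ z ≡ block a b v u +ᶠ block c d x w +ᶠ block e f z y
        regroup a b c d e f u v w x y z = (let open FS in solve 6 (λ A B C D E G → (# 0) :+ A :+ B :+ C :+ D :+ E :+ G := (A :+ (# 1) :* B) :+ (C :+ (# 1) :* D) :+ (E :+ (# 1) :* G)) refl (a *ᶠ u) (b *ᶠ v) (c *ᶠ w) (d *ᶠ x) (e *ᶠ y) (f *ᶠ z))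

      hyp-coords : ∀ w → hyp p w ≡ Q₆ (coords w)
      hyp-coords w = trans (let open FS in solve 6 (λ a b c d e f → a :* b :+ c :* d :+ e :* f := b :* a :+ d :* c :+ f :* e) refl (B e₁ w) (B w f₁) (B e₂ w) (B w f₂) (B e₃ w) (B w f₃))
        (sym (Q₆-def (coords w)))

      B-φφ : ∀ y z → B (φ y) (φ z) ≡ B₆ y z
      B-φφ y z = trans (B-φ y (φ z)) (cong (B₆ y) (coords-φ z))

      residue : V n → V n
      residue w = w ⊕ -ᶠ 1ᶠ ∙ φ (coords w)

      coords-residue : ∀ w → coords (residue w) ≡ 0ⱽ
      coords-residue w = trans (coords-⊕ w _ _) (trans (cong (coords w ⊕ -ᶠ 1ᶠ ∙_) (coords-φ (coords w))) (vsolve ((v# 0) ⊞ (-ᶠ 1ᶠ) ⊠ (v# 0)) 𝟘 ((coords w) ∷ []) (λ { (wᶜ ∷ []) → (let open FS in solve 1 (λ w → w :+ ( :- (# 1)) :* w := (# 0)) refl wᶜ) })))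

      from-residue : ∀ w → w ≡ φ (coords w) ⊕ 1ᶠ ∙ residue w
      from-residue w = (vsolve (v# 0) ((v# 1) ⊞ 1ᶠ ⊠ ((v# 0) ⊞ (-ᶠ 1ᶠ) ⊠ (v# 1))) (w ∷ (φ (coords w)) ∷ []) (λ { (wᶜ ∷ xᶜ ∷ []) → (let open FS in solve 2 (λ w x → w := x :+ (# 1) :* (w :+ ( :- (# 1)) :* x)) refl wᶜ xᶜ) }))

      coords-+ : ∀ y c z → coords z ≡ 0ⱽ → coords (φ y ⊕ c ∙ z) ≡ y
      coords-+ y c z e = trans (coords-⊕ (φ y) c z) (trans (cong₂ (λ a b → a ⊕ c ∙ b) (coords-φ y) e) (vsolve ((v# 0) ⊞ c ⊠ 𝟘) (v# 0) (y ∷ []) (λ { (yᶜ ∷ []) → (let open FS in solve 2 (λ y c → y :+ c :* (# 0) := y) refl yᶜ c) })))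

      cancel-∙ : ∀ {x z : V n} {c c'} → z ≢ 0ⱽ → x ⊕ c ∙ z ≡ x ⊕ c' ∙ z → c ≡ c'
      cancel-∙ {x} {z} {c} {c'} nz e = diff0 (cancelᶠ ne (trans (let open FS in solve 4 (λ x z c d → z :* (c :- d) := x :+ c :* z :- (x :+ d :* z)) refl (x ! i) (z ! i) c c')
        (trans (cong₂ (λ a b → a +ᶠ -ᶠ b) (trans (sym (lookup-⊕ x z c i)) (trans (cong (_! i) e) (lookup-⊕ x z c' i))) refl) (let open FS in solve 1 (λ a → a :- a := (# 0)) refl (x ! i +ᶠ c' *ᶠ z ! i)))))
        where
        i = proj₁ (nonzero-coordinate z nz)
        ne = proj₂ (nonzero-coordinate z nz)

    -- A nonzero residue, having zero coordinates, would be independent of the image of φ and give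
    -- an injection of seven coordinates into six.
    span₆ : (n ≡ 6) → (ε≡1 : ε ≡ 1ᶠ) → ∀ {e₁ e₂ e₃} (p : Plane e₁ e₂ e₃) (fr : Frame p) w → let open Coordinates ε≡1 p fr in w ≡ φ (coords w)
    span₆ refl ε≡1 p fr w with Coordinates.residue ε≡1 p fr w ≟ⱽ 0ⱽ
    ... | yes z = trans (from-residue w) (trans (cong (φ (coords w) ⊕ 1ᶠ ∙_) z) (vsolve ((v# 0) ⊞ 1ᶠ ⊠ 𝟘) (v# 0) ((φ (coords w)) ∷ []) (λ { (xᶜ ∷ []) → (let open FS in solve 1 (λ x → x :+ (# 1) :* (# 0) := x) refl xᶜ) })))
      where open Coordinates ε≡1 p fr
    ... | no nz = ⊥-elim (no-injection 6 ψ inj)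
      where
      open Coordinates ε≡1 p fr
      ψ : V 7 → V 6
      ψ (c ∷ y) = φ y ⊕ c ∙ residue w
      inj : ∀ a b → ψ a ≡ ψ b → a ≡ b
      inj (c ∷ y) (c' ∷ y') e = cong₂ _∷_ (cancel-∙ nz (trans e (cong (λ x → φ x ⊕ c' ∙ residue w) (sym y≡)))) y≡
        where
        y≡ : y ≡ y'
        y≡ = trans (sym (coords-+ y c _ (coords-residue w))) (trans (cong coords e) (coords-+ y' c' _ (coords-residue w)))

    module Complement (n≡7 : n ≡ 7) (ε≡1 : ε ≡ 1ᶠ) {e₁ e₂ e₃ : V n} (p : Plane e₁ e₂ e₃) (fr : Frame p) where
      open Coordinates ε≡1 p fr

      abstract
        -- With a trivial kernel the linear map `coords` would inject seven coordinates into six.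
        -- The vector found spans the orthogonal complement of the hyperbolic 6-space.
        kernel : ∃ λ g → coords g ≡ 0ⱽ × g ≢ 0ⱽ
        kernel with search {P = λ g → coords g ≡ 0ⱽ × g ≢ 0ⱽ} dec
          where
          dec : ∀ g → Dec (coords g ≡ 0ⱽ × g ≢ 0ⱽ)
          dec g with coords g ≟ⱽ 0ⱽ | g ≟ⱽ 0ⱽ
          ... | no a | _ = no (a ∘ proj₁)
          ... | yes a | yes b = no (λ x → proj₂ x b)
          ... | yes a | no b = yes (a , b)
        ... | inj₁ r = r
        ... | inj₂ none = ⊥-elim (absurd n≡7)
          where
          inj : ∀ a b → coords a ≡ coords b → a ≡ b
          inj a b e with (a ⊕ -ᶠ 1ᶠ ∙ b) ≟ⱽ 0ⱽ
          ... | yes z = trans (vsolve (v# 0) ((v# 1) ⊞ 1ᶠ ⊠ ((v# 0) ⊞ (-ᶠ 1ᶠ) ⊠ (v# 1))) (a ∷ b ∷ []) (λ { (aᶜ ∷ bᶜ ∷ []) → (let open FS in solve 2 (λ a b → a := b :+ (# 1) :* (a :+ ( :- (# 1)) :* b)) refl aᶜ bᶜ) })) (trans (cong (b ⊕ 1ᶠ ∙_) z) (vsolve ((v# 0) ⊞ 1ᶠ ⊠ 𝟘) (v# 0) (b ∷ []) (λ { (bᶜ ∷ []) → (let open FS in solve 1 (λ b → b :+ (# 1) :* (# 0) := b) refl bᶜ) })))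
          ... | no nz = ⊥-elim (none _ (trans (coords-⊕ a _ b) (trans (cong (_⊕ -ᶠ 1ᶠ ∙ coords b) e) (vsolve ((v# 0) ⊞ (-ᶠ 1ᶠ) ⊠ (v# 0)) 𝟘 ((coords b) ∷ []) (λ { (wᶜ ∷ []) → (let open FS in solve 1 (λ w → w :+ ( :- (# 1)) :* w := (# 0)) refl wᶜ) }))) , nz))
          absurd : n ≡ 7 → ⊥
          absurd refl = no-injection 6 coords inj

      g : V n
      g = proj₁ kernel

      g-coords : coords g ≡ 0ⱽ
      g-coords = proj₁ (proj₂ kernel)

      g≢0 : g ≢ 0ⱽ
      g≢0 = proj₂ (proj₂ kernel)

      abstract
        -- If z were no multiple of g, then φ y + c g + d z would be an injection of eight
        -- coordinates into seven.
        multiple : ∀ z → coords z ≡ 0ⱽ → ∃ λ γ → z ≡ 0ⱽ ⊕ γ ∙ g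
        multiple z cz with searchF {λ γ → z ≡ 0ⱽ ⊕ γ ∙ g} (λ γ → z ≟ⱽ 0ⱽ ⊕ γ ∙ g)
        ... | inj₁ r = r
        ... | inj₂ none = ⊥-elim (absurd n≡7)
          where
          ψ : V 8 → V n
          ψ (d ∷ c ∷ y) = φ y ⊕ c ∙ g ⊕ d ∙ z
          coords-ψ : ∀ d c y → coords (φ y ⊕ c ∙ g ⊕ d ∙ z) ≡ y
          coords-ψ d c y = trans (coords-⊕ _ d z) (trans (cong₂ (λ a b → a ⊕ d ∙ b) (coords-+ y c g g-coords) cz) (vsolve ((v# 0) ⊞ d ⊠ 𝟘) (v# 0) (y ∷ []) (λ { (yᶜ ∷ []) → (let open FS in solve 2 (λ y d → y :+ d :* (# 0) := y) refl yᶜ d) })))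
          inj : ∀ a b → ψ a ≡ ψ b → a ≡ b
          inj (d ∷ c ∷ y) (d' ∷ c' ∷ y') e = same y≡ (d ≟ᶠ d') e
            where
            y≡ : y ≡ y'
            y≡ = trans (sym (coords-ψ d c y)) (trans (cong coords e) (coords-ψ d' c' y'))
            same : ∀ {y'} → y ≡ y' → Dec (d ≡ d') → φ y ⊕ c ∙ g ⊕ d ∙ z ≡ φ y' ⊕ c' ∙ g ⊕ d' ∙ z → _≡_ {A = V 8} (d ∷ c ∷ y) (d' ∷ c' ∷ y')
            same refl (yes refl) e = cong {B = V 8} (λ x → d ∷ x ∷ y) (cancel-∙ g≢0 (begin
                X ⊕ c ∙ g                       ≡⟨ (vsolve ((v# 0) ⊞ c ⊠ (v# 1)) ((((v# 0) ⊞ c ⊠ (v# 1)) ⊞ d ⊠ (v# 2)) ⊞ (-ᶠ d) ⊠ (v# 2)) (X ∷ g ∷ z ∷ []) (λ { (xᶜ ∷ gᶜ ∷ zᶜ ∷ []) → (let open FS in solve 5 (λ x g z c d → x :+ c :* g := x :+ c :* g :+ d :* z :+ ( :- d) :* z) refl xᶜ gᶜ zᶜ c d) })) ⟩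
                X ⊕ c ∙ g ⊕ d ∙ z ⊕ -ᶠ d ∙ z    ≡⟨ cong (_⊕ -ᶠ d ∙ z) e ⟩
                X ⊕ c' ∙ g ⊕ d ∙ z ⊕ -ᶠ d ∙ z   ≡⟨ (vsolve ((v# 0) ⊞ c' ⊠ (v# 1)) ((((v# 0) ⊞ c' ⊠ (v# 1)) ⊞ d ⊠ (v# 2)) ⊞ (-ᶠ d) ⊠ (v# 2)) (X ∷ g ∷ z ∷ []) (λ { (xᶜ ∷ gᶜ ∷ zᶜ ∷ []) → (let open FS in solve 5 (λ x g z c d → x :+ c :* g := x :+ c :* g :+ d :* z :+ ( :- d) :* z) refl xᶜ gᶜ zᶜ c' d) })) ⟨
                X ⊕ c' ∙ g ∎))
              where
              X : V n
              X = φ y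
            same refl (no ne) e = ⊥-elim (none (i *ᶠ (c' +ᶠ -ᶠ c)) (begin
                z ≡⟨ (vsolve (v# 0) (𝟘 ⊞ 1ᶠ ⊠ (v# 0)) (z ∷ []) (λ { (zᶜ ∷ []) → (let open FS in solve 1 (λ z → z := (# 0) :+ (# 1) :* z) refl zᶜ) })) ⟩
                0ⱽ ⊕ 1ᶠ ∙ z ≡⟨ cong (0ⱽ ⊕_∙ z) (inverseᶠ _ dd) ⟨
                0ⱽ ⊕ (d +ᶠ -ᶠ d') *ᶠ i ∙ z
                  ≡⟨ (vsolve (𝟘 ⊞ ((d +ᶠ -ᶠ d') *ᶠ i) ⊠ (v# 2)) ((𝟘 ⊞ i ⊠ ((((v# 0) ⊞ c ⊠ (v# 1)) ⊞ d ⊠ (v# 2)) ⊞ (-ᶠ 1ᶠ) ⊠ (((v# 0) ⊞ c' ⊠ (v# 1)) ⊞ d' ⊠ (v# 2)))) ⊞ (i *ᶠ (c' +ᶠ -ᶠ c)) ⊠ (v# 1)) (X ∷ g ∷ z ∷ []) (λ { (xᶜ ∷ gᶜ ∷ zᶜ ∷ []) → (let open FS in solve 8 (λ x g z c d c' d' i → (# 0) :+ ((d :- d') :* i) :* z := (# 0) :+ i :* (x :+ c :* g :+ d :* z :+ ( :- (# 1)) :* (x :+ c' :* g :+ d' :* z)) :+ (i :* (c' :- c)) :* g) refl xᶜ gᶜ zᶜ c d c' d' i) })) ⟩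
                0ⱽ ⊕ i ∙ (X ⊕ c ∙ g ⊕ d ∙ z ⊕ -ᶠ 1ᶠ ∙ (X ⊕ c' ∙ g ⊕ d' ∙ z)) ⊕ i *ᶠ (c' +ᶠ -ᶠ c) ∙ g
                  ≡⟨ cong (λ v → 0ⱽ ⊕ i ∙ (v ⊕ -ᶠ 1ᶠ ∙ (X ⊕ c' ∙ g ⊕ d' ∙ z)) ⊕ i *ᶠ (c' +ᶠ -ᶠ c) ∙ g) e ⟩
                0ⱽ ⊕ i ∙ (X ⊕ c' ∙ g ⊕ d' ∙ z ⊕ -ᶠ 1ᶠ ∙ (X ⊕ c' ∙ g ⊕ d' ∙ z)) ⊕ i *ᶠ (c' +ᶠ -ᶠ c) ∙ g
                  ≡⟨ (vsolve ((𝟘 ⊞ i ⊠ ((v# 0) ⊞ (-ᶠ 1ᶠ) ⊠ (v# 0))) ⊞ (i *ᶠ (c' +ᶠ -ᶠ c)) ⊠ (v# 1)) (𝟘 ⊞ (i *ᶠ (c' +ᶠ -ᶠ c)) ⊠ (v# 1)) ((X ⊕ c' ∙ g ⊕ d' ∙ z) ∷ g ∷ []) (λ { (yᶜ ∷ gᶜ ∷ []) → (let open FS in solve 4 (λ y g i k → (# 0) :+ i :* (y :+ ( :- (# 1)) :* y) :+ (i :* k) :* g := (# 0) :+ (i :* k) :* g) refl yᶜ gᶜ i (c' +ᶠ -ᶠ c)) })) ⟩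
                0ⱽ ⊕ i *ᶠ (c' +ᶠ -ᶠ c) ∙ g ∎))
              where
              X : V n
              X = φ y
              i : K
              i = (d +ᶠ -ᶠ d') ⁻¹ᶠ
              dd : d +ᶠ -ᶠ d' ≢ 0ᶠ
              dd e = ne (diff0 e)
          absurd : n ≡ 7 → ⊥
          absurd refl = no-injection 7 ψ inj

      abstract
        decompose : ∀ w → ∃ λ γ → w ≡ φ (coords w) ⊕ γ ∙ g
        decompose w = let (γ , e) = multiple (residue w) (coords-residue w) in
          γ , trans (from-residue w) (trans (cong (φ (coords w) ⊕ 1ᶠ ∙_) e) (vsolve ((v# 0) ⊞ 1ᶠ ⊠ (𝟘 ⊞ γ ⊠ (v# 1))) ((v# 0) ⊞ γ ⊠ (v# 1)) ((φ (coords w)) ∷ g ∷ []) (λ { (xᶜ ∷ gᶜ ∷ []) → (let open FS in solve 3 (λ x g γ → x :+ (# 1) :* ((# 0) :+ γ :* g) := x :+ γ :* g) refl xᶜ gᶜ γ) })))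

  -- A plane in each of the spaces

  module StandardPlanes where
    open PolarSpaces
    open Spaces

    module StandardPlane₆ (σ : K) (σ² : σ *ᶠ σ ≡ 1ᶠ) (P : Polar 6)
      (B≡ : ∀ u w → Polar.B P u w ≡ Form.form σ σ² u w) (sing : ∀ j → Polar.Sing P (unit j 1ᶠ)) where
      open Form σ σ²
      private
        B = Polar.B P
        Plane = PolarTheory.Plane P

      value : ∀ i j {c} → sign j *ᶠ (unit i 1ᶠ ! dual j *ᶠ 1ᶠ) ≡ c → B (unit i 1ᶠ) (unit j 1ᶠ) ≡ c
      value i j e = trans (B≡ _ _) (trans (form-unit (unit i 1ᶠ) j 1ᶠ) e)

      plane : Plane (unit 0F 1ᶠ) (unit 2F 1ᶠ) (unit 4F 1ᶠ)
      plane = record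
        { s₁ = sing 0F ; s₂ = sing 2F ; s₃ = sing 4F
        ; p₁₂ = value 0F 2F zσ ; p₁₃ = value 0F 4F zσ ; p₂₃ = value 2F 4F zσ
        ; f₁ = unit 1F 1ᶠ ; f₂ = unit 3F 1ᶠ ; f₃ = unit 5F 1ᶠ
        ; d₁₁ = value 0F 1F o ; d₁₂ = value 0F 3F z ; d₁₃ = value 0F 5F z
        ; d₂₁ = value 2F 1F z ; d₂₂ = value 2F 3F o ; d₂₃ = value 2F 5F z
        ; d₃₁ = value 4F 1F z ; d₃₂ = value 4F 3F z ; d₃₃ = value 4F 5F o }
        where
        zσ : σ *ᶠ (0ᶠ *ᶠ 1ᶠ) ≡ 0ᶠ
        zσ = (let open FS in solve 1 (λ σ → σ :* ((# 0) :* (# 1)) := (# 0)) refl σ)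
        z : 1ᶠ *ᶠ (0ᶠ *ᶠ 1ᶠ) ≡ 0ᶠ
        z = (let open FS in solve 0 ((# 1) :* ((# 0) :* (# 1)) := (# 0)) refl)
        o : 1ᶠ *ᶠ (1ᶠ *ᶠ 1ᶠ) ≡ 1ᶠ
        o = (let open FS in solve 0 ((# 1) :* ((# 1) :* (# 1)) := (# 1)) refl)

    hyperbolic-plane : PolarTheory.Plane (Quadratic.polar hyperbolic) (unit 0F 1ᶠ) (unit 2F 1ᶠ) (unit 4F 1ᶠ)
    hyperbolic-plane = StandardPlane₆.plane 1ᶠ 1²≡1 (Quadratic.polar hyperbolic) (λ _ _ → refl) Q₆-unit

    symplectic-plane : PolarTheory.Plane symplectic (unit 0F 1ᶠ) (unit 2F 1ᶠ) (unit 4F 1ᶠ)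
    symplectic-plane = StandardPlane₆.plane (-ᶠ 1ᶠ) -1²≡1 symplectic (λ _ _ → refl) (λ _ → tt)

    parabolic-plane : PolarTheory.Plane (Quadratic.polar parabolic) (lift 0ᶠ (unit 0F 1ᶠ)) (lift 0ᶠ (unit 2F 1ᶠ)) (lift 0ᶠ (unit 4F 1ᶠ))
    parabolic-plane = record
      { s₁ = sing 0F ; s₂ = sing 2F ; s₃ = sing 4F
      ; p₁₂ = b H.p₁₂ ; p₁₃ = b H.p₁₃ ; p₂₃ = b H.p₂₃
      ; f₁ = lift 0ᶠ (unit 1F 1ᶠ) ; f₂ = lift 0ᶠ (unit 3F 1ᶠ) ; f₃ = lift 0ᶠ (unit 5F 1ᶠ)
      ; d₁₁ = b H.d₁₁ ; d₁₂ = b H.d₁₂ ; d₁₃ = b H.d₁₃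
      ; d₂₁ = b H.d₂₁ ; d₂₂ = b H.d₂₂ ; d₂₃ = b H.d₂₃
      ; d₃₁ = b H.d₃₁ ; d₃₂ = b H.d₃₂ ; d₃₃ = b H.d₃₃ }
      where
      module H = PolarTheory.Plane hyperbolic-plane
      sing : ∀ j → Q₇ (lift 0ᶠ (unit j 1ᶠ)) ≡ 0ᶠ
      sing j = trans (Q₇-lift _) (Q₆-unit j)
      b : ∀ {u w c} → B₆ u w ≡ c → B₇ (lift 0ᶠ u) (lift 0ᶠ w) ≡ c
      b {u} {w} e = trans (B₇-lift (lift 0ᶠ u) w) (trans (cong (λ z → B₆ z w) (first-lift 0ᶠ u)) e)

  -- Hyperbolic quadrics spanned by frames, and the planes on a line

  module Quadrics where
    open PolarSpaces
    open WeightIdentities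
    open Spaces
    open StandardPlanes

    -- The situation in which every frame spans an embedded Q⁺(5,q): the zeros of its form in the
    -- polar space are the singular points of the quadric. It holds for Q(6,q) and for W(5,q) with q
    -- even.
    record Good {n : ℕ} (P : Polar n) : Set where
      private
        Plane = PolarTheory.Plane P
        Frame : ∀ {e₁ e₂ e₃} → Plane e₁ e₂ e₃ → Set
        Frame = PolarTheory.Frame P
        hyp : ∀ {e₁ e₂ e₃} → Plane e₁ e₂ e₃ → V n → K
        hyp = PolarTheory.hyp P
      field
        ε≡1 : Polar.ε P ≡ 1ᶠ
        span : ∀ {e₁ e₂ e₃} (p : Plane e₁ e₂ e₃) (fr : Frame p) w → Polar.Sing P w → hyp p w ≡ 0ᶠ →
          w ≡ PolarTheory.Coordinates.φ P ε≡1 p fr (PolarTheory.Coordinates.coords P ε≡1 p fr w)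
        sing-φ : ∀ {e₁ e₂ e₃} (p : Plane e₁ e₂ e₃) (fr : Frame p) y → Q₆ y ≡ 0ᶠ → Polar.Sing P (PolarTheory.Coordinates.φ P ε≡1 p fr y)
        -- A plane of the polar space lies in the quadric or meets it in a line: on a plane the
        -- quadratic form has the zeros of a linear functional. The weight of the quadric is built
        -- on this.
        hyp-on-plane : ∀ {e₁ e₂ e₃} (p : Plane e₁ e₂ e₃) → Frame p → ∀ {a b c} → Plane a b c →
          ∃ λ m₁ → ∃ λ m₂ → ∃ λ m₃ → ∀ x y z → δ (hyp p (lc₃ x y z a b c)) ≡ δ (x *ᶠ m₁ +ᶠ y *ᶠ m₂ +ᶠ z *ᶠ m₃)

    module QuadraticFrames {n : ℕ} (S : Quadratic n) where
      open Quadratic S using (Q; Q-⊕)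
      P = Quadratic.polar S
      open PolarTheory P

      module _ {e₁ e₂ e₃ : V n} (p : Plane e₁ e₂ e₃) (fr : Frame p) where
        open Plane p
        open Frame fr
        open Coordinates refl p fr

        Q-φ : ∀ y → Q (φ y) ≡ Q₆ y
        Q-φ y = trans (step (step (step (step (step (step (Quadratic.Q-0 S) (B-0 _) s₁)
              (linˡ (B-0 _) d₁₁ refl) t₁)
              (linˡ-keep (linˡ-keep (B-0 _) p₁₂) (0-sym d₂₁)) s₂)
              (linˡ (linˡ-keep (linˡ-keep (B-0 _) d₁₂) g₁₂) d₂₂ refl) t₂)
              (linˡ-keep (linˡ-keep (linˡ-keep (linˡ-keep (B-0 _) p₁₃) (0-sym d₃₁)) p₂₃) (0-sym d₃₂)) s₃)
              (linˡ (linˡ-keep (linˡ-keep (linˡ-keep (linˡ-keep (B-0 _) d₁₃) g₁₃) d₂₃) g₂₃) d₃₃ refl) t₃)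
            (trans (let open FS in solve 6 (λ a b c d e f → (# 0) :+ a :* (# 0) :+ b :* ((# 0) :+ a :* (# 1)) :+ c :* (# 0) :+ d :* ((# 0) :+ c :* (# 1)) :+ e :* (# 0) :+ f :* ((# 0) :+ e :* (# 1)) := a :* b :+ c :* d :+ e :* f) refl (y ! 0F) (y ! 1F) (y ! 2F) (y ! 3F) (y ! 4F) (y ! 5F)) (sym (Q₆-def y)))
          where
          step : ∀ {x e c a b} → Q x ≡ a → B x e ≡ b → Q e ≡ 0ᶠ → Q (x ⊕ c ∙ e) ≡ a +ᶠ c *ᶠ b
          step {x} {e} {c} {a} {b} qx be qe = trans (Q-⊕ x c e) (trans (cong₂ (λ u v → u +ᶠ c *ᶠ B x e +ᶠ c *ᶠ c *ᶠ v) qx qe)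
            (trans (cong (λ u → a +ᶠ c *ᶠ u +ᶠ c *ᶠ c *ᶠ 0ᶠ) be) (let open FS in solve 3 (λ a b c → a :+ c :* b :+ c :* c :* (# 0) := a :+ c :* b) refl a b c)))

    δ-one : ∀ {x} → δ x ≡ 1# → x ≡ 0ᶠ
    δ-one {x} e with x ≟ᶠ 0ᶠ
    ... | yes z = z
    ... | no _ = ⊥-elim (0≢1 e)

    module H = PolarTheory (Quadratic.polar hyperbolic)

    -- A frame of the 6-space is a basis, so all frames inside Q⁺(5,q) define the same form. Hence a
    -- quadric does not depend on the plane from which it is described.
    hyp-hyperbolic : ∀ {a b c} (p : H.Plane a b c) → H.Frame p → ∀ z → H.hyp p z ≡ Q₆ z
    hyp-hyperbolic p fr z = trans (hyp-coords z) (trans (sym (QuadraticFrames.Q-φ hyperbolic p fr (coords z))) (cong Q₆ (sym (H.span₆ refl refl p fr z))))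
      where open H.Coordinates refl p fr

    module FromGood {n : ℕ} (P : Polar n) (good : Good P) where
      open PolarTheory P
      open Good good

      module OnQuadric {e₁ e₂ e₃ : V n} (p : Plane e₁ e₂ e₃) (fr : Frame p) where
        open Coordinates ε≡1 p fr public

        to-hyperbolic : ∀ {a b c} → Plane a b c → hyp p a ≡ 0ᶠ → hyp p b ≡ 0ᶠ → hyp p c ≡ 0ᶠ → H.Plane (coords a) (coords b) (coords c)
        to-hyperbolic {a} {b} {c} t ha hb hc = record
          { s₁ = sing ha ; s₂ = sing hb ; s₃ = sing hc
          ; p₁₂ = trans (b₆ t.s₁ ha b) t.p₁₂ ; p₁₃ = trans (b₆ t.s₁ ha c) t.p₁₃ ; p₂₃ = trans (b₆ t.s₂ hb c) t.p₂₃
          ; f₁ = coords t.f₁ ; f₂ = coords t.f₂ ; f₃ = coords t.f₃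
          ; d₁₁ = trans (b₆ t.s₁ ha _) t.d₁₁ ; d₁₂ = trans (b₆ t.s₁ ha _) t.d₁₂ ; d₁₃ = trans (b₆ t.s₁ ha _) t.d₁₃
          ; d₂₁ = trans (b₆ t.s₂ hb _) t.d₂₁ ; d₂₂ = trans (b₆ t.s₂ hb _) t.d₂₂ ; d₂₃ = trans (b₆ t.s₂ hb _) t.d₂₃
          ; d₃₁ = trans (b₆ t.s₃ hc _) t.d₃₁ ; d₃₂ = trans (b₆ t.s₃ hc _) t.d₃₂ ; d₃₃ = trans (b₆ t.s₃ hc _) t.d₃₃ }
          where
          module t = Plane t
          sing : ∀ {u} → hyp p u ≡ 0ᶠ → Q₆ (coords u) ≡ 0ᶠ
          sing {u} h = trans (sym (hyp-coords u)) h
          b₆ : ∀ {u} → Sing u → hyp p u ≡ 0ᶠ → ∀ w → B₆ (coords u) (coords w) ≡ B u w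
          b₆ {u} su hu w = trans (sym (B-φ (coords u) w)) (cong (λ x → B x w) (sym (span p fr u su hu)))

        from-hyperbolic : ∀ {x y z} → H.Plane x y z → Plane (φ x) (φ y) (φ z)
        from-hyperbolic t = record
          { s₁ = sing-φ p fr _ s₁ ; s₂ = sing-φ p fr _ s₂ ; s₃ = sing-φ p fr _ s₃
          ; p₁₂ = b p₁₂ ; p₁₃ = b p₁₃ ; p₂₃ = b p₂₃
          ; f₁ = φ f₁ ; f₂ = φ f₂ ; f₃ = φ f₃
          ; d₁₁ = b d₁₁ ; d₁₂ = b d₁₂ ; d₁₃ = b d₁₃ ; d₂₁ = b d₂₁ ; d₂₂ = b d₂₂ ; d₂₃ = b d₂₃ ; d₃₁ = b d₃₁ ; d₃₂ = b d₃₂ ; d₃₃ = b d₃₃ }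
          where
          open H.Plane t
          b : ∀ {x y c} → B₆ x y ≡ c → B (φ x) (φ y) ≡ c
          b {x} {y} e = trans (B-φφ x y) e

        hyp-φ : ∀ y → hyp p (φ y) ≡ Q₆ y
        hyp-φ y = trans (hyp-coords (φ y)) (cong Q₆ (coords-φ y))

        from-frame : ∀ {x y z} (t : H.Plane x y z) → H.Frame t → Frame (from-hyperbolic t)
        from-frame t ft = record { t₁ = sing-φ p fr _ t₁ ; t₂ = sing-φ p fr _ t₂ ; t₃ = sing-φ p fr _ t₃
          ; g₁₂ = trans (B-φφ _ _) g₁₂ ; g₁₃ = trans (B-φφ _ _) g₁₃ ; g₂₃ = trans (B-φφ _ _) g₂₃ }
          where open H.Frame ft

        from-hyp : ∀ {x y z} (t : H.Plane x y z) → H.Frame t → ∀ w → hyp (from-hyperbolic t) w ≡ hyp p w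
        from-hyp {x} {y} {z} t ft w = trans (cong₂ _+ᶠ_ (cong₂ _+ᶠ_ (m x f₁) (m y f₂)) (m z f₃)) (trans (hyp-hyperbolic t ft (coords w)) (sym (hyp-coords w)))
          where
          open H.Plane t
          m : ∀ x f → B (φ x) w *ᶠ B w (φ f) ≡ B₆ x (coords w) *ᶠ B₆ (coords w) f
          m x f = cong₂ _*ᶠ_ (B-φ x w) (trans (sym' (φ f) w) (trans (B-φ f w) (Quadratic.B-sym hyperbolic (coords w) f)))

        -- Allows any plane of the quadric to become the base plane. The frame is completed inside
        -- the standard Q⁺(5,q) and carried back by φ, because a frame completed in the whole space
        -- could leave the quadric.
        plane-frame : ∀ {a b c} → Plane a b c → hyp p a ≡ 0ᶠ → hyp p b ≡ 0ᶠ → hyp p c ≡ 0ᶠ →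
          Σ (Plane a b c) λ t → Frame t × ∀ w → hyp t w ≡ hyp p w
        plane-frame {a} {b} {c} t ha hb hc = transport (span p fr a (Plane.s₁ t) ha) (span p fr b (Plane.s₂ t) hb) (span p fr c (Plane.s₃ t) hc)
            (from-hyperbolic tH , from-frame tH fH , from-hyp tH fH)
          where
          tH = proj₁ (H.full-frame (to-hyperbolic t ha hb hc))
          fH = proj₂ (H.full-frame (to-hyperbolic t ha hb hc))
          transport : ∀ {a b c a' b' c'} → a ≡ a' → b ≡ b' → c ≡ c' → (Σ (Plane a' b' c') λ t → Frame t × ∀ w → hyp t w ≡ hyp p w) →
            Σ (Plane a b c) λ t → Frame t × ∀ w → hyp t w ≡ hyp p w
          transport refl refl refl x = x

        plane-through : ∀ u → Sing u → u ≢ 0ⱽ → hyp p u ≡ 0ᶠ → ∃₂ λ a b → Plane u a b × hyp p a ≡ 0ᶠ × hyp p b ≡ 0ᶠ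
        plane-through u su nz hu = let (d , e , t) = H.extend₁ hyperbolic-plane (trans (sym (hyp-coords u)) hu) y≢0 in
            φ d , φ e , subst (λ x → Plane x (φ d) (φ e)) (sym (span p fr u su hu)) (from-hyperbolic t)
              , trans (hyp-φ d) (H.Plane.s₂ t) , trans (hyp-φ e) (H.Plane.s₃ t)
          where
          φ-0 : φ 0ⱽ ≡ 0ⱽ
          φ-0 = trans (cong φ (vsolve 𝟘 (𝟘 ⊞ (-ᶠ 1ᶠ) ⊠ 𝟘) ([]) (λ { ([]) → (let open FS in solve 0 ((# 0) := (# 0) :+ ( :- (# 1)) :* (# 0)) refl) }))) (trans (φ-⊕ 0ⱽ (-ᶠ 1ᶠ) 0ⱽ) (vsolve ((v# 0) ⊞ (-ᶠ 1ᶠ) ⊠ (v# 0)) 𝟘 ((φ 0ⱽ) ∷ []) (λ { (xᶜ ∷ []) → (let open FS in solve 1 (λ x → x :+ ( :- (# 1)) :* x := (# 0)) refl xᶜ) })))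
          y≢0 : coords u ≢ 0ⱽ
          y≢0 e = nz (trans (span p fr u su hu) (trans (cong φ e) φ-0))

    module ParabolicFrames where
      open QuadraticFrames parabolic public
      open PolarTheory P

      module _ {e₁ e₂ e₃ : V 7} (p : Plane e₁ e₂ e₃) (fr : Frame p) where
        open Coordinates refl p fr
        open Complement refl refl p fr

        coordinate : ∀ i → coords g ! i ≡ 0ᶠ
        coordinate i = trans (cong (_! i) g-coords) (lookup-0 i)

        -- A singular g would be orthogonal to all six frame vectors, which `maximal-0` excludes.
        Qg≢0 : Q₇ g ≢ 0ᶠ
        Qg≢0 z = g≢0 (maximal-0 p z (inPlane (coordinate 1F) (coordinate 3F) (coordinate 5F)) (coordinate 0F) (coordinate 2F) (coordinate 4F))

        φ⊥g : ∀ y → B (φ y) g ≡ 0ᶠ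
        φ⊥g y = trans (B-φ y g) (trans (cong (B₆ y) g-coords) (H.B-0ʳ y))

        Q-decomposed : ∀ y γ → Q₇ (φ y ⊕ γ ∙ g) ≡ Q₆ y +ᶠ γ *ᶠ γ *ᶠ Q₇ g
        Q-decomposed y γ = trans (Quadratic.Q-⊕ parabolic (φ y) γ g) (trans (cong₂ (λ a b → a +ᶠ γ *ᶠ b +ᶠ γ *ᶠ γ *ᶠ Q₇ g) (Q-φ p fr y) (φ⊥g y))
          (let open FS in solve 3 (λ q c g → q :+ c :* (# 0) :+ c :* c :* g := q :+ c :* c :* g) refl (Q₆ y) γ (Q₇ g)))

        square-zero : ∀ γ → γ *ᶠ γ *ᶠ Q₇ g ≡ 0ᶠ → γ ≡ 0ᶠ
        square-zero γ e with γ ≟ᶠ 0ᶠ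
        ... | yes z = z
        ... | no n = cancelᶠ n (cancelᶠ Qg≢0 (trans (let open FS in solve 2 (λ c g → g :* (c :* c) := c :* c :* g) refl γ (Q₇ g)) e))

        -- Singularity says that `Q₆` y equals -γ² times the nonzero value of `Q₇` at g. So the
        -- quadric is the hyperplane section γ = 0 of Q(6,q), and γ is the linear functional wanted
        -- on planes.
        hyp-iff : ∀ y γ → Sing (φ y ⊕ γ ∙ g) → δ (hyp p (φ y ⊕ γ ∙ g)) ≡ δ γ
        hyp-iff y γ s = trans (cong δ (trans (hyp-coords _) (cong Q₆ (coords-+ y γ g g-coords))))
          (δ-cong (λ e → square-zero γ (trans (trans (let open FS in solve 1 (λ x → x := (# 0) :+ x) refl (γ *ᶠ γ *ᶠ Q₇ g)) (cong (_+ᶠ γ *ᶠ γ *ᶠ Q₇ g) (sym e))) (trans (sym (Q-decomposed y γ)) s)))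
                  (λ e → trans (trans (let open FS in solve 2 (λ q g → q := q :+ (# 0) :* (# 0) :* g) refl (Q₆ y) (Q₇ g)) (cong (λ c → Q₆ y +ᶠ c *ᶠ c *ᶠ Q₇ g) (sym e))) (trans (sym (Q-decomposed y γ)) s)))

        span : ∀ w → Sing w → hyp p w ≡ 0ᶠ → w ≡ φ (coords w)
        span w s h = trans e (trans (cong (φ (coords w) ⊕_∙ g) γ≡0) (vsolve ((v# 0) ⊞ 0ᶠ ⊠ (v# 1)) (v# 0) ((φ (coords w)) ∷ g ∷ []) (λ { (xᶜ ∷ gᶜ ∷ []) → (let open FS in solve 2 (λ x g → x :+ (# 0) :* g := x) refl xᶜ gᶜ) })))
          where
          γ = proj₁ (decompose w)
          e = proj₂ (decompose w)
          δγ : δ γ ≡ 1#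
          δγ = trans (sym (hyp-iff (coords w) γ (subst Sing e s))) (δ-1 (trans (cong (hyp p) (sym e)) h))
          γ≡0 : γ ≡ 0ᶠ
          γ≡0 = δ-one δγ

        on-plane : ∀ {a b c} → Plane a b c → ∃ λ m₁ → ∃ λ m₂ → ∃ λ m₃ → ∀ x y z → δ (hyp p (lc₃ x y z a b c)) ≡ δ (x *ᶠ m₁ +ᶠ y *ᶠ m₂ +ᶠ z *ᶠ m₃)
        on-plane {a} {b} {c} t = m₁ , m₂ , m₃ , λ x y z → trans (cong (λ w → δ (hyp p w)) (eq x y z))
            (hyp-iff (lc₃ x y z (coords a) (coords b) (coords c)) _ (subst Sing (eq x y z) (Sing-⊕ (Sing-⊕ (Sing-⊕ Sing-0 s₁ (B-0 _)) s₂ (linˡ-keep (B-0 _) p₁₂)) s₃ (linˡ-keep (linˡ-keep (B-0 _) p₁₃) p₂₃))))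
          where
          open Plane t
          m₁ = proj₁ (decompose a)
          m₂ = proj₁ (decompose b)
          m₃ = proj₁ (decompose c)
          φ-lc : ∀ x y z u v w → lc₃ x y z (φ u) (φ v) (φ w) ≡ φ (lc₃ x y z u v w)
          φ-lc x y z u v w = sym (trans (φ-⊕ _ z w) (cong (_⊕ z ∙ φ w) (trans (φ-⊕ _ y v) (cong (_⊕ y ∙ φ v) (trans (φ-⊕ 0ⱽ x u) (cong (_⊕ x ∙ φ u) φ-0))))))
            where
            φ-0 : φ 0ⱽ ≡ 0ⱽ
            φ-0 = trans (cong φ (vsolve 𝟘 (𝟘 ⊞ (-ᶠ 1ᶠ) ⊠ 𝟘) ([]) (λ { ([]) → (let open FS in solve 0 ((# 0) := (# 0) :+ ( :- (# 1)) :* (# 0)) refl) }))) (trans (φ-⊕ 0ⱽ (-ᶠ 1ᶠ) 0ⱽ) (vsolve ((v# 0) ⊞ (-ᶠ 1ᶠ) ⊠ (v# 0)) 𝟘 ((φ 0ⱽ) ∷ []) (λ { (xᶜ ∷ []) → (let open FS in solve 1 (λ x → x :+ ( :- (# 1)) :* x := (# 0)) refl xᶜ) })))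
          eq : ∀ x y z → lc₃ x y z a b c ≡ φ (lc₃ x y z (coords a) (coords b) (coords c)) ⊕ x *ᶠ m₁ +ᶠ y *ᶠ m₂ +ᶠ z *ᶠ m₃ ∙ g
          eq x y z = begin
            lc₃ x y z a b c ≡⟨ cong₂ (λ u v → u ⊕ z ∙ v) (cong₂ (λ u v → 0ⱽ ⊕ x ∙ u ⊕ y ∙ v) (proj₂ (decompose a)) (proj₂ (decompose b))) (proj₂ (decompose c)) ⟩
            lc₃ x y z (A ⊕ m₁ ∙ g) (B' ⊕ m₂ ∙ g) (C ⊕ m₃ ∙ g)
              ≡⟨ (vsolve (((𝟘 ⊞ x ⊠ ((v# 0) ⊞ m₁ ⊠ (v# 3))) ⊞ y ⊠ ((v# 1) ⊞ m₂ ⊠ (v# 3))) ⊞ z ⊠ ((v# 2) ⊞ m₃ ⊠ (v# 3))) ((((𝟘 ⊞ x ⊠ (v# 0)) ⊞ y ⊠ (v# 1)) ⊞ z ⊠ (v# 2)) ⊞ (((x *ᶠ m₁) +ᶠ (y *ᶠ m₂)) +ᶠ (z *ᶠ m₃)) ⊠ (v# 3)) (A ∷ B' ∷ C ∷ g ∷ []) (λ { (Aᶜ ∷ B'ᶜ ∷ Cᶜ ∷ gᶜ ∷ []) → (let open FS in solve 10 (λ A B' C g x y z m₁ m₂ m₃ → (# 0) :+ x :* (A :+ m₁ :* g) :+ y :* (B' :+ m₂ :* g) :+ z :* (C :+ m₃ :* g) := (# 0) :+ x :* A :+ y :* B' :+ z :* C :+ (x :* m₁ :+ y :* m₂ :+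 z :* m₃) :* g) refl Aᶜ B'ᶜ Cᶜ gᶜ x y z m₁ m₂ m₃) })) ⟩
            lc₃ x y z A B' C ⊕ x *ᶠ m₁ +ᶠ y *ᶠ m₂ +ᶠ z *ᶠ m₃ ∙ g ≡⟨ cong (_⊕ x *ᶠ m₁ +ᶠ y *ᶠ m₂ +ᶠ z *ᶠ m₃ ∙ g) (φ-lc x y z (coords a) (coords b) (coords c)) ⟩
            _ ∎
            where
            A = φ (coords a)
            B' = φ (coords b)
            C = φ (coords c)

    parabolic-good : Good (Quadratic.polar parabolic)
    parabolic-good = record { ε≡1 = refl ; span = ParabolicFrames.span ; sing-φ = λ p fr y e → trans (ParabolicFrames.Q-φ p fr y) e ; hyp-on-plane = ParabolicFrames.on-plane }

    abstract
      -- Squaring is injective because (r - s)² = r² - s² in characteristic 2. The root counts of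
      -- all elements add up to q and are at most 1, so none of them can be 0.
      square-root : 1ᶠ +ᶠ 1ᶠ ≡ 0ᶠ → ∀ a → ∃ λ r → r *ᶠ r ≡ a
      square-root char2 a with searchF (λ r → r *ᶠ r ≟ᶠ a)
      ... | inj₁ r = r
      ... | inj₂ none = ⊥-elim (1≰0 (+-cancel q (≤-trans (≤-reflexive (let open RS in solve 1 (λ q → (# 1) :+ q := q :+ (# 1)) refl q)) (≤-trans bound (≤-reflexive (let open RS in solve 1 (λ q → q := (# 0) :+ q) refl q))))))
        where
        roots : K → Carrier
        roots b = ∑F (λ r → 𝟙 (b ≟ᶠ r *ᶠ r))
        unique : ∀ {r s} → r *ᶠ r ≡ s *ᶠ s → r ≡ s
        unique {r} {s} e with r +ᶠ -ᶠ s ≟ᶠ 0ᶠ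
        ... | yes z = diff0 z
        ... | no n = ⊥-elim (n (cancelᶠ n (begin
            (r +ᶠ -ᶠ s) *ᶠ (r +ᶠ -ᶠ s) ≡⟨ (let open FS in solve 2 (λ r s → (r :- s) :* (r :- s) := r :* r :- s :* s :+ ((# 1) :+ (# 1)) :* (s :* s :- r :* s)) refl r s) ⟩
            r *ᶠ r +ᶠ -ᶠ (s *ᶠ s) +ᶠ (1ᶠ +ᶠ 1ᶠ) *ᶠ (s *ᶠ s +ᶠ -ᶠ (r *ᶠ s)) ≡⟨ cong₂ (λ x y → x +ᶠ -ᶠ (s *ᶠ s) +ᶠ y *ᶠ (s *ᶠ s +ᶠ -ᶠ (r *ᶠ s))) e char2 ⟩
            s *ᶠ s +ᶠ -ᶠ (s *ᶠ s) +ᶠ 0ᶠ *ᶠ (s *ᶠ s +ᶠ -ᶠ (r *ᶠ s)) ≡⟨ (let open FS in solve 2 (λ r s → s :* s :- s :* s :+ (# 0) :* (s :* s :- r :* s) := (# 0)) refl r s) ⟩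
            0ᶠ ∎)))
        roots≤1 : ∀ b → roots b ≤ 1#
        roots≤1 b with searchF (λ r → b ≟ᶠ r *ᶠ r)
        ... | inj₁ (r , e) = ≤-reflexive (trans (∑F-single r _ (λ s d → 𝟙-no (b ≟ᶠ s *ᶠ s) (λ e' → d (unique (trans (sym e') e))))) (𝟙-yes (b ≟ᶠ r *ᶠ r) e))
        ... | inj₂ no-root = ≤-trans (≤-reflexive (∑F-0 _ (λ r → 𝟙-no (b ≟ᶠ r *ᶠ r) (no-root r)))) 0≤1
        missed : ∀ b → roots b + 𝟙 (b ≟ᶠ a) * 1# ≤ 1#
        missed b with b ≟ᶠ a
        ... | yes refl = ≤-reflexive (trans (cong (_+ 1# * 1#) (∑F-0 _ (λ r → 𝟙-no (b ≟ᶠ r *ᶠ r) (λ e → none r (sym e))))) (let open RS in solve 0 ((# 0) :+ (# 1) :* (# 1) := (# 1)) refl))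
        ... | no _ = ≤-trans (≤-reflexive (let open RS in solve 1 (λ x → x :+ (# 0) :* (# 1) := x) refl (roots b))) (roots≤1 b)
        total : ∑F roots ≡ q
        total = trans (sum-swap elems elems _) (trans (sum-cong elems (λ r → trans (sum-cong elems (λ b → (let open RS in solve 1 (λ x → x := x :* (# 1)) refl (𝟙 (b ≟ᶠ r *ᶠ r))))) (∑F-δ (r *ᶠ r) (λ _ → 1#))))
          (trans (∑F-const 1#) (let open RS in solve 1 (λ q → q :* (# 1) := q) refl q)))
        bound : q + 1# ≤ q
        bound = ≤-trans (≤-reflexive (trans (cong₂ _+_ (sym total) (sym (∑F-δ a (λ _ → 1#)))) (sym (sum-+ elems _ _)))) (≤-trans (sum-≤ elems (λ b _ → missed b))
          (≤-reflexive (trans (∑F-const 1#) (let open RS in solve 1 (λ q → q :* (# 1) := q) refl q))))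

    -- Signs vanish, so the form is symmetric, and a frame is a basis of the whole space. On a
    -- totally isotropic plane the polar form of the quadratic form is zero; hence the quadratic
    -- form is the square of the linear functional whose coefficients are square roots of its values
    -- at the basis.
    symplectic-good : 1ᶠ +ᶠ 1ᶠ ≡ 0ᶠ → Good symplectic
    symplectic-good char2 = record { ε≡1 = ε≡1 ; span = λ p fr w _ _ → span₆ refl ε≡1 p fr w ; sing-φ = λ _ _ _ _ → tt ; hyp-on-plane = on-plane }
      where
      open PolarTheory symplectic
      ε≡1 : -ᶠ 1ᶠ ≡ 1ᶠ
      ε≡1 = trans (let open FS in solve 0 (:- (# 1) := (# 1) :- ((# 1) :+ (# 1))) refl) (trans (cong (λ z → 1ᶠ +ᶠ -ᶠ z) char2) (let open FS in solve 0 ((# 1) :- (# 0) := (# 1)) refl))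
      on-plane : ∀ {e₁ e₂ e₃} (p : Plane e₁ e₂ e₃) → Frame p → ∀ {a b c} → Plane a b c →
          ∃ λ m₁ → ∃ λ m₂ → ∃ λ m₃ → ∀ x y z → δ (hyp p (lc₃ x y z a b c)) ≡ δ (x *ᶠ m₁ +ᶠ y *ᶠ m₂ +ᶠ z *ᶠ m₃)
      on-plane p fr {a} {b} {c} t = m₁ , m₂ , m₃ , λ x y z → trans (cong δ (trans (hyp-coords _) (trans (cong Q₆ (coords-lc x y z)) (value x y z))))
          (δ-cong (λ e → root-zero (trans (square x y z) e)) (λ e → trans (sym (square x y z)) (trans (cong (λ r → r *ᶠ r) e) (let open FS in solve 0 ((# 0) :* (# 0) := (# 0)) refl))))
        where
        open Plane t
        open Coordinates ε≡1 p fr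
        A = coords a
        B' = coords b
        C = coords c
        m₁ = proj₁ (square-root char2 (Q₆ A))
        m₂ = proj₁ (square-root char2 (Q₆ B'))
        m₃ = proj₁ (square-root char2 (Q₆ C))
        root-zero : ∀ {r} → r *ᶠ r ≡ 0ᶠ → r ≡ 0ᶠ
        root-zero {r} e with r ≟ᶠ 0ᶠ
        ... | yes z = z
        ... | no n = cancelᶠ n e
        coords-lc : ∀ x y z → coords (lc₃ x y z a b c) ≡ lc₃ x y z A B' C
        coords-lc x y z = trans (coords-⊕ _ z c) (cong (_⊕ z ∙ C) (trans (coords-⊕ _ y b) (cong (_⊕ y ∙ B') (trans (coords-⊕ 0ⱽ x a) (cong (_⊕ x ∙ A) coords-0)))))
          where
          coords-0 : coords 0ⱽ ≡ 0ⱽ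
          coords-0 = trans (cong coords (vsolve 𝟘 (𝟘 ⊞ (-ᶠ 1ᶠ) ⊠ 𝟘) ([]) (λ { ([]) → (let open FS in solve 0 ((# 0) := (# 0) :+ ( :- (# 1)) :* (# 0)) refl) }))) (trans (coords-⊕ 0ⱽ (-ᶠ 1ᶠ) 0ⱽ) (vsolve ((v# 0) ⊞ (-ᶠ 1ᶠ) ⊠ (v# 0)) 𝟘 ((coords 0ⱽ) ∷ []) (λ { (xᶜ ∷ []) → (let open FS in solve 1 (λ x → x :+ ( :- (# 1)) :* x := (# 0)) refl xᶜ) })))
        b₆ : ∀ u w → B₆ (coords u) (coords w) ≡ B u w
        b₆ u w = trans (sym (B-φ (coords u) w)) (cong (λ x → B x w) (sym (span₆ refl ε≡1 p fr u)))
        value : ∀ x y z → Q₆ (lc₃ x y z A B' C) ≡ x *ᶠ x *ᶠ Q₆ A +ᶠ y *ᶠ y *ᶠ Q₆ B' +ᶠ z *ᶠ z *ᶠ Q₆ C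
        value x y z = trans (step (step (step (Quadratic.Q-0 hyperbolic) (H.B-0 A)) (H.linˡ-keep (H.B-0 B') (trans (b₆ a b) p₁₂)))
            (H.linˡ-keep (H.linˡ-keep (H.B-0 C) (trans (b₆ a c) p₁₃)) (trans (b₆ b c) p₂₃)))
            (let open FS in solve 3 (λ a b c → (# 0) :+ a :+ b :+ c := a :+ b :+ c) refl (x *ᶠ x *ᶠ Q₆ A) (y *ᶠ y *ᶠ Q₆ B') (z *ᶠ z *ᶠ Q₆ C))
          where
          step : ∀ {u w s c} → Q₆ u ≡ c → B₆ u w ≡ 0ᶠ → Q₆ (u ⊕ s ∙ w) ≡ c +ᶠ s *ᶠ s *ᶠ Q₆ w
          step {u} {w} {s} {c} qu b = trans (Q₆-⊕ u s w) (trans (cong₂ (λ x y → x +ᶠ s *ᶠ y +ᶠ s *ᶠ s *ᶠ Q₆ w) qu b) (let open FS in solve 3 (λ c s w → c :+ s :* (# 0) :+ s :* s :* w := c :+ s :* s :* w) refl c s (Q₆ w)))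
        square : ∀ x y z → (x *ᶠ m₁ +ᶠ y *ᶠ m₂ +ᶠ z *ᶠ m₃) *ᶠ (x *ᶠ m₁ +ᶠ y *ᶠ m₂ +ᶠ z *ᶠ m₃) ≡ x *ᶠ x *ᶠ Q₆ A +ᶠ y *ᶠ y *ᶠ Q₆ B' +ᶠ z *ᶠ z *ᶠ Q₆ C
        square x y z = begin
          _ ≡⟨ (let open FS in solve 3 (λ a b c → (a :+ b :+ c) :* (a :+ b :+ c) := a :* a :+ b :* b :+ c :* c :+ ((# 1) :+ (# 1)) :* (a :* b :+ a :* c :+ b :* c)) refl (x *ᶠ m₁) (y *ᶠ m₂) (z *ᶠ m₃)) ⟩
          _ ≡⟨ cong (λ k → x *ᶠ m₁ *ᶠ (x *ᶠ m₁) +ᶠ y *ᶠ m₂ *ᶠ (y *ᶠ m₂) +ᶠ z *ᶠ m₃ *ᶠ (z *ᶠ m₃) +ᶠ k *ᶠ (x *ᶠ m₁ *ᶠ (y *ᶠ m₂) +ᶠ x *ᶠ m₁ *ᶠ (z *ᶠ m₃) +ᶠ y *ᶠ m₂ *ᶠ (z *ᶠ m₃))) char2 ⟩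
          _ ≡⟨ (let open FS in solve 6 (λ x y z m₁ m₂ m₃ → x :* m₁ :* (x :* m₁) :+ y :* m₂ :* (y :* m₂) :+ z :* m₃ :* (z :* m₃) :+ (# 0) :* (x :* m₁ :* (y :* m₂) :+ x :* m₁ :* (z :* m₃) :+ y :* m₂ :* (z :* m₃)) := x :* x :* (m₁ :* m₁) :+ y :* y :* (m₂ :* m₂) :+ z :* z :* (m₃ :* m₃)) refl x y z m₁ m₂ m₃) ⟩
          _ ≡⟨ cong₂ _+ᶠ_ (cong₂ (λ u v → x *ᶠ x *ᶠ u +ᶠ y *ᶠ y *ᶠ v) (proj₂ (square-root char2 (Q₆ A))) (proj₂ (square-root char2 (Q₆ B')))) (cong (z *ᶠ z *ᶠ_) (proj₂ (square-root char2 (Q₆ C)))) ⟩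
          _ ∎

    module _ where
      open PolarTheory symplectic

      -- All points are isotropic, so the planes on ⟨a, b⟩ correspond to the points of the
      -- hyperbolic line ⟨u, c⟩. The vector u is free, which lets `no-grid` name two members of the
      -- fan explicitly.
      symplectic-fan : ∀ {a b c u} → Plane a b c → B a u ≡ 0ᶠ → B b u ≡ 0ᶠ → B c u ≢ 0ᶠ → Fan a b c (λ s → u ⊕ s ∙ c)
      symplectic-fan {a} {b} {c} {u} p au bu cu = record
        { k-sing = λ _ → tt ; k₁ = λ s → linʳ-keep au p₁₃ ; k₂ = λ s → linʳ-keep bu p₂₃
        ; k₃ = λ s e → cu (trans (sym (linʳ-keep refl (B-self tt))) e)
        ; root = λ w _ aw bw cw → let r = -ᶠ (B u w *ᶠ (B c w) ⁻¹ᶠ) in r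
            , linˡ refl refl (zero' (B u w) (B c w) cw)
            , λ s e → diff0 (cancelᶠ cw (trans (let open FS in solve 4 (λ x y s r → y :* (s :- r) := x :+ s :* y :- (x :+ r :* y)) refl (B u w) (B c w) s r)
                (trans (cong₂ (λ x y → x +ᶠ -ᶠ y) (trans (sym (B-lin u s c w)) e) (zero' (B u w) (B c w) cw)) (let open FS in solve 0 ((# 0) :- (# 0) := (# 0)) refl)))) }
        where
        open Plane p
        zero' : ∀ x y → y ≢ 0ᶠ → x +ᶠ -ᶠ (x *ᶠ y ⁻¹ᶠ) *ᶠ y ≡ 0ᶠ
        zero' x y n = trans (let open FS in solve 3 (λ x y i → x :+ ( :- (x :* i)) :* y := x :* ((# 1) :- y :* i)) refl x y (y ⁻¹ᶠ))
          (trans (cong (λ z → x *ᶠ (1ᶠ +ᶠ -ᶠ z)) (inverseᶠ y n)) (let open FS in solve 1 (λ x → x :* ((# 1) :- (# 1)) := (# 0)) refl x))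

      symplectic-fans : ∀ {a b c} → Plane a b c → ∃ (Fan a b c)
      symplectic-fans p = _ , symplectic-fan p d₁₃ d₂₃ (λ e → 0≢1ᶠ (trans (sym e) d₃₃))
        where open Plane p

    double-root : ∀ {G x γ c : K} → G ≢ 0ᶠ → x ≢ 0ᶠ → -ᶠ G *ᶠ (γ +ᶠ -ᶠ (c *ᶠ x)) *ᶠ (γ +ᶠ -ᶠ (c *ᶠ x)) ≡ 0ᶠ → c ≡ γ *ᶠ x ⁻¹ᶠ
    double-root {G} {x} {γ} {c} G≢0 nz e with γ +ᶠ -ᶠ (c *ᶠ x) ≟ᶠ 0ᶠ
    ... | yes z = trans (trans (let open FS in solve 1 (λ c → c := c :* (# 1)) refl c) (cong (c *ᶠ_) (sym (inverseᶠ x nz)))) (trans (let open FS in solve 3 (λ c x i → c :* (x :* i) := c :* x :* i) refl c x (x ⁻¹ᶠ)) (cong (_*ᶠ x ⁻¹ᶠ) (sym (diff0 z))))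
    ... | no n = ⊥-elim (n (cancelᶠ n (cancelᶠ G≢0 (trans (let open FS in solve 2 (λ G d → G :* (d :* d) := :- (( :- G) :* d :* d)) refl G (γ +ᶠ -ᶠ (c *ᶠ x))) (trans (cong -ᶠ_ e) (let open FS in solve 0 (:- (# 0) := (# 0)) refl))))))

    -- The planes on a line of Q(6,q) correspond to the points of a conic. In terms of e₃, f₃ and
    -- the vector g orthogonal to the frame, its points other than e₃ are f₃ + c g - c² Q(g) e₃.
    parabolic-fans : ∀ {a b c} → PolarTheory.Plane (Quadratic.polar parabolic) a b c → ∃ (PolarTheory.Fan (Quadratic.polar parabolic) a b c)
    parabolic-fans {e₁} {e₂} {e₃} p₀ = k , record
        { k-sing = k-sing ; k₁ = λ c → linʳ-keep (linʳ-keep d₁₃ (coordinate 1F)) p₁₃ ; k₂ = λ c → linʳ-keep (linʳ-keep d₂₃ (coordinate 3F)) p₂₃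
        ; k₃ = λ c e → 0≢1ᶠ (trans (sym e) (e₃k c)) ; root = root }
      where
      open QuadraticFrames parabolic
      open PolarTheory P
      p = proj₁ (full-frame p₀)
      fr = proj₂ (full-frame p₀)
      open Plane p
      open Frame fr
      open Coordinates refl p fr
      open Complement refl refl p fr
      coordinate : ∀ i → coords g ! i ≡ 0ᶠ
      coordinate i = trans (cong (_! i) g-coords) (lookup-0 i)
      Qg≢0 : Q₇ g ≢ 0ᶠ
      Qg≢0 z = g≢0 (maximal-0 p z (inPlane (coordinate 1F) (coordinate 3F) (coordinate 5F)) (coordinate 0F) (coordinate 2F) (coordinate 4F))
      G = Q₇ g
      k : K → V 7
      k c = f₃ ⊕ c ∙ g ⊕ -ᶠ (c *ᶠ c *ᶠ G) ∙ e₃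
      e₃k : ∀ c → B e₃ (k c) ≡ 1ᶠ
      e₃k c = linʳ-keep (linʳ-keep d₃₃ (coordinate 5F)) (B-self s₃)
      k-sing : ∀ c → Q₇ (k c) ≡ 0ᶠ
      k-sing c = begin
        Q₇ (k c) ≡⟨ Quadratic.Q-⊕ parabolic (f₃ ⊕ c ∙ g) s e₃ ⟩
        Q₇ (f₃ ⊕ c ∙ g) +ᶠ s *ᶠ B (f₃ ⊕ c ∙ g) e₃ +ᶠ s *ᶠ s *ᶠ Q₇ e₃
          ≡⟨ cong₂ (λ x y → x +ᶠ s *ᶠ y +ᶠ s *ᶠ s *ᶠ Q₇ e₃) (trans (Quadratic.Q-⊕ parabolic f₃ c g) (cong₂ (λ x y → x +ᶠ c *ᶠ y +ᶠ c *ᶠ c *ᶠ G) t₃ (0-sym (coordinate 4F))))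
               (linˡ (trans (sym' e₃ f₃) d₃₃) (0-sym (coordinate 5F)) refl) ⟩
        0ᶠ +ᶠ c *ᶠ 0ᶠ +ᶠ c *ᶠ c *ᶠ G +ᶠ s *ᶠ (1ᶠ +ᶠ c *ᶠ 0ᶠ) +ᶠ s *ᶠ s *ᶠ Q₇ e₃
          ≡⟨ cong (λ x → 0ᶠ +ᶠ c *ᶠ 0ᶠ +ᶠ c *ᶠ c *ᶠ G +ᶠ s *ᶠ (1ᶠ +ᶠ c *ᶠ 0ᶠ) +ᶠ s *ᶠ s *ᶠ x) s₃ ⟩
        0ᶠ +ᶠ c *ᶠ 0ᶠ +ᶠ c *ᶠ c *ᶠ G +ᶠ s *ᶠ (1ᶠ +ᶠ c *ᶠ 0ᶠ) +ᶠ s *ᶠ s *ᶠ 0ᶠ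
          ≡⟨ (let open FS in solve 2 (λ c G → (# 0) :+ c :* (# 0) :+ c :* c :* G :+ ( :- (c :* c :* G)) :* ((# 1) :+ c :* (# 0)) :+ ( :- (c :* c :* G)) :* ( :- (c :* c :* G)) :* (# 0) := (# 0)) refl c G) ⟩
        0ᶠ ∎
        where s = -ᶠ (c *ᶠ c *ᶠ G)
      root : ∀ w → Sing w → B e₁ w ≡ 0ᶠ → B e₂ w ≡ 0ᶠ → B e₃ w ≢ 0ᶠ → ∃ λ c₀ → B (k c₀) w ≡ 0ᶠ × (∀ c → B (k c) w ≡ 0ᶠ → c ≡ c₀)
      root w sw x₁ x₂ nz = γ *ᶠ x ⁻¹ᶠ
          , cancelᶠ nz (trans (key _) (trans (cong (λ z → -ᶠ G *ᶠ (γ +ᶠ -ᶠ z) *ᶠ (γ +ᶠ -ᶠ z)) γx) (let open FS in solve 2 (λ G c → ( :- G) :* (c :- c) :* (c :- c) := (# 0)) refl G γ)))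
          , λ c e → double-root Qg≢0 nz (trans (sym (key c)) (trans (cong (x *ᶠ_) e) (let open FS in solve 1 (λ x → x :* (# 0) := (# 0)) refl x)))
        where
        x = B e₃ w
        y = B w f₃
        γ = proj₁ (decompose w)
        γx : γ *ᶠ x ⁻¹ᶠ *ᶠ x ≡ γ
        γx = trans (let open FS in solve 3 (λ c x i → c :* i :* x := c :* (x :* i)) refl γ x (x ⁻¹ᶠ)) (trans (cong (γ *ᶠ_) (inverseᶠ x nz)) (let open FS in solve 1 (λ c → c :* (# 1) := c) refl γ))
        w-eq : w ≡ φ (coords w) ⊕ γ ∙ g
        w-eq = proj₂ (decompose w)
        φ⊥g : B (φ (coords w)) g ≡ 0ᶠ
        φ⊥g = trans (B-φ (coords w) g) (trans (cong (B₆ (coords w)) g-coords) (H.B-0ʳ (coords w)))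
        wg : B w g ≡ γ *ᶠ (G +ᶠ G)
        wg = trans (cong (λ z → B z g) w-eq) (linˡ φ⊥g (Quadratic.B-diag parabolic g) (let open FS in solve 2 (λ c G → (# 0) :+ c :* (G :+ G) := c :* (G :+ G)) refl γ G))
        Qw : y *ᶠ x +ᶠ γ *ᶠ γ *ᶠ G ≡ 0ᶠ
        Qw = begin
          y *ᶠ x +ᶠ γ *ᶠ γ *ᶠ G
            ≡⟨ (let open FS in solve 6 (λ a b y x c G → y :* x :+ c :* c :* G := a :* (# 0) :+ b :* (# 0) :+ y :* x :+ c :* (# 0) :+ c :* c :* G) refl (B w f₁) (B w f₂) y x γ G) ⟩
          B w f₁ *ᶠ 0ᶠ +ᶠ B w f₂ *ᶠ 0ᶠ +ᶠ y *ᶠ x +ᶠ γ *ᶠ 0ᶠ +ᶠ γ *ᶠ γ *ᶠ G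
            ≡⟨ cong₂ (λ a b → B w f₁ *ᶠ a +ᶠ B w f₂ *ᶠ b +ᶠ y *ᶠ x +ᶠ γ *ᶠ 0ᶠ +ᶠ γ *ᶠ γ *ᶠ G) x₁ x₂ ⟨
          B w f₁ *ᶠ B e₁ w +ᶠ B w f₂ *ᶠ B e₂ w +ᶠ y *ᶠ x +ᶠ γ *ᶠ 0ᶠ +ᶠ γ *ᶠ γ *ᶠ G
            ≡⟨ cong (λ z → z +ᶠ γ *ᶠ 0ᶠ +ᶠ γ *ᶠ γ *ᶠ G) (Q₆-def (coords w)) ⟨
          Q₆ (coords w) +ᶠ γ *ᶠ 0ᶠ +ᶠ γ *ᶠ γ *ᶠ G ≡⟨ cong₂ (λ a b → a +ᶠ γ *ᶠ b +ᶠ γ *ᶠ γ *ᶠ G) (Q-φ p fr (coords w)) φ⊥g ⟨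
          Q₇ (φ (coords w)) +ᶠ γ *ᶠ B (φ (coords w)) g +ᶠ γ *ᶠ γ *ᶠ G ≡⟨ Quadratic.Q-⊕ parabolic (φ (coords w)) γ g ⟨
          Q₇ (φ (coords w) ⊕ γ ∙ g) ≡⟨ cong Q₇ w-eq ⟨
          Q₇ w ≡⟨ sw ⟩
          0ᶠ ∎
        -- The equation `Qw` completes the square without a division by 2. A double root is what
        -- makes the fan member orthogonal to w unique: on a conic only equal points are orthogonal.
        key : ∀ c → x *ᶠ B (k c) w ≡ -ᶠ G *ᶠ (γ +ᶠ -ᶠ (c *ᶠ x)) *ᶠ (γ +ᶠ -ᶠ (c *ᶠ x))
        key c = begin
          x *ᶠ B (k c) w ≡⟨ cong (x *ᶠ_) (trans (sym' w (k c)) (linʳ (linʳ refl wg refl) (sym' e₃ w) refl)) ⟩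
          x *ᶠ (y +ᶠ c *ᶠ (γ *ᶠ (G +ᶠ G)) +ᶠ -ᶠ (c *ᶠ c *ᶠ G) *ᶠ x)
            ≡⟨ (let open FS in solve 5 (λ x y c d G → x :* (y :+ c :* (d :* (G :+ G)) :+ ( :- (c :* c :* G)) :* x) := (y :* x :+ d :* d :* G) :+ ( :- G) :* (d :- c :* x) :* (d :- c :* x)) refl x y c γ G) ⟩
          y *ᶠ x +ᶠ γ *ᶠ γ *ᶠ G +ᶠ -ᶠ G *ᶠ (γ +ᶠ -ᶠ (c *ᶠ x)) *ᶠ (γ +ᶠ -ᶠ (c *ᶠ x)) ≡⟨ cong (_+ᶠ -ᶠ G *ᶠ (γ +ᶠ -ᶠ (c *ᶠ x)) *ᶠ (γ +ᶠ -ᶠ (c *ᶠ x))) Qw ⟩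
          0ᶠ +ᶠ -ᶠ G *ᶠ (γ +ᶠ -ᶠ (c *ᶠ x)) *ᶠ (γ +ᶠ -ᶠ (c *ᶠ x)) ≡⟨ (let open FS in solve 1 (λ z → (# 0) :+ z := z) refl (-ᶠ G *ᶠ (γ +ᶠ -ᶠ (c *ᶠ x)) *ᶠ (γ +ᶠ -ᶠ (c *ᶠ x)))) ⟩
          _ ∎

  -- Weights on points and the counting identities

  module Sets {n : ℕ} (P : PolarSpaces.Polar n) where
    open RS using (nat; nat-suc)
    open PolarSpaces
    open PolarTheory P
    open WeightIdentities
    open Quadrics using (Good; module FromGood)

    D₃ : V n → V n → V n → V n → Carrier
    D₃ e₁ e₂ e₃ w = δ (B e₁ w) * (δ (B e₂ w) * δ (B e₃ w))

    module Weight (v : V n → Carrier) (supp : ∀ w → ¬ Sing w → v w ≡ 0#) where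

      ⟪_⟫ : (V n → Carrier) → Carrier
      ⟪ c ⟫ = ∑V (λ w → c w * v w)

      f : V n → V n → V n → Carrier
      f e₁ e₂ e₃ = ⟪ D₃ e₁ e₂ e₃ ⟫

      line : V n → V n → Carrier
      line e₁ e₂ = ∑F (λ a → ∑F (λ b → v (0ⱽ ⊕ a ∙ e₁ ⊕ b ∙ e₂)))

      pt : V n → Carrier
      pt e = ∑F (λ a → v (0ⱽ ⊕ a ∙ e))

      -- If f takes the values 0 and 1 on planes, N e₁ e₂ and (q + 1) T e are the
      -- numbers of planes with value 1 through the line ⟨e₁, e₂⟩ and the point ⟨e⟩.
      N : V n → V n → Carrier
      N e₁ e₂ = ⟪ (λ w → δ (B e₁ w) * δ (B e₂ w)) ⟫ + q * line e₁ e₂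

      T : V n → Carrier
      T e = ⟪ (λ w → δ (B e w)) ⟫ + q * q * pt e

      X : Carrier
      X = ∑V v

      infix 3 _≈⟪_⟫
      _≈⟪_⟫ : Carrier → (V n → Carrier) → Set
      x ≈⟪ c ⟫ = x ≡ ⟪ c ⟫

      -- Both sides are linear in the weight, so it is enough to compare their coefficients at each
      -- singular vector. Every identity in `Counting` is reduced to such a comparison of
      -- indicators.
      by : ∀ {x y c d} → x ≈⟪ c ⟫ → y ≈⟪ d ⟫ → (∀ w → Sing w → c w ≡ d w) → x ≡ y
      by {c = c} {d} p r e = trans p (trans (sum-cong (vecs n) lem) (sym r))
        where
        lem : ∀ w → c w * v w ≡ d w * v w
        lem w with Sing? w
        ... | yes s = cong (_* v w) (e w s)
        ... | no ns = trans (cong (c w *_) (supp w ns)) (trans (let open RS in solve 2 (λ x y → x :* (# 0) := y :* (# 0)) refl (c w) (d w)) (cong (d w *_) (sym (supp w ns))))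

      plus : ∀ {x y c d} → x ≈⟪ c ⟫ → y ≈⟪ d ⟫ → x + y ≈⟪ (λ w → c w + d w) ⟫
      plus {c = c} {d} refl refl = trans (sym (sum-+ (vecs n) _ _))
        (sum-cong (vecs n) (λ w → (let open RS in solve 3 (λ x y z → x :* z :+ y :* z := (x :+ y) :* z) refl (c w) (d w) (v w))))

      times : ∀ {x c} k → x ≈⟪ c ⟫ → k * x ≈⟪ (λ w → k * c w) ⟫
      times {c = c} k refl = trans (sym (sum-* (vecs n) k _))
        (sum-cong (vecs n) (λ w → (let open RS in solve 3 (λ k x z → k :* (x :* z) := k :* x :* z) refl k (c w) (v w))))

      over : ∀ {x : K → Carrier} {c : K → V n → Carrier} → (∀ s → x s ≈⟪ c s ⟫) → ∑F x ≈⟪ (λ w → ∑F (λ s → c s w)) ⟫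
      over {x} {c} e = trans (sum-cong elems e) (trans (sum-swap elems (vecs n) _)
        (sum-cong (vecs n) (λ w → sum-*ʳ elems (v w) (λ s → c s w))))

      X-w : X ≈⟪ (λ _ → 1#) ⟫
      X-w = sum-cong (vecs n) (λ w → (let open RS in solve 1 (λ x → x := (# 1) :* x) refl (v w)))

      module InPlaneOf {e₁ e₂ e₃} (p : Plane e₁ e₂ e₃) where
        open Plane p

        D : V n → Carrier
        D = D₃ e₁ e₂ e₃

        lc-coords : ∀ a b c → B (lc₃ a b c e₁ e₂ e₃) f₁ ≡ a × B (lc₃ a b c e₁ e₂ e₃) f₂ ≡ b × B (lc₃ a b c e₁ e₂ e₃) f₃ ≡ c
        lc-coords a b c =
            linˡ-keep (linˡ-keep (linˡ (B-0 _) d₁₁ (let open FS in solve 1 (λ a → (# 0) :+ a :* (# 1) := a) refl a)) d₂₁) d₃₁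
          , linˡ-keep (linˡ (linˡ-keep (B-0 _) d₁₂) d₂₂ (let open FS in solve 1 (λ b → (# 0) :+ b :* (# 1) := b) refl b)) d₃₂
          , linˡ (linˡ-keep (linˡ-keep (B-0 _) d₁₃) d₂₃) d₃₃ (let open FS in solve 1 (λ c → (# 0) :+ c :* (# 1) := c) refl c)

        lc-in : ∀ a b c → InPlane e₁ e₂ e₃ (lc₃ a b c e₁ e₂ e₃)
        lc-in a b c = inPlane
          (linʳ-keep (linʳ-keep (linʳ-keep (B-0ʳ _) (B-self s₁)) p₁₂) p₁₃)
          (linʳ-keep (linʳ-keep (linʳ-keep (B-0ʳ _) (0-sym p₁₂)) (B-self s₂)) p₂₃)
          (linʳ-keep (linʳ-keep (linʳ-keep (B-0ʳ _) (0-sym p₁₃)) (0-sym p₂₃)) (B-self s₃))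

        lc-sing : ∀ a b c → Sing (lc₃ a b c e₁ e₂ e₃)
        lc-sing a b c = Sing-⊕ (Sing-⊕ (Sing-⊕ Sing-0 s₁ (B-0 _)) s₂ (linˡ-keep (B-0 _) p₁₂)) s₃
          (linˡ-keep (linˡ-keep (B-0 _) p₁₃) p₂₃)

        in? : ∀ w → Dec (InPlane e₁ e₂ e₃ w)
        in? w with B e₁ w ≟ᶠ 0ᶠ | B e₂ w ≟ᶠ 0ᶠ | B e₃ w ≟ᶠ 0ᶠ
        ... | yes a | yes b | yes c = yes (inPlane a b c)
        ... | no a | _ | _ = no (a ∘ InPlane.i₁)
        ... | _ | no b | _ = no (b ∘ InPlane.i₂)
        ... | _ | _ | no c = no (c ∘ InPlane.i₃)

        D-in : ∀ {w} → InPlane e₁ e₂ e₃ w → D w ≡ 1#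
        D-in {w} (inPlane a b c) = trans (cong₂ _*_ (δ-1 a) (cong₂ _*_ (δ-1 b) (δ-1 c))) (let open RS in solve 0 ((# 1) :* ((# 1) :* (# 1)) := (# 1)) refl)

        D-out : ∀ {w} → ¬ InPlane e₁ e₂ e₃ w → D w ≡ 0#
        D-out {w} ni with B e₁ w ≟ᶠ 0ᶠ | B e₂ w ≟ᶠ 0ᶠ | B e₃ w ≟ᶠ 0ᶠ
        ... | yes a | yes b | yes c = ⊥-elim (ni (inPlane a b c))
        ... | no a | _ | _ = zeroˡ refl
        ... | yes _ | no b | _ = zeroʳ (zeroˡ refl)
        ... | yes _ | yes _ | no c = zeroʳ (zeroʳ refl)

        y₁ y₂ y₃ : V n → K
        y₁ w = B w f₁
        y₂ w = B w f₂
        y₃ w = B w f₃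

        -- By `maximal` a singular vector orthogonal to the plane is the combination with
        -- coefficients yᵢ w. Sums over coordinate triples thus become weighted sums over all
        -- vectors, the form that `by` compares.
        coordinates : ∀ (κ : K → K → K → Carrier) →
          ∑F (λ a → ∑F (λ b → ∑F (λ c → κ a b c * v (lc₃ a b c e₁ e₂ e₃)))) ≈⟪ (λ w → D w * κ (y₁ w) (y₂ w) (y₃ w)) ⟫
        coordinates κ = begin
          ∑F (λ a → ∑F (λ b → ∑F (λ c → κ a b c * v (lc₃ a b c e₁ e₂ e₃))))
            ≡⟨ sum-cong elems (λ a → sum-cong elems (λ b → sum-cong elems (λ c → ∑V-δ (lc₃ a b c e₁ e₂ e₃) (λ w → κ a b c * v w)))) ⟨
          ∑F (λ a → ∑F (λ b → ∑F (λ c → ∑V (λ w → G a b c w))))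
            ≡⟨ sum-cong elems (λ a → sum-cong elems (λ b → sum-swap elems (vecs n) _)) ⟩
          ∑F (λ a → ∑F (λ b → ∑V (λ w → ∑F (λ c → G a b c w))))
            ≡⟨ sum-cong elems (λ a → sum-swap elems (vecs n) _) ⟩
          ∑F (λ a → ∑V (λ w → ∑F (λ b → ∑F (λ c → G a b c w))))
            ≡⟨ sum-swap elems (vecs n) _ ⟩
          ∑V (λ w → ∑F (λ a → ∑F (λ b → ∑F (λ c → G a b c w))))
            ≡⟨ sum-cong (vecs n) pointwise ⟩
          ⟪ (λ w → D w * κ (y₁ w) (y₂ w) (y₃ w)) ⟫ ∎
          where
          G : K → K → K → V n → Carrier
          G a b c w = 𝟙 (w ≟ⱽ lc₃ a b c e₁ e₂ e₃) * (κ a b c * v w)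
          pointwise : ∀ w → ∑F (λ a → ∑F (λ b → ∑F (λ c → G a b c w))) ≡ D w * κ (y₁ w) (y₂ w) (y₃ w) * v w
          pointwise w with Sing? w
          ... | no ns = trans (∑F-0 _ (λ a → ∑F-0 _ (λ b → ∑F-0 _ (λ c → zeroʳ (zeroʳ (supp w ns)))))) (sym (zeroʳ (supp w ns)))
          ... | yes s with in? w
          ... | no ni = trans (∑F-0 _ (λ a → ∑F-0 _ (λ b → ∑F-0 _ (λ c → zeroˡ (𝟙-no (w ≟ⱽ _) (λ e → ni (subst (InPlane e₁ e₂ e₃) (sym e) (lc-in a b c)))))))) (sym (zeroˡ (zeroˡ (D-out ni))))
          ... | yes i = begin
            ∑F (λ a → ∑F (λ b → ∑F (λ c → G a b c w)))
              ≡⟨ ∑F-single (y₁ w) _ (λ a d → ∑F-0 _ (λ b → ∑F-0 _ (λ c → zeroˡ (𝟙-no (w ≟ⱽ _) (λ e → d (trans (sym (proj₁ (lc-coords a b c))) (cong y₁ (sym e)))))))) ⟩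
            ∑F (λ b → ∑F (λ c → G (y₁ w) b c w))
              ≡⟨ ∑F-single (y₂ w) _ (λ b d → ∑F-0 _ (λ c → zeroˡ (𝟙-no (w ≟ⱽ _) (λ e → d (trans (sym (proj₁ (proj₂ (lc-coords (y₁ w) b c)))) (cong y₂ (sym e))))))) ⟩
            ∑F (λ c → G (y₁ w) (y₂ w) c w)
              ≡⟨ ∑F-single (y₃ w) _ (λ c d → zeroˡ (𝟙-no (w ≟ⱽ _) (λ e → d (trans (sym (proj₂ (proj₂ (lc-coords (y₁ w) (y₂ w) c)))) (cong y₃ (sym e)))))) ⟩
            G (y₁ w) (y₂ w) (y₃ w) w
              ≡⟨ cong (_* (κ (y₁ w) (y₂ w) (y₃ w) * v w)) (𝟙-yes (w ≟ⱽ _) (maximal p s i)) ⟩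
            1# * (κ (y₁ w) (y₂ w) (y₃ w) * v w)
              ≡⟨ (let open RS in solve 2 (λ k x → (# 1) :* (k :* x) := (# 1) :* k :* x) refl (κ (y₁ w) (y₂ w) (y₃ w)) (v w)) ⟩
            1# * κ (y₁ w) (y₂ w) (y₃ w) * v w
              ≡⟨ cong (λ d → d * κ (y₁ w) (y₂ w) (y₃ w) * v w) (D-in i) ⟨
            D w * κ (y₁ w) (y₂ w) (y₃ w) * v w ∎

        f-sum : ∑F (λ a → ∑F (λ b → ∑F (λ c → v (lc₃ a b c e₁ e₂ e₃)))) ≡ f e₁ e₂ e₃
        f-sum = trans (sum-cong elems (λ a → sum-cong elems (λ b → sum-cong elems (λ c → (let open RS in solve 1 (λ x → x := (# 1) :* x) refl (v (lc₃ a b c e₁ e₂ e₃)))))))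
          (trans (coordinates (λ _ _ _ → 1#)) (sum-cong (vecs n) (λ w → (let open RS in solve 2 (λ d x → d :* (# 1) :* x := d :* x) refl (D w) (v w)))))

        last-δ : ∀ (h : K → K → K) → ∑F (λ a → ∑F (λ b → v (lc₃ a b (h a b) e₁ e₂ e₃))) ≈⟪ (λ w → D w * δ (y₃ w +ᶠ -ᶠ h (y₁ w) (y₂ w))) ⟫
        last-δ h = trans (sum-cong elems (λ a → sum-cong elems (λ b → sym (∑F-δ- (h a b) (λ c → v (lc₃ a b c e₁ e₂ e₃))))))
          (coordinates (λ a b c → δ (c +ᶠ -ᶠ h a b)))

        first-δ : ∀ (h : K → K → K) → ∑F (λ b → ∑F (λ c → v (lc₃ (h b c) b c e₁ e₂ e₃))) ≈⟪ (λ w → D w * δ (y₁ w +ᶠ -ᶠ h (y₂ w) (y₃ w))) ⟫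
        first-δ h = begin
          ∑F (λ b → ∑F (λ c → v (lc₃ (h b c) b c e₁ e₂ e₃)))
            ≡⟨ sum-cong elems (λ b → sum-cong elems (λ c → ∑F-δ- (h b c) (λ a → v (lc₃ a b c e₁ e₂ e₃)))) ⟨
          ∑F (λ b → ∑F (λ c → ∑F (λ a → G a b c))) ≡⟨ sum-cong elems (λ b → sum-swap elems elems _) ⟩
          ∑F (λ b → ∑F (λ a → ∑F (λ c → G a b c))) ≡⟨ sum-swap elems elems _ ⟩
          ∑F (λ a → ∑F (λ b → ∑F (λ c → G a b c))) ≡⟨ coordinates (λ a b c → δ (a +ᶠ -ᶠ h b c)) ⟩
          _ ∎
          where
          G : K → K → K → Carrier
          G a b c = δ (a +ᶠ -ᶠ h b c) * v (lc₃ a b c e₁ e₂ e₃)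

        line₁₂ : line e₁ e₂ ≈⟪ (λ w → D w * δ (y₃ w)) ⟫
        line₁₂ = trans (sum-cong elems (λ a → sum-cong elems (λ b → cong v (vsolve ((𝟘 ⊞ a ⊠ (v# 0)) ⊞ b ⊠ (v# 1)) (((𝟘 ⊞ a ⊠ (v# 0)) ⊞ b ⊠ (v# 1)) ⊞ 0ᶠ ⊠ (v# 2)) (e₁ ∷ e₂ ∷ e₃ ∷ []) (λ { (e₁ᶜ ∷ e₂ᶜ ∷ e₃ᶜ ∷ []) → (let open FS in solve 5 (λ e₁ e₂ e₃ a b → (# 0) :+ a :* e₁ :+ b :* e₂ := (# 0) :+ a :* e₁ :+ b :* e₂ :+ (# 0) :* e₃) refl e₁ᶜ e₂ᶜ e₃ᶜ a b) })))))
          (trans (last-δ (λ _ _ → 0ᶠ)) (sum-cong (vecs n) (λ w → cong (λ z → D w * δ z * v w) (let open FS in solve 1 (λ y → y :- (# 0) := y) refl (y₃ w)))))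

        line₁,₂₃ : ∀ s → line e₁ (e₂ ⊕ s ∙ e₃) ≈⟪ (λ w → D w * δ (y₃ w +ᶠ -ᶠ (s *ᶠ y₂ w))) ⟫
        line₁,₂₃ s = trans (sum-cong elems (λ a → sum-cong elems (λ b → cong v (vsolve ((𝟘 ⊞ a ⊠ (v# 0)) ⊞ b ⊠ ((v# 1) ⊞ s ⊠ (v# 2))) (((𝟘 ⊞ a ⊠ (v# 0)) ⊞ b ⊠ (v# 1)) ⊞ (s *ᶠ b) ⊠ (v# 2)) (e₁ ∷ e₂ ∷ e₃ ∷ []) (λ { (e₁ᶜ ∷ e₂ᶜ ∷ e₃ᶜ ∷ []) → (let open FS in solve 6 (λ e₁ e₂ e₃ a b s → (# 0) :+ a :* e₁ :+ b :* (e₂ :+ s :* e₃) := (# 0) :+ a :* e₁ :+ b :* e₂ :+ (s :* b) :* e₃) refl e₁ᶜ e₂ᶜ e₃ᶜ a b s) })))))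
          (last-δ (λ a b → s *ᶠ b))

        line₂₁,₃₁ : ∀ s r → line (e₂ ⊕ s ∙ e₁) (e₃ ⊕ r ∙ e₁) ≈⟪ (λ w → D w * δ (y₁ w +ᶠ -ᶠ (s *ᶠ y₂ w) +ᶠ -ᶠ (r *ᶠ y₃ w))) ⟫
        line₂₁,₃₁ s r = trans (sum-cong elems (λ b → sum-cong elems (λ c → cong v
            (vsolve ((𝟘 ⊞ b ⊠ ((v# 1) ⊞ s ⊠ (v# 0))) ⊞ c ⊠ ((v# 2) ⊞ r ⊠ (v# 0))) (((𝟘 ⊞ ((s *ᶠ b) +ᶠ (r *ᶠ c)) ⊠ (v# 0)) ⊞ b ⊠ (v# 1)) ⊞ c ⊠ (v# 2)) (e₁ ∷ e₂ ∷ e₃ ∷ []) (λ { (e₁ᶜ ∷ e₂ᶜ ∷ e₃ᶜ ∷ []) → (let open FS in solve 7 (λ e₁ e₂ e₃ b c s r → (# 0) :+ b :* (e₂ :+ s :* e₁) :+ c :* (e₃ :+ r :* e₁) := (# 0) :+ (s :* b :+ r :* c) :* e₁ :+ b :* e₂ :+ c :* e₃) refl e₁ᶜ e₂ᶜ e₃ᶜ b c s r) })))))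
          (trans (first-δ (λ b c → s *ᶠ b +ᶠ r *ᶠ c)) (sum-cong (vecs n) (λ w → cong (λ z → D w * δ z * v w)
            (let open FS in solve 5 (λ x y z s r → x :- (s :* y :+ r :* z) := x :- s :* y :- r :* z) refl (y₁ w) (y₂ w) (y₃ w) s r))))

        pt₁₂ : ∀ s → pt (e₁ ⊕ s ∙ e₂) ≈⟪ (λ w → D w * (δ (y₃ w) * δ (y₂ w +ᶠ -ᶠ (s *ᶠ y₁ w)))) ⟫
        pt₁₂ s = begin
          ∑F (λ a → v (0ⱽ ⊕ a ∙ (e₁ ⊕ s ∙ e₂)))
            ≡⟨ sum-cong elems (λ a → cong v (vsolve (𝟘 ⊞ a ⊠ ((v# 0) ⊞ s ⊠ (v# 1))) (((𝟘 ⊞ a ⊠ (v# 0)) ⊞ (s *ᶠ a) ⊠ (v# 1)) ⊞ 0ᶠ ⊠ (v# 2)) (e₁ ∷ e₂ ∷ e₃ ∷ []) (λ { (e₁ᶜ ∷ e₂ᶜ ∷ e₃ᶜ ∷ []) → (let open FS in solve 5 (λ e₁ e₂ e₃ a s → (# 0) :+ a :* (e₁ :+ s :* e₂) := (# 0) :+ a :* e₁ :+ (s :* a) :* e₂ :+ (# 0) :* e₃) refl e₁ᶜ e₂ᶜ e₃ᶜ a s) }))) ⟩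
          ∑F (λ a → v (lc₃ a (s *ᶠ a) 0ᶠ e₁ e₂ e₃))
            ≡⟨ sum-cong elems (λ a → ∑F-δ- (s *ᶠ a) (λ b → v (lc₃ a b 0ᶠ e₁ e₂ e₃))) ⟨
          ∑F (λ a → ∑F (λ b → δ (b +ᶠ -ᶠ (s *ᶠ a)) * v (lc₃ a b 0ᶠ e₁ e₂ e₃)))
            ≡⟨ sum-cong elems (λ a → sum-cong elems (λ b → trans (∑F-δ 0ᶠ (λ c → δ (b +ᶠ -ᶠ (s *ᶠ a)) * v (lc₃ a b c e₁ e₂ e₃))) refl)) ⟨
          ∑F (λ a → ∑F (λ b → ∑F (λ c → δ c * (δ (b +ᶠ -ᶠ (s *ᶠ a)) * v (lc₃ a b c e₁ e₂ e₃)))))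
            ≡⟨ sum-cong elems (λ a → sum-cong elems (λ b → sum-cong elems (λ c →
                 (let open RS in solve 3 (λ x y z → x :* (y :* z) := x :* y :* z) refl (δ c) (δ (b +ᶠ -ᶠ (s *ᶠ a))) (v (lc₃ a b c e₁ e₂ e₃)))))) ⟩
          ∑F (λ a → ∑F (λ b → ∑F (λ c → δ c * δ (b +ᶠ -ᶠ (s *ᶠ a)) * v (lc₃ a b c e₁ e₂ e₃))))
            ≡⟨ coordinates (λ a b c → δ c * δ (b +ᶠ -ᶠ (s *ᶠ a))) ⟩
          _ ∎

        pt₁ : pt e₁ ≈⟪ (λ w → D w * (δ (y₂ w) * δ (y₃ w))) ⟫
        pt₁ = trans (sum-cong elems (λ a → cong v (vsolve (𝟘 ⊞ a ⊠ (v# 0)) (𝟘 ⊞ a ⊠ ((v# 0) ⊞ 0ᶠ ⊠ (v# 1))) (e₁ ∷ e₂ ∷ []) (λ { (e₁ᶜ ∷ e₂ᶜ ∷ []) → (let open FS in solve 3 (λ e₁ e₂ a → (# 0) :+ a :* e₁ := (# 0) :+ a :* (e₁ :+ (# 0) :* e₂)) refl e₁ᶜ e₂ᶜ a) }))))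
          (by (pt₁₂ 0ᶠ) refl (λ w _ → trans (cong (λ z → D w * (δ (y₃ w) * δ z)) (let open FS in solve 2 (λ x y → x :- (# 0) :* y := x) refl (y₂ w) (y₁ w)))
            (let open RS in solve 3 (λ d x y → d :* (x :* y) := d :* (y :* x)) refl (D w) (δ (y₃ w)) (δ (y₂ w)))))

        pt₀ : v 0ⱽ ≈⟪ (λ w → D w * (δ (y₁ w) * (δ (y₂ w) * δ (y₃ w)))) ⟫
        pt₀ = begin
          v 0ⱽ ≡⟨ cong v (vsolve 𝟘 (((𝟘 ⊞ 0ᶠ ⊠ (v# 0)) ⊞ 0ᶠ ⊠ (v# 1)) ⊞ 0ᶠ ⊠ (v# 2)) (e₁ ∷ e₂ ∷ e₃ ∷ []) (λ { (e₁ᶜ ∷ e₂ᶜ ∷ e₃ᶜ ∷ []) → (let open FS in solve 3 (λ e₁ e₂ e₃ → (# 0) := (# 0) :+ (# 0) :* e₁ :+ (# 0) :* e₂ :+ (# 0) :* e₃) refl e₁ᶜ e₂ᶜ e₃ᶜ) })) ⟩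
          v (lc₃ 0ᶠ 0ᶠ 0ᶠ e₁ e₂ e₃) ≡⟨ ∑F-δ 0ᶠ (λ a → v (lc₃ a 0ᶠ 0ᶠ e₁ e₂ e₃)) ⟨
          ∑F (λ a → δ a * v (lc₃ a 0ᶠ 0ᶠ e₁ e₂ e₃)) ≡⟨ sum-cong elems (λ a → ∑F-δ 0ᶠ (λ b → δ a * v (lc₃ a b 0ᶠ e₁ e₂ e₃))) ⟨
          ∑F (λ a → ∑F (λ b → δ b * (δ a * v (lc₃ a b 0ᶠ e₁ e₂ e₃))))
            ≡⟨ sum-cong elems (λ a → sum-cong elems (λ b → ∑F-δ 0ᶠ (λ c → δ b * (δ a * v (lc₃ a b c e₁ e₂ e₃))))) ⟨
          ∑F (λ a → ∑F (λ b → ∑F (λ c → δ c * (δ b * (δ a * v (lc₃ a b c e₁ e₂ e₃))))))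
            ≡⟨ sum-cong elems (λ a → sum-cong elems (λ b → sum-cong elems (λ c →
               (let open RS in solve 4 (λ x y z t → z :* (y :* (x :* t)) := x :* (y :* z) :* t) refl (δ a) (δ b) (δ c) (v (lc₃ a b c e₁ e₂ e₃)))))) ⟩
          ∑F (λ a → ∑F (λ b → ∑F (λ c → δ a * (δ b * δ c) * v (lc₃ a b c e₁ e₂ e₃))))
            ≡⟨ coordinates (λ a b c → δ a * (δ b * δ c)) ⟩
          _ ∎

      line-swap : ∀ e₁ e₂ → line e₁ e₂ ≡ line e₂ e₁
      line-swap e₁ e₂ = trans (sum-cong elems (λ a → sum-cong elems (λ b → cong v (vsolve ((𝟘 ⊞ a ⊠ (v# 0)) ⊞ b ⊠ (v# 1)) ((𝟘 ⊞ b ⊠ (v# 1)) ⊞ a ⊠ (v# 0)) (e₁ ∷ e₂ ∷ []) (λ { (e₁ᶜ ∷ e₂ᶜ ∷ []) → (let open FS in solve 4 (λ e₁ e₂ a b → (# 0) :+ a :* e₁ :+ b :* e₂ := (# 0) :+ b :* e₂ :+ a :* e₁) refl e₁ᶜ e₂ᶜ a b) })))))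
        (sum-swap elems elems _)

      N-swap : ∀ e₁ e₂ → N e₁ e₂ ≡ N e₂ e₁
      N-swap e₁ e₂ = cong₂ (λ a b → a + q * b)
        (sum-cong (vecs n) (λ w → (let open RS in solve 3 (λ x y z → x :* y :* z := y :* x :* z) refl (δ (B e₁ w)) (δ (B e₂ w)) (v w)))) (line-swap e₁ e₂)

      f-swap₁₂ : ∀ e₁ e₂ e₃ → f e₁ e₂ e₃ ≡ f e₂ e₁ e₃
      f-swap₁₂ e₁ e₂ e₃ = sum-cong (vecs n) (λ w → (let open RS in solve 4 (λ x y z t → x :* (y :* z) :* t := y :* (x :* z) :* t) refl (δ (B e₁ w)) (δ (B e₂ w)) (δ (B e₃ w)) (v w)))

      f-swap₂₃ : ∀ e₁ e₂ e₃ → f e₁ e₂ e₃ ≡ f e₁ e₃ e₂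
      f-swap₂₃ e₁ e₂ e₃ = sum-cong (vecs n) (λ w → (let open RS in solve 4 (λ x y z t → x :* (y :* z) :* t := x :* (z :* y) :* t) refl (δ (B e₁ w)) (δ (B e₂ w)) (δ (B e₃ w)) (v w)))

      f-add₃₁ : ∀ e₁ e₂ e₃ s → f e₁ e₂ (e₃ ⊕ s ∙ e₁) ≡ f e₁ e₂ e₃
      f-add₃₁ e₁ e₂ e₃ s = sum-cong (vecs n) (λ w → cong (_* v w) (lem w))
        where
        lem : ∀ w → D₃ e₁ e₂ (e₃ ⊕ s ∙ e₁) w ≡ D₃ e₁ e₂ e₃ w
        lem w with B e₁ w ≟ᶠ 0ᶠ
        ... | no _ = (let open RS in solve 2 (λ x y → (# 0) :* x := (# 0) :* y) refl (δ (B e₂ w) * δ (B (e₃ ⊕ s ∙ e₁) w)) (δ (B e₂ w) * δ (B e₃ w)))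
        ... | yes e = cong (λ z → 1# * (δ (B e₂ w) * δ z)) (linˡ-keep refl e)

      f-add₃₂ : ∀ e₁ e₂ e₃ s → f e₁ e₂ (e₃ ⊕ s ∙ e₂) ≡ f e₁ e₂ e₃
      f-add₃₂ e₁ e₂ e₃ s = trans (f-swap₁₂ _ _ _) (trans (f-add₃₁ e₂ e₁ e₃ s) (f-swap₁₂ _ _ _))

      module Counting {e₁ e₂ e₃} (p : Plane e₁ e₂ e₃) where
        open Plane p
        open InPlaneOf p

        private
          toN : ∀ {u₁ u₂} {c : V n → Carrier} → line u₁ u₂ ≈⟪ (λ w → D w * c w) ⟫ → N u₁ u₂ ≈⟪ (λ w → δ (B u₁ w) * δ (B u₂ w) + q * (D w * c w)) ⟫
          toN l = plus refl (times q l)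

          N₁₂-w = toN line₁₂

          N₁₃-w : N e₁ e₃ ≈⟪ (λ w → δ (B e₁ w) * δ (B e₃ w) + q * (D w * δ (y₂ w))) ⟫
          N₁₃-w = plus refl (times q (by (InPlaneOf.line₁₂ (swap₂₃ p)) refl (λ w _ → cong (_* δ (y₂ w))
            (let open RS in solve 3 (λ x y z → x :* (z :* y) := x :* (y :* z)) refl (δ (B e₁ w)) (δ (B e₂ w)) (δ (B e₃ w))))))

          T₁-w : T e₁ ≈⟪ (λ w → δ (B e₁ w) + q * q * (D w * (δ (y₂ w) * δ (y₃ w)))) ⟫
          T₁-w = plus refl (times (q * q) pt₁)

        -- For a plane outside the set this bounds each N on the point by T. For a plane of the set
        -- the q + 1 values N add up to T + 2q, so their average is 2 exactly when T = 2.
        lines-on-point : N e₁ e₃ + ∑F (λ s → N e₁ (e₂ ⊕ s ∙ e₃)) ≡ T e₁ + (1# + 1#) * q * f e₁ e₂ e₃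
        lines-on-point = by (plus N₁₃-w (over (λ s → toN (line₁,₂₃ s)))) (plus T₁-w (times ((1# + 1#) * q) refl)) pw
          where
          pw : ∀ w → Sing w →
            δ (B e₁ w) * δ (B e₃ w) + q * (D w * δ (y₂ w)) + ∑F (λ s → δ (B e₁ w) * δ (B (e₂ ⊕ s ∙ e₃) w) + q * (D w * δ (y₃ w +ᶠ -ᶠ (s *ᶠ y₂ w))))
            ≡ δ (B e₁ w) + q * q * (D w * (δ (y₂ w) * δ (y₃ w))) + (1# + 1#) * q * D w
          pw w _ = begin
            _ ≡⟨ cong (δ (B e₁ w) * δ (B e₃ w) + q * (D w * δ (y₂ w)) +_) (trans (∑F-lin₂ _ q (D w) _ _) (cong₂ (λ a b → δ (B e₁ w) * a + q * (D w * b))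
                   (trans (sum-cong elems (λ s → cong δ (B-lin e₂ s e₃ w))) (∑F-affine (B e₃ w) (B e₂ w))) (∑F-affine⁻ (y₂ w) (y₃ w)))) ⟩
            δ (B e₁ w) * δ (B e₃ w) + q * (D w * δ (y₂ w)) + (δ (B e₁ w) * (1# - δ (B e₃ w) + q * (δ (B e₃ w) * δ (B e₂ w)))
              + q * (D w * (1# - δ (y₂ w) + q * (δ (y₂ w) * δ (y₃ w)))))
              ≡⟨ (let open RS in solve 6 (λ q a b c y z → a :* c :+ q :* (a :* (b :* c) :* y) :+ (a :* ((# 1) :- c :+ q :* (c :* b)) :+ q :* (a :* (b :* c) :* ((# 1) :- y :+ q :* (y :* z)))) := a :+ q :* q :* (a :* (b :* c) :* (y :* z)) :+ ((# 1) :+ (# 1)) :* q :* (a :* (b :* c))) refl q (δ (B e₁ w)) (δ (B e₂ w)) (δ (B e₃ w)) (δ (y₂ w)) (δ (y₃ w))) ⟩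
            _ ∎

        -- Combined with `lines-on-point`: for a plane outside the set the numbers N of all its
        -- lines add up to X. The term with v 0 stems from the zero vector, which lies on every
        -- line.
        lines-off-point : ∑F (λ s → ∑F (λ r → N (e₂ ⊕ s ∙ e₁) (e₃ ⊕ r ∙ e₁))) + T e₁
          ≡ X + (1# + 1#) * (q * q) * f e₁ e₂ e₃ + q * q * q * v 0ⱽ
        lines-off-point = by (plus (over (λ s → over (λ r → toN (line₂₁,₃₁ s r)))) T₁-w)
            (plus (plus X-w (times ((1# + 1#) * (q * q)) refl)) (times (q * q * q) pt₀)) pw
          where
          pw : ∀ w → Sing w → _
          pw w _ = begin
            ∑F (λ s → ∑F (λ r → δ (B (e₂ ⊕ s ∙ e₁) w) * δ (B (e₃ ⊕ r ∙ e₁) w) + q * (D w * δ (y₁ w +ᶠ -ᶠ (s *ᶠ y₂ w) +ᶠ -ᶠ (r *ᶠ y₃ w)))))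
              + (δ₁ + q * q * (D w * (e * g)))
              ≡⟨ cong (_+ (δ₁ + q * q * (D w * (e * g)))) (trans (sum-cong elems inner) outer) ⟩
            A₃ * A₂ + q * (D w * (q * (1# - g) + q * (g * (1# - e + q * (e * d))))) + (δ₁ + q * q * (D w * (e * g)))
              ≡⟨ cong (λ z → z + q * (D w * (q * (1# - g) + q * (g * (1# - e + q * (e * d))))) + (δ₁ + q * q * (D w * (e * g)))) idem ⟩
            1# - δ₁ + q * q * D w + q * (D w * (q * (1# - g) + q * (g * (1# - e + q * (e * d))))) + (δ₁ + q * q * (D w * (e * g)))
              ≡⟨ (let open RS in solve 7 (λ q a b c d e g → (# 1) :- a :+ q :* q :* (a :* (b :* c)) :+ q :* (a :* (b :* c) :* (q :* ((# 1) :- g) :+ q :* (g :* ((# 1) :- e :+ q :* (e :* d))))) :+ (a :+ q :* q :* (a :* (b :* c) :* (e :* g))) := (# 1) :+ ((# 1) :+ (# 1)) :* (q :* q) :* (a :* (b :* c)) :+ q :* q :* q :* (a :* (b :* c) :* (d :* (e :* g)))) refl q δ₁ δ₂ δ₃ d e g) ⟩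
            1# + (1# + 1#) * (q * q) * D w + q * q * q * (D w * (d * (e * g))) ∎
            where
            δ₁ = δ (B e₁ w)
            δ₂ = δ (B e₂ w)
            δ₃ = δ (B e₃ w)
            d = δ (y₁ w)
            e = δ (y₂ w)
            g = δ (y₃ w)
            A₂ = 1# - δ₁ + q * (δ₁ * δ₂)
            A₃ = 1# - δ₁ + q * (δ₁ * δ₃)
            idem : A₃ * A₂ ≡ 1# - δ₁ + q * q * D w
            idem = begin
              A₃ * A₂ ≡⟨ (let open RS in solve 4 (λ q a b c → ((# 1) :- a :+ q :* (a :* c)) :* ((# 1) :- a :+ q :* (a :* b)) := (# 1) :- a :- a :+ a :* a :+ q :* (a :- a :* a) :* (b :+ c) :+ q :* q :* ((a :* a) :* (b :* c))) refl q δ₁ δ₂ δ₃) ⟩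
              1# - δ₁ - δ₁ + δ₁ * δ₁ + q * (δ₁ - δ₁ * δ₁) * (δ₂ + δ₃) + q * q * ((δ₁ * δ₁) * (δ₂ * δ₃))
                ≡⟨ cong (λ z → 1# - δ₁ - δ₁ + z + q * (δ₁ - z) * (δ₂ + δ₃) + q * q * (z * (δ₂ * δ₃))) (δ² (B e₁ w)) ⟩
              1# - δ₁ - δ₁ + δ₁ + q * (δ₁ - δ₁) * (δ₂ + δ₃) + q * q * (δ₁ * (δ₂ * δ₃))
                ≡⟨ (let open RS in solve 4 (λ q a b c → (# 1) :- a :- a :+ a :+ q :* (a :- a) :* (b :+ c) :+ q :* q :* (a :* (b :* c)) := (# 1) :- a :+ q :* q :* (a :* (b :* c))) refl q δ₁ δ₂ δ₃) ⟩
              1# - δ₁ + q * q * D w ∎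
            h : K → Carrier
            h s = δ (y₁ w +ᶠ -ᶠ (s *ᶠ y₂ w))
            inner : ∀ s → ∑F (λ r → δ (B (e₂ ⊕ s ∙ e₁) w) * δ (B (e₃ ⊕ r ∙ e₁) w) + q * (D w * δ (y₁ w +ᶠ -ᶠ (s *ᶠ y₂ w) +ᶠ -ᶠ (r *ᶠ y₃ w))))
              ≡ A₃ * δ (B (e₂ ⊕ s ∙ e₁) w) + q * (D w * (1# - g + q * (g * h s)))
            inner s = trans (∑F-lin₂ _ q (D w) _ _) (cong₂ (λ a b → a + q * (D w * b))
              (trans (cong (δ (B (e₂ ⊕ s ∙ e₁) w) *_) (trans (sum-cong elems (λ r → cong δ (B-lin e₃ r e₁ w))) (∑F-affine (B e₁ w) (B e₃ w))))
                (let open RS in solve 2 (λ x y → x :* y := y :* x) refl (δ (B (e₂ ⊕ s ∙ e₁) w)) A₃))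
              (∑F-affine⁻ (y₃ w) _))
            outer : ∑F (λ s → A₃ * δ (B (e₂ ⊕ s ∙ e₁) w) + q * (D w * (1# - g + q * (g * h s))))
              ≡ A₃ * A₂ + q * (D w * (q * (1# - g) + q * (g * (1# - e + q * (e * d)))))
            outer = trans (∑F-lin₂ A₃ q (D w) _ _) (cong₂ (λ a b → A₃ * a + q * (D w * b))
              (trans (sum-cong elems (λ s → cong δ (B-lin e₂ s e₁ w))) (∑F-affine (B e₁ w) (B e₂ w)))
              (trans (sum-+ elems _ _) (cong₂ _+_ (∑F-const _) (trans (sum-* elems q _) (cong (q *_)
                (trans (sum-* elems g h) (cong (g *_) (∑F-affine⁻ (y₂ w) (y₁ w)))))))))

        -- Used in both directions: an upper bound on all T bounds N, and a small N forces a point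
        -- with small T onto the line.
        points-on-line : T e₂ + ∑F (λ s → T (e₁ ⊕ s ∙ e₂)) ≡ X + q * N e₁ e₂ + q * q * q * v 0ⱽ
        points-on-line = by (plus (plus refl (times (q * q) pt₂)) (over (λ s → plus refl (times (q * q) (pt₁₂ s)))))
            (plus (plus X-w (times q N₁₂-w)) (times (q * q * q) pt₀)) pw
          where
          pt₂ : pt e₂ ≈⟪ (λ w → D w * (δ (y₁ w) * δ (y₃ w))) ⟫
          pt₂ = by (InPlaneOf.pt₁ (swap₁₂ p)) refl (λ w _ → cong (_* (δ (y₁ w) * δ (y₃ w)))
            (let open RS in solve 3 (λ x y z → y :* (x :* z) := x :* (y :* z)) refl (δ (B e₁ w)) (δ (B e₂ w)) (δ (B e₃ w))))
          pw : ∀ w → Sing w → _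
          pw w _ = begin
            δ₂ + q * q * (D w * (d * g)) + ∑F (λ s → δ (B (e₁ ⊕ s ∙ e₂) w) + q * q * (D w * (g * δ (y₂ w +ᶠ -ᶠ (s *ᶠ y₁ w)))))
              ≡⟨ cong (δ₂ + q * q * (D w * (d * g)) +_) (trans (sum-+ elems _ _) (cong₂ _+_
                   (trans (sum-cong elems (λ s → cong δ (B-lin e₁ s e₂ w))) (∑F-affine (B e₂ w) (B e₁ w)))
                   (trans (sum-* elems (q * q) _) (cong (q * q *_) (trans (sum-* elems (D w) _) (cong (D w *_) (trans (sum-* elems g _) (cong (g *_) (∑F-affine⁻ (y₁ w) (y₂ w)))))))))) ⟩
            δ₂ + q * q * (D w * (d * g)) + ((1# - δ₂ + q * (δ₂ * δ₁)) + q * q * (D w * (g * (1# - d + q * (d * e)))))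
              ≡⟨ (let open RS in solve 7 (λ q a b c d e g → b :+ q :* q :* (a :* (b :* c) :* (d :* g)) :+ (((# 1) :- b :+ q :* (b :* a)) :+ q :* q :* (a :* (b :* c) :* (g :* ((# 1) :- d :+ q :* (d :* e))))) := (# 1) :+ q :* (a :* b :+ q :* (a :* (b :* c) :* g)) :+ q :* q :* q :* (a :* (b :* c) :* (d :* (e :* g)))) refl q δ₁ δ₂ δ₃ d e g) ⟩
            1# + q * (δ₁ * δ₂ + q * (D w * g)) + q * q * q * (D w * (d * (e * g))) ∎
            where
            δ₁ = δ (B e₁ w)
            δ₂ = δ (B e₂ w)
            δ₃ = δ (B e₃ w)
            d = δ (y₁ w)
            e = δ (y₂ w)
            g = δ (y₃ w)

        -- A singular vector orthogonal to the line is in one of the q + 1 planes if it is off the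
        -- line and in all of them otherwise; the second kind accounts for the summand q times
        -- `line`.
        planes-on-line : ∀ {k} → Fan e₁ e₂ e₃ k → N e₁ e₂ ≡ f e₁ e₂ e₃ + ∑F (λ c → f e₁ e₂ (k c))
        planes-on-line {k} fan = by N₁₂-w (plus refl (over (λ c → refl))) pw
          where
          open Fan fan
          pw : ∀ w → Sing w → δ (B e₁ w) * δ (B e₂ w) + q * (D w * δ (y₃ w)) ≡ D w + ∑F (λ c → δ (B e₁ w) * (δ (B e₂ w) * δ (B (k c) w)))
          pw w s with B e₁ w ≟ᶠ 0ᶠ | B e₂ w ≟ᶠ 0ᶠ
          ... | no _ | d = trans (let open RS in solve 4 (λ q a b y → (# 0) :* a :+ q :* ((# 0) :* (a :* b) :* y) := (# 0) :* (a :* b) :+ (# 0)) refl q (𝟙 d) (δ (B e₃ w)) (δ (y₃ w)))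
                             (cong (0# * (𝟙 d * δ (B e₃ w)) +_) (sym (∑F-0 _ (λ c → zeroˡ refl))))
          ... | yes _ | no _ = trans (let open RS in solve 3 (λ q b y → (# 1) :* (# 0) :+ q :* ((# 1) :* ((# 0) :* b) :* y) := (# 1) :* ((# 0) :* b) :+ (# 0)) refl q (δ (B e₃ w)) (δ (y₃ w)))
                             (cong (1# * (0# * δ (B e₃ w)) +_) (sym (∑F-0 _ (λ c → zeroʳ (zeroˡ refl)))))
          ... | yes z₁ | yes z₂ with B e₃ w ≟ᶠ 0ᶠ
          ... | no n₃ = let (c₀ , r , u) = root w s z₁ z₂ n₃ in
              trans (let open RS in solve 2 (λ q y → (# 1) :* (# 1) :+ q :* ((# 1) :* ((# 1) :* (# 0)) :* y) := (# 1) :* ((# 1) :* (# 0)) :+ (# 1)) refl q (δ (y₃ w)))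
                (cong (1# * (1# * 0#) +_) (sym (trans (∑F-single c₀ _ (λ c d → zeroʳ (zeroʳ (δ-0 (λ e → d (u c e))))))
                  (trans (cong (λ x → 1# * (1# * x)) (δ-1 r)) (let open RS in solve 0 ((# 1) :* ((# 1) :* (# 1)) := (# 1)) refl)))))
          -- Now w is in the base plane, and by `kw` its product with k c is its coefficient at e₃
          -- times a nonzero factor. So either all q planes of the fan contain w or none does.
          ... | yes z₃ = trans (let open RS in solve 2 (λ q y → (# 1) :* (# 1) :+ q :* ((# 1) :* ((# 1) :* (# 1)) :* y) := (# 1) :* ((# 1) :* (# 1)) :+ q :* y) refl q (δ (y₃ w)))
                (cong (1# * (1# * 1#) +_) (sym (trans (sum-cong elems (λ c → trans (let open RS in solve 1 (λ x → (# 1) :* ((# 1) :* x) := x) refl (δ (B (k c) w))) (same c))) (∑F-const _))))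
            where
            kw : ∀ c → B (k c) w ≡ 0ᶠ +ᶠ B w f₃ *ᶠ B (k c) e₃
            kw c = trans (cong (B (k c)) (maximal p s (inPlane z₁ z₂ z₃)))
              (linʳ (linʳ-keep (linʳ-keep (B-0ʳ _) (0-sym (k₁ c))) (0-sym (k₂ c))) refl refl)
            same : ∀ c → δ (B (k c) w) ≡ δ (y₃ w)
            same c = δ-cong (λ e → cancelᶠ (λ z → k₃ c (0-sym z)) (trans (let open FS in solve 2 (λ x y → x :* y := (# 0) :+ y :* x) refl (B (k c) e₃) (B w f₃)) (trans (sym (kw c)) e)))
                            (λ e → trans (kw c) (trans (cong (λ z → 0ᶠ +ᶠ z *ᶠ B (k c) e₃) e) (let open FS in solve 1 (λ x → (# 0) :+ (# 0) :* x := (# 0)) refl (B (k c) e₃))))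

        private
          δf : ∀ u w → δ (B u w) ≡ δ (B w u)
          δf u w = δ-cong 0-sym 0-sym

        -- `quadric-count` summed against the weight. It converts information on the q² + q + 1
        -- planes of the quadric adjacent to the base plane into the weight of the whole quadric.
        adjacent-planes : f e₁ e₃ f₂ + ∑F (λ s → f e₁ (e₂ ⊕ s ∙ e₃) (f₃ ⊕ -ᶠ s ∙ f₂))
            + ∑F (λ s → ∑F (λ r → f (e₂ ⊕ s ∙ e₁) (e₃ ⊕ r ∙ e₁) (f₁ ⊕ -ᶠ s ∙ f₂ ⊕ -ᶠ r ∙ f₃)))
          ≡ ⟪ (λ w → δ (hyp p w)) ⟫ + q * f e₁ e₂ e₃ + q * q * v 0ⱽ
        adjacent-planes = by (plus (plus refl (over (λ s → refl))) (over (λ s → over (λ r → refl))))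
            (plus (plus refl (times q refl)) (times (q * q) pt₀)) pw
          where
          pw : ∀ w → Sing w → _
          pw w _ = trans (cong₂ _+_ (cong₂ _+_ (cong (λ z → δ (B e₁ w) * (δ (B e₃ w) * z)) (δf f₂ w))
                     (sum-cong elems (λ s → cong₂ (λ a b → δ (B e₁ w) * (δ a * b)) (B-lin e₂ s e₃ w) (trans (δf _ w) (cong δ (trans (B-linʳ f₃ (-ᶠ s) f₂ w)
                        (let open FS in solve 3 (λ a b s → a :+ ( :- s) :* b := a :- s :* b) refl (B w f₃) (B w f₂) s)))))))
                     (sum-cong elems (λ s → sum-cong elems (λ r → cong₂ _*_ (cong δ (B-lin e₂ s e₁ w)) (cong₂ _*_ (cong δ (B-lin e₃ r e₁ w))
                       (trans (δf _ w) (cong δ (trans (B-linʳ _ (-ᶠ r) f₃ w) (trans (cong (_+ᶠ -ᶠ r *ᶠ B w f₃) (B-linʳ f₁ (-ᶠ s) f₂ w))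
                         (let open FS in solve 5 (λ a b c s r → a :+ ( :- s) :* b :+ ( :- r) :* c := a :- s :* b :- r :* c) refl (B w f₁) (B w f₂) (B w f₃) s r)))))))))
            ) (quadric-count (B e₁ w) (B e₂ w) (B e₃ w) (y₁ w) (y₂ w) (y₃ w))

    -- One removal step: large points, thin points and grids

    module Step
      (fans : ∀ {e₁ e₂ e₃} → Plane e₁ e₂ e₃ → ∃ (Fan e₁ e₂ e₃))
      (v : V n → Carrier) (supp : ∀ w → ¬ Sing w → v w ≡ 0#) (v-0 : v 0ⱽ ≡ 0#)
      (binary : ∀ {a b c} → Plane a b c → Weight.f v supp a b c ≡ 0# ⊎ Weight.f v supp a b c ≡ 1#) where

      open Weight v supp

      f≥0 : ∀ {a b c} → Plane a b c → 0# ≤ f a b c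
      f≥0 p with binary p
      ... | inj₁ e = ≤-reflexive (sym e)
      ... | inj₂ e = ≤-trans 0≤1 (≤-reflexive (sym e))

      fan-plane : ∀ {e₁ e₂ e₃ k} → Plane e₁ e₂ e₃ → Fan e₁ e₂ e₃ k → ∀ c → Plane e₁ e₂ (k c)
      fan-plane p fan c = replace p (k-sing c) (k₁ c) (k₂ c) (k₃ c)
        where open Fan fan

      module OnLine {e₁ e₂ e₃} (p : Plane e₁ e₂ e₃) where
        k = proj₁ (fans p)
        fan = proj₂ (fans p)

        kp : ∀ c → Plane e₁ e₂ (k c)
        kp = fan-plane p fan

        f≤N : f e₁ e₂ e₃ ≤ N e₁ e₂
        f≤N = ≤-diff _ (sum≥0 elems (f≥0 ∘ kp)) (Counting.planes-on-line p fan)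

        N≥0 : 0# ≤ N e₁ e₂
        N≥0 = ≤-trans (f≥0 p) f≤N

        -- The values on the q + 1 planes are 0 or 1, although N is defined by sums of an arbitrary
        -- weight.
        N-nat : ∃ λ m → N e₁ e₂ ≡ nat m
        N-nat with count elems (λ c → f e₁ e₂ (k c)) (binary ∘ kp) | binary p
        ... | m , e | inj₁ z = m , trans (Counting.planes-on-line p fan) (trans (cong₂ _+_ z e) (let open RS in solve 1 (λ x → (# 0) :+ x := x) refl (nat m)))
        ... | m , e | inj₂ z = suc m , trans (Counting.planes-on-line p fan) (trans (cong₂ _+_ z e) (sym (RS.nat-suc m)))

        N<3 : ¬ 3# ≤ N e₁ e₂ → N e₁ e₂ ≤ 2#
        N<3 l = subst (_≤ 2#) (sym (proj₂ N-nat)) (nat<3 (proj₁ N-nat) (l ∘ subst (3# ≤_) (sym (proj₂ N-nat))))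

      open OnLine using (f≤N; N≥0; N<3)

      no-v0 : ∀ {x} c → x + c * v 0ⱽ ≡ x
      no-v0 {x} c = trans (cong (λ z → x + c * z) v-0) (let open RS in solve 2 (λ x c → x :+ c :* (# 0) := x) refl x c)

      lines-off : ∀ {e₁ e₂ e₃} → Plane e₁ e₂ e₃ → Carrier
      lines-off {e₁} {e₂} {e₃} p = ∑F (λ s → ∑F (λ r → N (e₂ ⊕ s ∙ e₁) (e₃ ⊕ r ∙ e₁)))

      off : ∀ {e₁ e₂ e₃} (p : Plane e₁ e₂ e₃) → f e₁ e₂ e₃ ≡ 0# → lines-off p + T e₁ ≡ X
      off p z = trans (Counting.lines-off-point p) (trans (no-v0 _) (trans (cong (λ y → X + 2# * (q * q) * y) z) (let open RS in solve 2 (λ X q → X :+ ((# 1) :+ (# 1)) :* (q :* q) :* (# 0) := X) refl X q)))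

      on : ∀ {e₁ e₂ e₃} (p : Plane e₁ e₂ e₃) → f e₁ e₂ e₃ ≡ 0# → N e₁ e₃ + ∑F (λ s → N e₁ (e₂ ⊕ s ∙ e₃)) ≡ T e₁
      on {e₁} p z = trans (Counting.lines-on-point p) (trans (cong (λ y → T e₁ + 2# * q * y) z) (let open RS in solve 2 (λ t q → t :+ ((# 1) :+ (# 1)) :* q :* (# 0) := t) refl (T e₁) q))

      -- For a plane outside the set, X - T is the sum of N over its lines missing e₁. This is the
      -- criterion for large points: T > X excludes every such plane on the point.
      T≤X : ∀ {e₁ e₂ e₃} (p : Plane e₁ e₂ e₃) → f e₁ e₂ e₃ ≡ 0# → T e₁ ≤ X
      T≤X {e₁} p z = ≤-diff (lines-off p) (sum≥0 elems (λ s → sum≥0 elems (λ r → N≥0 (off-point s r p))))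
        (trans (sym (off p z)) (let open RS in solve 2 (λ a b → a :+ b := b :+ a) refl (lines-off p) (T e₁)))

      N≤T⁰ : ∀ {e₁ e₂ e₃} (p : Plane e₁ e₂ e₃) → f e₁ e₂ e₃ ≡ 0# → N e₁ e₃ ≤ T e₁
      N≤T⁰ p z = ≤-diff _ (sum≥0 elems (λ s → N≥0 (on-point s p))) (sym (on p z))

      X≥0 : ∀ {e₁ e₂ e₃} (p : Plane e₁ e₂ e₃) → f e₁ e₂ e₃ ≡ 0# → 0# ≤ X
      X≥0 p z = ≤-trans (≤-trans (N≥0 (swap₂₃ p)) (N≤T⁰ p z)) (T≤X p z)

      -- the planes adjacent to a plane outside the set are on different lines of that plane
      quadric≤X : ∀ {e₁ e₂ e₃} (p : Plane e₁ e₂ e₃) → Frame p → f e₁ e₂ e₃ ≡ 0# → ⟪ (λ w → δ (hyp p w)) ⟫ ≤ X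
      quadric≤X {e₁} {e₂} {e₃} p fr z = ≤-trans (≤-reflexive (sym eq)) (≤-trans
          (+-mono (+-mono (f≤N (adjacent₁ p fr)) (sum-≤ elems (λ s _ → f≤N (adjacent₂ p fr s))))
                  (sum-≤ elems (λ s _ → sum-≤ elems (λ r _ → f≤N (adjacent₃ p fr s r)))))
          (≤-reflexive (trans (cong (_+ lines-off p) (on p z)) (trans (let open RS in solve 2 (λ a b → a :+ b := b :+ a) refl (T e₁) (lines-off p)) (off p z)))))
        where
        open Plane p
        Y = ⟪ (λ w → δ (hyp p w)) ⟫
        eq : f e₁ e₃ f₂ + ∑F (λ s → f e₁ (e₂ ⊕ s ∙ e₃) (f₃ ⊕ -ᶠ s ∙ f₂))
            + ∑F (λ s → ∑F (λ r → f (e₂ ⊕ s ∙ e₁) (e₃ ⊕ r ∙ e₁) (f₁ ⊕ -ᶠ s ∙ f₂ ⊕ -ᶠ r ∙ f₃))) ≡ Y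
        eq = trans (Counting.adjacent-planes p) (trans (no-v0 _) (trans (cong (λ y → Y + q * y) z) (let open RS in solve 2 (λ y q → y :+ q :* (# 0) := y) refl Y q)))

      module Small (X<q : ¬ q ≤ X) (T≤ : ∀ {e} → Sing e → e ≢ 0ⱽ → T e ≤ X) where

        T≤₁ : ∀ {e₁ e₂ e₃} → Plane e₁ e₂ e₃ → T e₁ ≤ X
        T≤₁ p = T≤ (Plane.s₁ p) (nonzero (Plane.d₁₁ p))

        points : ∀ {e₁ e₂ e₃} (p : Plane e₁ e₂ e₃) → T e₂ + ∑F (λ s → T (e₁ ⊕ s ∙ e₂)) ≡ X + q * N e₁ e₂
        points p = trans (Counting.points-on-line p) (no-v0 _)

        on-line : ∀ {e₁ e₂ e₃} s → Plane e₁ e₂ e₃ → Plane (e₁ ⊕ s ∙ e₂) e₂ e₃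
        on-line s p = swap₁₃ (add₃₂ s (swap₁₃ p))

        -- The q + 1 values T on the line are at most X each and add up to X + q N.
        N≤X : ∀ {e₁ e₂ e₃} → Plane e₁ e₂ e₃ → N e₁ e₂ ≤ X
        N≤X {e₁} {e₂} p = cancel-≤ q≰0 (+-cancel X (≤-trans (≤-reflexive (trans (let open RS in solve 3 (λ q X m → q :* m :+ X := X :+ q :* m) refl q X (N e₁ e₂)) (sym (points p))))
          (≤-trans (+-mono (T≤₁ (swap₁₂ p)) (sum-≤ elems (λ s _ → T≤₁ (on-line s p))))
            (≤-reflexive (trans (cong (X +_) (∑F-const X)) (let open RS in solve 2 (λ q X → X :+ q :* X := q :* X :+ X) refl q X))))))

        -- Otherwise N = q + 1, while N ≤ X < q. The inequalities that hold for planes outside the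
        -- set thereby become available on every line.
        plane-off : ∀ {e₁ e₂ e₃} → Plane e₁ e₂ e₃ → ∃ λ g → Plane e₁ e₂ g × f e₁ e₂ g ≡ 0#
        plane-off {e₁} {e₂} {e₃} p with binary p
        ... | inj₁ z = e₃ , p , z
        ... | inj₂ o with searchF {λ c → f e₁ e₂ (OnLine.k p c) ≡ 0#} (λ c → dec (binary (OnLine.kp p c)))
          where
          dec : ∀ {x} → x ≡ 0# ⊎ x ≡ 1# → Dec (x ≡ 0#)
          dec (inj₁ e) = yes e
          dec (inj₂ e) = no (λ z → 0≢1 (trans (sym z) e))
        ... | inj₁ (c , z) = _ , OnLine.kp p c , z
        ... | inj₂ none = ⊥-elim (X<q (≤-trans (≤-diff 1# 0≤1 (trans full (let open RS in solve 1 (λ q → (# 1) :+ q := q :+ (# 1)) refl q))) (N≤X p)))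
          where
          one : ∀ c → f e₁ e₂ (OnLine.k p c) ≡ 1#
          one c with binary (OnLine.kp p c)
          ... | inj₁ z = ⊥-elim (none c z)
          ... | inj₂ e = e
          full : N e₁ e₂ ≡ 1# + q
          full = trans (Counting.planes-on-line p (OnLine.fan p)) (cong₂ _+_ o (trans (sum-cong elems one) (trans (∑F-const 1#) (let open RS in solve 1 (λ q → q :* (# 1) := q) refl q))))

        N≤T : ∀ {e₁ e₂ e₃} → Plane e₁ e₂ e₃ → N e₁ e₂ ≤ T e₁
        N≤T p = let (g , p' , z) = plane-off p in N≤T⁰ (swap₂₃ p') (trans (sym (f-swap₂₃ _ _ _)) z)

        on¹ : ∀ {e₁ e₂ e₃} (p : Plane e₁ e₂ e₃) → f e₁ e₂ e₃ ≡ 1# → N e₁ e₃ + ∑F (λ s → N e₁ (e₂ ⊕ s ∙ e₃)) ≡ T e₁ + 2# * q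
        on¹ {e₁} p z = trans (Counting.lines-on-point p) (trans (cong (λ y → T e₁ + 2# * q * y) z) (let open RS in solve 2 (λ t q → t :+ ((# 1) :+ (# 1)) :* q :* (# 1) := t :+ ((# 1) :+ (# 1)) :* q) refl (T e₁) q))

        -- The q + 1 lines of the plane on e₁ carry T + 2q in total and at most T each.
        2≤T : ∀ {e₁ e₂ e₃} (p : Plane e₁ e₂ e₃) → f e₁ e₂ e₃ ≡ 1# → 2# ≤ T e₁
        2≤T {e₁} p z = cancel-≤ q≰0 (+-cancel (T e₁) (≤-trans (≤-reflexive (trans (let open RS in solve 2 (λ q t → q :* ((# 1) :+ (# 1)) :+ t := t :+ ((# 1) :+ (# 1)) :* q) refl q (T e₁)) (sym (on¹ p z))))
          (≤-trans (+-mono (N≤T (swap₂₃ p)) (sum-≤ elems (λ s _ → N≤T (on-point s p))))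
            (≤-reflexive (trans (cong (T e₁ +_) (∑F-const (T e₁))) (let open RS in solve 2 (λ q t → t :+ q :* t := q :* t :+ t) refl q (T e₁)))))))

        Thin : V n → Set
        Thin e = ¬ 3# ≤ T e

        thin-N≤2 : ∀ {e₁ e₂ e₃} (p : Plane e₁ e₂ e₃) → Thin e₁ → N e₁ e₂ ≤ 2#
        thin-N≤2 p th = N<3 p (λ l → th (≤-trans l (N≤T p)))

        -- Each N on e₁ is a natural number bounded by T < 3, hence at most 2, whereas the q + 1 of
        -- them add up to T + 2q, at least 2(q + 1). So there is equality everywhere.
        thin-N : ∀ {e₁ e₂ e₃} (p : Plane e₁ e₂ e₃) → f e₁ e₂ e₃ ≡ 1# → Thin e₁ → N e₁ e₃ ≡ 2#
        thin-N {e₁} {e₂} {e₃} p o th = ≤-antisym (thin-N≤2 (swap₂₃ p) th)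
          (+-cancel (2# * q) (≤-trans (+-mono (2≤T p o) ≤-refl) (≤-trans (≤-reflexive (sym (on¹ p o)))
            (+-mono ≤-refl (≤-trans (sum-≤ elems (λ s _ → thin-N≤2 (on-point s p) th)) (≤-reflexive (trans (∑F-const 2#) (let open RS in solve 1 (λ q → q :* ((# 1) :+ (# 1)) := ((# 1) :+ (# 1)) :* q) refl q))))))))

        X+2q<3q : ∀ {x y} → x ≤ X + 2# * q → 0# ≤ y → ¬ q * 3# ≤ x - y
        X+2q<3q {x} {y} l y≥0 m = X<q (+-cancel (2# * q) (≤-trans (≤-reflexive (let open RS in solve 1 (λ q → q :+ ((# 1) :+ (# 1)) :* q := q :* ((# 1) :+ (# 1) :+ (# 1))) refl q))
          (≤-trans m (≤-trans (≤-diff y y≥0 (let open RS in solve 2 (λ x y → x := x :- y :+ y) refl x y)) l))))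

        -- Here X < q yields the constant 3: a total of at most X + 2q is less than 3q, so one of
        -- the q terms of the sum is less than 3.
        pigeon₃ : ∀ {x y} (g : K → Carrier) → y + ∑F g ≡ x → x ≤ X + 2# * q → 0# ≤ y → ∃ λ s → ¬ 3# ≤ g s
        pigeon₃ {x} {y} g e l y≥0 = proj₁ hole , proj₂ (proj₂ hole)
          where
          hole : ∃ λ s → _ × ¬ 3# ≤ g s
          hole = pigeon elems g 3# (λ m → X+2q<3q l y≥0 (≤-trans m (≤-reflexive
            (trans (let open RS in solve 2 (λ y s → s := y :+ s :- y) refl y (∑F g)) (cong (_- y) e)))))

        T≥0 : ∀ {e₁ e₂ e₃} → Plane e₁ e₂ e₃ → 0# ≤ T e₁
        T≥0 p = ≤-trans (N≥0 p) (N≤T p)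

        thin-point : ∀ {e₁ e₂ e₃} (p : Plane e₁ e₂ e₃) → N e₁ e₂ ≤ 2# → ∃ λ s → Thin (e₁ ⊕ s ∙ e₂)
        thin-point p l = pigeon₃ _ (points p) (+-mono ≤-refl (≤-trans (*-monoˡ 0≤q l) (≤-reflexive (let open RS in solve 1 (λ q → q :* ((# 1) :+ (# 1)) := ((# 1) :+ (# 1)) :* q) refl q)))) (T≥0 (swap₁₂ p))

        -- On e₁ the values N add up to T + 2q ≤ X + 2q, so some line has N ≤ 2. On that line the
        -- values T add up to at most X + 2q, so some point is thin; every line on a thin point has
        -- N ≤ 2 again. Keeping e₃ as third vector leaves the plane unchanged.
        two-thin : ∀ {e₁ e₂ e₃} → Plane e₁ e₂ e₃ → f e₁ e₂ e₃ ≡ 1# →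
          ∃₂ λ a b → Plane a b e₃ × f a b e₃ ≡ 1# × Thin a × Thin b
        two-thin {e₁} {e₂} {e₃} p o = a , b , p₃ , o₃ , thin-a , thin-b
          where
          line₁ = pigeon₃ (λ s → N e₁ (e₂ ⊕ s ∙ e₃)) (on¹ p o) (+-mono (T≤₁ p) ≤-refl) (N≥0 (swap₂₃ p))
          s = proj₁ line₁
          c = e₂ ⊕ s ∙ e₃
          p₁ : Plane e₁ c e₃
          p₁ = on-point s p
          o₁ : f e₁ c e₃ ≡ 1#
          o₁ = trans (f-swap₂₃ _ _ _) (trans (f-add₃₂ e₁ e₃ e₂ s) (trans (f-swap₂₃ _ _ _) o))
          pt₁ = thin-point p₁ (N<3 p₁ (proj₂ line₁))
          a = e₁ ⊕ proj₁ pt₁ ∙ c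
          thin-a = proj₂ pt₁
          p₂ : Plane a c e₃
          p₂ = on-line (proj₁ pt₁) p₁
          13-swap : ∀ x y z → f x y z ≡ f z y x
          13-swap x y z = trans (f-swap₁₂ x y z) (trans (f-swap₂₃ y x z) (f-swap₁₂ y z x))
          o₂ : f a c e₃ ≡ 1#
          o₂ = trans (13-swap _ _ _) (trans (f-add₃₂ e₃ c e₁ (proj₁ pt₁)) (trans (13-swap _ _ _) o₁))
          -- With the two vectors swapped, the search runs over the points c + s a, which are all
          -- different from a.
          pt₂ = thin-point (swap₁₂ p₂) (≤-trans (≤-reflexive (N-swap c a)) (thin-N≤2 p₂ thin-a))
          b = c ⊕ proj₁ pt₂ ∙ a
          thin-b = proj₂ pt₂
          p₃ : Plane a b e₃
          p₃ = swap₁₂ (on-line (proj₁ pt₂) (swap₁₂ p₂))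
          o₃ : f a b e₃ ≡ 1#
          o₃ = trans (f-swap₂₃ _ _ _) (trans (f-swap₁₂ _ _ _) (trans (f-add₃₂ e₃ a c (proj₁ pt₂)) (trans (f-swap₁₂ _ _ _) (trans (f-swap₂₃ _ _ _) o₂))))

        f-scale : ∀ a b c i → i ≢ 0ᶠ → f a b (0ⱽ ⊕ i ∙ c) ≡ f a b c
        f-scale a b c i i≢0 = sum-cong (vecs n) (λ w → cong (λ z → δ (B a w) * (δ (B b w) * z) * v w)
          (δ-cong (λ e → cancelᶠ i≢0 (trans (sym (iw w)) e)) (λ e → trans (iw w) (trans (cong (i *ᶠ_) e) (let open FS in solve 1 (λ i → i :* (# 0) := (# 0)) refl i)))))
          where
          iw : ∀ w → B (0ⱽ ⊕ i ∙ c) w ≡ i *ᶠ B c w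
          iw w = linˡ (B-0 w) refl (let open FS in solve 2 (λ i x → (# 0) :+ i :* x := i :* x) refl i (B c w))

        -- N = 2 leaves exactly one further plane of the set on the line. It is normalised to B e₃ g
        -- = 1, so that g can serve as a dual vector.
        second-plane : ∀ {e₁ e₂ e₃} (p : Plane e₁ e₂ e₃) → f e₁ e₂ e₃ ≡ 1# → Thin e₁ →
          ∃ λ g → Sing g × B e₁ g ≡ 0ᶠ × B e₂ g ≡ 0ᶠ × B e₃ g ≡ 1ᶠ × f e₁ e₂ g ≡ 1#
        second-plane {e₁} {e₂} {e₃} p o th with searchF {λ c → f e₁ e₂ (OnLine.k p c) ≡ 1#} (λ c → dec (binary (OnLine.kp p c)))
          where
          dec : ∀ {x} → x ≡ 0# ⊎ x ≡ 1# → Dec (x ≡ 1#)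
          dec (inj₂ e) = yes e
          dec (inj₁ e) = no (λ z → 0≢1 (trans (sym e) z))
        ... | inj₁ (c , e) = 0ⱽ ⊕ i ∙ k c , Sing-⊕ Sing-0 (k-sing c) (B-0 _) , linʳ-keep (B-0ʳ _) (k₁ c) , linʳ-keep (B-0ʳ _) (k₂ c)
            , trans (linʳ (B-0ʳ _) refl (let open FS in solve 2 (λ i x → (# 0) :+ i :* x := x :* i) refl i (B e₃ (k c)))) (inverseᶠ _ (k₃ c))
            , trans (f-scale _ _ _ i i≢0) e
          where
          open OnLine p using (k; fan)
          open Fan fan
          i = (B e₃ (k c)) ⁻¹ᶠ
          i≢0 : i ≢ 0ᶠ
          i≢0 z = 0≢1ᶠ (trans (trans (let open FS in solve 1 (λ x → (# 0) := x :* (# 0)) refl (B e₃ (k c))) (cong (B e₃ (k c) *ᶠ_) (sym z))) (inverseᶠ _ (k₃ c)))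
        ... | inj₂ none = ⊥-elim (1≰0 (+-cancel 1# (≤-reflexive (begin
            2#            ≡⟨ thin-N (swap₂₃ p) (trans (sym (f-swap₂₃ _ _ _)) o) th ⟨
            N e₁ e₂       ≡⟨ Counting.planes-on-line p (OnLine.fan p) ⟩
            f e₁ e₂ e₃ + ∑F (λ c → f e₁ e₂ (OnLine.k p c)) ≡⟨ cong₂ _+_ o (∑F-0 _ zero') ⟩
            1# + 0#       ≡⟨ (let open RS in solve 0 ((# 1) :+ (# 0) := (# 0) :+ (# 1)) refl) ⟩
            0# + 1#       ∎))))
          where
          zero' : ∀ c → f e₁ e₂ (OnLine.k p c) ≡ 0#
          zero' c with binary (OnLine.kp p c)
          ... | inj₁ z = z
          ... | inj₂ e = ⊥-elim (none c e)

        -- otherwise the lines ⟨e, a⟩ and ⟨e, b⟩ alone give T e ≥ 4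
        transversal : ∀ {e a b} → Plane e a b → Thin e → N e a ≡ 2# → N e b ≡ 2# → f e a b ≡ 1#
        transversal {e} {a} {b} p th na nb with binary p
        ... | inj₂ o = o
        ... | inj₁ z = ⊥-elim (th (≤-trans (≤-diff 1# 0≤1 (let open RS in solve 0 ((# 1) :+ (# 1) :+ ((# 1) :+ (# 1)) := (# 1) :+ (# 1) :+ (# 1) :+ (# 1)) refl))
              (≤-trans (+-mono (≤-reflexive (sym nb)) (≤-trans (≤-reflexive (sym (trans (cong (N e) (vsolve ((v# 0) ⊞ 0ᶠ ⊠ (v# 1)) (v# 0) (a ∷ b ∷ []) (λ { (aᶜ ∷ bᶜ ∷ []) → (let open FS in solve 2 (λ a b → a :+ (# 0) :* b := a) refl aᶜ bᶜ) }))) na)))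
                (term≤sum elems {λ s → N e (a ⊕ s ∙ b)} (λ s → N≥0 (on-point s p)) (elems-complete 0ᶠ)))) (≤-reflexive (on p z)))))

        -- In the residue of e₁, a generalized quadrangle, the planes ⟨e₁, e₂, e₃⟩ and ⟨e₁, f₂, f₃⟩
        -- are opposite lines; in the residue of e₂ the same holds for ⟨e₂, e₃, e₁⟩ and ⟨e₂, f₃,
        -- f₁⟩. These data determine the quadric.
        record Grid {e₁ e₂ e₃} (p : Plane e₁ e₂ e₃) : Set where
          open Plane p
          field
            frame : Frame p
            thin₁ : Thin e₁
            thin₂ : Thin e₂
            o₁₂₃ : f e₁ e₂ e₃ ≡ 1#
            o₁ : f e₁ f₂ f₃ ≡ 1#
            o₂ : f e₂ f₃ f₁ ≡ 1#

        -- All points of the two opposite lines in the residue of e₁ have N = 2. By `transversal`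
        -- the q + 1 lines joining them are in the set; they are the planes adjacent to the base
        -- plane along its lines through e₁.
        module Transversals {e₁ e₂ e₃} (p : Plane e₁ e₂ e₃) (fr : Frame p) (th : Thin e₁) (o : f e₁ e₂ e₃ ≡ 1#)
          (o' : f e₁ (Plane.f₂ p) (Plane.f₃ p) ≡ 1#) where
          open Plane p
          open Frame fr

          opposite : Plane e₁ f₂ f₃
          opposite = replace (swap₂₃ (adjacent₁ p fr)) t₃ d₁₃ g₂₃ (1≢0ᶠ d₃₃)

          N-e₂e₃ : ∀ s → N e₁ (e₂ ⊕ s ∙ e₃) ≡ 2#
          N-e₂e₃ s = thin-N (add₃₂ s (swap₂₃ p)) (trans (f-add₃₂ _ _ _ s) (trans (sym (f-swap₂₃ _ _ _)) o)) th

          N-f₃f₂ : ∀ s → N e₁ (f₃ ⊕ s ∙ f₂) ≡ 2#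
          N-f₃f₂ s = thin-N (add₃₂ s opposite) (trans (f-add₃₂ _ _ _ s) o') th

          one₁ : f e₁ e₃ f₂ ≡ 1#
          one₁ = transversal (adjacent₁ p fr) th (thin-N p o th) (thin-N (swap₂₃ opposite) (trans (sym (f-swap₂₃ _ _ _)) o') th)

          one₂ : ∀ s → f e₁ (e₂ ⊕ s ∙ e₃) (f₃ ⊕ -ᶠ s ∙ f₂) ≡ 1#
          one₂ s = transversal (adjacent₂ p fr s) th (N-e₂e₃ s) (N-f₃f₂ (-ᶠ s))

        quadric>q : ∀ {e₁ e₂ e₃} (p : Plane e₁ e₂ e₃) → Grid p → q ≤ ⟪ (λ w → δ (hyp p w)) ⟫
        quadric>q {e₁} {e₂} {e₃} p gr = +-cancel q (≤-trans (≤-trans (≤-diff 1# 0≤1 (let open RS in solve 1 (λ q → (# 1) :+ q :+ q := q :+ q :+ (# 1)) refl q))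
            (+-mono (≤-reflexive (sym first)) (≤-trans (≤-reflexive (sym third)) (term≤sum elems {λ s → ∑F (ρ s)} (λ s → sum≥0 elems (λ r → f≥0 (adjacent₃ p frame s r))) (elems-complete 0ᶠ)))))
            (≤-reflexive (trans (Counting.adjacent-planes p) (trans (no-v0 _) (trans (cong (λ y → ⟪ (λ w → δ (hyp p w)) ⟫ + q * y) o₁₂₃) (let open RS in solve 2 (λ x q → x :+ q :* (# 1) := x :+ q) refl (⟪ (λ w → δ (hyp p w)) ⟫) q))))))
          where
          open Grid gr
          open Plane p
          module T₁ = Transversals p frame thin₁ o₁₂₃ o₁
          module T₂ = Transversals (rot p) (rot-frame frame) thin₂ (trans (f-swap₂₃ _ _ _) (trans (f-swap₁₂ _ _ _) (trans (f-swap₂₃ _ _ _) (trans (f-swap₂₃ _ _ _) o₁₂₃)))) o₂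
          ρ : K → K → Carrier
          ρ s r = f (e₂ ⊕ s ∙ e₁) (e₃ ⊕ r ∙ e₁) (f₁ ⊕ -ᶠ s ∙ f₂ ⊕ -ᶠ r ∙ f₃)
          first : f e₁ e₃ f₂ + ∑F (λ s → f e₁ (e₂ ⊕ s ∙ e₃) (f₃ ⊕ -ᶠ s ∙ f₂)) ≡ 1# + q
          first = cong₂ _+_ T₁.one₁ (trans (sum-cong elems T₁.one₂) (trans (∑F-const 1#) (let open RS in solve 1 (λ q → q :* (# 1) := q) refl q)))
          -- The row s = 0 consists of the adjacent planes on e₂ whose line in the base plane misses
          -- e₁, so none of them is counted in `first`. After the term q for the base plane is taken
          -- off, q + 1 remains.
          third : ∑F (ρ 0ᶠ) ≡ q
          third = trans (sum-cong elems (λ r → trans (cong₂ (λ a b → f a (e₃ ⊕ r ∙ e₁) (b ⊕ -ᶠ r ∙ f₃)) (vsolve ((v# 0) ⊞ 0ᶠ ⊠ (v# 1)) (v# 0) (e₂ ∷ e₁ ∷ []) (λ { (e₂ᶜ ∷ e₁ᶜ ∷ []) → (let open FS in solve 2 (λ e₂ e₁ → e₂ :+ (# 0) :* e₁ := e₂) refl e₂ᶜ e₁ᶜ) }))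
            (vsolve ((v# 0) ⊞ (-ᶠ 0ᶠ) ⊠ (v# 1)) (v# 0) (f₁ ∷ f₂ ∷ []) (λ { (f₁ᶜ ∷ f₂ᶜ ∷ []) → (let open FS in solve 2 (λ f₁ f₂ → f₁ :+ ( :- (# 0)) :* f₂ := f₁) refl f₁ᶜ f₂ᶜ) }))) (T₂.one₂ r))) (trans (∑F-const 1#) (let open RS in solve 1 (λ q → q :* (# 1) := q) refl q))

        quadric⊆ : ∀ {e₁ e₂ e₃} (p : Plane e₁ e₂ e₃) → Grid p → ∀ {a b c} (τ : Plane a b c) → Frame τ →
          (∀ w → Sing w → hyp τ w ≡ 0ᶠ → hyp p w ≡ 0ᶠ) → (∀ w → Sing w → hyp p w ≡ 0ᶠ → hyp τ w ≡ 0ᶠ) → f a b c ≡ 1#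
        quadric⊆ p gr τ fr h₁ h₂ with binary τ
        ... | inj₂ o = o
        ... | inj₁ z = ⊥-elim (X<q (≤-trans (quadric>q p gr) (≤-trans (≤-reflexive (Weight.by v supp refl refl (λ w s → δ-cong (h₂ w s) (h₁ w s)))) (quadric≤X τ fr z))))

        -- Multiples of g₃ make g₁ and g₂ orthogonal to e₃, and a multiple of b makes them
        -- orthogonal to each other. The planes ⟨a, g₃, g₂⟩ and ⟨b, g₃, g₁⟩ stay the same, hence
        -- stay in the set.
        complete-grid : ∀ {a b e₃ g₁ g₂ g₃} (p : Plane a b e₃) → f a b e₃ ≡ 1# → Thin a → Thin b →
          Sing g₃ → B a g₃ ≡ 0ᶠ → B b g₃ ≡ 0ᶠ → B e₃ g₃ ≡ 1ᶠ →
          Sing g₂ → B a g₂ ≡ 0ᶠ → B g₃ g₂ ≡ 0ᶠ → B b g₂ ≡ 1ᶠ → f a g₃ g₂ ≡ 1# →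
          Sing g₁ → B b g₁ ≡ 0ᶠ → B g₃ g₁ ≡ 0ᶠ → B a g₁ ≡ 1ᶠ → f b g₃ g₁ ≡ 1# → Σ (Plane a b e₃) Grid
        complete-grid {a} {b} {e₃} {g₁} {g₂} {g₃} p o tha thb s₃ a3 b3 c3 s₂ a2 h32 b2 o13 s₁ b1 h31 a1 o23 = p' , record
            { frame = record { t₁ = Sing-⊕ (Sing-⊕ s₁ s₃ (0-sym h31)) (Plane.s₂ p) (linˡ-keep (0-sym b1) (0-sym b3)) ; t₂ = Sing-⊕ s₂ s₃ (0-sym h32) ; t₃ = s₃
                             ; g₁₂ = linˡ (linˡ-keep {z = g₂ ⊕ β ∙ g₃} refl (linʳ-keep h32 (B-self s₃))) (linʳ-keep b2 b3) (let open FS in solve 1 (λ x → x :+ ( :- x) :* (# 1) := (# 0)) refl (B g₁ (g₂ ⊕ β ∙ g₃)))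
                             ; g₁₃ = linˡ-keep (linˡ-keep (0-sym h31) (B-self s₃)) b3
                             ; g₂₃ = linˡ-keep (0-sym h32) (B-self s₃) }
            ; thin₁ = tha ; thin₂ = thb ; o₁₂₃ = o
            ; o₁ = trans (f-swap₂₃ _ _ _) (trans (f-add₃₂ a g₃ g₂ β) o13)
            ; o₂ = trans (f-add₃₁ b g₃ (g₁ ⊕ γ ∙ g₃) κ) (trans (f-add₃₂ b g₃ g₁ γ) o23) }
          where
          β γ κ : K
          β = -ᶠ B e₃ g₂
          γ = -ᶠ B e₃ g₁
          κ = -ᶠ B g₁ (g₂ ⊕ β ∙ g₃)
          p' : Plane a b e₃
          p' = record
            { s₁ = Plane.s₁ p ; s₂ = Plane.s₂ p ; s₃ = Plane.s₃ p ; p₁₂ = Plane.p₁₂ p ; p₁₃ = Plane.p₁₃ p ; p₂₃ = Plane.p₂₃ p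
            ; f₁ = g₁ ⊕ γ ∙ g₃ ⊕ κ ∙ b ; f₂ = g₂ ⊕ β ∙ g₃ ; f₃ = g₃
            ; d₁₁ = linʳ-keep (linʳ-keep a1 a3) (Plane.p₁₂ p) ; d₁₂ = linʳ-keep a2 a3 ; d₁₃ = a3
            ; d₂₁ = linʳ-keep (linʳ-keep b1 b3) (B-self (Plane.s₂ p)) ; d₂₂ = linʳ-keep b2 b3 ; d₂₃ = b3
            ; d₃₁ = linʳ-keep (linʳ refl c3 (let open FS in solve 1 (λ x → x :+ ( :- x) :* (# 1) := (# 0)) refl (B e₃ g₁))) (0-sym (Plane.p₂₃ p))
            ; d₃₂ = linʳ refl c3 (let open FS in solve 1 (λ x → x :+ ( :- x) :* (# 1) := (# 0)) refl (B e₃ g₂)) ; d₃₃ = c3 }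

        -- From the plane on the thin points a and b one crosses the line ⟨a, b⟩ to a second plane
        -- of the set, and from there the lines ⟨a, g₃⟩ and ⟨b, g₃⟩ to two more.
        grid : ∀ {e₁ e₂ e₃} → Plane e₁ e₂ e₃ → f e₁ e₂ e₃ ≡ 1# → ∃₂ λ a b → Σ (Plane a b e₃) Grid
        grid {e₁} {e₂} {e₃} p₀ o₀ =
          let (a , b , p , o , tha , thb) = two-thin p₀ o₀
              (g₃ , s₃ , a3 , b3 , c3 , o₁₂) = second-plane p o tha
              ρ = replace p s₃ a3 b3 (1≢0ᶠ c3)
              (g₂ , s₂ , a2 , h32 , b2 , o13) = second-plane (swap₂₃ ρ) (trans (sym (f-swap₂₃ a b g₃)) o₁₂) tha
              (g₁ , s₁ , b1 , h31 , a1 , o23) = second-plane (swap₂₃ (swap₁₂ ρ)) (trans (f-swap₂₃ b g₃ a) (trans (f-swap₁₂ b a g₃) o₁₂)) thb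
          in a , b , complete-grid p o tha thb s₃ a3 b3 c3 s₂ a2 h32 b2 o13 s₁ b1 h31 a1 o23

        -- In a symplectic space of odd characteristic a third plane of the set
        -- contains the line ⟨e₁, e₂ − e₃⟩.
        no-grid : ∀ {e₁ e₂ e₃} (p : Plane e₁ e₂ e₃) → Grid p → ε ≡ -ᶠ 1ᶠ → 1ᶠ +ᶠ 1ᶠ ≢ 0ᶠ →
          (∀ {a b c u} → Plane a b c → Sing u → B a u ≡ 0ᶠ → B b u ≡ 0ᶠ → B c u ≢ 0ᶠ → Fan a b c (λ s → u ⊕ s ∙ c)) → ⊥
        no-grid {e₁} {e₂} {e₃} p gr ε≡-1 2≢0 mkfan = 1≰0 (+-cancel 2# (≤-trans
            (≤-trans (≤-reflexive (let open RS in solve 0 ((# 1) :+ ((# 1) :+ (# 1)) := (# 1) :+ ((# 1) :+ (# 1))) refl)) (+-mono (≤-reflexive (sym oπ)) (≤-trans (+-mono (≤-reflexive (sym o0)) (≤-reflexive (sym o2)))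
              (two elems (λ c → f e₁ a (u ⊕ c ∙ e₃)) (λ c → f≥0 (fan-plane π fan c)) elems-unique (elems-complete 0ᶠ) (elems-complete (1ᶠ +ᶠ 1ᶠ)) (2≢0 ∘ sym)))))
            (≤-reflexive (trans (sym (Counting.planes-on-line π fan)) (trans (T₁.N-e₂e₃ s) (let open RS in solve 0 ((# 1) :+ (# 1) := (# 0) :+ ((# 1) :+ (# 1))) refl))))))
          where
          open Grid gr
          open Plane p
          open Frame frame
          module T₁ = Transversals p frame thin₁ o₁₂₃ o₁
          s = -ᶠ 1ᶠ
          a = e₂ ⊕ s ∙ e₃
          u = f₃ ⊕ -ᶠ s ∙ f₂
          π : Plane e₁ a e₃
          π = on-point s p
          oπ : f e₁ a e₃ ≡ 1#
          oπ = trans (f-swap₂₃ _ _ _) (trans (f-add₃₂ e₁ e₃ e₂ s) (trans (f-swap₂₃ _ _ _) o₁₂₃))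
          au : B a u ≡ 0ᶠ
          au = Plane.p₂₃ (adjacent₂ p frame s)
          fan : Fan e₁ a e₃ (λ c → u ⊕ c ∙ e₃)
          fan = mkfan π (Plane.s₃ (adjacent₂ p frame s)) (Plane.p₁₃ (adjacent₂ p frame s)) au (1≢0ᶠ (linʳ-keep d₃₃ d₃₂))
          o0 : f e₁ a (u ⊕ 0ᶠ ∙ e₃) ≡ 1#
          o0 = trans (cong (f e₁ a) (vsolve ((v# 0) ⊞ 0ᶠ ⊠ (v# 1)) (v# 0) (u ∷ e₃ ∷ []) (λ { (uᶜ ∷ e₃ᶜ ∷ []) → (let open FS in solve 2 (λ u e₃ → u :+ (# 0) :* e₃ := u) refl uᶜ e₃ᶜ) }))) (T₁.one₂ s)
          fe : ∀ {x y c} → B y x ≡ c → B x y ≡ -ᶠ c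
          fe {x} {y} {c} e = trans (B-sym y x) (trans (cong₂ _*ᶠ_ ε≡-1 e) (let open FS in solve 1 (λ c → ( :- (# 1)) :* c := :- c) refl c))
          ρ : Plane e₁ e₂ f₃
          ρ = replace p t₃ d₁₃ d₂₃ (1≢0ᶠ d₃₃)
          oρ : f e₁ e₂ f₃ ≡ 1#
          oρ = transversal ρ thin₁ (thin-N (swap₂₃ p) (trans (sym (f-swap₂₃ e₁ e₂ e₃)) o₁₂₃) thin₁) (thin-N T₁.opposite o₁ thin₁)
          -- The vectors x and y are on the transversals ⟨e₂, f₃⟩ and ⟨e₃, f₂⟩. Their product is B
          -- f₃ e₃ + B e₂ f₂ = -1 + 1 by skew symmetry, so ⟨e₁, x, y⟩ is a plane, and it is in the
          -- set by `transversal`.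
          x = f₃ ⊕ 1ᶠ ∙ e₂
          y = f₂ ⊕ 1ᶠ ∙ e₃
          xy : B x y ≡ 0ᶠ
          xy = linˡ (linʳ (0-sym g₂₃) (fe d₃₃) refl) (linʳ d₂₂ p₂₃ refl) (let open FS in solve 0 ((# 0) :+ (# 1) :* ( :- (# 1)) :+ (# 1) :* ((# 1) :+ (# 1) :* (# 0)) := (# 0)) refl)
          χ : Plane e₁ x y
          χ = replace (swap₂₃ (on-point' ρ)) (Sing-⊕ t₂ (Plane.s₃ p) (0-sym d₃₂)) (linʳ-keep d₁₂ p₁₃) xy (1≢0ᶠ (linʳ-keep d₂₂ p₂₃))
            where
            on-point' : Plane e₁ e₂ f₃ → Plane e₁ e₂ (f₃ ⊕ 1ᶠ ∙ e₂)
            on-point' = add₃₂ 1ᶠ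
          oχ : f e₁ x y ≡ 1#
          oχ = transversal χ thin₁ (thin-N (add₃₂ 1ᶠ ρ) (trans (f-add₃₂ _ _ _ 1ᶠ) oρ) thin₁)
                 (thin-N (add₃₂ 1ᶠ (adjacent₁ p frame)) (trans (f-add₃₂ _ _ _ 1ᶠ) T₁.one₁) thin₁)
          z = y ⊕ 1ᶠ ∙ x
          Nz : N e₁ z ≡ 2#
          Nz = thin-N (add₃₂ 1ᶠ χ) (trans (f-add₃₂ _ _ _ 1ᶠ) oχ) thin₁
          -- Identifies ⟨e₁, a, z⟩ as the member with parameter 2 of the fan on ⟨e₁, a⟩. The member
          -- 0 and the base plane are in the set too, and 2 ≠ 0 separates the two members.
          z-eq : z ⊕ -ᶠ 1ᶠ ∙ a ≡ u ⊕ 1ᶠ +ᶠ 1ᶠ ∙ e₃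
          z-eq = (vsolve ((((v# 0) ⊞ 1ᶠ ⊠ (v# 1)) ⊞ 1ᶠ ⊠ ((v# 2) ⊞ 1ᶠ ⊠ (v# 3))) ⊞ (-ᶠ 1ᶠ) ⊠ ((v# 3) ⊞ (-ᶠ 1ᶠ) ⊠ (v# 1))) (((v# 2) ⊞ (-ᶠ (-ᶠ 1ᶠ)) ⊠ (v# 0)) ⊞ (1ᶠ +ᶠ 1ᶠ) ⊠ (v# 1)) (f₂ ∷ e₃ ∷ f₃ ∷ e₂ ∷ []) (λ { (f₂ᶜ ∷ e₃ᶜ ∷ f₃ᶜ ∷ e₂ᶜ ∷ []) → (let open FS in solve 4 (λ f₂ e₃ f₃ e₂ → f₂ :+ (# 1) :* e₃ :+ (# 1) :* (f₃ :+ (# 1) :* e₂) :+ ( :- (# 1)) :* (e₂ :+ ( :- (# 1)) :* e₃) := f₃ :+ ( :- :- (# 1)) :* f₂ :+ ((# 1) :+ (# 1)) :* e₃) refl f₂ᶜ e₃ᶜ f₃ᶜ e₂ᶜ) }))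
          az : B a z ≡ 0ᶠ
          az = linʳ (linˡ (linʳ d₂₂ p₂₃ refl) (linʳ d₃₂ (B-self (Plane.s₃ p)) refl) refl) (linˡ (linʳ d₂₃ (B-self (Plane.s₂ p)) refl) (linʳ d₃₃ (0-sym p₂₃) refl) refl)
            (let open FS in solve 0 ((# 1) :+ (# 1) :* (# 0) :+ ( :- (# 1)) :* ((# 0) :+ (# 1) :* (# 0)) :+ (# 1) :* ((# 0) :+ (# 1) :* (# 0) :+ ( :- (# 1)) :* ((# 1) :+ (# 1) :* (# 0))) := (# 0)) refl)
          e₃z : B e₃ z ≡ 1ᶠ
          e₃z = linʳ (linʳ d₃₂ (B-self (Plane.s₃ p)) refl) (linʳ d₃₃ (0-sym p₂₃) refl) (let open FS in solve 0 ((# 0) :+ (# 1) :* (# 0) :+ (# 1) :* ((# 1) :+ (# 1) :* (# 0)) := (# 1)) refl)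
          o2 : f e₁ a (u ⊕ 1ᶠ +ᶠ 1ᶠ ∙ e₃) ≡ 1#
          o2 = trans (cong (f e₁ a) (sym z-eq)) (trans (f-add₃₂ _ _ _ (-ᶠ 1ᶠ))
            (transversal (replace π (Plane.s₃ (add₃₂ 1ᶠ χ)) (Plane.p₁₃ (add₃₂ 1ᶠ χ)) az (1≢0ᶠ e₃z)) thin₁ (T₁.N-e₂e₃ s) Nz))

    -- Numbers of planes on a line, on a point and in total

    module PlaneCount where

      module _ (fans : ∀ {e₁ e₂ e₃} → Plane e₁ e₂ e₃ → ∃ (Fan e₁ e₂ e₃))
        {E₁ E₂ E₃ : V n} (E : Plane E₁ E₂ E₃) where

        -- The constant weight. A plane has q³ vectors, and from this the identities compute in turn
        -- the numbers of singular vectors orthogonal to a line, to a point and in the whole space,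
        -- here including the zero vector.
        μ : V n → Carrier
        μ w = 𝟙 (Sing? w)

        μ-1 : ∀ {w} → Sing w → μ w ≡ 1#
        μ-1 = 𝟙-yes (Sing? _)

        module M = Weight μ (λ w → 𝟙-no (Sing? w))

        Sing-lc₂ : ∀ {e₁ e₂} a b → Sing e₁ → Sing e₂ → B e₁ e₂ ≡ 0ᶠ → Sing (0ⱽ ⊕ a ∙ e₁ ⊕ b ∙ e₂)
        Sing-lc₂ a b s₁ s₂ p = Sing-⊕ (Sing-⊕ Sing-0 s₁ (B-0 _)) s₂ (linˡ-keep (B-0 _) p)

        Sing-lc₁ : ∀ {e₁} a → Sing e₁ → Sing (0ⱽ ⊕ a ∙ e₁)
        Sing-lc₁ a s₁ = Sing-⊕ Sing-0 s₁ (B-0 _)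

        ∑F-1 : ∀ g → (∀ a → g a ≡ 1#) → ∑F g ≡ q
        ∑F-1 g e = trans (sum-cong elems e) (trans (∑F-const 1#) (let open RS in solve 1 (λ q → q :* (# 1) := q) refl q))

        ∑F-c : ∀ g c → (∀ a → g a ≡ c) → ∑F g ≡ q * c
        ∑F-c g c e = trans (sum-cong elems e) (∑F-const c)

        μ-plane : ∀ {e₁ e₂ e₃} → Plane e₁ e₂ e₃ → M.f e₁ e₂ e₃ ≡ q * q * q
        μ-plane p = trans (sym (M.InPlaneOf.f-sum p)) (trans (∑F-c _ (q * q) (λ a → trans (∑F-c _ q (λ b → ∑F-1 _ (λ c → μ-1 (M.InPlaneOf.lc-sing p a b c)))) refl))
          (let open RS in solve 1 (λ q → q :* (q :* q) := q :* q :* q) refl q))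

        μ-line : ∀ {e₁ e₂ e₃} → Plane e₁ e₂ e₃ → M.line e₁ e₂ ≡ q * q
        μ-line p = ∑F-c _ q (λ a → ∑F-1 _ (λ b → μ-1 (Sing-lc₂ a b s₁ s₂ p₁₂)))
          where open Plane p

        μ-pt : ∀ {e₁} → Sing e₁ → M.pt e₁ ≡ q
        μ-pt s = ∑F-1 _ (λ a → μ-1 (Sing-lc₁ a s))

        μ-N : ∀ {e₁ e₂ e₃} → Plane e₁ e₂ e₃ → M.N e₁ e₂ ≡ q * q * q + q * (q * q * q)
        μ-N p = trans (M.Counting.planes-on-line p fan) (cong₂ _+_ (μ-plane p) (∑F-c _ _ (λ c → μ-plane (replace p (k-sing c) (k₁ c) (k₂ c) (k₃ c)))))
          where
          fan = proj₂ (fans p)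
          open Fan fan

        solve-+ : ∀ {x y z} → x + y ≡ z → x ≡ z - y
        solve-+ {x} {y} refl = (let open RS in solve 2 (λ x y → x := x :+ y :- y) refl x y)

        μ-perp₂ : ∀ {e₁ e₂ e₃} → Plane e₁ e₂ e₃ → M.⟪ (λ w → δ (B e₁ w) * δ (B e₂ w)) ⟫ ≡ q * q * q * q
        μ-perp₂ p = trans (solve-+ (μ-N p)) (trans (cong (λ z → q * q * q + q * (q * q * q) - q * z) (μ-line p))
          (let open RS in solve 1 (λ q → q :* q :* q :+ q :* (q :* q :* q) :- q :* (q :* q) := q :* q :* q :* q) refl q))

        μ-T : ∀ {e₁ e₂ e₃} → Plane e₁ e₂ e₃ → M.T e₁ ≡ q * q * q * q * q + q * q * q
        μ-T {e₁} {e₂} {e₃} p = begin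
          M.T e₁ ≡⟨ solve-+ (sym (M.Counting.lines-on-point p)) ⟩
          M.N e₁ e₃ + ∑F (λ s → M.N e₁ (e₂ ⊕ s ∙ e₃)) - (1# + 1#) * q * M.f e₁ e₂ e₃
            ≡⟨ cong₂ (λ a b → a - (1# + 1#) * q * b) (cong₂ _+_ (μ-N (swap₂₃ p)) (∑F-c _ _ (λ s → μ-N (on-point s p)))) (μ-plane p) ⟩
          _ ≡⟨ (let open RS in solve 1 (λ q → q :* q :* q :+ q :* (q :* q :* q) :+ q :* (q :* q :* q :+ q :* (q :* q :* q)) :- ((# 1) :+ (# 1)) :* q :* (q :* q :* q) := q :* q :* q :* q :* q :+ q :* q :* q) refl q) ⟩
          _ ∎

        μ-perp₁ : ∀ {e₁ e₂ e₃} → Plane e₁ e₂ e₃ → M.⟪ (λ w → δ (B e₁ w)) ⟫ ≡ q * q * q * q * q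
        μ-perp₁ p = trans (solve-+ (μ-T p)) (trans (cong (λ z → q * q * q * q * q + q * q * q - q * q * z) (μ-pt (Plane.s₁ p)))
          (let open RS in solve 1 (λ q → q :* q :* q :* q :* q :+ q :* q :* q :- q :* q :* q := q :* q :* q :* q :* q) refl q))

        μ-total : M.X ≡ q * q * q * q * q * q
        μ-total = begin
          M.X ≡⟨ solve-+ (solve-+ (sym (M.Counting.points-on-line E))) ⟩
          M.T E₂ + ∑F (λ s → M.T (E₁ ⊕ s ∙ E₂)) - q * q * q * μ 0ⱽ - q * M.N E₁ E₂
            ≡⟨ cong₂ (λ a b → a - q * q * q * μ 0ⱽ - q * b) (cong₂ _+_ (μ-T (swap₁₂ E)) (∑F-c _ _ (λ s → μ-T (swap₁₃ (add₃₂ s (swap₁₃ E)))))) (μ-N E) ⟩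
          _ ≡⟨ cong (λ z → q * q * q * q * q + q * q * q + q * (q * q * q * q * q + q * q * q) - q * q * q * z - q * (q * q * q + q * (q * q * q))) (μ-1 Sing-0) ⟩
          _ ≡⟨ (let open RS in solve 1 (λ q → q :* q :* q :* q :* q :+ q :* q :* q :+ q :* (q :* q :* q :* q :* q :+ q :* q :* q) :- q :* q :* q :* (# 1) :- q :* (q :* q :* q :+ q :* (q :* q :* q)) := q :* q :* q :* q :* q :* q) refl q) ⟩
          _ ∎

        in-span : ∀ {e₁ e₂ e₃ w} (p : Plane e₁ e₂ e₃) a b → w ≡ 0ⱽ ⊕ a ∙ e₁ ⊕ b ∙ e₂ → D₃ e₁ e₂ e₃ w * δ (B w (Plane.f₃ p)) ≡ 1#
        in-span {e₁} {e₂} {e₃} p a b refl = trans (cong₂ _*_ (M.InPlaneOf.D-in p (inPlane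
            (linʳ-keep (linʳ-keep (B-0ʳ _) (B-self s₁)) p₁₂) (linʳ-keep (linʳ-keep (B-0ʳ _) (0-sym p₁₂)) (B-self s₂))
            (linʳ-keep (linʳ-keep (B-0ʳ _) (0-sym p₁₃)) (0-sym p₂₃)))) (δ-1 (linˡ-keep (linˡ-keep (B-0 _) d₁₃) d₂₃))) (let open RS in solve 0 ((# 1) :* (# 1) := (# 1)) refl)
          where open Plane p

        off-span : ∀ {e₁ e₂ e₃ w} (p : Plane e₁ e₂ e₃) → Sing w → B e₁ w ≡ 0ᶠ → B e₂ w ≡ 0ᶠ → Plane e₁ e₂ w → D₃ e₁ e₂ e₃ w * δ (B w (Plane.f₃ p)) ≡ 0#
        off-span {e₁} {e₂} {e₃} {w} p sw p₁ p₂ pw with B e₃ w ≟ᶠ 0ᶠ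
        ... | no _ = zeroˡ (zeroʳ (zeroʳ refl))
        ... | yes p₃ = zeroʳ (δ-0 (λ z → 1≢0 (trans (sym (Plane.d₃₃ pw)) (trans (cong (λ u → B u (Plane.f₃ pw)) (eq z))
               (linˡ-keep (linˡ-keep (B-0 _) (Plane.d₁₃ pw)) (Plane.d₂₃ pw))))))
          where
          1≢0 : 1ᶠ ≢ 0ᶠ
          1≢0 e = 0≢1ᶠ (sym e)
          open Plane p
          eq : B w f₃ ≡ 0ᶠ → w ≡ 0ⱽ ⊕ B w f₁ ∙ e₁ ⊕ B w f₂ ∙ e₂
          eq z = trans (maximal p sw (inPlane p₁ p₂ p₃)) (trans (cong (λ c → lc₃ (B w f₁) (B w f₂) c e₁ e₂ e₃) z)
            (vsolve (((𝟘 ⊞ (B w f₁) ⊠ (v# 0)) ⊞ (B w f₂) ⊠ (v# 1)) ⊞ 0ᶠ ⊠ (v# 2)) ((𝟘 ⊞ (B w f₁) ⊠ (v# 0)) ⊞ (B w f₂) ⊠ (v# 1)) (e₁ ∷ e₂ ∷ e₃ ∷ []) (λ { (e₁ᶜ ∷ e₂ᶜ ∷ e₃ᶜ ∷ []) → (let open FS in solve 5 (λ e₁ e₂ e₃ a b → (# 0) :+ a :* e₁ :+ b :* e₂ :+ (# 0) :* e₃ := (# 0) :+ a :* e₁ :+ b :* e₂) refl e₁ᶜ e₂ᶜ e₃ᶜ (B w f₁) (B w f₂)) })))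

        in-point : ∀ {e₁ e₂ e₃ w} (p : Plane e₁ e₂ e₃) a → w ≡ 0ⱽ ⊕ a ∙ e₁ →
          D₃ e₁ e₂ e₃ w * (δ (B w (Plane.f₂ p)) * δ (B w (Plane.f₃ p))) ≡ 1#
        in-point {e₁} {e₂} {e₃} p a refl = trans (cong₂ _*_ (M.InPlaneOf.D-in p (inPlane
            (linʳ-keep (B-0ʳ _) (B-self s₁)) (linʳ-keep (B-0ʳ _) (0-sym p₁₂)) (linʳ-keep (B-0ʳ _) (0-sym p₁₃))))
            (cong₂ _*_ (δ-1 (linˡ-keep (B-0 _) d₁₂)) (δ-1 (linˡ-keep (B-0 _) d₁₃)))) (let open RS in solve 0 ((# 1) :* ((# 1) :* (# 1)) := (# 1)) refl)
          where open Plane p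

        off-point-0 : ∀ {e₁ e₂ e₃ w d} (p : Plane e₁ e₂ e₃) → Sing w → Plane e₁ w d →
          D₃ e₁ e₂ e₃ w * (δ (B w (Plane.f₂ p)) * δ (B w (Plane.f₃ p))) ≡ 0#
        off-point-0 {e₁} {e₂} {e₃} {w} p sw pw with M.InPlaneOf.in? p w
        ... | no ni = zeroˡ (M.InPlaneOf.D-out p ni)
        ... | yes i with B w (Plane.f₂ p) ≟ᶠ 0ᶠ | B w (Plane.f₃ p) ≟ᶠ 0ᶠ
        ... | no _ | _ = zeroʳ (zeroˡ refl)
        ... | yes _ | no _ = zeroʳ (zeroʳ refl)
        ... | yes z₂ | yes z₃ = ⊥-elim (0≢1ᶠ (trans (sym (trans (cong (λ u → B u (Plane.f₂ pw)) eq) (linˡ-keep (B-0 _) (Plane.d₁₂ pw)))) (Plane.d₂₂ pw)))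
          where
          open Plane p
          eq : w ≡ 0ⱽ ⊕ B w f₁ ∙ e₁
          eq = trans (maximal p sw i) (trans (cong₂ (λ b c → lc₃ (B w f₁) b c e₁ e₂ e₃) z₂ z₃)
            (vsolve (((𝟘 ⊞ (B w f₁) ⊠ (v# 0)) ⊞ 0ᶠ ⊠ (v# 1)) ⊞ 0ᶠ ⊠ (v# 2)) (𝟘 ⊞ (B w f₁) ⊠ (v# 0)) (e₁ ∷ e₂ ∷ e₃ ∷ []) (λ { (e₁ᶜ ∷ e₂ᶜ ∷ e₃ᶜ ∷ []) → (let open FS in solve 4 (λ e₁ e₂ e₃ a → (# 0) :+ a :* e₁ :+ (# 0) :* e₂ :+ (# 0) :* e₃ := (# 0) :+ a :* e₁) refl e₁ᶜ e₂ᶜ e₃ᶜ (B w f₁)) })))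

        orthogonal : ∀ {e₁ e₂ e₃ u w} (p : Plane e₁ e₂ e₃) → Sing u → InPlane e₁ e₂ e₃ u → InPlane e₁ e₂ e₃ w → B u w ≡ 0ᶠ
        orthogonal {w = w} p su iu (inPlane a b c) = trans (cong (λ z → B z w) (maximal p su iu)) (linˡ-keep (linˡ-keep (linˡ-keep (B-0 _) a) b) c)

        δ-sym : ∀ u w → δ (B u w) ≡ δ (B w u)
        δ-sym u w = δ-cong 0-sym 0-sym

        reindex : ∀ (φ ψ : V n → V n) → (∀ z → ψ (φ z) ≡ z) → (∀ w → φ (ψ w) ≡ w) → ∀ (h : V n → Carrier) → ∑V (λ z → h (φ z)) ≡ ∑V h
        reindex φ ψ l r h = begin
          ∑V (λ z → h (φ z)) ≡⟨ sum-cong (vecs n) (λ z → ∑V-δ (φ z) h) ⟨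
          ∑V (λ z → ∑V (λ w → 𝟙 (w ≟ⱽ φ z) * h w)) ≡⟨ sum-swap (vecs n) (vecs n) _ ⟩
          ∑V (λ w → ∑V (λ z → 𝟙 (w ≟ⱽ φ z) * h w))
            ≡⟨ sum-cong (vecs n) (λ w → trans (sum-cong (vecs n) (λ z → cong (_* h w) (𝟙-cong (w ≟ⱽ φ z) (z ≟ⱽ ψ w)
                 (λ e → trans (sym (l z)) (cong ψ (sym e))) (λ e → trans (sym (r w)) (cong φ (sym e)))))) (∑V-δ (ψ w) (λ _ → h w))) ⟩
          ∑V h ∎

        ∑F-split : ∀ (g : K → Carrier) c → (∀ b → b ≢ 0ᶠ → g b ≡ c) → ∑F g ≡ g 0ᶠ + (q - 1#) * c
        ∑F-split g c e = trans (sum-cong elems lem) (trans (sum-+ elems _ _) (trans (cong₂ _+_ (∑F-const c) (∑F-δ 0ᶠ (λ _ → g 0ᶠ - c)))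
          (let open RS in solve 3 (λ q c x → q :* c :+ (x :- c) := x :+ (q :- (# 1)) :* c) refl q c (g 0ᶠ))))
          where
          lem : ∀ b → g b ≡ c + δ b * (g 0ᶠ - c)
          lem b with b ≟ᶠ 0ᶠ
          ... | yes refl = (let open RS in solve 2 (λ c x → x := c :+ (# 1) :* (x :- c)) refl c (g 0ᶠ))
          ... | no nz = trans (e b nz) (let open RS in solve 2 (λ c x → c := c :+ (# 0) :* (x :- c)) refl c (g 0ᶠ))

        module _ (v : V n → Carrier) (supp : ∀ w → ¬ Sing w → v w ≡ 0#) (v-0 : v 0ⱽ ≡ 0#)
          (ps : List (V n × V n × V n))
          (ps-plane : ∀ {a b c} → (a , b , c) ∈ ps → Plane a b c)
          (f-count : ∀ {a b c} → Plane a b c → Weight.f v supp a b c ≡ sum ps (λ { (r₁ , r₂ , r₃) → D₃ r₁ r₂ r₃ a * (D₃ r₁ r₂ r₃ b * D₃ r₁ r₂ r₃ c) }))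
          where

          open Weight v supp

          D³ : V n × V n × V n → V n → Carrier
          D³ (a , b , c) = D₃ a b c

          exchange-sums : ∀ (a b : V n → Carrier) (κ : V n → V n → Carrier) →
            M.⟪ (λ z → a z * ⟪ (λ w → b w * κ z w) ⟫) ⟫ ≡ ⟪ (λ w → b w * M.⟪ (λ z → a z * κ z w) ⟫) ⟫
          exchange-sums a b κ = begin
            ∑V (λ z → a z * ∑V (λ w → b w * κ z w * v w) * μ z)
              ≡⟨ sum-cong (vecs n) (λ z → trans (let open RS in solve 3 (λ a s m → a :* s :* m := a :* m :* s) refl (a z) (∑V (λ w → b w * κ z w * v w)) (μ z)) (sym (sum-* (vecs n) _ _))) ⟩
            ∑V (λ z → ∑V (λ w → a z * μ z * (b w * κ z w * v w))) ≡⟨ sum-swap (vecs n) (vecs n) _ ⟩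
            ∑V (λ w → ∑V (λ z → a z * μ z * (b w * κ z w * v w)))
              ≡⟨ sum-cong (vecs n) (λ w → trans (sum-cong (vecs n) (λ z → (let open RS in solve 5 (λ a m b k v → a :* m :* (b :* k :* v) := b :* v :* (a :* k :* m)) refl (a z) (μ z) (b w) (κ z w) (v w))))
                   (trans (sum-* (vecs n) _ _) (let open RS in solve 3 (λ b v s → b :* v :* s := b :* s :* v) refl (b w) (v w) (M.⟪ (λ z → a z * κ z w) ⟫)))) ⟩
            ∑V (λ w → b w * M.⟪ (λ z → a z * κ z w) ⟫ * v w) ∎

          exchange-list : ∀ (a : V n → Carrier) (κ : V n × V n × V n → V n → Carrier) (c : V n × V n × V n → Carrier) →
            (∀ ρ → ρ ∈ ps → M.⟪ (λ z → a z * κ ρ z) ⟫ ≡ q * q * q * c ρ) →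
            M.⟪ (λ z → a z * sum ps (λ ρ → κ ρ z)) ⟫ ≡ q * q * q * sum ps c
          exchange-list a κ c e = begin
            ∑V (λ z → a z * sum ps (λ ρ → κ ρ z) * μ z)
              ≡⟨ sum-cong (vecs n) (λ z → trans (let open RS in solve 3 (λ a s m → a :* s :* m := a :* m :* s) refl (a z) (sum ps (λ ρ → κ ρ z)) (μ z)) (trans (sym (sum-* ps _ _))
                   (sum-cong ps (λ ρ → (let open RS in solve 3 (λ a m k → a :* m :* k := a :* k :* m) refl (a z) (μ z) (κ ρ z)))))) ⟩
            ∑V (λ z → sum ps (λ ρ → a z * κ ρ z * μ z)) ≡⟨ sum-swap (vecs n) ps _ ⟩
            sum ps (λ ρ → M.⟪ (λ z → a z * κ ρ z) ⟫) ≡⟨ sum-cong∈ ps e ⟩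
            sum ps (λ ρ → q * q * q * c ρ) ≡⟨ sum-* ps _ _ ⟩
            q * q * q * sum ps c ∎

          #line : V n → V n → Carrier
          #line e₁ e₂ = sum ps (λ ρ → D³ ρ e₁ * D³ ρ e₂)

          #point : V n → Carrier
          #point e = sum ps (λ ρ → D³ ρ e)

          in-list : ∀ ρ → ρ ∈ ps → ∀ e → D³ ρ e ≡ 0# ⊎ (D³ ρ e ≡ 1# × InPlane (proj₁ ρ) (proj₁ (proj₂ ρ)) (proj₂ (proj₂ ρ)) e)
          in-list ρ m e with M.InPlaneOf.in? (ps-plane m) e
          ... | yes i = inj₂ (M.InPlaneOf.D-in (ps-plane m) i , i)
          ... | no ni = inj₁ (M.InPlaneOf.D-out (ps-plane m) ni)

          ⟪⟫-0 : ∀ (c : V n → Carrier) → (∀ z → c z ≡ 0#) → M.⟪ c ⟫ ≡ 0#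
          ⟪⟫-0 c e = trans (sum-cong (vecs n) (λ z → zeroˡ (e z))) (sum-0 (vecs n))

          perp-in : ∀ ρ (m : ρ ∈ ps) {e} → Sing e → InPlane (proj₁ ρ) (proj₁ (proj₂ ρ)) (proj₂ (proj₂ ρ)) e → ∀ z → δ (B e z) * D³ ρ z ≡ D³ ρ z
          perp-in ρ m {e} se ie z with in-list ρ m z
          ... | inj₁ d = trans (zeroʳ d) (sym d)
          ... | inj₂ (d , i) = trans (cong (_* D³ ρ z) (δ-1 (orthogonal (ps-plane m) se ie i))) (let open RS in solve 1 (λ d → (# 1) :* d := d) refl (D³ ρ z))

          D-perp : ∀ ρ → ρ ∈ ps → ∀ {e₁} → Sing e₁ → M.⟪ (λ z → δ (B e₁ z) * (D³ ρ e₁ * D³ ρ z)) ⟫ ≡ q * q * q * D³ ρ e₁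
          D-perp ρ m {e₁} s₁ with in-list ρ m e₁
          ... | inj₁ d = trans (⟪⟫-0 _ (λ z → zeroʳ (zeroˡ d))) (sym (zeroʳ d))
          ... | inj₂ (d , i) = trans (M.by refl refl (λ z _ → trans (cong (λ x → δ (B e₁ z) * (x * D³ ρ z)) d)
                  (trans (let open RS in solve 2 (λ b d → b :* ((# 1) :* d) := b :* d) refl (δ (B e₁ z)) (D³ ρ z)) (perp-in ρ m s₁ i z)))) (trans (μ-plane (ps-plane m)) (trans (let open RS in solve 1 (λ q → q :* q :* q := q :* q :* q :* (# 1)) refl q) (cong (q * q * q *_) (sym d))))

          D-perp₂ : ∀ ρ → ρ ∈ ps → ∀ {e₁ e₂} → Sing e₁ → Sing e₂ →
            M.⟪ (λ z → δ (B e₁ z) * δ (B e₂ z) * (D³ ρ e₁ * (D³ ρ e₂ * D³ ρ z))) ⟫ ≡ q * q * q * (D³ ρ e₁ * D³ ρ e₂)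
          D-perp₂ ρ m {e₁} {e₂} s₁ s₂ with in-list ρ m e₂
          ... | inj₁ d = trans (⟪⟫-0 _ (λ z → zeroʳ (zeroʳ (zeroˡ d)))) (sym (zeroʳ (zeroʳ d)))
          ... | inj₂ (d , i) = trans (M.by refl refl (λ z _ → trans (cong (λ x → δ (B e₁ z) * δ (B e₂ z) * (D³ ρ e₁ * (x * D³ ρ z))) d)
                  (trans (let open RS in solve 4 (λ a b c d → a :* b :* (c :* ((# 1) :* d)) := a :* (c :* (b :* d))) refl (δ (B e₁ z)) (δ (B e₂ z)) (D³ ρ e₁) (D³ ρ z))
                    (cong (λ x → δ (B e₁ z) * (D³ ρ e₁ * x)) (perp-in ρ m s₂ i z))))) (trans (D-perp ρ m s₁)
                  (trans (let open RS in solve 2 (λ q c → q :* q :* q :* c := q :* q :* q :* (c :* (# 1))) refl q (D³ ρ e₁)) (cong (λ x → q * q * q * (D³ ρ e₁ * x)) (sym d))))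

          D-lc : ∀ ρ → ρ ∈ ps → ∀ {e₁ e₂} a b → D³ ρ e₁ * (D³ ρ e₂ * D³ ρ (0ⱽ ⊕ a ∙ e₁ ⊕ b ∙ e₂)) ≡ D³ ρ e₁ * D³ ρ e₂
          D-lc ρ m {e₁} {e₂} a b with in-list ρ m e₁ | in-list ρ m e₂
          ... | inj₁ d | _ = trans (zeroˡ d) (sym (zeroˡ d))
          ... | inj₂ _ | inj₁ d = trans (zeroʳ (zeroˡ d)) (sym (zeroʳ d))
          ... | inj₂ (_ , inPlane x y z) | inj₂ (_ , inPlane x' y' z') = cong (D³ ρ e₁ *_) (trans (cong (D³ ρ e₂ *_) (M.InPlaneOf.D-in (ps-plane m)
                (inPlane (linʳ-keep (linʳ-keep (B-0ʳ _) x) x') (linʳ-keep (linʳ-keep (B-0ʳ _) y) y') (linʳ-keep (linʳ-keep (B-0ʳ _) z) z'))))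
                (let open RS in solve 1 (λ d → d :* (# 1) := d) refl (D³ ρ e₂)))

          c≢0 : ∀ {c} → 1# ≤ c → c ≢ 0#
          c≢0 l refl = 1≰0 l

          q*-mono : ∀ {c} → 1# ≤ c → 1# ≤ q * c
          q*-mono {c} l = ≤-trans l (≤-diff ((q - 1#) * c) (*-nonneg (diff-≤ (≤-trans (≤-diff 1# 0≤1 refl) 2≤q)) (≤-trans 0≤1 l)) (let open RS in solve 2 (λ q c → q :* c := c :+ (q :- (# 1)) :* c) refl q c))

          1≤q-1 : 1# ≤ q - 1#
          1≤q-1 = ≤-trans (≤-reflexive (let open RS in solve 0 ((# 1) := (# 1) :+ (# 1) :- (# 1)) refl)) (+-mono 2≤q ≤-refl)

          -- On planes, f and the list count agree. So the sum of their difference over all z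
          -- orthogonal to the line comes only from z on the line, where f degenerates to `A` and
          -- the count to `S`. Double counting gives a second value of this sum, and the resulting
          -- linear equation is solved by S = A + q L.
          line-count : ∀ {e₁ e₂ e₃} → Plane e₁ e₂ e₃ → #line e₁ e₂ ≡ N e₁ e₂
          line-count {e₁} {e₂} {e₃} p = ≢⇒cancel (c≢0 (q*-mono (q*-mono 1≤q-1))) (begin
            q * (q * (q - 1#)) * S
              ≡⟨ (let open RS in solve 4 (λ q A L S → q :* (q :* (q :- (# 1))) :* S := q :* (q :* (q :- (# 1))) :* (A :+ q :* L) :- (q :* q :* q :* A :+ (q :* q :* q :* q :- q :* q :* q) :* L :- q :* q :* q :* S :- q :* (q :* (A :- S)))) refl q A L S) ⟩
            q * (q * (q - 1#)) * N e₁ e₂ - (q * q * q * A + (q * q * q * q - q * q * q) * L - q * q * q * S - q * (q * (A - S)))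
              ≡⟨ cong (λ z → q * (q * (q - 1#)) * N e₁ e₂ - (z - q * (q * (A - S)))) (trans (sym total) (trans concentrated on-line)) ⟩
            q * (q * (q - 1#)) * N e₁ e₂ - (q * (q * (A - S)) - q * (q * (A - S)))
              ≡⟨ (let open RS in solve 2 (λ x y → x :- (y :- y) := x) refl (q * (q * (q - 1#)) * N e₁ e₂) (q * (q * (A - S)))) ⟩
            q * (q * (q - 1#)) * N e₁ e₂ ∎)
            where
            open Plane p
            A = ⟪ (λ w → δ (B e₁ w) * δ (B e₂ w)) ⟫
            L = line e₁ e₂
            S = #line e₁ e₂
            S₃ : V n → Carrier
            S₃ z = sum ps (λ ρ → D³ ρ e₁ * (D³ ρ e₂ * D³ ρ z))
            G : V n → Carrier
            G z = δ (B e₁ z) * δ (B e₂ z) * (f e₁ e₂ z - S₃ z) * μ z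
            module G = Weight G (λ w ns → zeroʳ (𝟙-no (Sing? w) ns))
            concentrated : ∑V G ≡ G.line e₁ e₂
            concentrated = trans (sum-cong (vecs n) pw) (sym (G.InPlaneOf.line₁₂ p))
              where
              pw : ∀ w → G w ≡ D₃ e₁ e₂ e₃ w * δ (B w f₃) * G w
              pw w with Sing? w | B e₁ w ≟ᶠ 0ᶠ | B e₂ w ≟ᶠ 0ᶠ
              ... | no ns | _ | _ = trans (zeroʳ refl) (sym (zeroʳ (zeroʳ refl)))
              ... | yes _ | no _ | _ = trans (zeroˡ (zeroˡ (zeroˡ refl))) (sym (zeroʳ (zeroˡ (zeroˡ (zeroˡ refl)))))
              ... | yes _ | yes _ | no _ = trans (zeroˡ (zeroˡ (zeroʳ refl))) (sym (zeroʳ (zeroˡ (zeroˡ (zeroʳ refl)))))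
              ... | yes s | yes z₁ | yes z₂ with extend₃ p s z₁ z₂
              ... | inj₁ pw = trans (zeroˡ x) (sym (zeroʳ (zeroˡ x)))
                where
                x : 1# * 1# * (f e₁ e₂ w - S₃ w) ≡ 0#
                x = zeroʳ (trans (cong (_- S₃ w) (f-count pw)) (let open RS in solve 1 (λ s → s :- s := (# 0)) refl (S₃ w)))
              ... | inj₂ (a , b , e) = trans (let open RS in solve 1 (λ g → g := (# 1) :* g) refl (1# * 1# * (f e₁ e₂ w - S₃ w) * 1#)) (cong (_* (1# * 1# * (f e₁ e₂ w - S₃ w) * 1#)) (sym one))
                where
                one : 1# * (1# * δ (B e₃ w)) * δ (B w f₃) ≡ 1#
                one = trans (cong₂ (λ x y → x * (y * δ (B e₃ w)) * δ (B w f₃)) (sym (δ-1 z₁)) (sym (δ-1 z₂))) (in-span p a b e)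
            on-line : G.line e₁ e₂ ≡ q * (q * (A - S))
            on-line = ∑F-c _ _ (λ a → ∑F-c _ _ (λ b → Glc a b))
              where
              Glc : ∀ a b → G (0ⱽ ⊕ a ∙ e₁ ⊕ b ∙ e₂) ≡ A - S
              Glc a b = trans (cong₂ _*_ (cong₂ _*_ (cong₂ _*_ (δ-1 (linʳ-keep (linʳ-keep (B-0ʳ _) (B-self s₁)) p₁₂)) (δ-1 (linʳ-keep (linʳ-keep (B-0ʳ _) (0-sym p₁₂)) (B-self s₂))))
                  (cong₂ _-_ fA (sum-cong∈ ps (λ ρ m → D-lc ρ m a b)))) (μ-1 (Sing-lc₂ a b s₁ s₂ p₁₂))) (let open RS in solve 1 (λ x → (# 1) :* (# 1) :* x :* (# 1) := x) refl (A - S))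
                where
                fA : f e₁ e₂ (0ⱽ ⊕ a ∙ e₁ ⊕ b ∙ e₂) ≡ A
                fA = trans (f-add₃₂ e₁ e₂ _ b) (trans (f-add₃₁ e₁ e₂ 0ⱽ a) (sum-cong (vecs n) (λ w → trans (cong (λ z → δ (B e₁ w) * (δ (B e₂ w) * z) * v w) (δ-1 (B-0 w)))
                  (let open RS in solve 3 (λ a b v → a :* (b :* (# 1)) :* v := a :* b :* v) refl (δ (B e₁ w)) (δ (B e₂ w)) (v w)))))
            -- For w orthogonal to the line, the singular vectors orthogonal to e₁, e₂ and w fill a
            -- plane (q³) if w is off the line and all of the orthogonal space of the line (q⁴)
            -- otherwise.
            inner : ∀ w → Sing w → δ (B e₁ w) * δ (B e₂ w) * M.⟪ (λ z → δ (B e₁ z) * δ (B e₂ z) * δ (B z w)) ⟫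
              ≡ q * q * q * (δ (B e₁ w) * δ (B e₂ w)) + (q * q * q * q - q * q * q) * (D₃ e₁ e₂ e₃ w * δ (B w f₃))
            inner w s with B e₁ w ≟ᶠ 0ᶠ | B e₂ w ≟ᶠ 0ᶠ
            ... | no _ | d = trans (zeroˡ (zeroˡ refl)) (sym (trans (cong₂ _+_ (zeroʳ (zeroˡ refl)) (zeroʳ (zeroˡ (zeroˡ refl)))) (let open RS in solve 0 ((# 0) :+ (# 0) := (# 0)) refl)))
            ... | yes _ | no _ = trans (zeroˡ (zeroʳ refl)) (sym (trans (cong₂ _+_ (zeroʳ (zeroʳ refl)) (zeroʳ (zeroˡ (zeroʳ (zeroˡ refl))))) (let open RS in solve 0 ((# 0) :+ (# 0) := (# 0)) refl)))
            ... | yes z₁ | yes z₂ with extend₃ p s z₁ z₂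
            ... | inj₁ pw = trans (cong (1# * 1# *_) (trans (M.by {d = D₃ e₁ e₂ w} refl refl (λ z _ → trans (let open RS in solve 3 (λ a b c → a :* b :* c := a :* (b :* c)) refl (δ (B e₁ z)) (δ (B e₂ z)) (δ (B z w)))
                    (cong (λ x → δ (B e₁ z) * (δ (B e₂ z) * x)) (δ-sym z w)))) (μ-plane pw)))
                  (trans (let open RS in solve 1 (λ q → (# 1) :* (# 1) :* (q :* q :* q) := q :* q :* q :* ((# 1) :* (# 1)) :+ (q :* q :* q :* q :- q :* q :* q) :* (# 0)) refl q) (cong (λ x → q * q * q * (1# * 1#) + (q * q * q * q - q * q * q) * x) (sym zero')))
              where
              zero' : 1# * (1# * δ (B e₃ w)) * δ (B w f₃) ≡ 0#
              zero' = trans (cong₂ (λ x y → x * (y * δ (B e₃ w)) * δ (B w f₃)) (sym (δ-1 z₁)) (sym (δ-1 z₂))) (off-span p s z₁ z₂ pw)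
            ... | inj₂ (a , b , e) = trans (cong (1# * 1# *_) (trans (M.by {d = λ z → δ (B e₁ z) * δ (B e₂ z)} refl refl (λ z _ → zw z)) (μ-perp₂ p)))
                  (trans (let open RS in solve 1 (λ q → (# 1) :* (# 1) :* (q :* q :* q :* q) := q :* q :* q :* ((# 1) :* (# 1)) :+ (q :* q :* q :* q :- q :* q :* q) :* (# 1)) refl q) (cong (λ x → q * q * q * (1# * 1#) + (q * q * q * q - q * q * q) * x) (sym one)))
              where
              one : 1# * (1# * δ (B e₃ w)) * δ (B w f₃) ≡ 1#
              one = trans (cong₂ (λ x y → x * (y * δ (B e₃ w)) * δ (B w f₃)) (sym (δ-1 z₁)) (sym (δ-1 z₂))) (in-span p a b e)
              zw : ∀ z → δ (B e₁ z) * δ (B e₂ z) * δ (B z w) ≡ δ (B e₁ z) * δ (B e₂ z)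
              zw z with B e₁ z ≟ᶠ 0ᶠ | B e₂ z ≟ᶠ 0ᶠ
              ... | no _ | d = trans (zeroˡ (zeroˡ refl)) (sym (zeroˡ refl))
              ... | yes _ | no _ = trans (zeroˡ (zeroʳ refl)) (sym (zeroʳ refl))
              ... | yes x | yes y = trans (cong (1# * 1# *_) (δ-1 (trans (cong (B z) e) (linʳ-keep (linʳ-keep (B-0ʳ _) (0-sym x)) (0-sym y))))) (let open RS in solve 0 ((# 1) :* (# 1) :* (# 1) := (# 1) :* (# 1)) refl)
            total : ∑V G ≡ q * q * q * A + (q * q * q * q - q * q * q) * L - q * q * q * S
            total = begin
              ∑V G ≡⟨ sum-cong (vecs n) (λ z → (let open RS in solve 5 (λ a b f s m → a :* b :* (f :- s) :* m := a :* b :* f :* m :+ ( :- (# 1)) :* (a :* b :* s :* m)) refl (δ (B e₁ z)) (δ (B e₂ z)) (f e₁ e₂ z) (S₃ z) (μ z))) ⟩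
              ∑V (λ z → δ (B e₁ z) * δ (B e₂ z) * f e₁ e₂ z * μ z + - 1# * (δ (B e₁ z) * δ (B e₂ z) * S₃ z * μ z))
                ≡⟨ trans (sum-+ (vecs n) _ _) (cong₂ _+_ refl (sum-* (vecs n) _ _)) ⟩
              M.⟪ (λ z → δ (B e₁ z) * δ (B e₂ z) * f e₁ e₂ z) ⟫ + - 1# * M.⟪ (λ z → δ (B e₁ z) * δ (B e₂ z) * S₃ z) ⟫
                ≡⟨ cong₂ (λ x y → x + - 1# * y) part₁ (exchange-list _ (λ ρ z → D³ ρ e₁ * (D³ ρ e₂ * D³ ρ z)) _ (λ ρ m → D-perp₂ ρ m s₁ s₂)) ⟩
              q * q * q * A + (q * q * q * q - q * q * q) * L + - 1# * (q * q * q * S)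
                ≡⟨ (let open RS in solve 2 (λ x y → x :+ ( :- (# 1)) :* y := x :- y) refl (q * q * q * A + (q * q * q * q - q * q * q) * L) (q * q * q * S)) ⟩
              _ ∎
              where
              part₁ : M.⟪ (λ z → δ (B e₁ z) * δ (B e₂ z) * f e₁ e₂ z) ⟫ ≡ q * q * q * A + (q * q * q * q - q * q * q) * L
              part₁ = trans (sum-cong (vecs n) (λ z → cong (λ x → δ (B e₁ z) * δ (B e₂ z) * x * μ z) (sum-cong (vecs n) (λ w → (let open RS in solve 4 (λ a b c v → a :* (b :* c) :* v := a :* b :* c :* v) refl (δ (B e₁ w)) (δ (B e₂ w)) (δ (B z w)) (v w))))))
                (trans (exchange-sums _ (λ w → δ (B e₁ w) * δ (B e₂ w)) (λ z w → δ (B z w)))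
                  (by refl (plus (times (q * q * q) refl) (times _ (InPlaneOf.line₁₂ p))) inner))

          sum-reindex : ∀ (φ ψ : K → K) → (∀ z → ψ (φ z) ≡ z) → (∀ w → φ (ψ w) ≡ w) → ∀ (h : K → Carrier) → ∑F (λ z → h (φ z)) ≡ ∑F h
          sum-reindex φ ψ l r h = begin
            ∑F (λ z → h (φ z)) ≡⟨ sum-cong elems (λ z → ∑F-δ (φ z) h) ⟨
            ∑F (λ z → ∑F (λ w → 𝟙 (w ≟ᶠ φ z) * h w)) ≡⟨ sum-swap elems elems _ ⟩
            ∑F (λ w → ∑F (λ z → 𝟙 (w ≟ᶠ φ z) * h w))
              ≡⟨ sum-cong elems (λ w → trans (sum-cong elems (λ z → cong (_* h w) (𝟙-cong (w ≟ᶠ φ z) (z ≟ᶠ ψ w)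
                   (λ e → trans (sym (l z)) (cong ψ (sym e))) (λ e → trans (sym (r w)) (cong φ (sym e)))))) (∑F-δ (ψ w) (λ _ → h w))) ⟩
            ∑F h ∎

          line-on-point : ∀ e a → line e (0ⱽ ⊕ a ∙ e) ≡ q * pt e
          line-on-point e a = trans (sum-swap elems elems _) (∑F-c _ _ (λ b → trans
              (sum-cong elems (λ c → cong v (vsolve ((𝟘 ⊞ c ⊠ (v# 0)) ⊞ b ⊠ (𝟘 ⊞ a ⊠ (v# 0))) (𝟘 ⊞ (c +ᶠ (b *ᶠ a)) ⊠ (v# 0)) (e ∷ []) (λ { (eᶜ ∷ []) → (let open FS in solve 4 (λ e a b c → (# 0) :+ c :* e :+ b :* ((# 0) :+ a :* e) := (# 0) :+ (c :+ b :* a) :* e) refl eᶜ a b c) }))))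
              (sum-reindex (_+ᶠ b *ᶠ a) (_+ᶠ -ᶠ (b *ᶠ a)) (λ z → (let open FS in solve 3 (λ z a b → z :+ b :* a :- b :* a := z) refl z a b)) (λ z → (let open FS in solve 3 (λ z a b → z :- b :* a :+ b :* a := z) refl z a b)) (λ c → v (0ⱽ ⊕ c ∙ e)))))

          -- For b ≠ 0 the map z ↦ a e₁ + b z permutes the singular vectors orthogonal to e₁. When
          -- `line e₁ z` is summed over z, only the part b = 0 remains to be computed separately.
          v-scaled : ∀ {e₁} a b → b ≢ 0ᶠ → Sing e₁ →
            ∑V (λ z → δ (B e₁ z) * v (0ⱽ ⊕ a ∙ e₁ ⊕ b ∙ z) * μ z) ≡ ⟪ (λ w → δ (B e₁ w)) ⟫
          v-scaled {e₁} a b b≢0 s₁ = trans (sum-cong (vecs n) pw) (reindex φ ψ φψ ψφ (λ w → δ (B e₁ w) * v w))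
            where
            i = b ⁻¹ᶠ
            φ ψ : V n → V n
            φ z = 0ⱽ ⊕ a ∙ e₁ ⊕ b ∙ z
            ψ w = 0ⱽ ⊕ -ᶠ (i *ᶠ a) ∙ e₁ ⊕ i ∙ w
            bi : b *ᶠ i ≡ 1ᶠ
            bi = inverseᶠ b b≢0
            φψ : ∀ z → ψ (φ z) ≡ z
            φψ z = trans (vsolve ((𝟘 ⊞ (-ᶠ (i *ᶠ a)) ⊠ (v# 0)) ⊞ i ⊠ ((𝟘 ⊞ a ⊠ (v# 0)) ⊞ b ⊠ (v# 1))) (𝟘 ⊞ (b *ᶠ i) ⊠ (v# 1)) (e₁ ∷ z ∷ []) (λ { (e₁ᶜ ∷ zᶜ ∷ []) → (let open FS in solve 5 (λ e₁ z a b i → (# 0) :+ ( :- (i :* a)) :* e₁ :+ i :* ((# 0) :+ a :* e₁ :+ b :* z) := (# 0) :+ (b :* i) :* z) refl e₁ᶜ zᶜ a b i) })) (trans (cong (λ c → 0ⱽ ⊕ c ∙ z) bi) (vsolve (𝟘 ⊞ 1ᶠ ⊠ (v# 0)) (v# 0) (z ∷ []) (λ { (zᶜ ∷ []) → (let open FS in solve 1 (λ z → (# 0) :+ (# 1) :* z := z) refl zᶜ) })))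
            ψφ : ∀ w → φ (ψ w) ≡ w
            ψφ w = trans (vsolve ((𝟘 ⊞ a ⊠ (v# 0)) ⊞ b ⊠ ((𝟘 ⊞ (-ᶠ (i *ᶠ a)) ⊠ (v# 0)) ⊞ i ⊠ (v# 1))) ((𝟘 ⊞ (a *ᶠ (1ᶠ +ᶠ -ᶠ (b *ᶠ i))) ⊠ (v# 0)) ⊞ (b *ᶠ i) ⊠ (v# 1)) (e₁ ∷ w ∷ []) (λ { (e₁ᶜ ∷ wᶜ ∷ []) → (let open FS in solve 5 (λ e₁ w a b i → (# 0) :+ a :* e₁ :+ b :* ((# 0) :+ ( :- (i :* a)) :* e₁ :+ i :* w) := (# 0) :+ (a :* ((# 1) :- b :* i)) :* e₁ :+ (b :* i) :* w) refl e₁ᶜ wᶜ a b i) }))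
              (trans (cong (λ c → 0ⱽ ⊕ a *ᶠ (1ᶠ +ᶠ -ᶠ c) ∙ e₁ ⊕ c ∙ w) bi) (vsolve ((𝟘 ⊞ (a *ᶠ (1ᶠ +ᶠ -ᶠ 1ᶠ)) ⊠ (v# 0)) ⊞ 1ᶠ ⊠ (v# 1)) (v# 1) (e₁ ∷ w ∷ []) (λ { (e₁ᶜ ∷ wᶜ ∷ []) → (let open FS in solve 3 (λ e₁ w a → (# 0) :+ (a :* ((# 1) :- (# 1))) :* e₁ :+ (# 1) :* w := w) refl e₁ᶜ wᶜ a) })))
            Bφ : ∀ z → B e₁ (φ z) ≡ b *ᶠ B e₁ z
            Bφ z = linʳ (linʳ-keep (B-0ʳ _) (B-self s₁)) refl (let open FS in solve 2 (λ b x → (# 0) :+ b :* x := b :* x) refl b (B e₁ z))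
            δφ : ∀ z → δ (B e₁ z) ≡ δ (B e₁ (φ z))
            δφ z = δ-cong (λ e → trans (Bφ z) (trans (cong (b *ᶠ_) e) (let open FS in solve 1 (λ b → b :* (# 0) := (# 0)) refl b))) (λ e → cancelᶠ b≢0 (trans (sym (Bφ z)) e))
            pw : ∀ z → δ (B e₁ z) * v (φ z) * μ z ≡ δ (B e₁ (φ z)) * v (φ z)
            pw z with Sing? z
            ... | yes s = trans (let open RS in solve 2 (λ d v → d :* v :* (# 1) := d :* v) refl (δ (B e₁ z)) (v (φ z))) (cong (_* v (φ z)) (δφ z))
            ... | no ns with B e₁ (φ z) ≟ᶠ 0ᶠ
            ... | no _ = trans (zeroʳ refl) (sym (zeroˡ refl))
            ... | yes e = trans (zeroʳ refl) (sym (zeroʳ (supp (φ z) (λ s → ns (subst Sing (φψ z) (Sing-⊕ (Sing-lc₁ _ s₁) s (linˡ-keep (B-0 _) e)))))))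

          -- The scheme of `line-count` one dimension lower: `N` and `#line` agree for z spanning a
          -- line with e₁, so their difference is concentrated on the multiples of e₁, where they
          -- degenerate to `T` and `#point`.
          point-count : ∀ {e₁ e₂ e₃} → Plane e₁ e₂ e₃ → #point e₁ ≡ (q + 1#) * T e₁
          point-count {e₁} {e₂} {e₃} p = ≢⇒cancel (c≢0 (q*-mono (≥1-* 1≤q-1 1≤q+1))) (begin
            q * ((q - 1#) * (q + 1#)) * S
              ≡⟨ (let open RS in solve 4 (λ q A D S → q :* ((q :- (# 1)) :* (q :+ (# 1))) :* S := q :* ((q :- (# 1)) :* (q :+ (# 1))) :* ((q :+ (# 1)) :* (D :+ q :* q :* A)) :- (q :* q :* q :* q :* D :+ (q :* q :* q :* q :* q :- q :* q :* q :* q) :* A :+ q :* (q :* q :* q :* q :* q :* A :+ (q :- (# 1)) :* (q :* D)) :- q :* q :* q :* S :- q :* (D :+ q :* q :* A :- S))) refl q A D S) ⟩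
            q * ((q - 1#) * (q + 1#)) * ((q + 1#) * T e₁) - (q * q * q * q * D + (q * q * q * q * q - q * q * q * q) * A + q * (q * q * q * q * q * A + (q - 1#) * (q * D)) - q * q * q * S - q * (T e₁ - S))
              ≡⟨ cong (λ z → q * ((q - 1#) * (q + 1#)) * ((q + 1#) * T e₁) - (z - q * (T e₁ - S))) (trans (sym total) (trans concentrated on-pt)) ⟩
            q * ((q - 1#) * (q + 1#)) * ((q + 1#) * T e₁) - (q * (T e₁ - S) - q * (T e₁ - S))
              ≡⟨ (let open RS in solve 2 (λ x y → x :- (y :- y) := x) refl (q * ((q - 1#) * (q + 1#)) * ((q + 1#) * T e₁)) (q * (T e₁ - S))) ⟩
            q * ((q - 1#) * (q + 1#)) * ((q + 1#) * T e₁) ∎)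
            where
            open Plane p
            ≥1-* : ∀ {x y} → 1# ≤ x → 1# ≤ y → 1# ≤ x * y
            ≥1-* {x} {y} a b = ≤-trans b (≤-diff ((x - 1#) * y) (*-nonneg (diff-≤ a) (≤-trans 0≤1 b)) (let open RS in solve 2 (λ x y → x :* y := y :+ (x :- (# 1)) :* y) refl x y))
            1≤q+1 : 1# ≤ q + 1#
            1≤q+1 = ≤-diff q 0≤q (let open RS in solve 1 (λ q → q :+ (# 1) := (# 1) :+ q) refl q)
            D = ⟪ (λ w → δ (B e₁ w)) ⟫
            A = pt e₁
            S = #point e₁
            G : V n → Carrier
            G z = δ (B e₁ z) * (N e₁ z - #line e₁ z) * μ z
            module G = Weight G (λ w ns → zeroʳ (𝟙-no (Sing? w) ns))
            concentrated : ∑V G ≡ G.pt e₁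
            concentrated = trans (sum-cong (vecs n) pw) (sym (G.InPlaneOf.pt₁ p))
              where
              pw : ∀ w → G w ≡ D₃ e₁ e₂ e₃ w * (δ (B w f₂) * δ (B w f₃)) * G w
              pw w with Sing? w | B e₁ w ≟ᶠ 0ᶠ
              ... | no ns | _ = trans (zeroʳ refl) (sym (zeroʳ (zeroʳ refl)))
              ... | yes _ | no _ = trans (zeroˡ (zeroˡ refl)) (sym (zeroʳ (zeroˡ (zeroˡ refl))))
              ... | yes s | yes z₁ with extend₂ p s z₁
              ... | inj₁ (_ , pw) = trans (zeroˡ x) (sym (zeroʳ (zeroˡ x)))
                where
                x : 1# * (N e₁ w - #line e₁ w) ≡ 0#
                x = zeroʳ (trans (cong (λ x → N e₁ w - x) (line-count pw)) (let open RS in solve 1 (λ s → s :- s := (# 0)) refl (N e₁ w)))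
              ... | inj₂ (a , e) = trans (let open RS in solve 1 (λ g → g := (# 1) :* g) refl (1# * (N e₁ w - #line e₁ w) * 1#)) (cong (_* (1# * (N e₁ w - #line e₁ w) * 1#)) (sym one))
                where
                one : 1# * (δ (B e₂ w) * δ (B e₃ w)) * (δ (B w f₂) * δ (B w f₃)) ≡ 1#
                one = trans (cong (λ x → x * (δ (B e₂ w) * δ (B e₃ w)) * (δ (B w f₂) * δ (B w f₃))) (sym (δ-1 z₁))) (in-point p a e)
            on-pt : G.pt e₁ ≡ q * (T e₁ - S)
            on-pt = ∑F-c _ _ Glc
              where
              Glc : ∀ a → G (0ⱽ ⊕ a ∙ e₁) ≡ T e₁ - S
              Glc a = trans (cong₂ _*_ (cong₂ _*_ (δ-1 (linʳ-keep (B-0ʳ _) (B-self s₁))) (cong₂ _-_ NT (sum-cong∈ ps (λ ρ m → D-lc₁ ρ m)))) (μ-1 (Sing-lc₁ a s₁)))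
                (let open RS in solve 1 (λ x → (# 1) :* x :* (# 1) := x) refl (T e₁ - S))
                where
                NT : N e₁ (0ⱽ ⊕ a ∙ e₁) ≡ T e₁
                NT = trans (cong₂ (λ x y → x + q * y) (sum-cong (vecs n) (λ w → cong (_* v w) (pe w))) (line-on-point e₁ a)) (let open RS in solve 3 (λ d q x → d :+ q :* (q :* x) := d :+ q :* q :* x) refl D q A)
                  where
                  pe : ∀ w → δ (B e₁ w) * δ (B (0ⱽ ⊕ a ∙ e₁) w) ≡ δ (B e₁ w)
                  pe w with B e₁ w ≟ᶠ 0ᶠ
                  ... | no _ = zeroˡ refl
                  ... | yes e = trans (cong (1# *_) (δ-1 (linˡ-keep (B-0 w) e))) (let open RS in solve 0 ((# 1) :* (# 1) := (# 1)) refl)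
                D-lc₁ : ∀ ρ → ρ ∈ ps → D³ ρ e₁ * D³ ρ (0ⱽ ⊕ a ∙ e₁) ≡ D³ ρ e₁
                D-lc₁ ρ m with in-list ρ m e₁
                ... | inj₁ d = trans (zeroˡ d) (sym d)
                ... | inj₂ (_ , inPlane x y z) = trans (cong (D³ ρ e₁ *_) (M.InPlaneOf.D-in (ps-plane m)
                  (inPlane (linʳ-keep (B-0ʳ _) x) (linʳ-keep (B-0ʳ _) y) (linʳ-keep (B-0ʳ _) z)))) (let open RS in solve 1 (λ d → d :* (# 1) := d) refl (D³ ρ e₁))
            inner : ∀ w → Sing w → δ (B e₁ w) * M.⟪ (λ z → δ (B e₁ z) * δ (B z w)) ⟫
              ≡ q * q * q * q * δ (B e₁ w) + (q * q * q * q * q - q * q * q * q) * (D₃ e₁ e₂ e₃ w * (δ (B w f₂) * δ (B w f₃)))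
            inner w s with B e₁ w ≟ᶠ 0ᶠ
            ... | no _ = trans (zeroˡ refl) (sym (trans (cong₂ _+_ (zeroʳ refl) (zeroʳ (zeroˡ (zeroˡ refl)))) (let open RS in solve 0 ((# 0) :+ (# 0) := (# 0)) refl)))
            ... | yes z₁ with extend₂ p s z₁
            ... | inj₁ (_ , pw) = trans (cong (1# *_) (trans (M.by {d = λ z → δ (B e₁ z) * δ (B w z)} refl refl (λ z _ → cong (δ (B e₁ z) *_) (δ-sym z w))) (μ-perp₂ pw)))
                  (trans (let open RS in solve 1 (λ q → (# 1) :* (q :* q :* q :* q) := q :* q :* q :* q :* (# 1) :+ (q :* q :* q :* q :* q :- q :* q :* q :* q) :* (# 0)) refl q) (cong (λ x → q * q * q * q * 1# + (q * q * q * q * q - q * q * q * q) * x) (sym zero')))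
              where
              zero' : 1# * (δ (B e₂ w) * δ (B e₃ w)) * (δ (B w f₂) * δ (B w f₃)) ≡ 0#
              zero' = trans (cong (λ x → x * (δ (B e₂ w) * δ (B e₃ w)) * (δ (B w f₂) * δ (B w f₃))) (sym (δ-1 z₁))) (off-point-0 p s pw)
            ... | inj₂ (a , e) = trans (cong (1# *_) (trans (M.by {d = λ z → δ (B e₁ z)} refl refl (λ z _ → zw z)) (μ-perp₁ p)))
                  (trans (let open RS in solve 1 (λ q → (# 1) :* (q :* q :* q :* q :* q) := q :* q :* q :* q :* (# 1) :+ (q :* q :* q :* q :* q :- q :* q :* q :* q) :* (# 1)) refl q) (cong (λ x → q * q * q * q * 1# + (q * q * q * q * q - q * q * q * q) * x) (sym one)))
              where
              one : 1# * (δ (B e₂ w) * δ (B e₃ w)) * (δ (B w f₂) * δ (B w f₃)) ≡ 1#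
              one = trans (cong (λ x → x * (δ (B e₂ w) * δ (B e₃ w)) * (δ (B w f₂) * δ (B w f₃))) (sym (δ-1 z₁))) (in-point p a e)
              zw : ∀ z → δ (B e₁ z) * δ (B z w) ≡ δ (B e₁ z)
              zw z with B e₁ z ≟ᶠ 0ᶠ
              ... | no _ = zeroˡ refl
              ... | yes x = trans (cong (1# *_) (δ-1 (trans (cong (B z) e) (linʳ-keep (B-0ʳ _) (0-sym x))))) (let open RS in solve 0 ((# 1) :* (# 1) := (# 1)) refl)
            lines : M.⟪ (λ z → δ (B e₁ z) * line e₁ z) ⟫ ≡ q * q * q * q * q * A + (q - 1#) * (q * D)
            lines = begin
              ∑V (λ z → δ (B e₁ z) * line e₁ z * μ z)
                ≡⟨ sum-cong (vecs n) (λ z → trans (let open RS in solve 3 (λ d l m → d :* l :* m := d :* m :* l) refl (δ (B e₁ z)) (line e₁ z) (μ z)) (trans (sym (sum-* elems _ _)) (sum-cong elems (λ a → trans (sym (sum-* elems _ _))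
                     (sum-cong elems (λ b → (let open RS in solve 3 (λ d l m → d :* m :* l := d :* l :* m) refl (δ (B e₁ z)) (v (0ⱽ ⊕ a ∙ e₁ ⊕ b ∙ z)) (μ z)))))))) ⟩
              ∑V (λ z → ∑F (λ a → ∑F (λ b → h a b z))) ≡⟨ sum-swap (vecs n) elems _ ⟩
              ∑F (λ a → ∑V (λ z → ∑F (λ b → h a b z))) ≡⟨ sum-cong elems (λ a → sum-swap (vecs n) elems _) ⟩
              ∑F (λ a → ∑F (λ b → ∑V (h a b))) ≡⟨ sum-swap elems elems _ ⟩
              ∑F (λ b → ∑F (λ a → ∑V (h a b))) ≡⟨ ∑F-split _ (q * D) (λ b b≢0 → ∑F-c _ _ (λ a → v-scaled a b b≢0 s₁)) ⟩
              ∑F (λ a → ∑V (h a 0ᶠ)) + (q - 1#) * (q * D) ≡⟨ cong (_+ (q - 1#) * (q * D)) (trans (sum-cong elems h0) (sum-* elems _ _)) ⟩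
              _ ∎
              where
              h : K → K → V n → Carrier
              h a b z = δ (B e₁ z) * v (0ⱽ ⊕ a ∙ e₁ ⊕ b ∙ z) * μ z
              h0 : ∀ a → ∑V (h a 0ᶠ) ≡ q * q * q * q * q * v (0ⱽ ⊕ a ∙ e₁)
              h0 a = trans (sum-cong (vecs n) (λ z → trans (cong (λ u → δ (B e₁ z) * v u * μ z) (vsolve ((𝟘 ⊞ a ⊠ (v# 0)) ⊞ 0ᶠ ⊠ (v# 1)) (𝟘 ⊞ a ⊠ (v# 0)) (e₁ ∷ z ∷ []) (λ { (e₁ᶜ ∷ zᶜ ∷ []) → (let open FS in solve 3 (λ e₁ z a → (# 0) :+ a :* e₁ :+ (# 0) :* z := (# 0) :+ a :* e₁) refl e₁ᶜ zᶜ a) })))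
                  (let open RS in solve 3 (λ d l m → d :* l :* m := d :* m :* l) refl (δ (B e₁ z)) (v (0ⱽ ⊕ a ∙ e₁)) (μ z))))
                (trans (sum-*ʳ (vecs n) _ _) (cong (_* v (0ⱽ ⊕ a ∙ e₁)) (μ-perp₁ p)))
            total : ∑V G ≡ q * q * q * q * D + (q * q * q * q * q - q * q * q * q) * A + q * (q * q * q * q * q * A + (q - 1#) * (q * D)) - q * q * q * S
            total = begin
              ∑V G ≡⟨ sum-cong (vecs n) (λ z → (let open RS in solve 6 (λ d x q l s m → d :* (x :+ q :* l :- s) :* m := d :* x :* m :+ (q :* (d :* l :* m) :+ ( :- (# 1)) :* (d :* s :* m))) refl (δ (B e₁ z)) (⟪ (λ w → δ (B e₁ w) * δ (B z w)) ⟫) q (line e₁ z) (#line e₁ z) (μ z))) ⟩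
              ∑V (λ z → δ (B e₁ z) * ⟪ (λ w → δ (B e₁ w) * δ (B z w)) ⟫ * μ z + (q * (δ (B e₁ z) * line e₁ z * μ z) + - 1# * (δ (B e₁ z) * #line e₁ z * μ z)))
                ≡⟨ trans (sum-+ (vecs n) _ _) (cong₂ _+_ refl (trans (sum-+ (vecs n) _ _) (cong₂ _+_ (sum-* (vecs n) q _) (sum-* (vecs n) (- 1#) _)))) ⟩
              M.⟪ (λ z → δ (B e₁ z) * ⟪ (λ w → δ (B e₁ w) * δ (B z w)) ⟫) ⟫ + (q * M.⟪ (λ z → δ (B e₁ z) * line e₁ z) ⟫ + - 1# * M.⟪ (λ z → δ (B e₁ z) * #line e₁ z) ⟫)
                ≡⟨ cong₂ _+_ (trans (exchange-sums _ (λ w → δ (B e₁ w)) (λ z w → δ (B z w))) (by refl (plus (times (q * q * q * q) refl) (times _ (InPlaneOf.pt₁ p))) inner))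
                     (cong₂ (λ x y → q * x + - 1# * y) lines (exchange-list _ (λ ρ z → D³ ρ e₁ * D³ ρ z) _ (λ ρ m → D-perp ρ m s₁))) ⟩
              q * q * q * q * D + (q * q * q * q * q - q * q * q * q) * A + (q * (q * q * q * q * q * A + (q - 1#) * (q * D)) + - 1# * (q * q * q * S))
                ≡⟨ (let open RS in solve 3 (λ x y z → x :+ (y :+ ( :- (# 1)) :* z) := x :+ y :- z) refl (q * q * q * q * D + (q * q * q * q * q - q * q * q * q) * A) (q * (q * q * q * q * q * A + (q - 1#) * (q * D))) (q * q * q * S)) ⟩
              _ ∎

          -- The last application of the scheme: by `point-count` the difference is concentrated at
          -- z = 0, where `T` degenerates to `X` and every plane of the list is counted. This
          -- identifies X with the parameter.
          total-count : nat (length ps) ≡ (q + 1#) * (q * q + 1#) * X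
          total-count = ≢⇒cancel (c≢0 (≥1-* 1≤q-1 (≤-diff (q * q + q) (≤-trans (≤-reflexive (let open RS in solve 0 ((# 0) := (# 0) :+ (# 0)) refl)) (+-mono (*-nonneg 0≤q 0≤q) 0≤q)) (let open RS in solve 1 (λ q → q :* q :+ q :+ (# 1) := (# 1) :+ (q :* q :+ q)) refl q)))) (begin
            (q - 1#) * (q * q + q + 1#) * S
              ≡⟨ (let open RS in solve 3 (λ q X S → (q :- (# 1)) :* (q :* q :+ q :+ (# 1)) :* S := (q :- (# 1)) :* (q :* q :+ q :+ (# 1)) :* ((q :+ (# 1)) :* (q :* q :+ (# 1)) :* X) :- ((q :+ (# 1)) :* (q :* q :* q :* q :* q :* X :+ q :* q :* ((q :- (# 1)) :* X)) :- q :* q :* q :* S :- ((q :+ (# 1)) :* X :- S))) refl q X S) ⟩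
            (q - 1#) * (q * q + q + 1#) * ((q + 1#) * (q * q + 1#) * X) - ((q + 1#) * (q * q * q * q * q * X + q * q * ((q - 1#) * X)) - q * q * q * S - ((q + 1#) * X - S))
              ≡⟨ cong (λ z → (q - 1#) * (q * q + q + 1#) * ((q + 1#) * (q * q + 1#) * X) - (z - ((q + 1#) * X - S))) (trans (sym total) concentrated) ⟩
            (q - 1#) * (q * q + q + 1#) * ((q + 1#) * (q * q + 1#) * X) - ((q + 1#) * X - S - ((q + 1#) * X - S))
              ≡⟨ (let open RS in solve 2 (λ x y → x :- (y :- y) := x) refl ((q - 1#) * (q * q + q + 1#) * ((q + 1#) * (q * q + 1#) * X)) ((q + 1#) * X - S)) ⟩
            (q - 1#) * (q * q + q + 1#) * ((q + 1#) * (q * q + 1#) * X) ∎)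
            where
            ≥1-* : ∀ {x y} → 1# ≤ x → 1# ≤ y → 1# ≤ x * y
            ≥1-* {x} {y} a b = ≤-trans b (≤-diff ((x - 1#) * y) (*-nonneg (diff-≤ a) (≤-trans 0≤1 b)) (let open RS in solve 2 (λ x y → x :* y := y :+ (x :- (# 1)) :* y) refl x y))
            S = nat (length ps)
            G : V n → Carrier
            G z = ((q + 1#) * T z - #point z) * μ z
            0-in : ∀ {r₁ r₂ r₃} → InPlane r₁ r₂ r₃ 0ⱽ
            0-in = inPlane (B-0ʳ _) (B-0ʳ _) (B-0ʳ _)
            #point-0 : #point 0ⱽ ≡ S
            #point-0 = trans (sum-cong∈ ps (λ ρ m → M.InPlaneOf.D-in (ps-plane m) 0-in)) (trans (sum-const ps 1#) (let open RS in solve 1 (λ s → s :* (# 1) := s) refl S))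
            T-0 : T 0ⱽ ≡ X
            T-0 = trans (cong₂ (λ x y → x + q * q * y) (sum-cong (vecs n) (λ w → trans (cong (_* v w) (δ-1 (B-0 w))) (let open RS in solve 1 (λ v → (# 1) :* v := v) refl (v w))))
              (∑F-0 _ (λ a → trans (cong v (vsolve (𝟘 ⊞ a ⊠ 𝟘) 𝟘 ([]) (λ { ([]) → (let open FS in solve 1 (λ a → (# 0) :+ a :* (# 0) := (# 0)) refl a) }))) v-0))) (let open RS in solve 2 (λ x q → x :+ q :* q :* (# 0) := x) refl X q)
            concentrated : ∑V G ≡ (q + 1#) * X - S
            concentrated = trans (sum-single (vecs n) G 0ⱽ (vecs-unique n) (vecs-complete 0ⱽ) off)
              (trans (cong₂ _*_ (cong₂ (λ x y → (q + 1#) * x - y) T-0 #point-0) (μ-1 Sing-0)) (let open RS in solve 1 (λ x → x :* (# 1) := x) refl ((q + 1#) * X - S)))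
              where
              off : ∀ z → z ≢ 0ⱽ → G z ≡ 0#
              off z nz with Sing? z
              ... | no _ = zeroʳ refl
              ... | yes s = zeroˡ (trans (cong (λ x → (q + 1#) * T z - x) (point-count (proj₂ (proj₂ (extend₁ E s nz))))) (let open RS in solve 1 (λ x → x :- x := (# 0)) refl ((q + 1#) * T z)))
            inner : ∀ w → Sing w → 1# * M.⟪ (λ z → 1# * δ (B z w)) ⟫ ≡ q * q * q * q * q * 1# + (q * q * q * q * q * q - q * q * q * q * q) * 𝟙 (w ≟ⱽ 0ⱽ)
            inner w s with w ≟ⱽ 0ⱽ
            ... | yes refl = trans (cong (1# *_) (trans (M.by refl M.X-w (λ z _ → trans (cong (1# *_) (δ-1 (B-0ʳ z))) (let open RS in solve 0 ((# 1) :* (# 1) := (# 1)) refl))) μ-total))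
                (let open RS in solve 1 (λ q → (# 1) :* (q :* q :* q :* q :* q :* q) := q :* q :* q :* q :* q :* (# 1) :+ (q :* q :* q :* q :* q :* q :- q :* q :* q :* q :* q) :* (# 1)) refl q)
            ... | no nz = trans (cong (1# *_) (trans (M.by {d = λ z → δ (B w z)} refl refl (λ z _ → trans (let open RS in solve 1 (λ d → (# 1) :* d := d) refl (δ (B z w))) (δ-sym z w))) (μ-perp₁ (proj₂ (proj₂ (extend₁ E s nz))))))
                (let open RS in solve 1 (λ q → (# 1) :* (q :* q :* q :* q :* q) := q :* q :* q :* q :* q :* (# 1) :+ (q :* q :* q :* q :* q :* q :- q :* q :* q :* q :* q) :* (# 0)) refl q)
            points : ∑V (λ z → pt z * μ z) ≡ (q - 1#) * X
            points = begin
              ∑V (λ z → pt z * μ z) ≡⟨ sum-cong (vecs n) (λ z → sym (sum-*ʳ elems _ _)) ⟩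
              ∑V (λ z → ∑F (λ a → v (0ⱽ ⊕ a ∙ z) * μ z)) ≡⟨ sum-swap (vecs n) elems _ ⟩
              ∑F (λ a → ∑V (λ z → v (0ⱽ ⊕ a ∙ z) * μ z)) ≡⟨ ∑F-split _ X off ⟩
              ∑V (λ z → v (0ⱽ ⊕ 0ᶠ ∙ z) * μ z) + (q - 1#) * X
                ≡⟨ cong (_+ (q - 1#) * X) (trans (sum-cong (vecs n) (λ z → zeroˡ (trans (cong v (vsolve (𝟘 ⊞ 0ᶠ ⊠ (v# 0)) 𝟘 (z ∷ []) (λ { (zᶜ ∷ []) → (let open FS in solve 1 (λ z → (# 0) :+ (# 0) :* z := (# 0)) refl zᶜ) }))) v-0))) (sum-0 (vecs n))) ⟩
              0# + (q - 1#) * X ≡⟨ (let open RS in solve 1 (λ x → (# 0) :+ x := x) refl ((q - 1#) * X)) ⟩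
              (q - 1#) * X ∎
              where
              off : ∀ a → a ≢ 0ᶠ → ∑V (λ z → v (0ⱽ ⊕ a ∙ z) * μ z) ≡ X
              off a a≢0 = trans (sum-cong (vecs n) (λ z → trans (let open RS in solve 2 (λ v m → v :* m := (# 1) :* v :* m) refl (v (0ⱽ ⊕ a ∙ z)) (μ z))
                  (cong₂ (λ x y → x * v y * μ z) (sym (δ-1 (B-0 z))) (vsolve (𝟘 ⊞ a ⊠ (v# 0)) ((𝟘 ⊞ 0ᶠ ⊠ 𝟘) ⊞ a ⊠ (v# 0)) (z ∷ []) (λ { (zᶜ ∷ []) → (let open FS in solve 2 (λ z a → (# 0) :+ a :* z := (# 0) :+ (# 0) :* (# 0) :+ a :* z) refl zᶜ a) })))))
                (trans (v-scaled {0ⱽ} 0ᶠ a a≢0 Sing-0) (sum-cong (vecs n) (λ w → trans (cong (_* v w) (δ-1 (B-0 w))) (let open RS in solve 1 (λ v → (# 1) :* v := v) refl (v w)))))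
            total : ∑V G ≡ (q + 1#) * (q * q * q * q * q * X + q * q * ((q - 1#) * X)) - q * q * q * S
            total = begin
              ∑V G ≡⟨ sum-cong (vecs n) (λ z → (let open RS in solve 5 (λ q t x s m → ((q :+ (# 1)) :* (t :+ q :* q :* x) :- s) :* m := (q :+ (# 1)) :* ((# 1) :* t :* m) :+ ((q :+ (# 1)) :* (q :* q) :* (x :* m) :+ ( :- (# 1)) :* ((# 1) :* s :* m))) refl q (⟪ (λ w → δ (B z w)) ⟫) (pt z) (#point z) (μ z))) ⟩
              _ ≡⟨ trans (sum-+ (vecs n) _ _) (cong₂ _+_ (sum-* (vecs n) (q + 1#) _) (trans (sum-+ (vecs n) _ _) (cong₂ _+_ (sum-* (vecs n) _ _) (sum-* (vecs n) (- 1#) _)))) ⟩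
              (q + 1#) * M.⟪ (λ z → 1# * ⟪ (λ w → δ (B z w)) ⟫) ⟫ + ((q + 1#) * (q * q) * ∑V (λ z → pt z * μ z) + - 1# * M.⟪ (λ z → 1# * #point z) ⟫)
                ≡⟨ cong₂ (λ x y → (q + 1#) * x + y) first (cong₂ (λ x y → (q + 1#) * (q * q) * x + - 1# * y) points last) ⟩
              (q + 1#) * (q * q * q * q * q * X) + ((q + 1#) * (q * q) * ((q - 1#) * X) + - 1# * (q * q * q * S))
                ≡⟨ (let open RS in solve 3 (λ q X S → (q :+ (# 1)) :* (q :* q :* q :* q :* q :* X) :+ ((q :+ (# 1)) :* (q :* q) :* ((q :- (# 1)) :* X) :+ ( :- (# 1)) :* (q :* q :* q :* S)) := (q :+ (# 1)) :* (q :* q :* q :* q :* q :* X :+ q :* q :* ((q :- (# 1)) :* X)) :- q :* q :* q :* S) refl q X S) ⟩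
              _ ∎
              where
              first : M.⟪ (λ z → 1# * ⟪ (λ w → δ (B z w)) ⟫) ⟫ ≡ q * q * q * q * q * X
              first = begin
                _ ≡⟨ sum-cong (vecs n) (λ z → cong (λ x → 1# * x * μ z) (sum-cong (vecs n) (λ w → (let open RS in solve 2 (λ d v → d :* v := (# 1) :* d :* v) refl (δ (B z w)) (v w))))) ⟩
                M.⟪ (λ z → 1# * ⟪ (λ w → 1# * δ (B z w)) ⟫) ⟫ ≡⟨ exchange-sums (λ _ → 1#) (λ _ → 1#) (λ z w → δ (B z w)) ⟩
                ⟪ (λ w → 1# * M.⟪ (λ z → 1# * δ (B z w)) ⟫) ⟫ ≡⟨ by refl (plus (times (q * q * q * q * q) X-w) (times (q * q * q * q * q * q - q * q * q * q * q) (sym (∑V-δ 0ⱽ v)))) inner ⟩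
                q * q * q * q * q * X + (q * q * q * q * q * q - q * q * q * q * q) * v 0ⱽ ≡⟨ cong (λ x → q * q * q * q * q * X + (q * q * q * q * q * q - q * q * q * q * q) * x) v-0 ⟩
                q * q * q * q * q * X + (q * q * q * q * q * q - q * q * q * q * q) * 0# ≡⟨ (let open RS in solve 2 (λ a b → a :+ b :* (# 0) := a) refl (q * q * q * q * q * X) (q * q * q * q * q * q - q * q * q * q * q)) ⟩
                _ ∎
              last : M.⟪ (λ z → 1# * #point z) ⟫ ≡ q * q * q * S
              last = trans (exchange-list (λ _ → 1#) D³ (λ _ → 1#) (λ ρ m → trans (M.by {d = D³ ρ} refl refl (λ z _ → (let open RS in solve 1 (λ d → (# 1) :* d := d) refl (D³ ρ z)))) (trans (μ-plane (ps-plane m)) (let open RS in solve 1 (λ q → q :* q :* q := q :* q :* q :* (# 1)) refl q))))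
                (cong (q * q * q *_) (trans (sum-const ps 1#) (let open RS in solve 1 (λ s → s :* (# 1) := s) refl S)))

    -- Cameron-Liebler sets and their removable parts

    record OddSymplectic : Set where
      field
        ε≡-1 : ε ≡ -ᶠ 1ᶠ
        2≢0 : 1ᶠ +ᶠ 1ᶠ ≢ 0ᶠ
        mkfan : ∀ {a b c u} → Plane a b c → Sing u → B a u ≡ 0ᶠ → B b u ≡ 0ᶠ → B c u ≢ 0ᶠ → Fan a b c (λ s → u ⊕ s ∙ c)

    record Quadric : Set where
      field
        {e₁ e₂ e₃} : V n
        base : Plane e₁ e₂ e₃
        frame : Frame base

      form : V n → K
      form = hyp base

      -- Three spanning vectors are enough in the good case: by `hyp-on-plane` the zeros of the form
      -- on a plane are those of a linear functional.
      Contains : V n → V n → V n → Set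
      Contains a b c = form a ≡ 0ᶠ × form b ≡ 0ᶠ × form c ≡ 0ᶠ

      contains? : ∀ a b c → Dec (Contains a b c)
      contains? a b c with form a ≟ᶠ 0ᶠ | form b ≟ᶠ 0ᶠ | form c ≟ᶠ 0ᶠ
      ... | yes x | yes y | yes z = yes (x , y , z)
      ... | no x | _ | _ = no (x ∘ proj₁)
      ... | yes _ | no y | _ = no (y ∘ proj₁ ∘ proj₂)
      ... | yes _ | yes _ | no z = no (z ∘ proj₂ ∘ proj₂)

    -- A weight whose sum over each plane is 0 or 1, that is, a degree one
    -- Cameron–Liebler set together with a preimage of its characteristic vector.
    record CL : Set where
      field
        v : V n → Carrier
        supp : ∀ w → ¬ Sing w → v w ≡ 0#
        v-0 : v 0ⱽ ≡ 0#
      field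
        binary : ∀ {a b c} → Plane a b c → Weight.f v supp a b c ≡ 0# ⊎ Weight.f v supp a b c ≡ 1#

      f : V n → V n → V n → Carrier
      f = Weight.f v supp

      T : V n → Carrier
      T = Weight.T v supp

      X : Carrier
      X = Weight.X v supp

    f≡0⇒f≢1 : ∀ {x} → x ≡ 0# → x ≢ 1#
    f≡0⇒f≢1 z o = 0≢1 (trans (sym z) o)

    module _ (L M : CL) (M⊆L : ∀ {a b c} → Plane a b c → CL.f M a b c ≡ 1# → CL.f L a b c ≡ 1#) where
      private
        module L = CL L
        module M = CL M
        v' : V n → Carrier
        v' w = L.v w - M.v w
        supp' : ∀ w → ¬ Sing w → v' w ≡ 0#
        supp' w ns = trans (cong₂ _-_ (L.supp w ns) (M.supp w ns)) (let open RS in solve 0 ((# 0) :- (# 0) := (# 0)) refl)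

      minus-f : ∀ a b c → Weight.f v' supp' a b c ≡ L.f a b c - M.f a b c
      minus-f a b c = trans (sum-cong (vecs n) (λ w → (let open RS in solve 3 (λ d x y → d :* (x :- y) := d :* x :+ ( :- (# 1)) :* (d :* y)) refl (D₃ a b c w) (L.v w) (M.v w))))
        (trans (sum-+ (vecs n) _ _) (trans (cong (L.f a b c +_) (sum-* (vecs n) (- 1#) _)) (let open RS in solve 2 (λ x y → x :+ ( :- (# 1)) :* y := x :- y) refl (L.f a b c) (M.f a b c))))

      minus : CL
      minus = record
        { v = v' ; supp = supp' ; v-0 = trans (cong₂ _-_ L.v-0 M.v-0) (let open RS in solve 0 ((# 0) :- (# 0) := (# 0)) refl) ; binary = binary }
        where
        binary : ∀ {a b c} → Plane a b c → Weight.f v' supp' a b c ≡ 0# ⊎ Weight.f v' supp' a b c ≡ 1#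
        binary {a} {b} {c} p with M.binary p | L.binary p
        ... | inj₁ m | inj₁ l = inj₁ (trans (minus-f a b c) (trans (cong₂ _-_ l m) (let open RS in solve 0 ((# 0) :- (# 0) := (# 0)) refl)))
        ... | inj₁ m | inj₂ l = inj₂ (trans (minus-f a b c) (trans (cong₂ _-_ l m) (let open RS in solve 0 ((# 1) :- (# 0) := (# 1)) refl)))
        ... | inj₂ m | _ = inj₁ (trans (minus-f a b c) (trans (cong₂ _-_ (M⊆L p m) m) (let open RS in solve 0 ((# 1) :- (# 1) := (# 0)) refl)))

      minus-X : CL.X minus ≡ L.X - M.X
      minus-X = trans (sum-cong (vecs n) (λ w → (let open RS in solve 2 (λ x y → x :- y := x :+ ( :- (# 1)) :* y) refl (L.v w) (M.v w))))
        (trans (sum-+ (vecs n) _ _) (trans (cong (L.X +_) (sum-* (vecs n) (- 1#) _)) (let open RS in solve 2 (λ x y → x :+ ( :- (# 1)) :* y := x :- y) refl L.X M.X)))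

      minus-in : ∀ {a b c} → M.f a b c ≡ 1# → Plane a b c → CL.f minus a b c ≡ 0#
      minus-in {a} {b} {c} m p = trans (minus-f a b c) (trans (cong₂ _-_ (M⊆L p m) m) (let open RS in solve 0 ((# 1) :- (# 1) := (# 0)) refl))

      minus-out : ∀ {a b c} → M.f a b c ≡ 0# → CL.f minus a b c ≡ L.f a b c
      minus-out {a} {b} {c} m = trans (minus-f a b c) (trans (cong (λ x → L.f a b c - x) m) (let open RS in solve 1 (λ x → x :- (# 0) := x) refl (L.f a b c)))

    module Removal (fans : ∀ {e₁ e₂ e₃} → Plane e₁ e₂ e₃ → ∃ (Fan e₁ e₂ e₃))
      {E₁ E₂ E₃ : V n} (E : Plane E₁ E₂ E₃) (kind : Good P ⊎ OddSymplectic) where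

      open PlaneCount using (μ-plane; μ-total; μ; μ-1)

      abstract
        plane? : ∀ a b c → Dec (Plane a b c)
        plane? a b c with Sing? a | a ≟ⱽ 0ⱽ
        ... | no ns | _ = no (ns ∘ Plane.s₁)
        ... | yes _ | yes z = no (λ p → nonzero (Plane.d₁₁ p) z)
        ... | yes sa | no nz with Sing? b | B a b ≟ᶠ 0ᶠ
        ... | no ns | _ = no (ns ∘ Plane.s₂)
        ... | yes _ | no na = no (na ∘ Plane.p₁₂)
        ... | yes sb | yes ab with extend₂ (proj₂ (proj₂ (extend₁ E sa nz))) sb ab
        ... | inj₂ (s , e) = no (λ p → 1≢0ᶠ (Plane.d₂₂ p) (trans (cong (λ x → B x (Plane.f₂ p)) e) (linˡ-keep (B-0 _) (Plane.d₁₂ p))))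
        ... | inj₁ (_ , p₂) with Sing? c | B a c ≟ᶠ 0ᶠ | B b c ≟ᶠ 0ᶠ
        ... | no ns | _ | _ = no (ns ∘ Plane.s₃)
        ... | yes _ | no na | _ = no (na ∘ Plane.p₁₃)
        ... | yes _ | yes _ | no nb = no (nb ∘ Plane.p₂₃)
        ... | yes sc | yes ac | yes bc with extend₃ p₂ sc ac bc
        ... | inj₁ p₃ = yes p₃
        ... | inj₂ (s , t , e) = no (λ p → 1≢0ᶠ (Plane.d₃₃ p) (trans (cong (λ x → B x (Plane.f₃ p)) e) (linˡ-keep (linˡ-keep (B-0 _) (Plane.d₁₃ p)) (Plane.d₂₃ p))))

      common-plane : ∀ u w → Sing u → u ≢ 0ⱽ → Sing w → B u w ≡ 0ᶠ → ∃ λ a → ∃ λ b → ∃ λ c → Plane a b c × InPlane a b c u × InPlane a b c w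
      common-plane u w su nz sw uw with extend₁ E su nz
      ... | d , e , p with extend₂ p sw uw
      ... | inj₁ (_ , p') = _ , _ , _ , p' , inPlane (B-self su) (0-sym uw) (0-sym (Plane.p₁₃ p')) , inPlane uw (B-self sw) (0-sym (Plane.p₂₃ p'))
      ... | inj₂ (s , refl) = _ , _ , _ , p , inPlane (B-self su) (0-sym (Plane.p₁₂ p)) (0-sym (Plane.p₁₃ p))
          , inPlane uw (linʳ-keep (B-0ʳ _) (0-sym (Plane.p₁₂ p))) (linʳ-keep (B-0ʳ _) (0-sym (Plane.p₁₃ p)))

      -- Both inclusions between the set and its parts are recorded: `∋quadric` and `∋pencil` are
      -- what separates a newly added part from the old ones. `odd⇒0` ensures that the quadrics
      -- present belong to a good space.
      record Solution (L : CL) : Set where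
        open CL L
        field
          α k : ℕ
          X≡ : X ≡ 2# * nat α + nat k
          quadric : Fin α → Quadric
          point : Fin k → V n
          disjoint : ∀ i j → i ≢ j → ∀ {a b c} → Plane a b c → ¬ (Quadric.Contains (quadric i) a b c × Quadric.Contains (quadric j) a b c)
          sing : ∀ j → Sing (point j) × point j ≢ 0ⱽ
          noncollinear : ∀ i j → i ≢ j → B (point i) (point j) ≢ 0ᶠ
          off : ∀ j i → Quadric.form (quadric i) (point j) ≢ 0ᶠ
          members : ∀ {a b c} → Plane a b c → f a b c ≡ 1# → (∃ λ i → Quadric.Contains (quadric i) a b c) ⊎ (∃ λ j → InPlane a b c (point j))
          ∋quadric : ∀ {a b c} → Plane a b c → ∀ i → Quadric.Contains (quadric i) a b c → f a b c ≡ 1#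
          ∋pencil : ∀ {a b c} → Plane a b c → ∀ j → InPlane a b c (point j) → f a b c ≡ 1#
          odd⇒0 : OddSymplectic → α ≡ 0

      infixr 5 _◂_
      _◂_ : ∀ {A : Set} {k} → A → (Fin k → A) → Fin (suc k) → A
      (a ◂ g) Fin.zero = a
      (a ◂ g) (Fin.suc i) = g i

      plane-on-quadric : ∀ {k} (Q : Fin k → Quadric) → (OddSymplectic → k ≡ 0) → ∀ i u → Sing u → u ≢ 0ⱽ → Quadric.form (Q i) u ≡ 0ᶠ →
        ∃₂ λ a b → Plane u a b × Quadric.Contains (Q i) u a b
      plane-on-quadric {k} Q z i u su nz h = on kind
        where
        none : ∀ {m} → m ≡ 0 → Fin m → ⊥
        none refl ()
        on : Good P ⊎ OddSymplectic → ∃₂ λ a b → Plane u a b × Quadric.Contains (Q i) u a b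
        on (inj₁ good) = let (a , b , p , ha , hb) = FromGood.OnQuadric.plane-through P good (Quadric.base (Q i)) (Quadric.frame (Q i)) u su nz h
                         in a , b , p , h , ha , hb
        on (inj₂ odd) = ⊥-elim (none (z odd) i)

      in-own : ∀ {u a b} → Plane u a b → InPlane u a b u
      in-own p = inPlane (B-self s₁) (0-sym p₁₂) (0-sym p₁₃)
        where open Plane p

      -- All separation statements have one reason: planes on e are missing from the remainder,
      -- while every old part is inside it. A vertex collinear with e shares a plane with e, and a
      -- quadric through e has a plane on e.
      module AddPencil (L M : CL) (M⊆L : ∀ {a b c} → Plane a b c → CL.f M a b c ≡ 1# → CL.f L a b c ≡ 1#) (XM : CL.X M ≡ 1#)
        (e : V n) (se : Sing e) (e≢0 : e ≢ 0ⱽ)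
        (M-in : ∀ {a b c} → Plane a b c → InPlane a b c e → CL.f M a b c ≡ 1#)
        (M-out : ∀ {a b c} → Plane a b c → ¬ InPlane a b c e → CL.f M a b c ≡ 0#)
        (S : Solution (minus L M M⊆L)) where
        open Solution S

        removed : ∀ {a b c} → Plane a b c → InPlane a b c e → CL.f (minus L M M⊆L) a b c ≢ 1#
        removed p i = f≡0⇒f≢1 (minus-in L M M⊆L (M-in p i) p)

        kept : ∀ {a b c} → Plane a b c → CL.f (minus L M M⊆L) a b c ≡ 1# → CL.f L a b c ≡ 1#
        kept p o with CL.binary M p
        ... | inj₁ z = trans (sym (minus-out L M M⊆L z)) o
        ... | inj₂ m = M⊆L p m

        apart : ∀ j → B e (point j) ≢ 0ᶠ
        apart j z = let (a , b , c , p , ie , ij) = common-plane e (point j) se e≢0 (proj₁ (sing j)) z in removed p ie (∋pencil p j ij)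

        solution : Solution L
        solution = record
          { α = α ; k = suc k
          ; X≡ = begin
              CL.X L ≡⟨ (let open RS in solve 1 (λ x → x := x :- (# 1) :+ (# 1)) refl (CL.X L)) ⟩
              CL.X L - 1# + 1# ≡⟨ cong (λ y → CL.X L - y + 1#) XM ⟨
              CL.X L - CL.X M + 1# ≡⟨ cong (_+ 1#) (minus-X L M M⊆L) ⟨
              CL.X (minus L M M⊆L) + 1# ≡⟨ cong (_+ 1#) X≡ ⟩
              2# * nat α + nat k + 1# ≡⟨ (let open RS in solve 2 (λ a k → a :+ k :+ (# 1) := a :+ ((# 1) :+ k)) refl (2# * nat α) (nat k)) ⟩
              2# * nat α + (1# + nat k) ≡⟨ cong (2# * nat α +_) (nat-suc k) ⟨
              2# * nat α + nat (suc k) ∎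
          ; quadric = quadric ; point = e ◂ point ; disjoint = disjoint
          ; sing = λ { Fin.zero → se , e≢0 ; (Fin.suc j) → sing j }
          ; noncollinear = λ { Fin.zero Fin.zero d → ⊥-elim (d refl) ; Fin.zero (Fin.suc j) _ → apart j ; (Fin.suc i) Fin.zero _ → apart i ∘ 0-sym
                             ; (Fin.suc i) (Fin.suc j) d → noncollinear i j (λ { refl → d refl }) }
          ; off = λ { Fin.zero i h → let (a , b , p , c) = plane-on-quadric quadric odd⇒0 i e se e≢0 h in removed p (in-own p) (∋quadric p i c)
                    ; (Fin.suc j) i → off j i }
          ; members = mem
          ; ∋quadric = λ p i c → kept p (∋quadric p i c)
          ; ∋pencil = λ { p Fin.zero i → M⊆L p (M-in p i) ; p (Fin.suc j) i → kept p (∋pencil p j i) }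
          ; odd⇒0 = odd⇒0 }
          where
          mem : ∀ {a b c} → Plane a b c → CL.f L a b c ≡ 1# → (∃ λ i → Quadric.Contains (quadric i) a b c) ⊎ (∃ λ j → InPlane a b c ((e ◂ point) j))
          mem {a} {b} {c} p o = split (Weight.InPlaneOf.in? (CL.v L) (CL.supp L) p e)
            where
            split : Dec (InPlane a b c e) → _
            split (yes i) = inj₂ (Fin.zero , i)
            split (no ni) = Sum.map₂ (λ (j , r) → Fin.suc j , r) (members p (trans (minus-out L M M⊆L (M-out p ni)) o))

      module AddQuadric (good : Good P) (L M : CL) (M⊆L : ∀ {a b c} → Plane a b c → CL.f M a b c ≡ 1# → CL.f L a b c ≡ 1#) (XM : CL.X M ≡ 2#)
        (H : Quadric)
        (M-in : ∀ {a b c} → Plane a b c → Quadric.Contains H a b c → CL.f M a b c ≡ 1#)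
        (M-out : ∀ {a b c} → Plane a b c → ¬ Quadric.Contains H a b c → CL.f M a b c ≡ 0#)
        (S : Solution (minus L M M⊆L)) where
        open Solution S
        private module H = Quadric H

        removed : ∀ {a b c} → Plane a b c → H.Contains a b c → CL.f (minus L M M⊆L) a b c ≢ 1#
        removed p i = f≡0⇒f≢1 (minus-in L M M⊆L (M-in p i) p)

        kept : ∀ {a b c} → Plane a b c → CL.f (minus L M M⊆L) a b c ≡ 1# → CL.f L a b c ≡ 1#
        kept p o with CL.binary M p
        ... | inj₁ z = trans (sym (minus-out L M M⊆L z)) o
        ... | inj₂ m = M⊆L p m

        solution : Solution L
        solution = record
          { α = suc α ; k = k
          ; X≡ = begin
              CL.X L ≡⟨ (let open RS in solve 1 (λ x → x := x :- ((# 1) :+ (# 1)) :+ ((# 1) :+ (# 1))) refl (CL.X L)) ⟩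
              CL.X L - 2# + 2# ≡⟨ cong (λ y → CL.X L - y + 2#) XM ⟨
              CL.X L - CL.X M + 2# ≡⟨ cong (_+ 2#) (minus-X L M M⊆L) ⟨
              CL.X (minus L M M⊆L) + 2# ≡⟨ cong (_+ 2#) X≡ ⟩
              2# * nat α + nat k + 2# ≡⟨ (let open RS in solve 2 (λ a k → ((# 1) :+ (# 1)) :* a :+ k :+ ((# 1) :+ (# 1)) := ((# 1) :+ (# 1)) :* ((# 1) :+ a) :+ k) refl (nat α) (nat k)) ⟩
              2# * (1# + nat α) + nat k ≡⟨ cong (λ z → 2# * z + nat k) (nat-suc α) ⟨
              2# * nat (suc α) + nat k ∎
          ; quadric = H ◂ quadric ; point = point
          ; disjoint = λ { Fin.zero Fin.zero d _ _ → d refl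
                         ; Fin.zero (Fin.suc j) _ p (x , y) → removed p x (∋quadric p j y)
                         ; (Fin.suc i) Fin.zero _ p (x , y) → removed p y (∋quadric p i x)
                         ; (Fin.suc i) (Fin.suc j) d p → disjoint i j (λ { refl → d refl }) p }
          ; sing = sing ; noncollinear = noncollinear
          ; off = λ { j Fin.zero h → let (a , b , p , ha , hb) = FromGood.OnQuadric.plane-through P good H.base H.frame (point j) (proj₁ (sing j)) (proj₂ (sing j)) h
                                     in removed p (h , ha , hb) (∋pencil p j (in-own p))
                    ; j (Fin.suc i) → off j i }
          ; members = mem
          ; ∋quadric = λ { p Fin.zero c → M⊆L p (M-in p c) ; p (Fin.suc i) c → kept p (∋quadric p i c) }
          ; ∋pencil = λ p j i → kept p (∋pencil p j i)
          -- A good space has sign 1 and an odd symplectic one sign -1, so together they would give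
          -- 2 = 0.
          ; odd⇒0 = λ odd → ⊥-elim (OddSymplectic.2≢0 odd (trans (cong (_+ᶠ 1ᶠ) (trans (sym (Good.ε≡1 good)) (OddSymplectic.ε≡-1 odd))) (let open FS in solve 0 (:- (# 1) :+ (# 1) := (# 0)) refl))) }
          where
          mem : ∀ {a b c} → Plane a b c → CL.f L a b c ≡ 1# → (∃ λ i → Quadric.Contains ((H ◂ quadric) i) a b c) ⊎ (∃ λ j → InPlane a b c (point j))
          mem {a} {b} {c} p o = split (H.contains? a b c)
            where
            split : Dec (H.Contains a b c) → _
            split (yes h) = inj₁ (Fin.zero , h)
            split (no nh) = Sum.map₁ (λ (i , r) → Fin.suc i , r) (members p (trans (minus-out L M M⊆L (M-out p nh)) o))

      module _ (e : V n) (se : Sing e) (e≢0 : e ≢ 0ⱽ) where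
        private
          v : V n → Carrier
          -- All the weight sits on one vector representing the vertex: the total is 1, and a plane
          -- sum tests whether the plane contains the vertex.
          v w = 𝟙 (w ≟ⱽ e)
          supp : ∀ w → ¬ Sing w → v w ≡ 0#
          supp w ns = 𝟙-no (w ≟ⱽ e) (λ z → ns (subst Sing (sym z) se))

        pencil-f : ∀ a b c → Weight.f v supp a b c ≡ D₃ a b c e
        pencil-f a b c = trans (sum-cong (vecs n) (λ w → (let open RS in solve 2 (λ d x → d :* x := x :* d) refl (D₃ a b c w) (v w)))) (∑V-δ e (D₃ a b c))

        pencil-in : ∀ {a b c} → Plane a b c → InPlane a b c e → Weight.f v supp a b c ≡ 1#
        pencil-in {a} {b} {c} p i = trans (pencil-f a b c) (Weight.InPlaneOf.D-in v supp p i)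

        pencil-out : ∀ {a b c} → Plane a b c → ¬ InPlane a b c e → Weight.f v supp a b c ≡ 0#
        pencil-out {a} {b} {c} p i = trans (pencil-f a b c) (Weight.InPlaneOf.D-out v supp p i)

        pencil : CL
        pencil = record { v = v ; supp = supp ; v-0 = 𝟙-no (0ⱽ ≟ⱽ e) (e≢0 ∘ sym) ; binary = binary }
          where
          binary : ∀ {a b c} → Plane a b c → Weight.f v supp a b c ≡ 0# ⊎ Weight.f v supp a b c ≡ 1#
          binary p with Weight.InPlaneOf.in? v supp p e
          ... | yes i = inj₂ (pencil-in p i)
          ... | no ni = inj₁ (pencil-out p ni)

        pencil-X : CL.X pencil ≡ 1#
        pencil-X = trans (sum-cong (vecs n) (λ w → (let open RS in solve 1 (λ x → x := x :* (# 1)) refl (v w)))) (∑V-δ e (λ _ → 1#))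

      count-linear : ∀ m₁ m₂ m₃ → ∑F (λ x → ∑F (λ y → ∑F (λ z → δ (x *ᶠ m₁ +ᶠ y *ᶠ m₂ +ᶠ z *ᶠ m₃))))
        ≡ q * q + (q * q * q - q * q) * (δ m₁ * (δ m₂ * δ m₃))
      count-linear m₁ m₂ m₃ = begin
        _ ≡⟨ sum-cong elems (λ x → trans (sum-cong elems (λ y → ∑F-affine m₃ (x *ᶠ m₁ +ᶠ y *ᶠ m₂))) (affine-sum (1# - c) (q * c) m₂ (x *ᶠ m₁) (λ z → (let open RS in solve 3 (λ q c d → (# 1) :- c :+ q :* (c :* d) := (# 1) :- c :+ q :* c :* d) refl q c (δ z))))) ⟩
        ∑F (λ x → q * (1# - c) + q * c * (1# - b + q * (b * δ (x *ᶠ m₁))))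
          ≡⟨ sum-cong elems (λ x → trans (let open RS in solve 4 (λ q b c d → q :* ((# 1) :- c) :+ q :* c :* ((# 1) :- b :+ q :* (b :* d)) := q :* ((# 1) :- c) :+ q :* c :* ((# 1) :- b) :+ q :* c :* q :* b :* d) refl q b c (δ (x *ᶠ m₁)))
               (cong (λ u → q * (1# - c) + q * c * (1# - b) + q * c * q * b * δ u) (let open FS in solve 2 (λ x m₁ → x :* m₁ := (# 0) :+ x :* m₁) refl x m₁))) ⟩
        ∑F (λ x → q * (1# - c) + q * c * (1# - b) + q * c * q * b * δ (0ᶠ +ᶠ x *ᶠ m₁))
          ≡⟨ affine-sum _ _ m₁ 0ᶠ {g = λ u → q * (1# - c) + q * c * (1# - b) + q * c * q * b * δ u} (λ z → refl) ⟩
        q * (q * (1# - c) + q * c * (1# - b)) + q * c * q * b * (1# - a + q * (a * δ 0ᶠ))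
          ≡⟨ cong (λ u → q * (q * (1# - c) + q * c * (1# - b)) + q * c * q * b * (1# - a + q * (a * u))) (δ-1 refl) ⟩
        q * (q * (1# - c) + q * c * (1# - b)) + q * c * q * b * (1# - a + q * (a * 1#))
          ≡⟨ (let open RS in solve 4 (λ q a b c → q :* (q :* ((# 1) :- c) :+ q :* c :* ((# 1) :- b)) :+ q :* c :* q :* b :* ((# 1) :- a :+ q :* (a :* (# 1))) := q :* q :+ (q :* q :* q :- q :* q) :* (a :* (b :* c))) refl q a b c) ⟩
        _ ∎
        where
        a = δ m₁
        b = δ m₂
        c = δ m₃
        affine-sum : ∀ k l m y {g : K → Carrier} → (∀ z → g z ≡ k + l * δ z) → ∑F (λ s → g (y +ᶠ s *ᶠ m)) ≡ q * k + l * (1# - δ m + q * (δ m * δ y))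
        affine-sum k l m y e = trans (sum-cong elems (λ s → e _)) (trans (sum-+ elems _ _) (cong₂ _+_ (∑F-const k) (trans (sum-* elems l _) (cong (l *_) (∑F-affine m y)))))

      1≤q : 1# ≤ q
      1≤q = ≤-trans (≤-diff 1# 0≤1 refl) 2≤q

      grow : ∀ {x} → 1# ≤ x → x ≤ q * x
      grow {x} l = ≤-diff ((q - 1#) * x) (*-nonneg (diff-≤ 1≤q) (≤-trans 0≤1 l)) (let open RS in solve 2 (λ q x → q :* x := x :+ (q :- (# 1)) :* x) refl q x)

      ≥1⇒≢0 : ∀ {x} → 1# ≤ x → x ≢ 0#
      ≥1⇒≢0 l refl = 1≰0 l

      q³-1≢0 : q * (q * q) - 1# ≢ 0#
      q³-1≢0 = ≥1⇒≢0 (≤-trans (≤-reflexive (let open RS in solve 0 ((# 1) := (# 1) :+ (# 1) :- (# 1)) refl)) (+-mono (≤-trans 2≤q (≤-trans (grow 1≤q) (grow (≤-trans 1≤q (grow 1≤q))))) ≤-refl))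

      -- The weight is α on the singular points of the quadric and β on the others,
      -- the solution of (q³ − 1)α = 1 and (q² − 1)α + (q³ − q²)β = 0.
      module QuadricWeight (good : Good P) (H : Quadric) where
        open Quadric H
        α β κ : Carrier
        α = proj₁ (inverse (q * (q * q) - 1#) q³-1≢0)
        β = - ((q + 1#) * α) * proj₁ (inverse (q * q) (≥1⇒≢0 (≤-trans 1≤q (grow 1≤q))))
        κ = α - β

        α-eq : α * (q * (q * q) - 1#) ≡ 1#
        α-eq = proj₂ (inverse (q * (q * q) - 1#) q³-1≢0)

        β-eq : β * (q * q) ≡ - ((q + 1#) * α)
        β-eq = trans (let open RS in solve 3 (λ x r s → x :* r :* s := x :* (r :* s)) refl (- ((q + 1#) * α)) (proj₁ (inverse (q * q) (≥1⇒≢0 (≤-trans 1≤q (grow 1≤q))))) (q * q))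
          (trans (cong (- ((q + 1#) * α) *_) (proj₂ (inverse (q * q) (≥1⇒≢0 (≤-trans 1≤q (grow 1≤q)))))) (let open RS in solve 1 (λ x → x :* (# 1) := x) refl (- ((q + 1#) * α))))

        μ' : V n → Carrier
        μ' = μ fans E

        v₁ v : V n → Carrier
        v₁ w = μ' w * (β + κ * δ (form w))
        -- The zero vector is a zero of the form and would get the value α. Subtracting it achieves
        -- `v-0` and explains the -1 in the equations for α and β.
        v w = v₁ w - α * 𝟙 (w ≟ⱽ 0ⱽ)

        supp₁ : ∀ w → ¬ Sing w → v₁ w ≡ 0#
        supp₁ w ns = zeroˡ (𝟙-no (Sing? w) ns)

        supp : ∀ w → ¬ Sing w → v w ≡ 0#
        supp w ns = trans (cong₂ (λ x y → x - α * y) (supp₁ w ns) (𝟙-no (w ≟ⱽ 0ⱽ) (λ z → ns (subst Sing (sym z) Sing-0)))) (let open RS in solve 1 (λ a → (# 0) :- a :* (# 0) := (# 0)) refl α)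

        form-0 : form 0ⱽ ≡ 0ᶠ
        form-0 = trans (cong₂ _+ᶠ_ (cong₂ _+ᶠ_ (cong₂ _*ᶠ_ (B-0ʳ _) (B-0 _)) (cong₂ _*ᶠ_ (B-0ʳ _) (B-0 _))) (cong₂ _*ᶠ_ (B-0ʳ _) (B-0 _))) (let open FS in solve 0 ((# 0) :* (# 0) :+ (# 0) :* (# 0) :+ (# 0) :* (# 0) := (# 0)) refl)

        v-0 : v 0ⱽ ≡ 0#
        v-0 = trans (cong₂ _-_ (cong₂ (λ x y → x * (β + κ * y)) (μ-1 fans E Sing-0) (δ-1 form-0)) (cong (α *_) (𝟙-yes (0ⱽ ≟ⱽ 0ⱽ) refl))) (let open RS in solve 2 (λ a b → (# 1) :* (b :+ (a :- b) :* (# 1)) :- a :* (# 1) := (# 0)) refl α β)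

        Δ : V n → V n → V n → Carrier
        Δ a b c = δ (form a) * (δ (form b) * δ (form c))

        f-v₁ : ∀ {a b c} → Plane a b c → Weight.f v₁ supp₁ a b c ≡ β * (q * (q * q)) + κ * (q * q + (q * q * q - q * q) * Δ a b c)
        f-v₁ {a} {b} {c} p = begin
          Weight.f v₁ supp₁ a b c ≡⟨ Weight.InPlaneOf.f-sum v₁ supp₁ p ⟨
          ∑F (λ x → ∑F (λ y → ∑F (λ z → v₁ (lc₃ x y z a b c))))
            ≡⟨ sum-cong elems (λ x → sum-cong elems (λ y → sum-cong elems (λ z → trans (cong₂ (λ s t → s * (β + κ * t)) (μ-1 fans E (Weight.InPlaneOf.lc-sing v₁ supp₁ p x y z)) (m-eq x y z))
                 (let open RS in solve 3 (λ b k d → (# 1) :* (b :+ k :* d) := b :+ k :* d) refl β κ (δ (x *ᶠ m₁ +ᶠ y *ᶠ m₂ +ᶠ z *ᶠ m₃)))))) ⟩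
          ∑F (λ x → ∑F (λ y → ∑F (λ z → β + κ * δ (x *ᶠ m₁ +ᶠ y *ᶠ m₂ +ᶠ z *ᶠ m₃))))
            ≡⟨ trans (sum-cong elems (λ x → trans (sum-cong elems (λ y → lin β _)) (lin (q * β) _))) (lin (q * (q * β)) _) ⟩
          q * (q * (q * β)) + κ * ∑F (λ x → ∑F (λ y → ∑F (λ z → δ (x *ᶠ m₁ +ᶠ y *ᶠ m₂ +ᶠ z *ᶠ m₃))))
            ≡⟨ cong₂ (λ s t → s + κ * t) (let open RS in solve 2 (λ q b → q :* (q :* (q :* b)) := b :* (q :* (q :* q))) refl q β) (trans (count-linear m₁ m₂ m₃)
                 (cong (λ t → q * q + (q * q * q - q * q) * t) (cong₂ _*_ (m-at 1ᶠ 0ᶠ 0ᶠ (vsolve (((𝟘 ⊞ 1ᶠ ⊠ (v# 0)) ⊞ 0ᶠ ⊠ (v# 1)) ⊞ 0ᶠ ⊠ (v# 2)) (v# 0) (a ∷ b ∷ c ∷ []) (λ { (aᶜ ∷ bᶜ ∷ cᶜ ∷ []) → (let open FS in solve 3 (λ a b c → (# 0) :+ (# 1) :* a :+ (# 0) :* b :+ (# 0) :* c := a) refl aᶜ bᶜ cᶜ) })) (let open FS in solve 3 (λ m₁ m₂ m₃ → (# 1) :* m₁ :+ (# 0) :* m₂ :+ (# 0) :* m₃ := m₁) refl m₁ m₂ m₃))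
                   (cong₂ _*_ (m-at 0ᶠ 1ᶠ 0ᶠ (vsolve (((𝟘 ⊞ 0ᶠ ⊠ (v# 0)) ⊞ 1ᶠ ⊠ (v# 1)) ⊞ 0ᶠ ⊠ (v# 2)) (v# 1) (a ∷ b ∷ c ∷ []) (λ { (aᶜ ∷ bᶜ ∷ cᶜ ∷ []) → (let open FS in solve 3 (λ a b c → (# 0) :+ (# 0) :* a :+ (# 1) :* b :+ (# 0) :* c := b) refl aᶜ bᶜ cᶜ) })) (let open FS in solve 3 (λ m₁ m₂ m₃ → (# 0) :* m₁ :+ (# 1) :* m₂ :+ (# 0) :* m₃ := m₂) refl m₁ m₂ m₃))
                     (m-at 0ᶠ 0ᶠ 1ᶠ (vsolve (((𝟘 ⊞ 0ᶠ ⊠ (v# 0)) ⊞ 0ᶠ ⊠ (v# 1)) ⊞ 1ᶠ ⊠ (v# 2)) (v# 2) (a ∷ b ∷ c ∷ []) (λ { (aᶜ ∷ bᶜ ∷ cᶜ ∷ []) → (let open FS in solve 3 (λ a b c → (# 0) :+ (# 0) :* a :+ (# 0) :* b :+ (# 1) :* c := c) refl aᶜ bᶜ cᶜ) })) (let open FS in solve 3 (λ m₁ m₂ m₃ → (# 0) :* m₁ :+ (# 0) :* m₂ :+ (# 1) :* m₃ := m₃) refl m₁ m₂ m₃)))))) ⟩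
          _ ∎
          where
          M = Good.hyp-on-plane good base frame p
          m₁ = proj₁ M
          m₂ = proj₁ (proj₂ M)
          m₃ = proj₁ (proj₂ (proj₂ M))
          m-eq : ∀ x y z → δ (form (lc₃ x y z a b c)) ≡ δ (x *ᶠ m₁ +ᶠ y *ᶠ m₂ +ᶠ z *ᶠ m₃)
          m-eq = proj₂ (proj₂ (proj₂ M))
          m-at : ∀ x y z {u m} → lc₃ x y z a b c ≡ u → x *ᶠ m₁ +ᶠ y *ᶠ m₂ +ᶠ z *ᶠ m₃ ≡ m → δ m ≡ δ (form u)
          m-at x y z refl refl = sym (m-eq x y z)
          lin : ∀ k (g : K → Carrier) → ∑F (λ z → k + κ * g z) ≡ q * k + κ * ∑F g
          lin k g = trans (sum-+ elems _ _) (cong₂ _+_ (∑F-const k) (sum-* elems κ g))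

        f-v : ∀ {a b c} → Plane a b c → Weight.f v supp a b c ≡ Δ a b c
        f-v {a} {b} {c} p = begin
          Weight.f v supp a b c
            ≡⟨ sum-cong (vecs n) (λ w → (let open RS in solve 4 (λ d x a y → d :* (x :- a :* y) := d :* x :+ ( :- a) :* (y :* d)) refl (D₃ a b c w) (v₁ w) α (𝟙 (w ≟ⱽ 0ⱽ)))) ⟩
          _ ≡⟨ trans (sum-+ (vecs n) _ _) (cong (Weight.f v₁ supp₁ a b c +_) (trans (sum-* (vecs n) (- α) _) (cong (- α *_) (trans (∑V-δ 0ⱽ (D₃ a b c)) (Weight.InPlaneOf.D-in v₁ supp₁ p (inPlane (B-0ʳ a) (B-0ʳ b) (B-0ʳ c))))))) ⟩
          Weight.f v₁ supp₁ a b c + - α * 1# ≡⟨ cong (_+ - α * 1#) (f-v₁ p) ⟩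
          β * (q * (q * q)) + κ * (q * q + (q * q * q - q * q) * Δ a b c) + - α * 1#
            ≡⟨ (let open RS in solve 4 (λ q a b d → b :* (q :* (q :* q)) :+ (a :- b) :* (q :* q :+ (q :* q :* q :- q :* q) :* d) :+ ( :- a) :* (# 1) := b :* (q :* q) :* (q :- (# 1)) :* ((# 1) :- d) :+ a :* (q :* q :- (# 1)) :* ((# 1) :- d) :+ a :* (q :* (q :* q) :- (# 1)) :* d) refl q α β (Δ a b c)) ⟩
          β * (q * q) * (q - 1#) * (1# - Δ a b c) + α * (q * q - 1#) * (1# - Δ a b c) + α * (q * (q * q) - 1#) * Δ a b c
            ≡⟨ cong₂ (λ x y → x * (q - 1#) * (1# - Δ a b c) + α * (q * q - 1#) * (1# - Δ a b c) + y * Δ a b c) β-eq α-eq ⟩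
          - ((q + 1#) * α) * (q - 1#) * (1# - Δ a b c) + α * (q * q - 1#) * (1# - Δ a b c) + 1# * Δ a b c
            ≡⟨ (let open RS in solve 3 (λ q a d → ( :- ((q :+ (# 1)) :* a)) :* (q :- (# 1)) :* ((# 1) :- d) :+ a :* (q :* q :- (# 1)) :* ((# 1) :- d) :+ (# 1) :* d := d) refl q α (Δ a b c)) ⟩
          Δ a b c ∎

        inside : ∀ {a b c} → Plane a b c → Contains a b c → Weight.f v supp a b c ≡ 1#
        inside p (x , y , z) = trans (f-v p) (trans (cong₂ _*_ (δ-1 x) (cong₂ _*_ (δ-1 y) (δ-1 z))) (let open RS in solve 0 ((# 1) :* ((# 1) :* (# 1)) := (# 1)) refl))

        outside : ∀ {a b c} → Plane a b c → ¬ Contains a b c → Weight.f v supp a b c ≡ 0#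
        outside {a} {b} {c} p no-c = trans (f-v p) zero'
          where
          zero' : Δ a b c ≡ 0#
          zero' with form a ≟ᶠ 0ᶠ | form b ≟ᶠ 0ᶠ | form c ≟ᶠ 0ᶠ
          ... | yes x | yes y | yes z = ⊥-elim (no-c (x , y , z))
          ... | no _ | _ | _ = zeroˡ refl
          ... | yes _ | no _ | _ = zeroʳ (zeroˡ refl)
          ... | yes _ | yes _ | no _ = zeroʳ (zeroʳ refl)

        quadricCL : CL
        quadricCL = record { v = v ; supp = supp ; v-0 = v-0 ; binary = binary }
          where
          split : ∀ {a b c} → Plane a b c → Dec (Contains a b c) → Weight.f v supp a b c ≡ 0# ⊎ Weight.f v supp a b c ≡ 1#
          split p (yes i) = inj₂ (inside p i)
          split p (no o) = inj₁ (outside p o)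
          binary : ∀ {a b c} → Plane a b c → Weight.f v supp a b c ≡ 0# ⊎ Weight.f v supp a b c ≡ 1#
          binary {a} {b} {c} p = split p (contains? a b c)

        module M = Weight μ' (λ w → 𝟙-no (Sing? w))

        size : ∀ {x y z s a o} → x + y + z ≡ s + q * a + q * q * o → x ≡ q * q * q → y ≡ q * (q * q * q) → z ≡ q * (q * (q * q * q)) → a ≡ q * q * q → o ≡ 1# →
          s ≡ q * q * q * q * q + q * q * q - q * q
        size {s = s} e refl refl refl refl refl = trans (let open RS in solve 2 (λ s q → s := s :+ q :* (q :* q :* q) :+ q :* q :* (# 1) :- (q :* (q :* q :* q) :+ q :* q :* (# 1))) refl s q) (trans (cong (_- (q * (q * q * q) + q * q * 1#)) (sym e))
          (let open RS in solve 1 (λ q → q :* q :* q :+ q :* (q :* q :* q) :+ q :* (q :* (q :* q :* q)) :- (q :* (q :* q :* q) :+ q :* q :* (# 1)) := q :* q :* q :* q :* q :+ q :* q :* q :- q :* q) refl q))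

        -- Obtained from `adjacent-planes` for the constant weight, where every plane sum is q³, so
        -- that the points of Q⁺(5,q) need no separate count.
        quadric-size : M.⟪ (λ w → δ (form w)) ⟫ ≡ q * q * q * q * q + q * q * q - q * q
        quadric-size = size (M.Counting.adjacent-planes base) (μ-plane fans E (adjacent₁ base frame)) (c _ _ (λ s → μ-plane fans E (adjacent₂ base frame s)))
            (c _ _ (λ s → c _ _ (λ r → μ-plane fans E (adjacent₃ base frame s r)))) (μ-plane fans E base) (μ-1 fans E Sing-0)
          where
          c : ∀ (g : K → Carrier) k → (∀ a → g a ≡ k) → ∑F g ≡ q * k
          c g k e = trans (sum-cong elems e) (∑F-const k)

        -- The number of planes of Q⁺(5,q) is 2(q + 1)(q² + 1), which is parameter 2. Here the value
        -- follows from the q⁶ singular vectors of the space, the size of the quadric and the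
        -- equations for α and β.
        quadric-X : CL.X quadricCL ≡ 2#
        quadric-X = begin
          ∑V v ≡⟨ sum-cong (vecs n) (λ w → (let open RS in solve 6 (λ m a b k d y → m :* (b :+ k :* d) :- a :* y := b :* m :+ (k :* (d :* m) :+ ( :- a) :* (y :* (# 1)))) refl (μ' w) α β κ (δ (form w)) (𝟙 (w ≟ⱽ 0ⱽ)))) ⟩
          _ ≡⟨ trans (sum-+ (vecs n) _ _) (cong₂ _+_ (sum-* (vecs n) β μ') (trans (sum-+ (vecs n) _ _) (cong₂ _+_ (sum-* (vecs n) κ _) (trans (sum-* (vecs n) (- α) _) (cong (- α *_) (∑V-δ {n} 0ⱽ (λ _ → 1#))))))) ⟩
          β * M.X + (κ * M.⟪ (λ w → δ (form w)) ⟫ + - α * 1#) ≡⟨ cong₂ (λ x y → β * x + (κ * y + - α * 1#)) (μ-total fans E) quadric-size ⟩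
          β * (q * q * q * q * q * q) + (κ * (q * q * q * q * q + q * q * q - q * q) + - α * 1#)
            ≡⟨ (let open RS in solve 3 (λ q a b → b :* (q :* q :* q :* q :* q :* q) :+ ((a :- b) :* (q :* q :* q :* q :* q :+ q :* q :* q :- q :* q) :+ ( :- a) :* (# 1)) := b :* (q :* q) :* (q :* q :* q :* q :- q :* q :* q :- q :+ (# 1)) :+ a :* (q :* q :* q :* q :* q :+ q :* q :* q :- q :* q :- (# 1))) refl q α β) ⟩
          β * (q * q) * (q * q * q * q - q * q * q - q + 1#) + α * (q * q * q * q * q + q * q * q - q * q - 1#)
            ≡⟨ cong (λ x → x * (q * q * q * q - q * q * q - q + 1#) + α * (q * q * q * q * q + q * q * q - q * q - 1#)) β-eq ⟩
          - ((q + 1#) * α) * (q * q * q * q - q * q * q - q + 1#) + α * (q * q * q * q * q + q * q * q - q * q - 1#)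
            ≡⟨ (let open RS in solve 2 (λ q a → ( :- ((q :+ (# 1)) :* a)) :* (q :* q :* q :* q :- q :* q :* q :- q :+ (# 1)) :+ a :* (q :* q :* q :* q :* q :+ q :* q :* q :- q :* q :- (# 1)) := ((# 1) :+ (# 1)) :* (a :* (q :* (q :* q) :- (# 1)))) refl q α) ⟩
          2# * (α * (q * (q * q) - 1#)) ≡⟨ cong (2# *_) α-eq ⟩
          2# * 1# ≡⟨ (let open RS in solve 0 (((# 1) :+ (# 1)) :* (# 1) := (# 1) :+ (# 1)) refl) ⟩
          2# ∎

      record QuadricCL (H : Quadric) : Set where
        field
          set : CL
          X≡2 : CL.X set ≡ 2#
          inside : ∀ {a b c} → Plane a b c → Quadric.Contains H a b c → CL.f set a b c ≡ 1#
          outside : ∀ {a b c} → Plane a b c → ¬ Quadric.Contains H a b c → CL.f set a b c ≡ 0#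

      abstract
        quadric-set : Good P → (H : Quadric) → QuadricCL H
        quadric-set good H = record { set = quadricCL ; X≡2 = quadric-X ; inside = inside ; outside = outside }
          where open QuadricWeight good H

    -- Decomposition by repeated removal

    module Recursion
      (fans : ∀ {e₁ e₂ e₃} → Plane e₁ e₂ e₃ → ∃ (Fan e₁ e₂ e₃))
      {E₁ E₂ E₃ : V n} (E : Plane E₁ E₂ E₃)
      (kind : Good P ⊎ OddSymplectic) where

      open Removal fans E kind

      same-f : ∀ (L : CL) {a b c a' b' c'} → (∀ w → D₃ a b c w ≡ D₃ a' b' c' w) → CL.f L a b c ≡ CL.f L a' b' c'
      same-f L e = sum-cong (vecs n) (λ w → cong (_* CL.v L w) (e w))

      exchange-D₃ : ∀ {a b c u} (p : Plane a b c) → Sing u → InPlane a b c u → B u (Plane.f₃ p) ≢ 0ᶠ → ∀ w → D₃ a b u w ≡ D₃ a b c w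
      exchange-D₃ {a} {b} {c} {u} p su i nz w with B a w ≟ᶠ 0ᶠ | B b w ≟ᶠ 0ᶠ
      ... | no _ | d = trans (zeroˡ refl) (sym (zeroˡ refl))
      ... | yes _ | no _ = trans (zeroʳ (zeroˡ refl)) (sym (zeroʳ (zeroˡ refl)))
      ... | yes x | yes y = cong (λ z → 1# * (1# * z)) (δ-cong (λ e → cancelᶠ nz (trans (sym uw) e)) (λ e → trans uw (trans (cong (B u f₃ *ᶠ_) e) (let open FS in solve 1 (λ x → x :* (# 0) := (# 0)) refl (B u f₃)))))
        where
        open Plane p
        uw : B u w ≡ B u f₃ *ᶠ B c w
        uw = trans (cong (λ z → B z w) (maximal p su i)) (linˡ (linˡ-keep (linˡ-keep (B-0 w) x) y) refl (let open FS in solve 2 (λ s x → (# 0) :+ s :* x := s :* x) refl (B u f₃) (B c w)))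

      through-last : ∀ (L : CL) {a b c u} (p : Plane a b c) → Sing u → InPlane a b c u → B u (Plane.f₃ p) ≢ 0ᶠ →
        Plane u a b × CL.f L u a b ≡ CL.f L a b c
      through-last L p su i@(inPlane x y _) nz = rot (rot (exchange p su x y nz)) ,
        trans (trans (Weight.f-swap₁₂ (CL.v L) (CL.supp L) _ _ _) (Weight.f-swap₂₃ (CL.v L) (CL.supp L) _ _ _)) (same-f L (exchange-D₃ p su i nz))

      -- The bounds on T concern the first basis vector of a plane, so a plane containing u is given
      -- a basis starting with u. By `maximal-0` some coefficient of u is nonzero, and f depends on
      -- the span only.
      through : ∀ (L : CL) {a b c u} → Plane a b c → Sing u → u ≢ 0ⱽ → InPlane a b c u → ∃₂ λ d e → Plane u d e × CL.f L u d e ≡ CL.f L a b c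
      through L {a} {b} {c} {u} p su nz i@(inPlane x y z) with B u (Plane.f₃ p) ≟ᶠ 0ᶠ | B u (Plane.f₂ p) ≟ᶠ 0ᶠ | B u (Plane.f₁ p) ≟ᶠ 0ᶠ
      ... | no n₃ | _ | _ = _ , _ , through-last L p su i n₃
      ... | yes _ | no n₂ | _ = let (p' , e) = through-last L (swap₂₃ p) su (inPlane x z y) n₂ in _ , _ , p' , trans e (Weight.f-swap₂₃ (CL.v L) (CL.supp L) _ _ _)
      ... | yes _ | yes _ | no n₁ = let (p' , e) = through-last L (rot p) su (inPlane y z x) n₁ in _ , _ , p' ,
              trans e (trans (Weight.f-swap₂₃ (CL.v L) (CL.supp L) _ _ _) (Weight.f-swap₁₂ (CL.v L) (CL.supp L) _ _ _))
      ... | yes z₃ | yes z₂ | yes z₁ = ⊥-elim (nz (maximal-0 p su i z₁ z₂ z₃))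

      module St (L : CL) = Step fans (CL.v L) (CL.supp L) (CL.v-0 L) (CL.binary L)

      decide : ∀ {P : V n → Set} → ∃ P ⊎ (∀ w → ¬ P w) → Dec (∃ P)
      decide (inj₁ x) = yes x
      decide (inj₂ x) = no (λ (w , p) → x w p)

      abstract
        any-plane : ∀ L → (∃ λ a → ∃ λ b → ∃ λ c → Plane a b c × CL.f L a b c ≡ 1#) ⊎ (∀ {a b c} → Plane a b c → CL.f L a b c ≡ 0#)
        any-plane L with search {P = λ a → ∃ λ b → ∃ λ c → Plane a b c × CL.f L a b c ≡ 1#} (λ a → decide (search (λ b → decide (search (λ c → member? a b c)))))
          where
          member? : ∀ a b c → Dec (Plane a b c × CL.f L a b c ≡ 1#)
          member? a b c with plane? a b c
          ... | no np = no (np ∘ proj₁)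
          ... | yes p with CL.binary L p
          ... | inj₁ z = no (f≡0⇒f≢1 z ∘ proj₂)
          ... | inj₂ o = yes (p , o)
        ... | inj₁ x = inj₁ x
        ... | inj₂ none = inj₂ zero'
          where
          zero' : ∀ {a b c} → Plane a b c → CL.f L a b c ≡ 0#
          zero' p with CL.binary L p
          ... | inj₁ z = z
          ... | inj₂ o = ⊥-elim (none _ (_ , _ , p , o))

        large-point : ∀ L → (∃ λ e → Sing e × e ≢ 0ⱽ × ¬ CL.T L e ≤ CL.X L) ⊎ (∀ {e} → Sing e → e ≢ 0ⱽ → CL.T L e ≤ CL.X L)
        large-point L with search {P = λ e → Sing e × e ≢ 0ⱽ × ¬ CL.T L e ≤ CL.X L} large?
          where
          large? : ∀ e → Dec (Sing e × e ≢ 0ⱽ × ¬ CL.T L e ≤ CL.X L)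
          large? e with Sing? e | e ≟ⱽ 0ⱽ | CL.T L e ≤? CL.X L
          ... | no ns | _ | _ = no (ns ∘ proj₁)
          ... | yes _ | yes z | _ = no (λ x → proj₁ (proj₂ x) z)
          ... | yes _ | no _ | yes l = no (λ x → proj₂ (proj₂ x) l)
          ... | yes s | no z | no l = yes (s , z , l)
        ... | inj₁ x = inj₁ x
        ... | inj₂ none = inj₂ small
          where
          small : ∀ {e} → Sing e → e ≢ 0ⱽ → CL.T L e ≤ CL.X L
          small {e} s nz with CL.T L e ≤? CL.X L
          ... | yes l = l
          ... | no l = ⊥-elim (none e (s , nz , l))

      -- The weight itself may be nonzero here. Its total vanishes because zero plane sums make
      -- every N zero, hence T at a point and then X.
      empty : ∀ L → (∀ {a b c} → Plane a b c → CL.f L a b c ≡ 0#) → Solution L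
      empty L none = record
        { α = 0 ; k = 0 ; X≡ = trans X≡0 (let open RS in solve 0 ((# 0) := ((# 1) :+ (# 1)) :* (# 0) :+ (# 0)) refl) ; quadric = λ () ; point = λ () ; disjoint = λ () ; sing = λ () ; noncollinear = λ () ; off = λ ()
        ; members = λ p o → ⊥-elim (f≡0⇒f≢1 (none p) o) ; ∋quadric = λ _ () ; ∋pencil = λ _ () ; odd⇒0 = λ _ → refl }
        where
        module S = St L
        open Weight (CL.v L) (CL.supp L) using (N; module Counting)
        N≡0 : ∀ {a b c} → Plane a b c → N a b ≡ 0#
        N≡0 p = trans (Counting.planes-on-line p (S.OnLine.fan p)) (trans (cong₂ _+_ (none p) (∑F-0 _ (λ c → none (S.OnLine.kp p c)))) (let open RS in solve 0 ((# 0) :+ (# 0) := (# 0)) refl))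
        T≡0 : CL.T L E₁ ≡ 0#
        T≡0 = trans (sym (S.on E (none E))) (trans (cong₂ _+_ (N≡0 (swap₂₃ E)) (∑F-0 _ (λ s → N≡0 (on-point s E)))) (let open RS in solve 0 ((# 0) :+ (# 0) := (# 0)) refl))
        X≡0 : CL.X L ≡ 0#
        X≡0 = trans (sym (S.off E (none E))) (trans (cong₂ _+_ (∑F-0 _ (λ s → ∑F-0 _ (λ r → N≡0 (off-point s r E)))) T≡0) (let open RS in solve 0 ((# 0) :+ (# 0) := (# 0)) refl))

      -- The recursive call for a set whose total is at least 1 below the bound m. Nonnegativity of
      -- the total is included to make the call at m = 0 contradictory.
      Continue : CL → ℕ → Set
      Continue L m = ∀ L' → ¬ q ≤ CL.X L' → 0# ≤ CL.X L' → CL.X L' + 1# ≤ nat m → Solution L'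

      remove-pencil : ∀ L m → ¬ q ≤ CL.X L → CL.X L ≤ nat m → Continue L m → ∀ e → Sing e → e ≢ 0ⱽ → ¬ CL.T L e ≤ CL.X L → Solution L
      remove-pencil L m X<q l rec e se nz big = AddPencil.solution L M M⊆L (pencil-X e se nz) e se nz (pencil-in e se nz) (pencil-out e se nz)
          (rec L' (λ q≤ → X<q (≤-trans q≤ (≤-trans (≤-reflexive X') (≤-diff 1# 0≤1 (let open RS in solve 1 (λ x → x := x :- (# 1) :+ (# 1)) refl (CL.X L))))))
            -- X ≥ 0 is known for sets that miss some plane; a plane just removed is such a plane.
            (St.X≥0 L' pe (minus-in L M M⊆L (pencil-in e se nz pe (in-own pe)) pe))
            (≤-trans (≤-reflexive (trans (cong (_+ 1#) X') (let open RS in solve 1 (λ x → x :- (# 1) :+ (# 1) := x) refl (CL.X L)))) l))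
        where
        M : CL
        M = pencil e se nz
        contained : ∀ {a b c} → Plane a b c → InPlane a b c e → CL.f L a b c ≡ 1#
        contained p i with CL.binary L p
        ... | inj₂ o = o
        ... | inj₁ z = let (_ , _ , p' , f') = through L p se nz i in ⊥-elim (big (St.T≤X L p' (trans f' z)))
        M⊆L : ∀ {a b c} → Plane a b c → CL.f M a b c ≡ 1# → CL.f L a b c ≡ 1#
        M⊆L p o with Weight.InPlaneOf.in? (CL.v L) (CL.supp L) p e
        ... | yes i = contained p i
        ... | no ni = ⊥-elim (f≡0⇒f≢1 (pencil-out e se nz p ni) o)
        L' : CL
        L' = minus L M M⊆L
        X' : CL.X L' ≡ CL.X L - 1#
        X' = trans (minus-X L M M⊆L) (cong (λ x → CL.X L - x) (pencil-X e se nz))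
        pe : Plane e _ _
        pe = proj₂ (proj₂ (extend₁ E se nz))

      remove-quadric : ∀ L m → ¬ q ≤ CL.X L → CL.X L ≤ nat m → Continue L m → Good P → (H : Quadric) →
        (∀ {a b c} → Plane a b c → Quadric.Contains H a b c → CL.f L a b c ≡ 1#) → Solution L
      remove-quadric L m X<q l rec good H contained = AddQuadric.solution good L M M⊆L W.X≡2 H W.inside W.outside
          (rec L' (λ q≤ → X<q (≤-trans q≤ (≤-trans (≤-reflexive X') (≤-diff 2# (≤-trans 0≤1 (≤-diff 1# 0≤1 refl)) (let open RS in solve 1 (λ x → x := x :- ((# 1) :+ (# 1)) :+ ((# 1) :+ (# 1))) refl (CL.X L))))))
            (St.X≥0 L' base (minus-in L M M⊆L (W.inside base (z₁ , z₂ , z₃)) base))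
            (≤-trans (≤-diff 1# 0≤1 (trans (let open RS in solve 1 (λ x → x := x :- ((# 1) :+ (# 1)) :+ (# 1) :+ (# 1)) refl (CL.X L)) (cong (λ x → x + 1# + 1#) (sym X')))) l))
        where
        module W = QuadricCL (quadric-set good H)
        open Quadric H
        M : CL
        M = W.set
        M⊆L : ∀ {a b c} → Plane a b c → CL.f M a b c ≡ 1# → CL.f L a b c ≡ 1#
        M⊆L {a} {b} {c} p o with contains? a b c
        ... | yes i = contained p i
        ... | no ni = ⊥-elim (f≡0⇒f≢1 (W.outside p ni) o)
        L' : CL
        L' = minus L M M⊆L
        X' : CL.X L' ≡ CL.X L - 2#
        X' = trans (minus-X L M M⊆L) (cong (λ x → CL.X L - x) W.X≡2)
        open Plane base
        sum-0ᶠ : ∀ {x y z a b c} → x ≡ 0ᶠ → y ≡ 0ᶠ → z ≡ 0ᶠ → x *ᶠ a +ᶠ y *ᶠ b +ᶠ z *ᶠ c ≡ 0ᶠ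
        sum-0ᶠ {a = a} {b} {c} refl refl refl = (let open FS in solve 3 (λ a b c → (# 0) :* a :+ (# 0) :* b :+ (# 0) :* c := (# 0)) refl a b c)
        z₁ : form e₁ ≡ 0ᶠ
        z₁ = sum-0ᶠ (B-self s₁) (0-sym p₁₂) (0-sym p₁₃)
        z₂ : form e₂ ≡ 0ᶠ
        z₂ = sum-0ᶠ p₁₂ (B-self s₂) (0-sym p₂₃)
        z₃ : form e₃ ≡ 0ᶠ
        z₃ = sum-0ᶠ p₁₃ p₂₃ (B-self s₃)

      remove : ∀ L m → ¬ q ≤ CL.X L → CL.X L ≤ nat m → Continue L m → Solution L
      remove L m X<q l rec = on-planes (any-plane L)
        where
        on-grid : (T≤ : ∀ {e} → Sing e → e ≢ 0ⱽ → CL.T L e ≤ CL.X L) → Good P ⊎ OddSymplectic →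
          ∀ {a b c} (p : Plane a b c) → St.Small.Grid L X<q T≤ p → Solution L
        on-grid T≤ (inj₂ odd) p gr = ⊥-elim (St.Small.no-grid L X<q T≤ p gr (OddSymplectic.ε≡-1 odd) (OddSymplectic.2≢0 odd) (OddSymplectic.mkfan odd))
        on-grid T≤ (inj₁ good) p gr = remove-quadric L m X<q l rec good H (λ t (ha , hb , hc) →
            let (t' , fr , e) = FromGood.OnQuadric.plane-frame P good p (St.Small.Grid.frame gr) t ha hb hc
            in St.Small.quadric⊆ L X<q T≤ p gr t' fr (λ w _ z → trans (sym (e w)) z) (λ w _ z → trans (e w) z))
          where
          H : Quadric
          H = record { base = p ; frame = St.Small.Grid.frame gr }
        on-points : ∀ {a b c} → Plane a b c → CL.f L a b c ≡ 1# →
          (∃ λ e → Sing e × e ≢ 0ⱽ × ¬ CL.T L e ≤ CL.X L) ⊎ (∀ {e} → Sing e → e ≢ 0ⱽ → CL.T L e ≤ CL.X L) → Solution L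
        on-points p o (inj₁ (e , se , nz , big)) = remove-pencil L m X<q l rec e se nz big
        on-points p o (inj₂ T≤) = let (_ , _ , p' , gr) = St.Small.grid L X<q T≤ p o in on-grid T≤ kind p' gr
        on-planes : (∃ λ a → ∃ λ b → ∃ λ c → Plane a b c × CL.f L a b c ≡ 1#) ⊎ (∀ {a b c} → Plane a b c → CL.f L a b c ≡ 0#) → Solution L
        on-planes (inj₂ none) = empty L none
        on-planes (inj₁ (_ , _ , _ , p , o)) = on-points p o (large-point L)

      -- The induction runs over a natural bound for X, as X is seen to be an integer only from the
      -- decomposition itself.
      decompose : ∀ m L → ¬ q ≤ CL.X L → CL.X L ≤ nat m → Solution L
      decompose zero L X<q l = remove L zero X<q l (λ L' _ nn l' → ⊥-elim (1≰0 (≤-trans (≤-diff (CL.X L') nn (let open RS in solve 1 (λ x → x :+ (# 1) := (# 1) :+ x) refl (CL.X L'))) l')))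
      decompose (suc m) L X<q l = remove L (suc m) X<q l (λ L' X'<q _ l' → decompose m L' X'<q (+-cancel 1# (≤-trans l' (≤-reflexive (trans (nat-suc m) (let open RS in solve 1 (λ x → (# 1) :+ x := x :+ (# 1)) refl (nat m)))))))

  -- Translation to the coordinates of the statement

  module Translation where
    open PolarSpaces
    open Spaces
    open Quadrics
    open StandardPlanes
    private module G = Geometry F

    tab : ∀ {n} → G.Vect n → V n
    tab = tabulate

    lookup-tab : ∀ {n} (u : G.Vect n) i → lookup (tab u) i ≡ u i
    lookup-tab u i = Vecₚ.lookup∘tabulate u i

    tab-lookup : ∀ {n} (u : V n) → tab (lookup u) ≡ u
    tab-lookup = Vecₚ.tabulate∘lookup

    tab-cong : ∀ {n} {u w : G.Vect n} → u G.≐ w → tab u ≡ tab w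
    tab-cong e = Vecₚ.tabulate-cong e

    tab-zero : ∀ {n} {u : G.Vect n} → u G.≐ G.zeroV → tab u ≡ 0ⱽ
    tab-zero {u = u} e = ext (λ i → trans (lookup-tab u i) (trans (e i) (sym (lookup-0 i))))

    zero-tab : ∀ {n} {u : G.Vect n} → tab u ≡ 0ⱽ → u G.≐ G.zeroV
    zero-tab {u = u} e i = trans (sym (lookup-tab u i)) (trans (cong (_! i) e) (lookup-0 i))

    tab-lin : ∀ {n} (c : Fin 3 → K) (π : G.Triple n) → tab (G.lin c π) ≡ lc₃ (c 0F) (c 1F) (c 2F) (tab (π 0F)) (tab (π 1F)) (tab (π 2F))
    tab-lin c π = ext λ i → trans (lookup-tab (G.lin c π) i) (sym (trans (lookup-evalV (𝟘 ⊞ c 0F ⊠ v# 0 ⊞ c 1F ⊠ v# 1 ⊞ c 2F ⊠ v# 2) (tab (π 0F) ∷ tab (π 1F) ∷ tab (π 2F) ∷ []) i)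
      (trans (cong₂ (λ x y → 0ᶠ +ᶠ c 0F *ᶠ x +ᶠ c 1F *ᶠ y +ᶠ c 2F *ᶠ lookup (tab (π 2F)) i) (lookup-tab (π 0F) i) (lookup-tab (π 1F) i))
        (trans (cong (λ z → 0ᶠ +ᶠ c 0F *ᶠ π 0F i +ᶠ c 1F *ᶠ π 1F i +ᶠ c 2F *ᶠ z) (lookup-tab (π 2F) i))
          (let open FS in solve 6 (λ a b c x y z → (# 0) :+ a :* x :+ b :* y :+ c :* z := a :* x :+ (b :* y :+ (c :* z :+ (# 0)))) refl (c 0F) (c 1F) (c 2F) (π 0F i) (π 1F i) (π 2F i))))))

    triple : ∀ {A : Set} → A → A → A → Fin 3 → A
    triple a b c 0F = a
    triple a b c 1F = b
    triple a b c 2F = c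

    module Planes {n : ℕ} (P : Polar n) where
      open PolarTheory P

      PlaneOf : G.Triple n → Set
      PlaneOf π = Plane (tab (π 0F)) (tab (π 1F)) (tab (π 2F))

      InPlaneOf : G.Triple n → V n → Set
      InPlaneOf π = InPlane (tab (π 0F)) (tab (π 1F)) (tab (π 2F))

      lin-zero : ∀ (π : G.Triple n) a b c → lc₃ a b c (tab (π 0F)) (tab (π 1F)) (tab (π 2F)) ≡ 0ⱽ → G.lin (triple a b c) π G.≐ G.zeroV
      lin-zero π a b c e = zero-tab (trans (tab-lin (triple a b c) π) e)

      independent : ∀ {π : G.Triple n} → PlaneOf π → G.LinIndep π
      independent {π} p c z = coef
        where
        open Plane p
        e : lc₃ (c 0F) (c 1F) (c 2F) (tab (π 0F)) (tab (π 1F)) (tab (π 2F)) ≡ 0ⱽ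
        e = trans (sym (tab-lin c π)) (tab-zero z)
        zero' : ∀ {x} f → B (lc₃ (c 0F) (c 1F) (c 2F) (tab (π 0F)) (tab (π 1F)) (tab (π 2F))) f ≡ x → x ≡ 0ᶠ
        zero' f r = trans (sym r) (trans (cong (λ u → B u f) e) (B-0 f))
        coef : ∀ j → c j ≡ 0ᶠ
        coef 0F = zero' f₁ (linˡ-keep (linˡ-keep (linˡ (B-0 _) d₁₁ (let open FS in solve 1 (λ a → (# 0) :+ a :* (# 1) := a) refl (c 0F))) d₂₁) d₃₁)
        coef 1F = zero' f₂ (linˡ-keep (linˡ (linˡ-keep (B-0 _) d₁₂) d₂₂ (let open FS in solve 1 (λ a → (# 0) :+ a :* (# 1) := a) refl (c 1F))) d₃₂)
        coef 2F = zero' f₃ (linˡ (linˡ-keep (linˡ-keep (B-0 _) d₁₃) d₂₃) d₃₃ (let open FS in solve 1 (λ a → (# 0) :+ a :* (# 1) := a) refl (c 2F)))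

      -- The given plane is exchanged vector by vector for π. Each failure of an extension is a
      -- linear dependence with a coefficient 1 or -1, against `LinIndep`; success produces the dual
      -- system.
      to-plane : ∀ {E₁ E₂ E₃} → Plane E₁ E₂ E₃ → (π : G.Triple n) → G.LinIndep π → (∀ i → Sing (tab (π i))) → (∀ i j → B (tab (π i)) (tab (π j)) ≡ 0ᶠ) → PlaneOf π
      to-plane E π ind s b = on₁ (extend₁ E (s 0F) nz)
        where
        x y z : V n
        x = tab (π 0F)
        y = tab (π 1F)
        z = tab (π 2F)
        1≢0 : 1ᶠ ≢ 0ᶠ
        1≢0 e = 0≢1ᶠ (sym e)
        -1≢0 : -ᶠ 1ᶠ ≢ 0ᶠ
        -1≢0 e = 1≢0 (trans (let open FS in solve 0 ((# 1) := :- :- (# 1)) refl) (trans (cong -ᶠ_ e) (let open FS in solve 0 (:- (# 0) := (# 0)) refl)))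
        nz : x ≢ 0ⱽ
        nz e = 1≢0 (ind (triple 1ᶠ 0ᶠ 0ᶠ) (lin-zero π 1ᶠ 0ᶠ 0ᶠ (trans (vsolve (((𝟘 ⊞ 1ᶠ ⊠ (v# 0)) ⊞ 0ᶠ ⊠ (v# 1)) ⊞ 0ᶠ ⊠ (v# 2)) (v# 0) (x ∷ y ∷ z ∷ []) (λ { (xᶜ ∷ yᶜ ∷ zᶜ ∷ []) → (let open FS in solve 3 (λ x y z → (# 0) :+ (# 1) :* x :+ (# 0) :* y :+ (# 0) :* z := x) refl xᶜ yᶜ zᶜ) })) e)) 0F)
        on₃ : Plane x y z ⊎ (∃₂ λ s t → z ≡ 0ⱽ ⊕ s ∙ x ⊕ t ∙ y) → Plane x y z
        on₃ (inj₁ p) = p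
        on₃ (inj₂ (s , t , e)) = ⊥-elim (-1≢0 (ind (triple s t (-ᶠ 1ᶠ)) (lin-zero π s t (-ᶠ 1ᶠ)
          (trans (cong (0ⱽ ⊕ s ∙ x ⊕ t ∙ y ⊕ -ᶠ 1ᶠ ∙_) e) (vsolve (((𝟘 ⊞ s ⊠ (v# 0)) ⊞ t ⊠ (v# 1)) ⊞ (-ᶠ 1ᶠ) ⊠ ((𝟘 ⊞ s ⊠ (v# 0)) ⊞ t ⊠ (v# 1))) 𝟘 (x ∷ y ∷ []) (λ { (xᶜ ∷ yᶜ ∷ []) → (let open FS in solve 4 (λ x y s t → (# 0) :+ s :* x :+ t :* y :+ ( :- (# 1)) :* ((# 0) :+ s :* x :+ t :* y) := (# 0)) refl xᶜ yᶜ s t) })))) 2F))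
        on₂ : (∃ λ d → Plane x y d) ⊎ (∃ λ s → y ≡ 0ⱽ ⊕ s ∙ x) → Plane x y z
        on₂ (inj₁ (_ , p)) = on₃ (extend₃ p (s 2F) (b 0F 2F) (b 1F 2F))
        on₂ (inj₂ (s , e)) = ⊥-elim (-1≢0 (ind (triple s (-ᶠ 1ᶠ) 0ᶠ) (lin-zero π s (-ᶠ 1ᶠ) 0ᶠ
          (trans (cong (λ u → 0ⱽ ⊕ s ∙ x ⊕ -ᶠ 1ᶠ ∙ u ⊕ 0ᶠ ∙ z) e) (vsolve (((𝟘 ⊞ s ⊠ (v# 0)) ⊞ (-ᶠ 1ᶠ) ⊠ (𝟘 ⊞ s ⊠ (v# 0))) ⊞ 0ᶠ ⊠ (v# 1)) 𝟘 (x ∷ z ∷ []) (λ { (xᶜ ∷ zᶜ ∷ []) → (let open FS in solve 3 (λ x z s → (# 0) :+ s :* x :+ ( :- (# 1)) :* ((# 0) :+ s :* x) :+ (# 0) :* z := (# 0)) refl xᶜ zᶜ s) })))) 1F))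
        on₁ : (∃₂ λ d e → Plane x d e) → Plane x y z
        on₁ (_ , _ , p) = on₂ (extend₂ p (s 1F) (b 0F 1F))

      singular-of : ∀ {π : G.Triple n} → PlaneOf π → ∀ i → Sing (tab (π i)) × tab (π i) ≢ 0ⱽ
      singular-of p = λ { 0F → s₁ , nz d₁₁ ; 1F → s₂ , nz d₂₂ ; 2F → s₃ , nz d₃₃ }
        where
        open Plane p
        nz : ∀ {u f} → B u f ≡ 1ᶠ → u ≢ 0ⱽ
        nz e refl = 0≢1ᶠ (trans (sym (B-0 _)) e)

      perp-of : ∀ {π : G.Triple n} → PlaneOf π → ∀ i j → B (tab (π i)) (tab (π j)) ≡ 0ᶠ
      perp-of p = λ { 0F 0F → B-self s₁ ; 0F 1F → p₁₂ ; 0F 2F → p₁₃ ; 1F 0F → 0-sym p₁₂ ; 1F 1F → B-self s₂ ; 1F 2F → p₂₃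
                    ; 2F 0F → 0-sym p₁₃ ; 2F 1F → 0-sym p₂₃ ; 2F 2F → B-self s₃ }
        where open Plane p

      lc-in : ∀ {a b c} → Plane a b c → ∀ x y z → InPlane a b c (lc₃ x y z a b c)
      lc-in p x y z = inPlane
          (linʳ-keep (linʳ-keep (linʳ-keep (B-0ʳ _) (B-self s₁)) p₁₂) p₁₃)
          (linʳ-keep (linʳ-keep (linʳ-keep (B-0ʳ _) (0-sym p₁₂)) (B-self s₂)) p₂₃)
          (linʳ-keep (linʳ-keep (linʳ-keep (B-0ʳ _) (0-sym p₁₃)) (0-sym p₂₃)) (B-self s₃))
        where open Plane p

      lc-sing : ∀ {a b c} → Plane a b c → ∀ x y z → Sing (lc₃ x y z a b c)
      lc-sing p x y z = Sing-⊕ (Sing-⊕ (Sing-⊕ Sing-0 s₁ (B-0 _)) s₂ (linˡ-keep (B-0 _) p₁₂)) s₃ (linˡ-keep (linˡ-keep (B-0 _) p₁₃) p₂₃)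
        where open Plane p

      span-in : ∀ {π : G.Triple n} → PlaneOf π → ∀ {u} → u G.∈span π → InPlaneOf π (tab u)
      span-in {π} p {u} (c , e) = subst (InPlaneOf π) (sym (trans (tab-cong e) (tab-lin c π))) (lc-in p (c 0F) (c 1F) (c 2F))

      in-span : ∀ {π : G.Triple n} → PlaneOf π → ∀ {u} → Sing (tab u) → InPlaneOf π (tab u) → u G.∈span π
      in-span {π} p {u} s i = c , λ j → trans (sym (lookup-tab u j)) (trans (cong (_! j) (trans (maximal p s i) (sym (tab-lin c π)))) (lookup-tab (G.lin c π) j))
        where
        c : Fin 3 → K
        c = triple (B (tab u) (Plane.f₁ p)) (B (tab u) (Plane.f₂ p)) (B (tab u) (Plane.f₃ p))

      orthogonal : ∀ {a b c u w} → Plane a b c → Sing u → InPlane a b c u → InPlane a b c w → B u w ≡ 0ᶠ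
      orthogonal {w = w} p su iu (inPlane a b c) = trans (cong (λ z → B z w) (maximal p su iu)) (linˡ-keep (linˡ-keep (linˡ-keep (B-0 _) a) b) c)

      -- One inclusion is enough: vectors of ρ are then orthogonal to π, and π is maximal.
      same-span : ∀ {π ρ : G.Triple n} → PlaneOf π → PlaneOf ρ → (∀ i → InPlaneOf ρ (tab (π i))) → G.SameSpan π ρ
      same-span {π} {ρ} p r i = (λ j → in-span {ρ} r (proj₁ (singular-of {π} p j)) (i j)) , (λ j → in-span {π} p (proj₁ (singular-of {ρ} r j)) (in-π j))
        where
        in-ρ : ∀ j → InPlaneOf ρ (tab (ρ j))
        in-ρ j = inPlane (perp-of {ρ} r 0F j) (perp-of {ρ} r 1F j) (perp-of {ρ} r 2F j)
        in-π : ∀ j → InPlaneOf π (tab (ρ j))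
        in-π j = inPlane (orth 0F j) (orth 1F j) (orth 2F j)
          where
          orth : ∀ k j → B (tab (π k)) (tab (ρ j)) ≡ 0ᶠ
          orth k j = orthogonal r (proj₁ (singular-of {π} p k)) (i k) (in-ρ j)

    module HP = Planes (Quadratic.polar hyperbolic)

    Qhyp-tab : ∀ y → G.Qhyp y ≡ Q₆ (tab y)
    Qhyp-tab y = sym (Q₆-def (tab y))

    polar-tab : ∀ {n} (S : Quadratic n) (q : G.Vect n → K) → (∀ u → q u ≡ Quadratic.Q S (tab u)) → ∀ u w →
      (q (u G.+V w) +ᶠ -ᶠ q u) +ᶠ -ᶠ q w ≡ Quadratic.B S (tab u) (tab w)
    polar-tab S q e u w = trans (cong₂ (λ a b → (a +ᶠ -ᶠ b) +ᶠ -ᶠ q w) (trans (e _) (trans (cong Q sum≡) (Q-⊕ (tab u) 1ᶠ (tab w)))) (e u))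
      (trans (cong (λ z → Q (tab u) +ᶠ 1ᶠ *ᶠ B (tab u) (tab w) +ᶠ 1ᶠ *ᶠ 1ᶠ *ᶠ Q (tab w) +ᶠ -ᶠ Q (tab u) +ᶠ -ᶠ z) (e w))
        (let open FS in solve 3 (λ a b c → a :+ (# 1) :* b :+ (# 1) :* (# 1) :* c :- a :- c := b) refl (Q (tab u)) (B (tab u) (tab w)) (Q (tab w))))
      where
      open Quadratic S
      sum≡ : tab (u G.+V w) ≡ tab u ⊕ 1ᶠ ∙ tab w
      sum≡ = ext (λ i → trans (lookup-tab (u G.+V w) i) (sym (trans (lookup-⊕ (tab u) (tab w) 1ᶠ i)
        (trans (cong₂ (λ x y → x +ᶠ 1ᶠ *ᶠ y) (lookup-tab u i) (lookup-tab w i)) (let open FS in solve 2 (λ a b → a :+ (# 1) :* b := a :+ b) refl (u i) (w i))))))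

    fhyp-tab : ∀ u w → G.fhyp u w ≡ B₆ (tab u) (tab w)
    fhyp-tab = polar-tab hyperbolic G.Qhyp Qhyp-tab

    hyp-plane : ∀ g → G.IsHypGen g → HP.PlaneOf g
    hyp-plane g (ind , s , b) = HP.to-plane hyperbolic-plane g ind (λ i → trans (sym (Qhyp-tab (g i))) (proj₂ (s i))) (λ i j → trans (sym (fhyp-tab (g i) (g j))) (b i j))

    plane-hyp : ∀ g → HP.PlaneOf g → G.IsHypGen g
    plane-hyp g p = HP.independent {g} p , (λ i → (λ z → proj₂ (HP.singular-of {g} p i) (tab-zero z)) , trans (Qhyp-tab (g i)) (proj₁ (HP.singular-of {g} p i)))
      , (λ i j → trans (fhyp-tab (g i) (g j)) (HP.perp-of {g} p i j))

    record Model (S : G.Space) : Set₁ where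
      field
        polar : Polar (G.dim S)
      private
        B = Polar.B polar
        Sing = Polar.Sing polar
        Plane = PolarTheory.Plane polar
      field
        fans : ∀ {a b c} → Plane a b c → ∃ (PolarTheory.Fan polar a b c)
        {E₁ E₂ E₃} : V (G.dim S)
        E : Plane E₁ E₂ E₃
        kind : Good polar ⊎ Sets.OddSymplectic polar
        odd : S ≡ G.W → ¬ (1ᶠ +ᶠ 1ᶠ ≡ 0ᶠ) → Sets.OddSymplectic polar
        perp : ∀ u w → G.Perp S u w → B (tab u) (tab w) ≡ 0ᶠ
        perp⁻ : ∀ u w → B (tab u) (tab w) ≡ 0ᶠ → G.Perp S u w
        singular : ∀ u → G.Singular S u → Sing (tab u) × tab u ≢ 0ⱽ
        singular⁻ : ∀ u → Sing (tab u) → tab u ≢ 0ⱽ → G.Singular S u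

    module Assembly (S : G.Space) (model : Model S) where
      open Model model
      open PolarTheory polar
      open Planes polar

      plane-of : ∀ π → G.IsPlane S π → PlaneOf π
      plane-of π (ind , s , b) = to-plane E π ind (λ i → proj₁ (singular (π i) (s i))) (λ i j → perp (π i) (π j) (b i j))

      is-plane : ∀ π → PlaneOf π → G.IsPlane S π
      is-plane π p = independent {π} p , (λ i → singular⁻ (π i) (proj₁ (singular-of {π} p i)) (proj₂ (singular-of {π} p i))) , (λ i j → perp⁻ (π i) (π j) (perp-of {π} p i j))

      module Columns (H : Sets.Quadric polar) where
        open Sets.Quadric H
        open Plane base

        -- The interleaving of the eᵢ and fᵢ matches the coordinate pairs 01, 23, 45 of `Qhyp`.
        columns : G.Embedding S
        columns 0F = lookup e₁
        columns 1F = lookup f₁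
        columns 2F = lookup e₂
        columns 3F = lookup f₂
        columns 4F = lookup e₃
        columns 5F = lookup f₃

        ContainsOf : G.Triple (G.dim S) → Set
        ContainsOf π = Contains (tab (π 0F)) (tab (π 1F)) (tab (π 2F))

        module _ (good : Good polar) where
          open FromGood.OnQuadric polar good base frame

          apply-φ : ∀ y → tab (G.apply {S} columns y) ≡ φ (tab y)
          apply-φ y = ext λ i → trans (lookup-tab (G.apply {S} columns y) i) (sym (trans (lookup-evalV
            (𝟘 ⊞ y 0F ⊠ v# 0 ⊞ y 1F ⊠ v# 1 ⊞ y 2F ⊠ v# 2 ⊞ y 3F ⊠ v# 3 ⊞ y 4F ⊠ v# 4 ⊞ y 5F ⊠ v# 5) (e₁ ∷ f₁ ∷ e₂ ∷ f₂ ∷ e₃ ∷ f₃ ∷ []) i)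
            (let open FS in solve 6 (λ a b c d e f → (# 0) :+ a :+ b :+ c :+ d :+ e :+ f := a :+ (b :+ (c :+ (d :+ (e :+ (f :+ (# 0))))))) refl (y 0F *ᶠ e₁ ! i) (y 1F *ᶠ f₁ ! i) (y 2F *ᶠ e₂ ! i) (y 3F *ᶠ f₂ ! i) (y 4F *ᶠ e₃ ! i) (y 5F *ᶠ f₃ ! i))))

          φ-injective : ∀ {y} → φ y ≡ 0ⱽ → y ≡ 0ⱽ
          φ-injective {y} e = trans (sym (coords-φ y)) (trans (cong coords e) (trans (cong coords (vsolve 𝟘 (𝟘 ⊞ (-ᶠ 1ᶠ) ⊠ 𝟘) ([]) (λ { ([]) → (let open FS in solve 0 ((# 0) := (# 0) :+ ( :- (# 1)) :* (# 0)) refl) }))) (trans (coords-⊕ 0ⱽ (-ᶠ 1ᶠ) 0ⱽ) (vsolve ((v# 0) ⊞ (-ᶠ 1ᶠ) ⊠ (v# 0)) 𝟘 ((coords 0ⱽ) ∷ []) (λ { (xᶜ ∷ []) → (let open FS in solve 1 (λ x → x :+ ( :- (# 1)) :* x := (# 0)) refl xᶜ) })))))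

          embedded : G.EmbeddedHyperbolic S columns
          embedded = (λ c z j → zero-tab {u = c} (φ-injective (trans (sym (apply-φ c)) (tab-zero z))) j)
            , (λ y nz qy → singular⁻ _ (subst Sing (sym (apply-φ y)) (Good.sing-φ good base frame (tab y) (trans (sym (Qhyp-tab y)) qy)))
                  (λ z → nz (zero-tab {u = y} (φ-injective (trans (sym (apply-φ y)) z)))))
            , (λ g h → is-plane _ (subst₃ (sym (apply-φ (g 0F))) (sym (apply-φ (g 1F))) (sym (apply-φ (g 2F))) (from-hyperbolic (hyp-plane g h))))
            where
            subst₃ : ∀ {a b c a' b' c'} → a ≡ a' → b ≡ b' → c ≡ c' → Plane a b c → Plane a' b' c'
            subst₃ refl refl refl p = p

          quadric→ : ∀ π → PlaneOf π → G.PlaneOfQuadric {S} columns π → ContainsOf π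
          quadric→ π p (g , h , (i , _)) = on 0F , on 1F , on 2F
            where
            t : HP.PlaneOf g
            t = hyp-plane g h
            on : ∀ j → form (tab (π j)) ≡ 0ᶠ
            on j = let (c , e) = i j in trans (cong form (trans (tab-cong e) (trans (tab-lin c (G.applyT {S} columns g)) (trans
                (cong₂ (λ u w → u ⊕ c 2F ∙ w) (cong₂ (λ u w → 0ⱽ ⊕ c 0F ∙ u ⊕ c 1F ∙ w) (apply-φ (g 0F)) (apply-φ (g 1F))) (apply-φ (g 2F)))
                (φ-lc (c 0F) (c 1F) (c 2F) (tab (g 0F)) (tab (g 1F)) (tab (g 2F)))))))
              (trans (hyp-φ _) (HP.lc-sing t (c 0F) (c 1F) (c 2F)))
              where
              φ-0 : φ 0ⱽ ≡ 0ⱽ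
              φ-0 = trans (cong φ (vsolve 𝟘 (𝟘 ⊞ (-ᶠ 1ᶠ) ⊠ 𝟘) ([]) (λ { ([]) → (let open FS in solve 0 ((# 0) := (# 0) :+ ( :- (# 1)) :* (# 0)) refl) }))) (trans (φ-⊕ 0ⱽ (-ᶠ 1ᶠ) 0ⱽ) (vsolve ((v# 0) ⊞ (-ᶠ 1ᶠ) ⊠ (v# 0)) 𝟘 ((φ 0ⱽ) ∷ []) (λ { (xᶜ ∷ []) → (let open FS in solve 1 (λ x → x :+ ( :- (# 1)) :* x := (# 0)) refl xᶜ) })))
              φ-lc : ∀ x y z u v w → lc₃ x y z (φ u) (φ v) (φ w) ≡ φ (lc₃ x y z u v w)
              φ-lc x y z u v w = sym (trans (φ-⊕ _ z w) (cong (_⊕ z ∙ φ w) (trans (φ-⊕ _ y v) (cong (_⊕ y ∙ φ v) (trans (φ-⊕ 0ⱽ x u) (cong (_⊕ x ∙ φ u) φ-0))))))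

          quadric← : ∀ π → PlaneOf π → ContainsOf π → G.PlaneOfQuadric {S} columns π
          quadric← π p (h₀ , h₁ , h₂) = g , plane-hyp g (subst₃ (sym (tab-lookup _)) (sym (tab-lookup _)) (sym (tab-lookup _)) (to-hyperbolic p h₀ h₁ h₂))
              , same-span {π} {G.applyT {S} columns g} p (subst₃' (sym (image 0F)) (sym (image 1F)) (sym (image 2F)) p) in-image
            where
            g : G.Triple 6
            g j = lookup (coords (tab (π j)))
            subst₃ : ∀ {a b c a' b' c'} → a ≡ a' → b ≡ b' → c ≡ c' → H.Plane a b c → H.Plane a' b' c'
            subst₃ refl refl refl p = p
            subst₃' : ∀ {a b c a' b' c'} → a ≡ a' → b ≡ b' → c ≡ c' → Plane a b c → Plane a' b' c'
            subst₃' refl refl refl p = p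
            h : ∀ j → form (tab (π j)) ≡ 0ᶠ
            h 0F = h₀
            h 1F = h₁
            h 2F = h₂
            image : ∀ j → tab (G.applyT {S} columns g j) ≡ tab (π j)
            image j = trans (apply-φ (g j)) (trans (cong φ (tab-lookup (coords (tab (π j))))) (sym (Good.span good base frame (tab (π j)) (proj₁ (singular-of {π} p j)) (h j))))
            in-image : ∀ i → InPlaneOf (G.applyT {S} columns g) (tab (π i))
            in-image i = inPlane (trans (cong (λ u → B u (tab (π i))) (image 0F)) (perp-of {π} p 0F i)) (trans (cong (λ u → B u (tab (π i))) (image 1F)) (perp-of {π} p 1F i))
              (trans (cong (λ u → B u (tab (π i))) (image 2F)) (perp-of {π} p 2F i))

          point→ : ∀ u → G.PointOfQuadric {S} columns u → form (tab u) ≡ 0ᶠ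
          point→ u (y , _ , qy , e) = trans (cong form (trans (tab-cong e) (apply-φ y))) (trans (hyp-φ (tab y)) (trans (sym (Qhyp-tab y)) qy))

      Conclusion : G.PlaneSet S → ℕ → ℕ → Set
      Conclusion L α k = Σ (Fin α → G.Embedding S) λ φ → Σ (Fin k → G.Vect (G.dim S)) λ p →
          (∀ i → G.EmbeddedHyperbolic S (φ i))
        × (∀ i j → i ≢ j → ∀ π → G.IsPlane S π → ¬ (G.PlaneOfQuadric {S} (φ i) π × G.PlaneOfQuadric {S} (φ j) π))
        × (∀ j → G.Singular S (p j))
        × (∀ j j′ → j ≢ j′ → ¬ G.Perp S (p j) (p j′))
        × (∀ j i → ¬ G.PointOfQuadric {S} (φ i) (p j))
        × (∀ π → G.IsPlane S π → (L π ≡ true ⇔ ((∃ λ i → G.PlaneOfQuadric {S} (φ i) π) ⊎ (∃ λ j → G.PointIn (p j) π))))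
        × (S ≡ G.W → ¬ G.Char2 → α ≡ 0)

      conclude : ∀ (L : G.PlaneSet S) (C : Sets.CL polar) (sol : Sets.Removal.Solution polar fans E kind C) →
        (∀ π → G.IsPlane S π → L π ≡ true → Sets.CL.f C (tab (π 0F)) (tab (π 1F)) (tab (π 2F)) ≡ 1#) →
        (∀ π → G.IsPlane S π → Sets.CL.f C (tab (π 0F)) (tab (π 1F)) (tab (π 2F)) ≡ 1# → L π ≡ true) →
        Conclusion L (Sets.Removal.Solution.α sol) (Sets.Removal.Solution.k sol)
      conclude L C sol to from =
          (λ i → columns (quadric i)) , (λ j → lookup (point j))
        , (λ i → embedded (quadric i) (good i))
        , (λ i j d π P (a , b) → disjoint i j d (plane-of π P) (quadric→ (quadric i) (good i) π (plane-of π P) a , quadric→ (quadric j) (good j) π (plane-of π P) b))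
        , (λ j → singular⁻ _ (subst Sing (sym (tab-lookup (point j))) (proj₁ (sing j))) (λ z → proj₂ (sing j) (trans (sym (tab-lookup (point j))) z)))
        , (λ i j d z → noncollinear i j d (trans (sym (cong₂ B (tab-lookup (point i)) (tab-lookup (point j)))) (perp _ _ z)))
        , (λ j i z → off j i (trans (cong (Sets.Quadric.form (quadric i)) (sym (tab-lookup (point j)))) (point→ (quadric i) (good i) _ z)))
        , (λ π P → mk⇔ (λ l → found π P (members (plane-of π P) (to π P l))) (λ { (inj₁ (i , x)) → from π P (∋quadric (plane-of π P) i (quadric→ (quadric i) (good i) π (plane-of π P) x))
                                                                         ; (inj₂ (j , x)) → from π P (∋pencil (plane-of π P) j (subst (InPlaneOf π) (tab-lookup (point j)) (span-in {π} (plane-of π P) x))) }))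
        , (λ w c → odd⇒0 (odd w c))
        where
        open Sets.Removal.Solution sol
        open Columns
        good : Fin α → Good polar
        good = choose kind
          where
          none : ∀ {m} → m ≡ 0 → Fin m → ⊥
          none refl ()
          choose : Good polar ⊎ Sets.OddSymplectic polar → Fin α → Good polar
          choose (inj₁ g) _ = g
          choose (inj₂ o) i = ⊥-elim (none (odd⇒0 o) i)
        found : ∀ π → G.IsPlane S π → (∃ λ i → ContainsOf (quadric i) π) ⊎ (∃ λ j → InPlaneOf π (point j)) →
          (∃ λ i → G.PlaneOfQuadric {S} (columns (quadric i)) π) ⊎ (∃ λ j → G.PointIn (lookup (point j)) π)
        found π P (inj₁ (i , x)) = inj₁ (i , quadric← (quadric i) (good i) π (plane-of π P) x)
        found π P (inj₂ (j , x)) = inj₂ (j , in-span {π} (plane-of π P) (subst Sing (sym (tab-lookup (point j))) (proj₁ (sing j))) (subst (InPlaneOf π) (sym (tab-lookup (point j))) x))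

      module SetWeight (L : G.PlaneSet S) where
        open RS using (nat)
        open WeightIdentities

        D₃ : V (G.dim S) → V (G.dim S) → V (G.dim S) → V (G.dim S) → Carrier
        D₃ = Sets.D₃ polar

        χ : G.Triple (G.dim S) → Carrier
        χ π = if L π then 1# else 0#

        χ-true : ∀ π → χ π ≡ 1# → L π ≡ true
        χ-true π e with L π
        ... | true = refl
        ... | false = ⊥-elim (0≢1 e)

        true-χ : ∀ π → L π ≡ true → χ π ≡ 1#
        true-χ π e = cong (λ b → if b then 1# else 0#) e

        χ-01 : ∀ π → χ π ≡ 0# ⊎ χ π ≡ 1#
        χ-01 π with L π
        ... | true = inj₂ refl
        ... | false = inj₁ refl

        vectors : V (G.dim S) → V (G.dim S) → V (G.dim S) → G.Triple (G.dim S)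
        vectors a b c = triple (lookup a) (lookup b) (lookup c)

        vectors-plane : ∀ {a b c} → Plane a b c → PlaneOf (vectors a b c)
        vectors-plane {a} {b} {c} = transport (sym (tab-lookup a)) (sym (tab-lookup b)) (sym (tab-lookup c))
          where
          transport : ∀ {a b c a' b' c'} → a ≡ a' → b ≡ b' → c ≡ c' → Plane a b c → Plane a' b' c'
          transport refl refl refl p = p

        point-term : (G.Vect (G.dim S) → Carrier) → G.Triple (G.dim S) → K → K → K → Carrier
        point-term v π a b c = if G.isZero a ∧ G.isZero b ∧ G.isZero c then 0# else v (lookup (lc₃ a b c (tab (π 0F)) (tab (π 1F)) (tab (π 2F))))

        module _ (v : G.Vect (G.dim S) → Carrier) (r : Carrier) (r-eq : r * (q - 1#) ≡ 1#)
          (v-sum : ∀ π → G.IsPlane S π → χ π * (q - 1#) ≡ ∑F (λ a → ∑F (λ b → ∑F (λ c → point-term v π a b c)))) where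

          -- `DegreeOneCL` sums over nonzero vectors and carries a factor q - 1, which r cancels.
          -- Values at 0 and off the polar space enter no plane sum of that definition and are set
          -- to 0.
          weight : V (G.dim S) → Carrier
          weight u = 𝟙 (Sing? u) * ((1# - 𝟙 (u ≟ⱽ 0ⱽ)) * (r * v (lookup u)))

          supp : ∀ u → ¬ Sing u → weight u ≡ 0#
          supp u ns = zeroˡ (𝟙-no (Sing? u) ns)

          nonzero-term : ∀ π (p : PlaneOf π) a b c → lc₃ a b c (tab (π 0F)) (tab (π 1F)) (tab (π 2F)) ≢ 0ⱽ →
            weight (lc₃ a b c (tab (π 0F)) (tab (π 1F)) (tab (π 2F))) ≡ r * v (lookup (lc₃ a b c (tab (π 0F)) (tab (π 1F)) (tab (π 2F))))
          nonzero-term π p a b c nz = trans (cong₂ (λ x y → x * ((1# - y) * (r * v (lookup (lc₃ a b c (tab (π 0F)) (tab (π 1F)) (tab (π 2F))))))) (𝟙-yes (Sing? _) (lc-sing p a b c)) (𝟙-no (_ ≟ⱽ 0ⱽ) nz))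
            (let open RS in solve 1 (λ x → (# 1) :* (((# 1) :- (# 0)) :* x) := x) refl (r * v (lookup (lc₃ a b c (tab (π 0F)) (tab (π 1F)) (tab (π 2F))))))

          lc≢0 : ∀ π → PlaneOf π → ∀ a b c → ¬ (a ≡ 0ᶠ × b ≡ 0ᶠ × c ≡ 0ᶠ) → lc₃ a b c (tab (π 0F)) (tab (π 1F)) (tab (π 2F)) ≢ 0ⱽ
          lc≢0 π p a b c n e = n (coord f₁ (proj₁ xs) , coord f₂ (proj₁ (proj₂ xs)) , coord f₃ (proj₂ (proj₂ xs)))
            where
            open Plane p
            xs = Sets.Weight.InPlaneOf.lc-coords polar weight supp p a b c
            coord : ∀ {x} g → B (lc₃ a b c (tab (π 0F)) (tab (π 1F)) (tab (π 2F))) g ≡ x → x ≡ 0ᶠ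
            coord g y = trans (sym y) (trans (cong (λ u → B u g) e) (B-0 g))

          weight-term : ∀ π → PlaneOf π → ∀ a b c → weight (lc₃ a b c (tab (π 0F)) (tab (π 1F)) (tab (π 2F))) ≡ r * point-term v π a b c
          weight-term π p a b c = cases (a ≟ᶠ 0ᶠ) (b ≟ᶠ 0ᶠ) (c ≟ᶠ 0ᶠ)
            where
            W = weight (lc₃ a b c (tab (π 0F)) (tab (π 1F)) (tab (π 2F)))
            t = v (lookup (lc₃ a b c (tab (π 0F)) (tab (π 1F)) (tab (π 2F))))
            vanish : a ≡ 0ᶠ → b ≡ 0ᶠ → c ≡ 0ᶠ → W ≡ r * 0#
            vanish refl refl refl = trans (zeroʳ (zeroˡ (trans (cong (λ x → 1# - x) (𝟙-yes (_ ≟ⱽ 0ⱽ) zero')) (let open RS in solve 0 ((# 1) :- (# 1) := (# 0)) refl)))) (sym (zeroʳ refl))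
              where
              zero' : lc₃ 0ᶠ 0ᶠ 0ᶠ (tab (π 0F)) (tab (π 1F)) (tab (π 2F)) ≡ 0ⱽ
              zero' = (vsolve (((𝟘 ⊞ 0ᶠ ⊠ (v# 0)) ⊞ 0ᶠ ⊠ (v# 1)) ⊞ 0ᶠ ⊠ (v# 2)) 𝟘 ((tab (π 0F)) ∷ (tab (π 1F)) ∷ (tab (π 2F)) ∷ []) (λ { (xᶜ ∷ yᶜ ∷ zᶜ ∷ []) → (let open FS in solve 3 (λ x y z → (# 0) :+ (# 0) :* x :+ (# 0) :* y :+ (# 0) :* z := (# 0)) refl xᶜ yᶜ zᶜ) }))
            cases : (x : Dec (a ≡ 0ᶠ)) (y : Dec (b ≡ 0ᶠ)) (z : Dec (c ≡ 0ᶠ)) → W ≡ r * (if does x ∧ does y ∧ does z then 0# else t)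
            cases (yes x) (yes y) (yes z) = vanish x y z
            cases (no x) _ _ = nonzero-term π p a b c (lc≢0 π p a b c (x ∘ proj₁))
            cases (yes _) (no y) _ = nonzero-term π p a b c (lc≢0 π p a b c (y ∘ proj₁ ∘ proj₂))
            cases (yes _) (yes _) (no z) = nonzero-term π p a b c (lc≢0 π p a b c (z ∘ proj₂ ∘ proj₂))

          f-χ : ∀ π → G.IsPlane S π → Sets.Weight.f polar weight supp (tab (π 0F)) (tab (π 1F)) (tab (π 2F)) ≡ χ π
          f-χ π P = begin
            _ ≡⟨ Sets.Weight.InPlaneOf.f-sum polar weight supp (plane-of π P) ⟨
            ∑F (λ a → ∑F (λ b → ∑F (λ c → weight (lc₃ a b c (tab (π 0F)) (tab (π 1F)) (tab (π 2F))))))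
              ≡⟨ sum-cong elems (λ a → trans (sum-cong elems (λ b → trans (sum-cong elems (λ c → weight-term π (plane-of π P) a b c)) (sum-* elems r _))) (sum-* elems r _)) ⟩
            ∑F (λ a → r * ∑F (λ b → ∑F (λ c → point-term v π a b c))) ≡⟨ sum-* elems r _ ⟩
            r * ∑F (λ a → ∑F (λ b → ∑F (λ c → point-term v π a b c))) ≡⟨ cong (r *_) (v-sum π P) ⟨
            r * (χ π * (q - 1#)) ≡⟨ (let open RS in solve 3 (λ r x d → r :* (x :* d) := r :* d :* x) refl r (χ π) (q - 1#)) ⟩
            r * (q - 1#) * χ π ≡⟨ cong (_* χ π) r-eq ⟩
            1# * χ π ≡⟨ (let open RS in solve 1 (λ x → (# 1) :* x := x) refl (χ π)) ⟩
            χ π ∎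

          f-vectors : ∀ {a b c} → Plane a b c → Sets.Weight.f polar weight supp a b c ≡ χ (vectors a b c)
          f-vectors {a} {b} {c} p = trans (cong-f (sym (tab-lookup a)) (sym (tab-lookup b)) (sym (tab-lookup c))) (f-χ (vectors a b c) (is-plane (vectors a b c) (vectors-plane p)))
            where
            cong-f : ∀ {a b c a' b' c'} → a ≡ a' → b ≡ b' → c ≡ c' → Sets.Weight.f polar weight supp a b c ≡ Sets.Weight.f polar weight supp a' b' c'
            cong-f refl refl refl = refl

          set : Sets.CL polar
          set = record
            { v = weight ; supp = supp
            ; v-0 = zeroʳ (zeroˡ (trans (cong (λ x → 1# - x) (𝟙-yes (0ⱽ ≟ⱽ 0ⱽ) refl)) (let open RS in solve 0 ((# 1) :- (# 1) := (# 0)) refl)))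
            ; binary = λ {a} {b} {c} p → binary (f-vectors p) (χ-01 (vectors a b c)) }
            where
            binary : ∀ {x y} → x ≡ y → y ≡ 0# ⊎ y ≡ 1# → x ≡ 0# ⊎ x ≡ 1#
            binary refl z = z

          module _ (wd : G.WellDefined S L) (N : ℕ) (size : G.HasSize S L N) where
            private
              ps = proj₁ size
              member = proj₁ (proj₂ (proj₂ size))
              distinct = proj₁ (proj₂ (proj₂ (proj₂ size)))
              complete = proj₂ (proj₂ (proj₂ (proj₂ size)))

            -- The representatives have pairwise different spans, so at most one of them has the
            -- span of a given plane, and the sum of indicators is the indicator of membership in
            -- the list.
            sum-unique : ∀ {A : Set} (xs : List A) (g : A → Carrier) (Q : A → Set) →
              (∀ x → x ∈ xs → (g x ≡ 1# × Q x) ⊎ (g x ≡ 0# × ¬ Q x)) →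
              (∀ i j → i ≢ j → ¬ (Q (List.lookup xs i) × Q (List.lookup xs j))) →
              ((∃ λ x → x ∈ xs × Q x) → sum xs g ≡ 1#) × ((∀ x → x ∈ xs → ¬ Q x) → sum xs g ≡ 0#)
            sum-unique [] g Q val pair = (λ { (_ , () , _) }) , λ _ → refl
            sum-unique (x ∷ xs) g Q val pair = go (val x (here refl))
              where
              rest = sum-unique xs g Q (λ y m → val y (there m)) (λ i j d → pair (Fin.suc i) (Fin.suc j) (λ { refl → d refl }))
              index : ∀ {ys : List _} {y} → y ∈ ys → ∃ λ i → List.lookup ys i ≡ y
              index (here refl) = Fin.zero , refl
              index (there m) = let (i , e) = index m in Fin.suc i , e
              go : (g x ≡ 1# × Q x) ⊎ (g x ≡ 0# × ¬ Q x) → ((∃ λ y → y ∈ x ∷ xs × Q y) → g x + sum xs g ≡ 1#) × ((∀ y → y ∈ x ∷ xs → ¬ Q y) → g x + sum xs g ≡ 0#)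
              go (inj₁ (e , qx)) = (λ _ → trans (cong₂ _+_ e (proj₂ rest (λ y m qy → let (i , r) = index m in pair Fin.zero (Fin.suc i) (λ ()) (qx , subst Q (sym r) qy)))) (let open RS in solve 0 ((# 1) :+ (# 0) := (# 1)) refl))
                , (λ no-Q → ⊥-elim (no-Q x (here refl) qx))
              go (inj₂ (e , nqx)) = (λ { (y , here refl , qy) → ⊥-elim (nqx qy) ; (y , there m , qy) → trans (cong₂ _+_ e (proj₁ rest (y , m , qy))) (let open RS in solve 0 ((# 0) :+ (# 1) := (# 1)) refl) })
                , (λ no-Q → trans (cong₂ _+_ e (proj₂ rest (λ y m → no-Q y (there m)))) (let open RS in solve 0 ((# 0) :+ (# 0) := (# 0)) refl))

            vec : G.Triple (G.dim S) → V (G.dim S) × V (G.dim S) × V (G.dim S)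
            vec ρ = tab (ρ 0F) , tab (ρ 1F) , tab (ρ 2F)

            Dρ : G.Triple (G.dim S) → V (G.dim S) → Carrier
            Dρ ρ = D₃ (tab (ρ 0F)) (tab (ρ 1F)) (tab (ρ 2F))

            ρ-plane : ∀ ρ → ρ ∈ ps → PlaneOf ρ
            ρ-plane ρ m = plane-of ρ (proj₁ (member ρ m))

            transitive : ∀ {π ρ σ} → PlaneOf π → PlaneOf ρ → PlaneOf σ → G.SameSpan π ρ → G.SameSpan π σ → G.SameSpan ρ σ
            transitive {π} {ρ} {σ} p r s (_ , ρ⊆π) (_ , σ⊆π) = same-span {ρ} {σ} r s (λ i → inPlane (perp-σρ 0F i) (perp-σρ 1F i) (perp-σρ 2F i))
              where
              perp-σρ : ∀ k i → B (tab (σ k)) (tab (ρ i)) ≡ 0ᶠ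
              perp-σρ k i = orthogonal p (proj₁ (singular-of {σ} s k)) (span-in {π} p (σ⊆π k)) (span-in {π} p (ρ⊆π i))

            value : ∀ {a b c} → Plane a b c → ∀ ρ → ρ ∈ ps →
              (Dρ ρ a * (Dρ ρ b * Dρ ρ c) ≡ 1# × G.SameSpan (vectors a b c) ρ) ⊎ (Dρ ρ a * (Dρ ρ b * Dρ ρ c) ≡ 0# × ¬ G.SameSpan (vectors a b c) ρ)
            value {a} {b} {c} p ρ m = cases (in? a) (in? b) (in? c)
              where
              ρp : PlaneOf ρ
              ρp = ρ-plane ρ m
              open Sets.Weight.InPlaneOf polar weight supp ρp using (in?; D-in; D-out)
              π = vectors a b c
              not-in : ∀ j {u} → tab (π j) ≡ u → ¬ InPlaneOf ρ u → ¬ G.SameSpan π ρ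
              not-in j refl n (i , _) = n (span-in {ρ} ρp (i j))
              cases : Dec (InPlaneOf ρ a) → Dec (InPlaneOf ρ b) → Dec (InPlaneOf ρ c) →
                (Dρ ρ a * (Dρ ρ b * Dρ ρ c) ≡ 1# × G.SameSpan π ρ) ⊎ (Dρ ρ a * (Dρ ρ b * Dρ ρ c) ≡ 0# × ¬ G.SameSpan π ρ)
              cases (yes x) (yes y) (yes z) = inj₁ (trans (cong₂ _*_ (D-in x) (cong₂ _*_ (D-in y) (D-in z))) (let open RS in solve 0 ((# 1) :* ((# 1) :* (# 1)) := (# 1)) refl)
                , same-span {π} {ρ} (vectors-plane p) ρp (λ { 0F → subst (InPlaneOf ρ) (sym (tab-lookup a)) x ; 1F → subst (InPlaneOf ρ) (sym (tab-lookup b)) y ; 2F → subst (InPlaneOf ρ) (sym (tab-lookup c)) z }))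
              cases (no x) _ _ = inj₂ (zeroˡ (D-out x) , not-in 0F (tab-lookup a) x)
              cases (yes _) (no y) _ = inj₂ (zeroʳ (zeroˡ (D-out y)) , not-in 1F (tab-lookup b) y)
              cases (yes _) (yes _) (no z) = inj₂ (zeroʳ (zeroʳ (D-out z)) , not-in 2F (tab-lookup c) z)

            f-count : ∀ {a b c} → Plane a b c → Sets.Weight.f polar weight supp a b c ≡ sum (map vec ps) (λ { (r₁ , r₂ , r₃) → D₃ r₁ r₂ r₃ a * (D₃ r₁ r₂ r₃ b * D₃ r₁ r₂ r₃ c) })
            f-count {a} {b} {c} p = trans (f-vectors p) (trans (on-L (L π) refl) (sym (sum-map vec ps _)))
              where
              π = vectors a b c
              P : G.IsPlane S π
              P = is-plane π (vectors-plane p)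
              g : G.Triple (G.dim S) → Carrier
              g ρ = Dρ ρ a * (Dρ ρ b * Dρ ρ c)
              pair : ∀ i j → i ≢ j → ¬ (G.SameSpan π (List.lookup ps i) × G.SameSpan π (List.lookup ps j))
              pair i j d (x , y) = distinct i j d (transitive {π} (vectors-plane p) (ρ-plane _ (∈-lookup i)) (ρ-plane _ (∈-lookup j)) x y)
                where open import Data.List.Membership.Propositional.Properties using (∈-lookup)
              sums = sum-unique ps g (G.SameSpan π) (value p) pair
              on-L : ∀ b → L π ≡ b → (if b then 1# else 0#) ≡ sum ps g
              on-L true e = sym (proj₁ sums (complete π P e))
              -- The set is a function on spanning triples; `wd` carries membership over from a
              -- listed triple with the same span.
              on-L false e = sym (proj₂ sums (λ ρ m s → absurd (trans (sym e) (trans (wd π ρ P (proj₁ (member ρ m)) s) (proj₂ (member ρ m))))))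
                where
                absurd : false ≡ true → ⊥
                absurd ()

            ps-plane : ∀ {a b c} → (a , b , c) ∈ map vec ps → Plane a b c
            ps-plane m with ∈-map⁻ vec m
            ... | ρ , m' , refl = ρ-plane ρ m'

            parameter : nat N ≡ (q + 1#) * (q * q + 1#) * Sets.CL.X set
            parameter = trans (cong nat (trans (sym (proj₁ (proj₂ size))) (sym (Listₚ.length-map vec ps))))
              (Sets.PlaneCount.total-count polar fans E weight supp (Sets.CL.v-0 set) (map vec ps) ps-plane f-count)

  -- The two polar spaces as models

  module Models where
    open PolarSpaces
    open Spaces
    open Quadrics
    open Translation
    open StandardPlanes
    private module G = Geometry F

    Bsymp-tab : ∀ u w → G.Bsymp u w ≡ Form⁻.form (tab u) (tab w)
    Bsymp-tab u w = trans (let open FS in solve 12 (λ a b c d e f a' b' c' d' e' f' → (a :* b' :- b :* a') :+ (c :* d' :- d :* c') :+ (e :* f' :- f :* e') := (a :* b' :+ ( :- (# 1)) :* (b :* a')) :+ (c :* d' :+ ( :- (# 1)) :* (d :* c')) :+ (e :* f' :+ ( :- (# 1)) :* (f :* e'))) refl (u 0F) (u 1F) (u 2F) (u 3F) (u 4F) (u 5F) (w 0F) (w 1F) (w 2F) (w 3F) (w 4F) (w 5F))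
      (sym (Form⁻.form-def (tab u) (tab w)))

    Qpar-tab : ∀ u → G.Qpar u ≡ Q₇ (tab u)
    Qpar-tab u = sym (trans (Q₇-def (tab u)) (cong (_+ᶠ u 6F *ᶠ u 6F) (trans (Q₆-def (first (tab u))) (cong (λ z → z ! 0F *ᶠ z ! 1F +ᶠ z ! 2F *ᶠ z ! 3F +ᶠ z ! 4F *ᶠ z ! 5F) (first-def (tab u))))))

    odd-symplectic : ¬ (1ᶠ +ᶠ 1ᶠ ≡ 0ᶠ) → Sets.OddSymplectic symplectic
    odd-symplectic n = record { ε≡-1 = refl ; 2≢0 = n ; mkfan = λ p _ → symplectic-fan p }

    symplectic-model : Model G.W
    symplectic-model = record
      { polar = symplectic ; fans = symplectic-fans ; E = symplectic-plane
      ; kind = kind (1ᶠ +ᶠ 1ᶠ ≟ᶠ 0ᶠ)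
      ; odd = λ _ → odd-symplectic
      ; perp = λ u w e → trans (sym (Bsymp-tab u w)) e ; perp⁻ = λ u w e → trans (Bsymp-tab u w) e
      ; singular = λ u nz → tt , λ z → nz (zero-tab z) ; singular⁻ = λ u _ nz z → nz (tab-zero z) }
      where
      kind : Dec (1ᶠ +ᶠ 1ᶠ ≡ 0ᶠ) → Good symplectic ⊎ Sets.OddSymplectic symplectic
      kind (yes c) = inj₁ (symplectic-good c)
      kind (no n) = inj₂ (odd-symplectic n)

    parabolic-model : Model G.Q
    parabolic-model = record
      { polar = Quadratic.polar parabolic ; fans = parabolic-fans ; E = parabolic-plane
      ; kind = inj₁ parabolic-good ; odd = λ ()
      ; perp = λ u w e → trans (sym (fpar-tab u w)) e ; perp⁻ = λ u w e → trans (fpar-tab u w) e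
      ; singular = λ u (nz , z) → trans (sym (Qpar-tab u)) z , λ e → nz (zero-tab e)
      ; singular⁻ = λ u s nz → (λ z → nz (tab-zero z)) , trans (Qpar-tab u) s }
      where
      fpar-tab : ∀ u w → G.fpar u w ≡ B₇ (tab u) (tab w)
      fpar-tab = polar-tab parabolic G.Qpar Qpar-tab

    model : ∀ S → Model S
    model G.W = symplectic-model
    model G.Q = parabolic-model

-- The instance for the theorem. Everything up to this point uses the ordered field axioms alone, so
-- no rational number is ever normalised there.
ℚ-field : OrderedField
ℚ-field = record
  { Carrier = ℚ ; _+_ = ℚ._+_ ; _*_ = ℚ._*_ ; -_ = ℚ.-_ ; 0# = ℚ.0ℚ ; 1# = ℚ.1ℚ
  ; isCommutativeRing = ℚₚ.+-*-isCommutativeRing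
  ; 0≢1 = λ ()
  ; inverse = λ x n → (ℚ.1/ x) {{ℚ.≢-nonZero n}} , ℚₚ.*-inverseˡ x {{ℚ.≢-nonZero n}}
  ; _≤_ = ℚ._≤_ ; _≤?_ = ℚₚ._≤?_ ; ≤-trans = ℚₚ.≤-trans ; ≤-antisym = ℚₚ.≤-antisym ; ≤-total = ℚₚ.≤-total
  ; +-mono = ℚₚ.+-mono-≤
  ; *-nonneg = λ {x} {y} a b → ℚₚ.nonNegative⁻¹ (x ℚ.* y) {{ℚₚ.nonNeg*nonNeg⇒nonNeg x {{ℚ.nonNegative a}} y {{ℚ.nonNegative b}}}}
  ; 0≤1 = from-yes (ℚ.0ℚ ℚₚ.≤? ℚ.1ℚ) }

-- Rational numbers, the bound on the parameter and the conclusion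

module Rationals (F : FiniteField) where
  open Over ℚ-field F
  open RS using (nat; nat-suc; nat-+; nat-*)
  open WeightIdentities using (0≤q; q≰0)
  private module G = Geometry F

  ℕtoℚ-suc : ∀ n → G.ℕtoℚ (suc n) ≡ 1# + G.ℕtoℚ n
  ℕtoℚ-suc n = ℚₚ.toℚᵘ-injective (ℚᵘₚ.≃-trans (ℚₚ.toℚᵘ-fromℚᵘ (ℚᵘ.mkℚᵘ (ℤ.+ suc n) 0)) (ℚᵘₚ.≃-trans step
      (ℚᵘₚ.≃-sym (ℚᵘₚ.≃-trans (ℚₚ.toℚᵘ-homo-+ 1# (G.ℕtoℚ n)) (ℚᵘₚ.+-congʳ (ℚ.toℚᵘ 1#) (ℚₚ.toℚᵘ-fromℚᵘ (ℚᵘ.mkℚᵘ (ℤ.+ n) 0)))))))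
    where
    step : ℚᵘ.mkℚᵘ (ℤ.+ suc n) 0 ℚᵘ.≃ ℚ.toℚᵘ 1# ℚᵘ.+ ℚᵘ.mkℚᵘ (ℤ.+ n) 0
    step = ℚᵘ.*≡* (cong (ℤ._* ℤ.+ 1) (cong (λ z → ℤ.+ 1 ℤ.+ z) (sym (ℤₚ.*-identityʳ (ℤ.+ n)))))

  nat-ℕtoℚ : ∀ n → G.ℕtoℚ n ≡ nat n
  nat-ℕtoℚ zero = refl
  nat-ℕtoℚ (suc n) = trans (ℕtoℚ-suc n) (trans (cong (1# +_) (nat-ℕtoℚ n)) (sym (nat-suc n)))

  q-1 : G.ℕtoℚ (order ℕ.∸ 1) ≡ q - 1#
  q-1 = trans (nat-ℕtoℚ (order ℕ.∸ 1)) (predecessor order (λ e → q≰0 (≤-reflexive (cong nat e))))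
    where
    predecessor : ∀ m → m ≢ 0 → nat (m ℕ.∸ 1) ≡ nat m - 1#
    predecessor zero n = ⊥-elim (n refl)
    predecessor (suc m) _ = trans (let open RS in solve 1 (λ x → x := (# 1) :+ x :- (# 1)) refl (nat m)) (cong (_- 1#) (sym (nat-suc m)))

  parameter-factor : G.ℕtoℚ ((order ℕ.+ 1) ℕ.* (order ℕ.* order ℕ.+ 1)) ≡ (q + 1#) * (q * q + 1#)
  parameter-factor = trans (nat-ℕtoℚ ((order ℕ.+ 1) ℕ.* (order ℕ.* order ℕ.+ 1))) (trans (nat-* (order ℕ.+ 1) (order ℕ.* order ℕ.+ 1)) (cong₂ _*_ (nat-+ order 1)
    (trans (nat-+ (order ℕ.* order) 1) (cong (_+ 1#) (nat-* order order)))))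

  -- The recursion inside ΣQ is a local function without a name; the
  -- underscore stands for it and is determined by ΣQ-sum.
  mutual
    local-sum : ∀ (f : FiniteField.Carrier F → ℚ) as → _ ≡ sum as f
    local-sum f [] = refl
    local-sum f (a ∷ as) = cong (f a +_) (local-sum f as)

    ΣQ-sum : ∀ f → G.ΣQ f ≡ ∑F f
    ΣQ-sum f with FiniteField.elems F
    ... | as = local-sum f as

  -- x < q follows from the bound with r = q + 1/4 and s = 3/2
  range : ∀ x → G.InRange x → ¬ q ≤ x
  range x (_ , bound) q≤x = <⇒≱ (bound (q + h) s r≥0 (from-yes (0# ≤? s)) r-large s-small) (≤-trans (≤-reflexive below) (≤-trans (+-mono (≤-refl {G.ℕtoℚ 6 * q}) (from-yes ((G.ℕtoℚ 6 * h - G.ℕtoℚ 2 * s + 1#) ≤? 0#)))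
      (≤-trans (≤-reflexive (let open RS in solve 1 (λ x → x :+ (# 0) := x) refl (G.ℕtoℚ 6 * q))) (*-monoˡ (from-yes (0# ≤? (G.ℕtoℚ 6))) q≤x))))
    where
    -- Since q ≥ 2, (q + 1/4)³ > q³ ≥ 2q² and (3/2)³ = 27/8 < 8 ≤ 4q. The bound becomes 6x < 6q +
    -- 6/4 - 3 + 1 = 6q - 1/2.
    h s : ℚ
    h = (ℤ.+ 1) ℚ./ 4
    s = (ℤ.+ 3) ℚ./ 2
    <⇒≱ : ∀ {a b} → a ℚ.< b → ¬ b ≤ a
    <⇒≱ l l' = ℚₚ.<-irrefl refl (ℚₚ.<-≤-trans l l')
    h≥0 : 0# ≤ h
    h≥0 = from-yes (0# ≤? h)
    0+0 : ∀ {x y} → 0# ≤ x → 0# ≤ y → 0# ≤ x + y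
    0+0 a b = ≤-trans (≤-reflexive (let open RS in solve 0 ((# 0) := (# 0) :+ (# 0)) refl)) (+-mono a b)
    r≥0 : 0# ≤ q + h
    r≥0 = 0+0 0≤q h≥0
    below : G.ℕtoℚ 6 * (q + h) - G.ℕtoℚ 2 * s + 1# ≡ G.ℕtoℚ 6 * q + (G.ℕtoℚ 6 * h - G.ℕtoℚ 2 * s + 1#)
    below = lemma (G.ℕtoℚ 6) (G.ℕtoℚ 2) h s
      where
      lemma : ∀ a b h s → a * (q + h) - b * s + 1# ≡ a * q + (a * h - b * s + 1#)
      lemma a b h s = (let open RS in solve 5 (λ a b h s q → a :* (q :+ h) :- b :* s :+ (# 1) := a :* q :+ (a :* h :- b :* s :+ (# 1))) refl a b h s q)
    r-large : G.ℕtoℚ (2 ℕ.* order ℕ.* order) ℚ.< (q + h) * (q + h) * (q + h)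
    r-large = ℚₚ.≰⇒> (λ l → from-no ((h * h * h) ≤? 0#) (+-cancel (q * q * q) (≤-trans (≤-diff _ rest (cube h)) (≤-trans l
        (≤-trans (≤-reflexive (trans (nat-ℕtoℚ (2 ℕ.* order ℕ.* order)) (trans (nat-* (2 ℕ.* order) order) (cong (_* q) (nat-* 2 order)))))
          (≤-trans (≤-reflexive (let open RS in solve 1 (λ q → ((# 1) :+ (# 1)) :* q :* q := q :* q :* ((# 1) :+ (# 1))) refl q)) (≤-trans (*-monoˡ (*-nonneg 0≤q 0≤q) 2≤q) (≤-reflexive (let open RS in solve 1 (λ q → q :* q :* q := (# 0) :+ q :* q :* q) refl q)))))))))
      where
      3·q²h = q * q * h + q * q * h + q * q * h + (q * h * h + q * h * h + q * h * h)
      q²h≥0 : 0# ≤ q * q * h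
      q²h≥0 = *-nonneg (*-nonneg 0≤q 0≤q) h≥0
      qh²≥0 : 0# ≤ q * h * h
      qh²≥0 = *-nonneg (*-nonneg 0≤q h≥0) h≥0
      rest : 0# ≤ 3·q²h
      rest = 0+0 (0+0 (0+0 q²h≥0 q²h≥0) q²h≥0) (0+0 (0+0 qh²≥0 qh²≥0) qh²≥0)
      cube : ∀ h → (q + h) * (q + h) * (q + h) ≡ h * h * h + q * q * q + (q * q * h + q * q * h + q * q * h + (q * h * h + q * h * h + q * h * h))
      cube h = (let open RS in solve 2 (λ q h → (q :+ h) :* (q :+ h) :* (q :+ h) := h :* h :* h :+ q :* q :* q :+ (q :* q :* h :+ q :* q :* h :+ q :* q :* h :+ (q :* h :* h :+ q :* h :* h :+ q :* h :* h))) refl q h)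
    s-small : s * s * s ℚ.< G.ℕtoℚ (4 ℕ.* order)
    s-small = ℚₚ.≰⇒> (λ l → from-no ((nat 4 * 2') ≤? (s * s * s)) (≤-trans (*-monoˡ (nat≥0 4) 2≤q)
        (≤-trans (≤-reflexive (sym (trans (nat-ℕtoℚ (4 ℕ.* order)) (nat-* 4 order)))) l)))
      where
      2' : ℚ
      2' = 1# + 1#

  module Main (S : Geometry.Space F) (L : Geometry.PlaneSet F S) where
    open Translation using (tab; lookup-tab; tab-lin; triple; module Model; module Assembly)
    open Models using (model)
    open Assembly.SetWeight S (model S) L
    open Model (model S) using (polar; fans; E; kind)
    Conclusion = Assembly.Conclusion S (model S)

    plane-sum : ∀ v → (∀ u w → u G.≐ w → v u ≡ v w) → ∀ π → G.ΣPlane v π ≡ ∑F (λ a → ∑F (λ b → ∑F (λ c → point-term v π a b c)))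
    plane-sum v v-resp π = trans (ΣQ-sum _) (sum-cong elems (λ a → trans (ΣQ-sum _) (sum-cong elems (λ b → trans (ΣQ-sum _) (sum-cong elems (λ c →
        cong (λ z → if G.isZero a ∧ G.isZero b ∧ G.isZero c then 0# else z) (v-resp _ _ (λ i → trans (sym (lookup-tab (G.lin (triple a b c) π) i)) (cong (λ u → lookup u i) (tab-lin (triple a b c) π))))))))))

    1≤q-1 : 1# ≤ q - 1#
    1≤q-1 = ≤-trans (≤-reflexive (let open RS in solve 0 ((# 1) := (# 1) :+ (# 1) :- (# 1)) refl)) (+-mono 2≤q ≤-refl)

    positive : ∀ {x} → 1# ≤ x → x ≢ 0#
    positive l refl = 1≰0 l

    module _ (x : ℚ) (wd : G.WellDefined S L) (cl : G.DegreeOneCL S L) (hp : G.HasParameter S L x) (ir : G.InRange x) where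
      v : G.Vect (G.dim S) → ℚ
      v = proj₁ cl

      r : ∃ λ r → r * (q - 1#) ≡ 1#
      r = OrderedField.inverse ℚ-field (q - 1#) (positive 1≤q-1)

      v-sum : ∀ π → G.IsPlane S π → χ π * (q - 1#) ≡ ∑F (λ a → ∑F (λ b → ∑F (λ c → point-term v π a b c)))
      v-sum π P = trans (cong (χ π *_) (sym q-1)) (trans (proj₂ (proj₂ (proj₂ cl)) π P) (plane-sum v (proj₁ (proj₂ cl)) π))

      C : Sets.CL polar
      C = set v (proj₁ r) (proj₂ r) v-sum

      x≡X : x ≡ Sets.CL.X C
      x≡X = ≢⇒cancel (positive 1≤c) (trans (let open RS in solve 2 (λ c x → c :* x := x :* c) refl ((q + 1#) * (q * q + 1#)) x) (trans (cong (x *_) (sym parameter-factor)) (trans (proj₂ (proj₂ hp))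
          (trans (nat-ℕtoℚ (proj₁ hp)) (parameter v (proj₁ r) (proj₂ r) v-sum wd (proj₁ hp) (proj₁ (proj₂ hp)))))))
        where
        1≤c : 1# ≤ (q + 1#) * (q * q + 1#)
        1≤c = ≤-diff (q * (q * q) + q * q + q) (≤-trans (≤-reflexive (let open RS in solve 0 ((# 0) := (# 0) :+ (# 0) :+ (# 0)) refl)) (+-mono (+-mono (*-nonneg 0≤q (*-nonneg 0≤q 0≤q)) (*-nonneg 0≤q 0≤q)) 0≤q))
          (let open RS in solve 1 (λ q → (q :+ (# 1)) :* (q :* q :+ (# 1)) := (# 1) :+ (q :* (q :* q) :+ q :* q :+ q)) refl q)

      X<q : ¬ q ≤ Sets.CL.X C
      X<q = subst (λ y → ¬ q ≤ y) x≡X (range x ir)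

      solution : Sets.Removal.Solution polar fans E kind C
      -- X < q makes the order of the field a natural bound with which the induction can start.
      solution = Sets.Recursion.decompose polar fans E kind order C X<q (≰⇒≥ X<q)

      open Sets.Removal.Solution solution using (α; k; X≡)

      x-eq : x ≡ G.ℕtoℚ 2 ℚ.* G.ℕtoℚ α ℚ.+ G.ℕtoℚ k
      x-eq = trans x≡X (trans X≡ (cong₂ (λ a b → nat 2 * a + b) (sym (nat-ℕtoℚ α)) (sym (nat-ℕtoℚ k))))

      conclusion : Conclusion L α k
      conclusion = Assembly.conclude S (model S) L C solution
        (λ π P l → trans (f-χ v (proj₁ r) (proj₂ r) v-sum π P) (true-χ π l))
        (λ π P o → χ-true π (trans (sym (f-χ v (proj₁ r) (proj₂ r) v-sum π P)) o))

      answer : Σ ℕ λ α → Σ ℕ λ k → (x ≡ G.ℕtoℚ 2 ℚ.* G.ℕtoℚ α ℚ.+ G.ℕtoℚ k) × Conclusion L α k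
      answer = α , k , x-eq , conclusion

theorem5p9 : (F : FiniteField) → let open Geometry F in
    (S : Space) (L : PlaneSet S) (x : ℚ) →
    WellDefined S L → DegreeOneCL S L → HasParameter S L x → InRange x →
    Σ ℕ λ α → Σ ℕ λ k →
    (x ≡ ℕtoℚ 2 ℚ.* ℕtoℚ α ℚ.+ ℕtoℚ k)
    × Σ (Fin α → Embedding S) λ φ → Σ (Fin k → Vect (dim S)) λ P →
    (∀ i → EmbeddedHyperbolic S (φ i))
    × (∀ i j → i ≢ j → ∀ π → IsPlane S π →
    ¬ (PlaneOfQuadric (φ i) π × PlaneOfQuadric (φ j) π))
    × (∀ j → Singular S (P j))
    × (∀ j j′ → j ≢ j′ → ¬ Perp S (P j) (P j′))
    × (∀ j i → ¬ PointOfQuadric (φ i) (P j))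
    × (∀ π → IsPlane S π →
    (L π ≡ true ⇔ ((∃ λ i → PlaneOfQuadric (φ i) π) ⊎ (∃ λ j → PointIn (P j) π))))
    × (S ≡ W → ¬ Char2 → α ≡ 0)
theorem5p9 F S L x wd cl hp ir = Rationals.Main.answer F S L x wd cl hp ir
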